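{- For every $\delta > 0$ there exist $n_0$ and $\sigma > 0$ such that the following holds for every $n \geq n_0$. If $\mathcal{H}$ is an $n$-vertex linear hypergraph with maximum degree at most $(1-\delta)n$ such that the number of edges $e$ of $\mathcal{H}$ with $(1-\delta)\sqrt{n} \le |e| \le (1+\delta)\sqrt{n}$ is at most $(1-3\delta)n$, then $\chi'(\mathcal{H}) \leq (1-\sigma)n$.
   Context: A hypergraph has a finite vertex set and a set of (non-repeated) nonempty subsets of it as edges; it is linear if any two distinct edges share at most one vertex. The degree of a vertex is the number of edges containing it. $\chi'(\mathcal{H})$ is the chromatic index: the minimum number of colours in an assignment of colours to edges such that intersecting distinct edges get distinct colours. -}

module Defs where

open import Data.Nat using (ℕ)
import Data.Nat
open import Data.Bool using (Bool)
open import Data.Fin using (Fin)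
open import Data.Fin.Subset using (Subset; _∈_; _∩_; ∣_∣; Nonempty)
open import Data.Fin.Subset.Properties using (_∈?_)
open import Data.Vec using (tabulate)
open import Data.Product using (Σ; ∃; _×_; _,_)
open import Data.Sum using (_⊎_)
open import Data.Integer using (+_)
open import Data.Rational using (ℚ; _/_; _*_; _-_; _+_; _≤_; _<_; 0ℚ; 1ℚ)
open import Function.Definitions using (Injective)
open import Relation.Binary.PropositionalEquality using (_≡_; _≢_)
open import Relation.Nullary using (Dec; does)
open import Relation.Nullary.Decidable using (_⊎-dec_; _×-dec_)
open import Data.Rational.Properties using (_≤?_)

ℕ→ℚ : ℕ → ℚ
ℕ→ℚ k = (+ k) / 1

count : ∀ {m} {P : Fin m → Set} → ((i : Fin m) → Dec (P i)) → ℕ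
count P? = ∣ tabulate (λ i → does (P? i)) ∣

record Hypergraph (n : ℕ) : Set where
  field
    m        : ℕ
    edge     : Fin m → Subset n
    injEdge  : Injective _≡_ _≡_ edge
    nonempty : ∀ i → Nonempty (edge i)

open Hypergraph public

Linear : ∀ {n} → Hypergraph n → Set
Linear H = ∀ i j → i ≢ j → ∣ edge H i ∩ edge H j ∣ Data.Nat.≤ 1

degree : ∀ {n} → Hypergraph n → Fin n → ℕ
degree H v = count (λ i → v ∈? edge H i)

ProperEdgeColouring : ∀ {n} → (H : Hypergraph n) → (k : ℕ) → (Fin (m H) → Fin k) → Set
ProperEdgeColouring H k c =
  ∀ i j → i ≢ j → Nonempty (edge H i ∩ edge H j) → c i ≢ c j

ChromaticIndex≤ : ∀ {n} → Hypergraph n → ℚ → Set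
ChromaticIndex≤ H t =
  Σ ℕ λ k → (ℕ→ℚ k ≤ t) × Σ (Fin (m H) → Fin k) λ c → ProperEdgeColouring H k c

-- (1-δ)√n ≤ s ≤ (1+δ)√n, written without square roots:
-- s ≤ (1+δ)√n  ⇔  s² ≤ (1+δ)² n   (both sides nonnegative),
-- (1-δ)√n ≤ s  ⇔  1-δ ≤ 0  or  (1-δ)² n ≤ s².
MidSize : ℚ → ℕ → ℕ → Set
MidSize δ n s =
  ((1ℚ - δ ≤ 0ℚ) ⊎ ((1ℚ - δ) * (1ℚ - δ) * ℕ→ℚ n ≤ ℕ→ℚ s * ℕ→ℚ s))
  × (ℕ→ℚ s * ℕ→ℚ s ≤ (1ℚ + δ) * (1ℚ + δ) * ℕ→ℚ n)

midSize? : (δ : ℚ) (n s : ℕ) → Dec (MidSize δ n s)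
midSize? δ n s =
  ((1ℚ - δ ≤? 0ℚ) ⊎-dec ((1ℚ - δ) * (1ℚ - δ) * ℕ→ℚ n ≤? ℕ→ℚ s * ℕ→ℚ s))
  ×-dec (ℕ→ℚ s * ℕ→ℚ s ≤? (1ℚ + δ) * (1ℚ + δ) * ℕ→ℚ n)

numMidEdges : ∀ {n} → ℚ → Hypergraph n → ℕ
numMidEdges {n} δ H = count (λ i → midSize? δ n ∣ edge H i ∣)

{-# OPTIONS --safe #-}

-- Edges are split by size into small, medium and large ones, with widely separated thresholds. Medium edges have degree
-- o(n) and receive a few colours of their own. Large edges are coloured with (1-τ)n colours. If every sub-hypergraph has
-- an edge of minimum size k meeting fewer than about n of its edges, greedy colouring suffices. Otherwise some
-- sub-hypergraph is saturated: its edges of size about k cover nearly all pairs of vertices. As each of them meets about n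
-- others, k is at most about √n. If k is close to √n, there are more than (1-3δ)n edges of middle size, which is excluded.
-- If k < (1-δ)√n, every neighbourhood contains many disjoint pairs of edges, so colour classes with repetitions in every
-- neighbourhood save a positive proportion of the colours.
--
-- A small edge meets few large edges, so more than (1-δ)n colours, that is more than the maximum degree, remain available
-- for it; its list is then long enough for a nibble. All random choices are derandomised: each step is chosen so that a
-- sum of exponential weights of list sizes, colour degrees and degrees, whose expected change is not positive, does not
-- grow. Saving classes are found in the same way, by conditional expectations over independent bits.

module Submission where

open import Defs
open import Data.Nat using (ℕ; zero; suc; _≥_; z≤n; s≤s)
import Data.Nat as ℕ
import Data.Nat.Properties as ℕₚ
import Data.Nat.DivMod as ℕ-DivMod
open import Data.Bool using (Bool; true; false; _∧_; _∨_; not; if_then_else_)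
open import Data.Fin using (Fin; zero; suc)
import Data.Fin as Fin
import Data.Fin.Properties as Finₚ
open import Data.Maybe using (Maybe; just; nothing)
open import Data.Product using (Σ; _×_; _,_; proj₁; proj₂)
open import Data.Sum using (_⊎_; inj₁; inj₂)
import Data.Sum
open import Data.Empty using (⊥; ⊥-elim)
open import Data.Unit using (⊤; tt)
import Data.Integer as ℤ
import Data.Integer.Properties as ℤₚ
import Data.Rational.Unnormalised as ℚᵘ
import Data.Rational.Unnormalised.Properties as ℚᵘₚ
open import Data.Rational using (ℚ; _+_; _*_; _-_; -_; _≤_; _<_; 0ℚ; 1ℚ)
import Data.Rational as ℚ
open import Data.Rational.Properties using (≤-refl; ≤-trans; ≤-reflexive; <⇒≤; ≤-<-trans; <-≤-trans; <-irrefl; ≮⇒≥; ≰⇒>; _≤?_; _<?_; +-mono-≤; +-mono-<-≤; +-mono-≤-<; +-monoˡ-≤; +-monoʳ-≤; +-identityˡ; +-identityʳ; +-comm; +-assoc; *-comm; *-assoc; *-identityˡ; *-identityʳ; *-zeroˡ; *-zeroʳ; *-distribˡ-+; *-distribʳ-+)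
import Data.Rational.Properties as ℚₚ
open import Relation.Binary.PropositionalEquality using (_≡_; _≢_; refl; sym; trans; cong; cong₂; subst; subst₂)
open import Relation.Nullary using (¬_; Dec; yes; no; does)
open import Function using (_∘_; case_of_)
import Data.Rational.Solver as ℚ-Solver
import Data.Nat.Solver as ℕ-Solver
open import Data.Vec using (Vec; []; _∷_)
import Data.Vec as Vec
open import Data.Vec.N-ary using (N-ary; _$ⁿ_)
import Data.Maybe as Maybe
open import Data.Fin.Subset using (Subset; ∣_∣; _∩_)
open import Data.Fin.Subset.Properties using (_∈?_; x∈p∩q⁻)
import Data.Vec.Properties as Vecₚ
open import Relation.Nullary.Decidable using (dec-true)

-- The nibble is a sequence of two kinds of moves: colour an edge, or merely delete a colour from
-- its list. Deletions are weighted by the gap between `κ` and the current number of conflicts, so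
-- every listed colour of every edge is lost at the same total rate `κ`. A colour degree loses its
-- edges at the rate `κ` plus the surplus of list size over colour degree; this surplus is why a
-- colour degree below the list size is the right hypothesis and why their ratio keeps falling until
-- greedy colouring takes over. Exponentials and logarithms are avoided: weights are natural powers
-- of a rational `1 + η`, compared by Bernoulli's inequality, and time is cut into steps so short
-- that a step may be idle. A union bound becomes the statement that a potential is below 1. For
-- saturated hypergraphs the errors form a hierarchy q, q², q³, q⁴, q⁵: each averaging argument pays
-- for a weaker conclusion about almost all objects with one or more powers of q.

ι : ℕ → ℚ
ι zero = 0ℚ
ι (suc n) = 1ℚ + ι n

-- Polynomial identities. The two sides are compared as closed normal forms, so no open term has to be normalised.

module ℚ-Identities where
  open ℚ-Solver.+-*-Solver

  private
    agree : ∀ {n} → Polynomial n × Polynomial n → Maybe ⊤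
    agree (p , q) = Maybe.map (λ _ → tt) (normalise p ≟N normalise q)

    polynomials : ∀ n → N-ary n (Polynomial n) (Polynomial n × Polynomial n) → Polynomial n × Polynomial n
    polynomials n f = f $ⁿ Vec.map var (Vec.allFin n)

    decide : ∀ n f (ρ : Vec ℚ n) {_ : agree (polynomials n f) ≡ just tt} → ⟦ proj₁ (polynomials n f) ⟧ ρ ≡ ⟦ proj₂ (polynomials n f) ⟧ ρ
    decide n f ρ {eq} = by (proj₁ (polynomials n f)) (proj₂ (polynomials n f)) eq
      where
      by : ∀ p q → agree (p , q) ≡ just tt → ⟦ p ⟧ ρ ≡ ⟦ q ⟧ ρ
      by p q eq with normalise p ≟N normalise q
      ... | just p≈q = trans (sym (correct p ρ)) (trans (⟦ p≈q ⟧N-cong ρ) (correct q ρ))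
      ... | nothing = case eq of λ ()

  ring-1 : ∀ a → a - a ≡ 0ℚ
  ring-1 a = decide 1 (λ a → a :- a := con 0ℚ) (a ∷ []) {refl}

  ring-2 : ∀ a b → a ≡ (a - b) + b
  ring-2 a b = decide 2 (λ a b → a := (a :- b) :+ b) (a ∷ b ∷ []) {refl}

  ring-3 : ∀ a b → a ≡ b + (a - b)
  ring-3 a b = decide 2 (λ a b → a := b :+ (a :- b)) (a ∷ b ∷ []) {refl}

  ring-4 : ∀ x → 1ℚ - (1ℚ - x) ≡ x
  ring-4 x = decide 1 (λ x → con 1ℚ :- (con 1ℚ :- x) := x) (x ∷ []) {refl}

  ring-6 : ∀ x y → y + x * y ≡ (1ℚ + x) * y
  ring-6 x y = decide 2 (λ x y → y :+ x :* y := (con 1ℚ :+ x) :* y) (x ∷ y ∷ []) {refl}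

  ring-7 : ∀ x y → x ≡ (x + y) - y
  ring-7 x y = decide 2 (λ x y → x := (x :+ y) :- y) (x ∷ y ∷ []) {refl}

  ring-8 : ∀ a b c d → a * b * (c * d) ≡ a * c * (b * d)
  ring-8 a b c d = decide 4 (λ a b c d → a :* b :* (c :* d) := a :* c :* (b :* d)) (a ∷ b ∷ c ∷ d ∷ []) {refl}

  ring-9 : ∀ x → 1ℚ + 0ℚ * x ≡ 1ℚ
  ring-9 x = decide 1 (λ x → con 1ℚ :+ con 0ℚ :* x := con 1ℚ) (x ∷ []) {refl}

  ring-10 : ∀ i x → (1ℚ + x) * (1ℚ + i * x) ≡ (1ℚ + (1ℚ + i) * x) + i * (x * x)
  ring-10 i x = decide 2 (λ i x → (con 1ℚ :+ x) :* (con 1ℚ :+ i :* x) := (con 1ℚ :+ (con 1ℚ :+ i) :* x) :+ i :* (x :* x)) (i ∷ x ∷ []) {refl}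

  ring-11 : ∀ x → (0ℚ - x) * (0ℚ - x) ≡ x * x
  ring-11 x = decide 1 (λ x → (con 0ℚ :- x) :* (con 0ℚ :- x) := x :* x) (x ∷ []) {refl}

  ring-12 : ∀ x → (1ℚ + x) - 1ℚ ≡ x
  ring-12 x = decide 1 (λ x → (con 1ℚ :+ x) :- con 1ℚ := x) (x ∷ []) {refl}

  ring-13 : ∀ i x → 1ℚ - i * x ≡ 1ℚ + i * (0ℚ - x)
  ring-13 i x = decide 2 (λ i x → con 1ℚ :- i :* x := con 1ℚ :+ i :* (con 0ℚ :- x)) (i ∷ x ∷ []) {refl}

  ring-14 : ∀ x → 1ℚ - x ≡ 1ℚ + (0ℚ - x)
  ring-14 x = decide 1 (λ x → con 1ℚ :- x := con 1ℚ :+ (con 0ℚ :- x)) (x ∷ []) {refl}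

  ring-15 : ∀ x → 0ℚ ≡ (0ℚ - x) + x
  ring-15 x = decide 1 (λ x → con 0ℚ := (con 0ℚ :- x) :+ x) (x ∷ []) {refl}

  ring-16 : ∀ P b c → P * (b * c) ≡ b * (P * c)
  ring-16 P b c = decide 3 (λ P b c → P :* (b :* c) := b :* (P :* c)) (P ∷ b ∷ c ∷ []) {refl}

  ring-17 : ∀ a s i → i * (a * s) ≡ a * (i * s)
  ring-17 a s i = decide 3 (λ a s i → i :* (a :* s) := a :* (i :* s)) (a ∷ s ∷ i ∷ []) {refl}

  ring-18 : ∀ b → ι 7 * b ≡ b + ι 6 * b
  ring-18 b = decide 1 (λ b → con (ι 7) :* b := b :+ con (ι 6) :* b) (b ∷ []) {refl}

  ring-19 : ∀ g → 1ℚ ≡ (1ℚ - g) + g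
  ring-19 g = decide 1 (λ g → con 1ℚ := (con 1ℚ :- g) :+ g) (g ∷ []) {refl}

  ring-20 : ∀ b → 1ℚ + ι 7 * b ≡ (1ℚ + b) * ((1ℚ + b) * ((1ℚ + b) * 1ℚ)) + (ι 3 * (b * (1ℚ - b)) + b * ((1ℚ - b) * (1ℚ + b)))
  ring-20 b = decide 1 (λ b → con 1ℚ :+ con (ι 7) :* b := (con 1ℚ :+ b) :* ((con 1ℚ :+ b) :* ((con 1ℚ :+ b) :* con 1ℚ)) :+ (con (ι 3) :* (b :* (con 1ℚ :- b)) :+ b :* ((con 1ℚ :- b) :* (con 1ℚ :+ b)))) (b ∷ []) {refl}

  ring-21 : ∀ g → 1ℚ ≡ g * (1ℚ + (1ℚ - g)) + (1ℚ - g) * (1ℚ - g)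
  ring-21 g = decide 1 (λ g → con 1ℚ := g :* (con 1ℚ :+ (con 1ℚ :- g)) :+ (con 1ℚ :- g) :* (con 1ℚ :- g)) (g ∷ []) {refl}

  ring-22 : ∀ P z g → (z * z) * g * P ≡ P * (z * z) * g
  ring-22 P z g = decide 3 (λ P z g → (z :* z) :* g :* P := P :* (z :* z) :* g) (P ∷ z ∷ g ∷ []) {refl}

  ring-23 : ∀ b z g → (z * z) * g * (b * z) ≡ b * (z * (z * z)) * g
  ring-23 b z g = decide 3 (λ b z g → (z :* z) :* g :* (b :* z) := b :* (z :* (z :* z)) :* g) (b ∷ z ∷ g ∷ []) {refl}

  ring-24 : ∀ b z → (b * (b * (b * 1ℚ))) * (z * (z * z)) ≡ (z * b) * ((z * b) * ((z * b) * 1ℚ))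
  ring-24 b z = decide 2 (λ b z → (b :* (b :* (b :* con 1ℚ))) :* (z :* (z :* z)) := (z :* b) :* ((z :* b) :* ((z :* b) :* con 1ℚ))) (b ∷ z ∷ []) {refl}

  ring-25 : ∀ a b c d → (a + b) + (c + d) ≡ (a + c) + (b + d)
  ring-25 a b c d = decide 4 (λ a b c d → (a :+ b) :+ (c :+ d) := (a :+ c) :+ (b :+ d)) (a ∷ b ∷ c ∷ d ∷ []) {refl}

  ring-26 : ∀ a b c d → (a - b) + (c - d) ≡ (a + c) - (b + d)
  ring-26 a b c d = decide 4 (λ a b c d → (a :- b) :+ (c :- d) := (a :+ c) :- (b :+ d)) (a ∷ b ∷ c ∷ d ∷ []) {refl}

  ring-27 : ∀ c i → c + i * c ≡ (1ℚ + i) * c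
  ring-27 c i = decide 2 (λ c i → c :+ i :* c := (con 1ℚ :+ i) :* c) (c ∷ i ∷ []) {refl}

  ring-28 : ∀ N W F F₀ → W * (F - F₀) ≡ N * (F - F₀) + (N - W) * (F₀ - F)
  ring-28 N W F F₀ = decide 4 (λ N W F F₀ → W :* (F :- F₀) := N :* (F :- F₀) :+ (N :- W) :* (F₀ :- F)) (N ∷ W ∷ F ∷ F₀ ∷ []) {refl}

  ring-29 : ∀ w₁ w₂ x y F F₀ → (w₁ + w₂) * (F - F₀) - (w₁ * (x - F₀) + w₂ * (y - F₀)) ≡ 0ℚ - (w₁ * (x - F) + w₂ * (y - F))
  ring-29 w₁ w₂ x y F F₀ = decide 6 (λ w₁ w₂ x y F F₀ → (w₁ :+ w₂) :* (F :- F₀) :- (w₁ :* (x :- F₀) :+ w₂ :* (y :- F₀)) := con 0ℚ :- (w₁ :* (x :- F) :+ w₂ :* (y :- F))) (w₁ ∷ w₂ ∷ x ∷ y ∷ F ∷ F₀ ∷ []) {refl}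

  ring-30 : ∀ w x → 0ℚ ≡ (0ℚ * x - w) + w
  ring-30 w x = decide 2 (λ w x → con 0ℚ := (con 0ℚ :* x :- w) :+ w) (w ∷ x ∷ []) {refl}

  ring-31 : ∀ x y → 1ℚ * x - 1ℚ * y ≡ x - y
  ring-31 x y = decide 2 (λ x y → con 1ℚ :* x :- con 1ℚ :* y := x :- y) (x ∷ y ∷ []) {refl}

  ring-32 : ∀ e y b → e * y * b ≡ e * (1ℚ * y) * b
  ring-32 e y b = decide 3 (λ e y b → e :* y :* b := e :* (con 1ℚ :* y) :* b) (e ∷ y ∷ b ∷ []) {refl}

  ring-33 : ∀ x y → 0ℚ ≡ (x - y) + (y - x)
  ring-33 x y = decide 2 (λ x y → con 0ℚ := (x :- y) :+ (y :- x)) (x ∷ y ∷ []) {refl}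

  ring-34 : ∀ η x y → η * x ≡ ((1ℚ + η) - 1ℚ) * x + (1ℚ - 1ℚ) * y
  ring-34 η x y = decide 3 (λ η x y → η :* x := ((con 1ℚ :+ η) :- con 1ℚ) :* x :+ (con 1ℚ :- con 1ℚ) :* y) (η ∷ x ∷ y ∷ []) {refl}

  ring-35 : ∀ l m x y → (l - 1ℚ) * x + (1ℚ - l * m) * y ≡ (y - x) + l * (x - m * y)
  ring-35 l m x y = decide 4 (λ l m x y → (l :- con 1ℚ) :* x :+ (con 1ℚ :- l :* m) :* y := (y :- x) :+ l :* (x :- m :* y)) (l ∷ m ∷ x ∷ y ∷ []) {refl}

  ring-36 : ∀ e k w l → e * w * k * l ≡ k * e * l * w
  ring-36 e k w l = decide 4 (λ e k w l → e :* w :* k :* l := k :* e :* l :* w) (e ∷ k ∷ w ∷ l ∷ []) {refl}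

  ring-37 : ∀ a b g w d → a * (g * b) + w * (g * d) ≡ g * (a * b) + d * (g * w)
  ring-37 a b g w d = decide 5 (λ a b g w d → a :* (g :* b) :+ w :* (g :* d) := g :* (a :* b) :+ d :* (g :* w)) (a ∷ b ∷ g ∷ w ∷ d ∷ []) {refl}

  ring-38 : ∀ g a k x → g * (a * x) + g * (a * (k - x)) ≡ g * k * a
  ring-38 g a k x = decide 4 (λ g a k x → g :* (a :* x) :+ g :* (a :* (k :- x)) := g :* k :* a) (g ∷ a ∷ k ∷ x ∷ []) {refl}

  ring-39 : ∀ w w′ a a′ b b′ c c′ → w * ((a + a′) - (b + b′)) + w′ * ((c + c′) - (b + b′)) ≡ (w * (a - b) + w′ * (c - b)) + (w * (a′ - b′) + w′ * (c′ - b′))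
  ring-39 w w′ a a′ b b′ c c′ = decide 8 (λ w w′ a a′ b b′ c c′ → w :* ((a :+ a′) :- (b :+ b′)) :+ w′ :* ((c :+ c′) :- (b :+ b′)) := (w :* (a :- b) :+ w′ :* (c :- b)) :+ (w :* (a′ :- b′) :+ w′ :* (c′ :- b′))) (w ∷ w′ ∷ a ∷ a′ ∷ b ∷ b′ ∷ c ∷ c′ ∷ []) {refl}

  ring-40 : ∀ k w w′ a b c → w * (k * a - k * b) + w′ * (k * c - k * b) ≡ k * (w * (a - b) + w′ * (c - b))
  ring-40 k w w′ a b c = decide 6 (λ k w w′ a b c → w :* (k :* a :- k :* b) :+ w′ :* (k :* c :- k :* b) := k :* (w :* (a :- b) :+ w′ :* (c :- b))) (k ∷ w ∷ w′ ∷ a ∷ b ∷ c ∷ []) {refl}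

  ring-41 : ∀ w w′ → w * (0ℚ - 0ℚ) + w′ * (0ℚ - 0ℚ) ≡ 0ℚ
  ring-41 w w′ = decide 2 (λ w w′ → w :* (con 0ℚ :- con 0ℚ) :+ w′ :* (con 0ℚ :- con 0ℚ) := con 0ℚ) (w ∷ w′ ∷ []) {refl}

  ring-42 : ∀ l l′ y x c d k → l + y + (k - c) ≡ (l′ + k - d) + ((l - l′) + ((y + x) - c) + (d - x))
  ring-42 l l′ y x c d k = decide 7 (λ l l′ y x c d k → l :+ y :+ (k :- c) := (l′ :+ k :- d) :+ ((l :- l′) :+ ((y :+ x) :- c) :+ (d :- x))) (l ∷ l′ ∷ y ∷ x ∷ c ∷ d ∷ k ∷ []) {refl}

  ring-43 : ∀ x y → 1ℚ + 0ℚ ≡ 1ℚ + x * (0ℚ * y)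
  ring-43 x y = decide 2 (λ x y → con 1ℚ :+ con 0ℚ := con 1ℚ :+ x :* (con 0ℚ :* y)) (x ∷ y ∷ []) {refl}

  ring-44 : ∀ x y → 0ℚ ≡ 0ℚ + x * (0ℚ * y)
  ring-44 x y = decide 2 (λ x y → con 0ℚ := con 0ℚ :+ x :* (con 0ℚ :* y)) (x ∷ y ∷ []) {refl}

  ring-45 : ∀ y → y ≡ 0ℚ + 1ℚ * (1ℚ * y)
  ring-45 y = decide 1 (λ y → y := con 0ℚ :+ con 1ℚ :* (con 1ℚ :* y)) (y ∷ []) {refl}

  ring-46 : ∀ y → 0ℚ ≡ 0ℚ + 0ℚ * (1ℚ * y)
  ring-46 y = decide 1 (λ y → con 0ℚ := con 0ℚ :+ con 0ℚ :* (con 1ℚ :* y)) (y ∷ []) {refl}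

  ring-47 : ∀ a b t d h i → a * (t + d * h) + b * (d * i) ≡ t * a + d * (a * h + b * i)
  ring-47 a b t d h i = decide 6 (λ a b t d h i → a :* (t :+ d :* h) :+ b :* (d :* i) := t :* a :+ d :* (a :* h :+ b :* i)) (a ∷ b ∷ t ∷ d ∷ h ∷ i ∷ []) {refl}

  ring-48 : ∀ z a o h k i → z + (a * (o * h) + a * k * i) ≡ (z + i * a * k) + o * a * h
  ring-48 z a o h k i = decide 6 (λ z a o h k i → z :+ (a :* (o :* h) :+ a :* k :* i) := (z :+ i :* a :* k) :+ o :* a :* h) (z ∷ a ∷ o ∷ h ∷ k ∷ i ∷ []) {refl}

  ring-49 : ∀ a b c → a * b ≡ b * a + c * 0ℚ
  ring-49 a b c = decide 3 (λ a b c → a :* b := b :* a :+ c :* con 0ℚ) (a ∷ b ∷ c ∷ []) {refl}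

  ring-50 : ∀ a l y k → a * (l + y + k) ≡ (a * l + a * k) + a * y
  ring-50 a l y k = decide 4 (λ a l y k → a :* (l :+ y :+ k) := (a :* l :+ a :* k) :+ a :* y) (a ∷ l ∷ y ∷ k ∷ []) {refl}

  ring-51 : ∀ a b x y g → a * (0ℚ - x * g) + b * (0ℚ - y * g) ≡ (0ℚ - g) * (a * x + b * y)
  ring-51 a b x y g = decide 5 (λ a b x y g → a :* (con 0ℚ :- x :* g) :+ b :* (con 0ℚ :- y :* g) := (con 0ℚ :- g) :* (a :* x :+ b :* y)) (a ∷ b ∷ x ∷ y ∷ g ∷ []) {refl}

  ring-52 : ∀ g S x → (0ℚ - g) * x ≡ (0ℚ - g) * S + g * (S - x)
  ring-52 g S x = decide 3 (λ g S x → (con 0ℚ :- g) :* x := (con 0ℚ :- g) :* S :+ g :* (S :- x)) (g ∷ S ∷ x ∷ []) {refl}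

  ring-53 : ∀ b r x t T → 0ℚ - b * t * r * T ≡ (0ℚ - b * T) * (x * r) + b * r * (x * T - t * T)
  ring-53 b r x t T = decide 5 (λ b r x t T → con 0ℚ :- b :* t :* r :* T := (con 0ℚ :- b :* T) :* (x :* r) :+ b :* r :* (x :* T :- t :* T)) (b ∷ r ∷ x ∷ t ∷ T ∷ []) {refl}

  ring-54 : ∀ y x j b → 0ℚ - j * (b * x) ≡ (y - x) + (x * (1ℚ - j * b) - y)
  ring-54 y x j b = decide 4 (λ y x j b → con 0ℚ :- j :* (b :* x) := (y :- x) :+ (x :* (con 1ℚ :- j :* b) :- y)) (y ∷ x ∷ j ∷ b ∷ []) {refl}

  ring-56 : ∀ a N k x → N * (k - 1ℚ) * x ≡ (0ℚ - a * x) + (a - N * (1ℚ - k)) * x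
  ring-56 a N k x = decide 4 (λ a N k x → N :* (k :- con 1ℚ) :* x := (con 0ℚ :- a :* x) :+ (a :- N :* (con 1ℚ :- k)) :* x) (a ∷ N ∷ k ∷ x ∷ []) {refl}

  ring-57 : ∀ N c G g x → c * g * (N * (G - 1ℚ) * x) ≡ N * (c * (G * g) * x - c * g * x)
  ring-57 N c G g x = decide 5 (λ N c G g x → c :* g :* (N :* (G :- con 1ℚ) :* x) := N :* (c :* (G :* g) :* x :- c :* g :* x)) (N ∷ c ∷ G ∷ g ∷ x ∷ []) {refl}

  ring-58 : ∀ N x x′ y y′ z z′ → N * (x - x′) + (N * (y - y′) + N * (z - z′)) ≡ N * ((x + (y + z)) - (x′ + (y′ + z′)))
  ring-58 N x x′ y y′ z z′ = decide 7 (λ N x x′ y y′ z z′ → N :* (x :- x′) :+ (N :* (y :- y′) :+ N :* (z :- z′)) := N :* ((x :+ (y :+ z)) :- (x′ :+ (y′ :+ z′)))) (N ∷ x ∷ x′ ∷ y ∷ y′ ∷ z ∷ z′ ∷ []) {refl}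

  ring-59 : ∀ a b c → a + (b + c) ≡ b + (a + c)
  ring-59 a b c = decide 3 (λ a b c → a :+ (b :+ c) := b :+ (a :+ c)) (a ∷ b ∷ c ∷ []) {refl}

  ring-60 : ∀ a b c → a + (b + c) ≡ c + (a + b)
  ring-60 a b c = decide 3 (λ a b c → a :+ (b :+ c) := c :+ (a :+ b)) (a ∷ b ∷ c ∷ []) {refl}

  ring-61 : ∀ e p q → e * (p + q) ≡ p * e + e * q
  ring-61 e p q = decide 3 (λ e p q → e :* (p :+ q) := p :* e :+ e :* q) (e ∷ p ∷ q ∷ []) {refl}

  ring-62 : ∀ e p r → e * p * (1ℚ + r * e) ≡ e * ((1ℚ + r * e) * p)
  ring-62 e p r = decide 3 (λ e p r → e :* p :* (con 1ℚ :+ r :* e) := e :* ((con 1ℚ :+ r :* e) :* p)) (e ∷ p ∷ r ∷ []) {refl}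

  ring-63 : ∀ j b e r → (1ℚ + j * (b * (1ℚ + r * e))) - (j * b * (1ℚ + j * e)) ≡ 1ℚ + j * b * ((r - j) * e)
  ring-63 j b e r = decide 4 (λ j b e r → (con 1ℚ :+ j :* (b :* (con 1ℚ :+ r :* e))) :- (j :* b :* (con 1ℚ :+ j :* e)) := con 1ℚ :+ j :* b :* ((r :- j) :* e)) (j ∷ b ∷ e ∷ r ∷ []) {refl}

  ring-64 : ∀ j b e → (1ℚ + j * e) * (1ℚ - j * b) ≡ (1ℚ + j * e) - (j * b * (1ℚ + j * e))
  ring-64 j b e = decide 3 (λ j b e → (con 1ℚ :+ j :* e) :* (con 1ℚ :- j :* b) := (con 1ℚ :+ j :* e) :- (j :* b :* (con 1ℚ :+ j :* e))) (j ∷ b ∷ e ∷ []) {refl}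

  ring-65 : ∀ a b c → 1ℚ + a + b + c ≡ 1ℚ + (a + b + c)
  ring-65 a b c = decide 3 (λ a b c → con 1ℚ :+ a :+ b :+ c := con 1ℚ :+ (a :+ b :+ c)) (a ∷ b ∷ c ∷ []) {refl}

  ring-66 : ∀ a b c → 1ℚ + a + b + c ≡ a + (1ℚ + b + c)
  ring-66 a b c = decide 3 (λ a b c → con 1ℚ :+ a :+ b :+ c := a :+ (con 1ℚ :+ b :+ c)) (a ∷ b ∷ c ∷ []) {refl}

  ring-67 : ∀ a b c → 1ℚ + a + b + c ≡ b + (1ℚ + a + c)
  ring-67 a b c = decide 3 (λ a b c → con 1ℚ :+ a :+ b :+ c := b :+ (con 1ℚ :+ a :+ c)) (a ∷ b ∷ c ∷ []) {refl}

  ring-68 : ∀ b Y c x e r → (1ℚ + Y * (b * c)) * (1ℚ - x * e) + (x * (e - b * (1ℚ + r * e))) ≡ 1ℚ + b * ((Y * c - x) - e * (x * (Y * c + r)))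
  ring-68 b Y c x e r = decide 6 (λ b Y c x e r → (con 1ℚ :+ Y :* (b :* c)) :* (con 1ℚ :- x :* e) :+ (x :* (e :- b :* (con 1ℚ :+ r :* e))) := con 1ℚ :+ b :* ((Y :* c :- x) :- e :* (x :* (Y :* c :+ r)))) (b ∷ Y ∷ c ∷ x ∷ e ∷ r ∷ []) {refl}

  ring-69 : ∀ p x e → p ≡ p + x * (e - e)
  ring-69 p x e = decide 3 (λ p x e → p := p :+ x :* (e :- e)) (p ∷ x ∷ e ∷ []) {refl}

  ring-70 : ∀ e w Y → (1ℚ + w * e) * (1ℚ - Y * e) ≡ 1ℚ + e * ((w - Y) - e * (Y * w))
  ring-70 e w Y = decide 3 (λ e w Y → (con 1ℚ :+ w :* e) :* (con 1ℚ :- Y :* e) := con 1ℚ :+ e :* ((w :- Y) :- e :* (Y :* w))) (e ∷ w ∷ Y ∷ []) {refl}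

  ring-71 : ∀ g k h → g * ((1ℚ + k) * h) ≡ g * h * k + g * h
  ring-71 g k h = decide 3 (λ g k h → g :* ((con 1ℚ :+ k) :* h) := g :* h :* k :+ g :* h) (g ∷ k ∷ h ∷ []) {refl}

  ring-72 : ∀ e → 1ℚ ≡ (1ℚ - e) * (1ℚ + e) + e * e
  ring-72 e = decide 1 (λ e → con 1ℚ := (con 1ℚ :- e) :* (con 1ℚ :+ e) :+ e :* e) (e ∷ []) {refl}

  ring-73 : ∀ q r s → r * (q * s) ≡ q * (r * s)
  ring-73 q r s = decide 3 (λ q r s → r :* (q :* s) := q :* (r :* s)) (q ∷ r ∷ s ∷ []) {refl}

  ring-74 : ∀ y → 1ℚ ≡ (1ℚ + y) * (1ℚ - y) + y * y
  ring-74 y = decide 1 (λ y → con 1ℚ := (con 1ℚ :+ y) :* (con 1ℚ :- y) :+ y :* y) (y ∷ []) {refl}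

  ring-75 : ∀ r d e l → r * d * e * l ≡ l * r * d * e
  ring-75 r d e l = decide 4 (λ r d e l → r :* d :* e :* l := l :* r :* d :* e) (r ∷ d ∷ e ∷ l ∷ []) {refl}

  ring-76 : ∀ x → x ≡ (1ℚ + x) - 1ℚ
  ring-76 x = decide 1 (λ x → x := (con 1ℚ :+ x) :- con 1ℚ) (x ∷ []) {refl}

  ring-77 : ∀ B D z r → B * z * r * (D * z) ≡ z * z * (B * r * D)
  ring-77 B D z r = decide 4 (λ B D z r → B :* z :* r :* (D :* z) := z :* z :* (B :* r :* D)) (B ∷ D ∷ z ∷ r ∷ []) {refl}

  ring-78 : ∀ z R b c → z * z * R * (b * c) ≡ b * (z * z * (R * c))
  ring-78 z R b c = decide 4 (λ z R b c → z :* z :* R :* (b :* c) := b :* (z :* z :* (R :* c))) (z ∷ R ∷ b ∷ c ∷ []) {refl}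

  ring-79 : ∀ b z D′ B′ r D → b * (z * z * (D′ * (B′ + r * D - D))) ≡ b * (D′ * z) * (B′ * z + r * (D * z) - D * z)
  ring-79 b z D′ B′ r D = decide 6 (λ b z D′ B′ r D → b :* (z :* z :* (D′ :* (B′ :+ r :* D :- D))) := b :* (D′ :* z) :* (B′ :* z :+ r :* (D :* z) :- D :* z)) (b ∷ z ∷ D′ ∷ B′ ∷ r ∷ D ∷ []) {refl}

  ring-80 : ∀ b z V B → b * (z * z * (V * B)) ≡ b * (V * z) * (B * z)
  ring-80 b z V B = decide 4 (λ b z V B → b :* (z :* z :* (V :* B)) := b :* (V :* z) :* (B :* z)) (b ∷ z ∷ V ∷ B ∷ []) {refl}

  ring-81 : ∀ t a b P z c → t * (a * b * (P * z * c)) ≡ t * P * z * (a * c * b)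
  ring-81 t a b P z c = decide 6 (λ t a b P z c → t :* (a :* b :* (P :* z :* c)) := t :* P :* z :* (a :* c :* b)) (t ∷ a ∷ b ∷ P ∷ z ∷ c ∷ []) {refl}

  ring-82 : ∀ a b c → ι 3 * (a + (b + c)) ≡ ι 3 * a + (ι 3 * b + ι 3 * c)
  ring-82 a b c = decide 3 (λ a b c → con (ι 3) :* (a :+ (b :+ c)) := con (ι 3) :* a :+ (con (ι 3) :* b :+ con (ι 3) :* c)) (a ∷ b ∷ c ∷ []) {refl}

  ring-83 : ∀ P t y → P * (t * y * (t * y)) ≡ P * (t * t) * (y * y)
  ring-83 P t y = decide 3 (λ P t y → P :* (t :* y :* (t :* y)) := P :* (t :* t) :* (y :* y)) (P ∷ t ∷ y ∷ []) {refl}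

  ring-84 : ∀ x k y → x + k * (y - y) ≡ x
  ring-84 x k y = decide 3 (λ x k y → x :+ k :* (y :- y) := x) (x ∷ k ∷ y ∷ []) {refl}

  ring-85 : ∀ x q → ι 8 * (ι 2 * x * q) ≡ ι 16 * x * q
  ring-85 x q = decide 2 (λ x q → con (ι 8) :* (con (ι 2) :* x :* q) := con (ι 16) :* x :* q) (x ∷ q ∷ []) {refl}

  ring-86 : ∀ c S → (c - 1ℚ) * S ≡ c * S - S
  ring-86 c S = decide 2 (λ c S → (c :- con 1ℚ) :* S := c :* S :- S) (c ∷ S ∷ []) {refl}

  ring-87 : ∀ c S r q → c * S - ι 2 * (r * c) * q ≡ c * (S - ι 2 * r * q)
  ring-87 c S r q = decide 4 (λ c S r q → c :* S :- con (ι 2) :* (r :* c) :* q := c :* (S :- con (ι 2) :* r :* q)) (c ∷ S ∷ r ∷ q ∷ []) {refl}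

  ring-88 : ∀ S r q j → S + (r - 1ℚ) * j ≡ r * (ι 2 * q + j) + ((S - ι 2 * r * q) - j)
  ring-88 S r q j = decide 4 (λ S r q j → S :+ (r :- con 1ℚ) :* j := r :* (con (ι 2) :* q :+ j) :+ ((S :- con (ι 2) :* r :* q) :- j)) (S ∷ r ∷ q ∷ j ∷ []) {refl}

  ring-89 : ∀ S r q j → r * S ≡ (S + (r - 1ℚ) * j) + (r - 1ℚ) * (((S - ι 2 * r * q) - j) + ι 2 * r * q)
  ring-89 S r q j = decide 4 (λ S r q j → r :* S := (S :+ (r :- con 1ℚ) :* j) :+ (r :- con 1ℚ) :* (((S :- con (ι 2) :* r :* q) :- j) :+ con (ι 2) :* r :* q)) (S ∷ r ∷ q ∷ j ∷ []) {refl}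

  ring-90 : ∀ q k S → ι 4 * ((q * k * (ι 2 * q + (k + 1ℚ)) - k * (ι 2 * S + q)) - (q + k + 1ℚ) * (q * (k + 1ℚ) + 1ℚ)) ≡ (q * (q + ι 31 + ι 4 * (q - ι 16)) + (q - ι 16) + (k - ι 3) * (q * (ι 2 * (q - ι 16) + (q + ι 23)) + ((q - ι 16) + ι 12))) + k * (q * q - ι 8 * S)
  ring-90 q k S = decide 3 (λ q k S → con (ι 4) :* ((q :* k :* (con (ι 2) :* q :+ (k :+ con 1ℚ)) :- k :* (con (ι 2) :* S :+ q)) :- (q :+ k :+ con 1ℚ) :* (q :* (k :+ con 1ℚ) :+ con 1ℚ)) := (q :* (q :+ con (ι 31) :+ con (ι 4) :* (q :- con (ι 16))) :+ (q :- con (ι 16)) :+ (k :- con (ι 3)) :* (q :* (con (ι 2) :* (q :- con (ι 16)) :+ (q :+ con (ι 23))) :+ ((q :- con (ι 16)) :+ con (ι 12)))) :+ k :* (q :* q :- con (ι 8) :* S)) (q ∷ k ∷ S ∷ []) {refl}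

  ring-91 : ∀ a b c d → b - d ≡ (a - c) + ((b - a) + (c - d))
  ring-91 a b c d = decide 4 (λ a b c d → b :- d := (a :- c) :+ ((b :- a) :+ (c :- d))) (a ∷ b ∷ c ∷ d ∷ []) {refl}

  ring-92 : ∀ q k S r → S * q * r * (q * k * (ι 2 * q + (k + 1ℚ)) - k * (ι 2 * S + q)) ≡ (q + k + 1ℚ) * (S * q * r * (q * (k + 1ℚ) + 1ℚ)) + S * q * r * ((q * k * (ι 2 * q + (k + 1ℚ)) - k * (ι 2 * S + q)) - (q + k + 1ℚ) * (q * (k + 1ℚ) + 1ℚ))
  ring-92 q k S r = decide 4 (λ q k S r → S :* q :* r :* (q :* k :* (con (ι 2) :* q :+ (k :+ con 1ℚ)) :- k :* (con (ι 2) :* S :+ q)) := (q :+ k :+ con 1ℚ) :* (S :* q :* r :* (q :* (k :+ con 1ℚ) :+ con 1ℚ)) :+ S :* q :* r :* ((q :* k :* (con (ι 2) :* q :+ (k :+ con 1ℚ)) :- k :* (con (ι 2) :* S :+ q)) :- (q :+ k :+ con 1ℚ) :* (q :* (k :+ con 1ℚ) :+ con 1ℚ))) (q ∷ k ∷ S ∷ r ∷ []) {refl}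

  ring-93 : ∀ S q r k → S * q * r * (q * k * (ι 2 * q + (k + 1ℚ)) - k * (ι 2 * S + q)) ≡ q * (k * (S * q * (r * (ι 2 * q + (k + 1ℚ)))) - k * (ι 2 * S + q) * (r * S))
  ring-93 S q r k = decide 4 (λ S q r k → S :* q :* r :* (q :* k :* (con (ι 2) :* q :+ (k :+ con 1ℚ)) :- k :* (con (ι 2) :* S :+ q)) := q :* (k :* (S :* q :* (r :* (con (ι 2) :* q :+ (k :+ con 1ℚ)))) :- k :* (con (ι 2) :* S :+ q) :* (r :* S))) (S ∷ q ∷ r ∷ k ∷ []) {refl}

  ring-94 : ∀ q k S A → (S - 1ℚ) * (k * (q - 1ℚ) * ((q - 1ℚ) * A)) ≡ q * (k * (S * q * A) - k * (ι 2 * S + q) * A) + k * A * (S + q + (q - 1ℚ))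
  ring-94 q k S A = decide 4 (λ q k S A → (S :- con 1ℚ) :* (k :* (q :- con 1ℚ) :* ((q :- con 1ℚ) :* A)) := q :* (k :* (S :* q :* A) :- k :* (con (ι 2) :* S :+ q) :* A) :+ k :* A :* (S :+ q :+ (q :- con 1ℚ))) (q ∷ k ∷ S ∷ A ∷ []) {refl}

  ring-95 : ∀ S k q r → (S - 1ℚ) * (k * (q - 1ℚ) * (S * (q - 1ℚ) + r * (q * (k + 1ℚ) + 1ℚ) - (q * (k + 1ℚ) + 1ℚ))) ≡ (S - 1ℚ) * (k * (q - 1ℚ) * ((q - 1ℚ) * (S + (r - 1ℚ) * (k + 1ℚ)))) + (S - 1ℚ) * (k * (q - 1ℚ) * ((r - 1ℚ) * (k + 1ℚ + 1ℚ)))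
  ring-95 S k q r = decide 4 (λ S k q r → (S :- con 1ℚ) :* (k :* (q :- con 1ℚ) :* (S :* (q :- con 1ℚ) :+ r :* (q :* (k :+ con 1ℚ) :+ con 1ℚ) :- (q :* (k :+ con 1ℚ) :+ con 1ℚ))) := (S :- con 1ℚ) :* (k :* (q :- con 1ℚ) :* ((q :- con 1ℚ) :* (S :+ (r :- con 1ℚ) :* (k :+ con 1ℚ)))) :+ (S :- con 1ℚ) :* (k :* (q :- con 1ℚ) :* ((r :- con 1ℚ) :* (k :+ con 1ℚ :+ con 1ℚ)))) (S ∷ k ∷ q ∷ r ∷ []) {refl}

  ring-96 : ∀ x h B r D → x * h * (B * h * r * (D * h)) ≡ h * (h * h) * (x * (B * r * D))
  ring-96 x h B r D = decide 5 (λ x h B r D → x :* h :* (B :* h :* r :* (D :* h)) := h :* (h :* h) :* (x :* (B :* r :* D))) (x ∷ h ∷ B ∷ r ∷ D ∷ []) {refl}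

  ring-97 : ∀ Y h d b r D → Y * h * (d * h * (b * h + r * (D * h) - D * h)) ≡ h * (h * h) * (Y * (d * (b + r * D - D)))
  ring-97 Y h d b r D = decide 6 (λ Y h d b r D → Y :* h :* (d :* h :* (b :* h :+ r :* (D :* h) :- D :* h)) := h :* (h :* h) :* (Y :* (d :* (b :+ r :* D :- D)))) (Y ∷ h ∷ d ∷ b ∷ r ∷ D ∷ []) {refl}

  ring-98 : ∀ Y h v b → Y * h * (v * h * (b * h)) ≡ h * (h * h) * (Y * (v * b))
  ring-98 Y h v b = decide 4 (λ Y h v b → Y :* h :* (v :* h :* (b :* h)) := h :* (h :* h) :* (Y :* (v :* b))) (Y ∷ h ∷ v ∷ b ∷ []) {refl}

  ring-99 : ∀ b r D → b + r * D - D ≡ b + (r - 1ℚ) * D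
  ring-99 b r D = decide 3 (λ b r D → b :+ r :* D :- D := b :+ (r :- con 1ℚ) :* D) (b ∷ r ∷ D ∷ []) {refl}

  ring-100 : ∀ p a b → (1ℚ - p) * a + p * b ≡ a + p * (b - a)
  ring-100 p a b = decide 3 (λ p a b → (con 1ℚ :- p) :* a :+ p :* b := a :+ p :* (b :- a)) (p ∷ a ∷ b ∷ []) {refl}

  ring-101 : ∀ p a b → (1ℚ - p) * a + p * b ≡ b + (1ℚ - p) * (a - b)
  ring-101 p a b = decide 3 (λ p a b → (con 1ℚ :- p) :* a :+ p :* b := b :+ (con 1ℚ :- p) :* (a :- b)) (p ∷ a ∷ b ∷ []) {refl}

  ring-102 : ∀ p c → (1ℚ - p) * c + p * c ≡ c
  ring-102 p c = decide 2 (λ p c → (con 1ℚ :- p) :* c :+ p :* c := c) (p ∷ c ∷ []) {refl}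

  ring-103 : ∀ p a b c d → (1ℚ - p) * (a + b) + p * (c + d) ≡ ((1ℚ - p) * a + p * c) + ((1ℚ - p) * b + p * d)
  ring-103 p a b c d = decide 5 (λ p a b c d → (con 1ℚ :- p) :* (a :+ b) :+ p :* (c :+ d) := ((con 1ℚ :- p) :* a :+ p :* c) :+ ((con 1ℚ :- p) :* b :+ p :* d)) (p ∷ a ∷ b ∷ c ∷ d ∷ []) {refl}

  ring-104 : ∀ p k a b → (1ℚ - p) * (k * a) + p * (k * b) ≡ k * ((1ℚ - p) * a + p * b)
  ring-104 p k a b = decide 4 (λ p k a b → (con 1ℚ :- p) :* (k :* a) :+ p :* (k :* b) := k :* ((con 1ℚ :- p) :* a :+ p :* b)) (p ∷ k ∷ a ∷ b ∷ []) {refl}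

  ring-105 : ∀ p a b e → (1ℚ - p) * (a * e) + p * (b * e) ≡ ((1ℚ - p) * a + p * b) * e
  ring-105 p a b e = decide 4 (λ p a b e → (con 1ℚ :- p) :* (a :* e) :+ p :* (b :* e) := ((con 1ℚ :- p) :* a :+ p :* b) :* e) (p ∷ a ∷ b ∷ e ∷ []) {refl}

  ring-106 : ∀ a s → (1ℚ - a) * (1ℚ - s) ≡ (1ℚ - (a + s)) + a * s
  ring-106 a s = decide 2 (λ a s → (con 1ℚ :- a) :* (con 1ℚ :- s) := (con 1ℚ :- (a :+ s)) :+ a :* s) (a ∷ s ∷ []) {refl}

  ring-107 : ∀ p → 1ℚ + 1ℚ * (p - 1ℚ) ≡ p
  ring-107 p = decide 1 (λ p → con 1ℚ :+ con 1ℚ :* (p :- con 1ℚ) := p) (p ∷ []) {refl}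

  ring-108 : ∀ p → 1ℚ + 0ℚ * (p - 1ℚ) ≡ 1ℚ
  ring-108 p = decide 1 (λ p → con 1ℚ :+ con 0ℚ :* (p :- con 1ℚ) := con 1ℚ) (p ∷ []) {refl}

  ring-109 : ∀ c h → c * (ℚ.½ * h) ≡ c * h * (1ℚ - ℚ.½ * 1ℚ)
  ring-109 c h = decide 2 (λ c h → c :* (con ℚ.½ :* h) := c :* h :* (con 1ℚ :- con ℚ.½ :* con 1ℚ)) (c ∷ h ∷ []) {refl}

  ring-110 : ∀ c h → c * h ≡ c * h * (1ℚ - ℚ.½ * 0ℚ)
  ring-110 c h = decide 2 (λ c h → c :* h := c :* h :* (con 1ℚ :- con ℚ.½ :* con 0ℚ)) (c ∷ h ∷ []) {refl}

  ring-111 : ∀ t a s b u n → t * (a * (1ℚ - ℚ.½ * s) + b * (u * n)) ≡ t * a + (0ℚ - t * a * ℚ.½) * s + t * (b * u) * n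
  ring-111 t a s b u n = decide 6 (λ t a s b u n → t :* (a :* (con 1ℚ :- con ℚ.½ :* s) :+ b :* (u :* n)) := t :* a :+ (con 0ℚ :- t :* a :* con ℚ.½) :* s :+ t :* (b :* u) :* n) (t ∷ a ∷ s ∷ b ∷ u ∷ n ∷ []) {refl}

  ring-112 : ∀ s x → 1ℚ - ℚ.½ * s ≡ (1ℚ - ℚ.½ * x) + ℚ.½ * (x - s)
  ring-112 s x = decide 2 (λ s x → con 1ℚ :- con ℚ.½ :* s := (con 1ℚ :- con ℚ.½ :* x) :+ con ℚ.½ :* (x :- s)) (s ∷ x ∷ []) {refl}

  ring-113 : ∀ t a s b u → t * a + (0ℚ - t * a * ℚ.½) * s + t * b * u ≡ t * (a * (1ℚ - ℚ.½ * s) + b * u)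
  ring-113 t a s b u = decide 5 (λ t a s b u → t :* a :+ (con 0ℚ :- t :* a :* con ℚ.½) :* s :+ t :* b :* u := t :* (a :* (con 1ℚ :- con ℚ.½ :* s) :+ b :* u)) (t ∷ a ∷ s ∷ b ∷ u ∷ []) {refl}

  ring-114 : ∀ c k h x → c * k * h * x ≡ c * (x * k) * h
  ring-114 c k h x = decide 4 (λ c k h x → c :* k :* h :* x := c :* (x :* k) :* h) (c ∷ k ∷ h ∷ x ∷ []) {refl}

  ring-115 : ∀ x → (1ℚ + 1ℚ * (0ℚ - 1ℚ)) * x ≡ 0ℚ
  ring-115 x = decide 1 (λ x → (con 1ℚ :+ con 1ℚ :* (con 0ℚ :- con 1ℚ)) :* x := con 0ℚ) (x ∷ []) {refl}

  ring-116 : ∀ x y → x * ((1ℚ + 1ℚ * (0ℚ - 1ℚ)) * y) ≡ 0ℚ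
  ring-116 x y = decide 2 (λ x y → x :* ((con 1ℚ :+ con 1ℚ :* (con 0ℚ :- con 1ℚ)) :* y) := con 0ℚ) (x ∷ y ∷ []) {refl}

  ring-117 : ∀ x y → x * (y * (1ℚ - 1ℚ * 1ℚ)) ≡ 0ℚ
  ring-117 x y = decide 2 (λ x y → x :* (y :* (con 1ℚ :- con 1ℚ :* con 1ℚ)) := con 0ℚ) (x ∷ y ∷ []) {refl}

  ring-118 : ∀ p D s → 1ℚ - p * s ≡ ℚ.½ + (ℚ.½ * (1ℚ - ι 6 * (p * D)) + p * (D + (D + D) - s))
  ring-118 p D s = decide 3 (λ p D s → con 1ℚ :- p :* s := con ℚ.½ :+ (con ℚ.½ :* (con 1ℚ :- con (ι 6) :* (p :* D)) :+ p :* (D :+ (D :+ D) :- s))) (p ∷ D ∷ s ∷ []) {refl}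

  ring-119 : ∀ p → (1ℚ + 1ℚ * (p - 1ℚ)) * ((1ℚ + 0ℚ * (p - 1ℚ)) * (1ℚ - p * 0ℚ)) ≡ (1ℚ - p) * 0ℚ + p * 1ℚ
  ring-119 p = decide 1 (λ p → (con 1ℚ :+ con 1ℚ :* (p :- con 1ℚ)) :* ((con 1ℚ :+ con 0ℚ :* (p :- con 1ℚ)) :* (con 1ℚ :- p :* con 0ℚ)) := (con 1ℚ :- p) :* con 0ℚ :+ p :* con 1ℚ) (p ∷ []) {refl}

  ring-120 : ∀ p → (1ℚ + 0ℚ * (p - 1ℚ)) * ((1ℚ + 1ℚ * (p - 1ℚ)) * (1ℚ - p * 0ℚ)) ≡ (1ℚ - p) * 0ℚ + p * 1ℚ
  ring-120 p = decide 1 (λ p → (con 1ℚ :+ con 0ℚ :* (p :- con 1ℚ)) :* ((con 1ℚ :+ con 1ℚ :* (p :- con 1ℚ)) :* (con 1ℚ :- p :* con 0ℚ)) := (con 1ℚ :- p) :* con 0ℚ :+ p :* con 1ℚ) (p ∷ []) {refl}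

  ring-121 : ∀ p → (1ℚ + 0ℚ * (p - 1ℚ)) * ((1ℚ + 0ℚ * (p - 1ℚ)) * (1ℚ - p * 1ℚ)) ≡ (1ℚ - p) * 1ℚ + p * 0ℚ
  ring-121 p = decide 1 (λ p → (con 1ℚ :+ con 0ℚ :* (p :- con 1ℚ)) :* ((con 1ℚ :+ con 0ℚ :* (p :- con 1ℚ)) :* (con 1ℚ :- p :* con 1ℚ)) := (con 1ℚ :- p) :* con 1ℚ :+ p :* con 0ℚ) (p ∷ []) {refl}

  ring-122 : ∀ p → (1ℚ + 0ℚ * (p - 1ℚ)) * ((1ℚ + 0ℚ * (p - 1ℚ)) * (1ℚ - p * 0ℚ)) ≡ (1ℚ - p) * 1ℚ + p * 1ℚ
  ring-122 p = decide 1 (λ p → (con 1ℚ :+ con 0ℚ :* (p :- con 1ℚ)) :* ((con 1ℚ :+ con 0ℚ :* (p :- con 1ℚ)) :* (con 1ℚ :- p :* con 0ℚ)) := (con 1ℚ :- p) :* con 1ℚ :+ p :* con 1ℚ) (p ∷ []) {refl}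

  ring-123 : ∀ p → (1ℚ - p) * (1ℚ + 0ℚ) + p * (1ℚ + 1ℚ) ≡ 1ℚ + p * 1ℚ
  ring-123 p = decide 1 (λ p → (con 1ℚ :- p) :* (con 1ℚ :+ con 0ℚ) :+ p :* (con 1ℚ :+ con 1ℚ) := con 1ℚ :+ p :* con 1ℚ) (p ∷ []) {refl}

  ring-124 : ∀ p → (1ℚ - p) * (1ℚ + 0ℚ) + p * (1ℚ + 0ℚ) ≡ 1ℚ + p * 0ℚ
  ring-124 p = decide 1 (λ p → (con 1ℚ :- p) :* (con 1ℚ :+ con 0ℚ) :+ p :* (con 1ℚ :+ con 0ℚ) := con 1ℚ :+ p :* con 0ℚ) (p ∷ []) {refl}

  ring-125 : ∀ p D d → ι 6 * (1ℚ - p * d) ≡ ι 5 + ((1ℚ - ι 6 * (p * D)) + ι 6 * (p * (D - d)))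
  ring-125 p D d = decide 3 (λ p D d → con (ι 6) :* (con 1ℚ :- p :* d) := con (ι 5) :+ ((con 1ℚ :- con (ι 6) :* (p :* D)) :+ con (ι 6) :* (p :* (D :- d)))) (p ∷ D ∷ d ∷ []) {refl}

  ring-126 : ∀ G x → ι 2 * (G * (x * ℚ.½)) ≡ G * x
  ring-126 G x = decide 2 (λ G x → con (ι 2) :* (G :* (x :* con ℚ.½)) := G :* x) (G ∷ x ∷ []) {refl}

  ring-127 : ∀ K t s → s - 1ℚ ≡ ((K - 1ℚ) * 1ℚ + t * K * 1ℚ) + (s - (1ℚ + t) * K)
  ring-127 K t s = decide 3 (λ K t s → s :- con 1ℚ := ((K :- con 1ℚ) :* con 1ℚ :+ t :* K :* con 1ℚ) :+ (s :- (con 1ℚ :+ t) :* K)) (K ∷ t ∷ s ∷ []) {refl}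

  ring-128 : ∀ K t s → s - 1ℚ ≡ ((K - 1ℚ) * 1ℚ + t * K * 0ℚ) + (s - K)
  ring-128 K t s = decide 3 (λ K t s → s :- con 1ℚ := ((K :- con 1ℚ) :* con 1ℚ :+ t :* K :* con 0ℚ) :+ (s :- K)) (K ∷ t ∷ s ∷ []) {refl}

  ring-129 : ∀ K t s → (K - 1ℚ) * 0ℚ + t * K * 0ℚ ≡ 0ℚ * (s - 1ℚ)
  ring-129 K t s = decide 3 (λ K t s → (K :- con 1ℚ) :* con 0ℚ :+ t :* K :* con 0ℚ := con 0ℚ :* (s :- con 1ℚ)) (K ∷ t ∷ s ∷ []) {refl}

  ring-130 : ∀ K e → (1ℚ + e) * (K - 1ℚ) ≡ K + ((e * K - ι 2) + (1ℚ - e))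
  ring-130 K e = decide 2 (λ K e → (con 1ℚ :+ e) :* (K :- con 1ℚ) := K :+ ((e :* K :- con (ι 2)) :+ (con 1ℚ :- e))) (K ∷ e ∷ []) {refl}

  ring-131 : ∀ e x → (1ℚ + e) * x ≡ x + e * x
  ring-131 e x = decide 2 (λ e x → (con 1ℚ :+ e) :* x := x :+ e :* x) (e ∷ x ∷ []) {refl}

  ring-132 : ∀ e k d x → e * k * d + e * x ≡ e * (k * d + x)
  ring-132 e k d x = decide 4 (λ e k d x → e :* k :* d :+ e :* x := e :* (k :* d :+ x)) (e ∷ k ∷ d ∷ x ∷ []) {refl}

  ring-133 : ∀ a b → b ≡ (a - 1ℚ) + ((1ℚ + b) - a)
  ring-133 a b = decide 2 (λ a b → b := (a :- con 1ℚ) :+ ((con 1ℚ :+ b) :- a)) (a ∷ b ∷ []) {refl}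

  ring-134 : ∀ x → 0ℚ + (1ℚ * 1ℚ + (x + 0ℚ)) ≡ 1ℚ + (0ℚ + (x + 0ℚ))
  ring-134 x = decide 1 (λ x → con 0ℚ :+ (con 1ℚ :* con 1ℚ :+ (x :+ con 0ℚ)) := con 1ℚ :+ (con 0ℚ :+ (x :+ con 0ℚ))) (x ∷ []) {refl}

  ring-135 : ∀ s → s ≡ (s - 1ℚ) + 1ℚ
  ring-135 s = decide 1 (λ s → s := (s :- con 1ℚ) :+ con 1ℚ) (s ∷ []) {refl}

  ring-136 : ∀ g q K → g - 1ℚ ≡ (1ℚ - ι 3 * q) * K + ((g - (1ℚ - ι 2 * q) * K) + (q * K - 1ℚ))
  ring-136 g q K = decide 3 (λ g q K → g :- con 1ℚ := (con 1ℚ :- con (ι 3) :* q) :* K :+ ((g :- (con 1ℚ :- con (ι 2) :* q) :* K) :+ (q :* K :- con 1ℚ))) (g ∷ q ∷ K ∷ []) {refl}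

  ring-137 : ∀ q K → (1ℚ + q) * K * ((1ℚ + q) * K) ≡ (1ℚ + q) * (1ℚ + q) * (K * K)
  ring-137 q K = decide 2 (λ q K → (con 1ℚ :+ q) :* K :* ((con 1ℚ :+ q) :* K) := (con 1ℚ :+ q) :* (con 1ℚ :+ q) :* (K :* K)) (q ∷ K ∷ []) {refl}

  ring-138 : ∀ q d N → ((1ℚ - d) * (1ℚ - d) + ι 5 * q) * N ≡ (ι 2 * q * N + (1ℚ + q) * (1ℚ + q) * ((1ℚ - d) * (1ℚ - d) * N)) + (q * (1ℚ - q) + ι 2 * (q * (d * (1ℚ - d))) + ι 2 * (q * d) + q * q * (d * (1ℚ - d)) + q * q * d) * N
  ring-138 q d N = decide 3 (λ q d N → ((con 1ℚ :- d) :* (con 1ℚ :- d) :+ con (ι 5) :* q) :* N := (con (ι 2) :* q :* N :+ (con 1ℚ :+ q) :* (con 1ℚ :+ q) :* ((con 1ℚ :- d) :* (con 1ℚ :- d) :* N)) :+ (q :* (con 1ℚ :- q) :+ con (ι 2) :* (q :* (d :* (con 1ℚ :- d))) :+ con (ι 2) :* (q :* d) :+ q :* q :* (d :* (con 1ℚ :- d)) :+ q :* q :* d) :* N) (q ∷ d ∷ N ∷ []) {refl}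

  ring-139 : ∀ d N z → ι 48 * ((1ℚ - ℚ.½ * d) * N - z) ≡ ι 48 * (ℚ.½ * N) + (ι 3 * (d * N - ι 16 * z) + (ι 9 * (1ℚ - ι 3 * d) + ι 15) * N)
  ring-139 d N z = decide 3 (λ d N z → con (ι 48) :* ((con 1ℚ :- con ℚ.½ :* d) :* N :- z) := con (ι 48) :* (con ℚ.½ :* N) :+ (con (ι 3) :* (d :* N :- con (ι 16) :* z) :+ (con (ι 9) :* (con 1ℚ :- con (ι 3) :* d) :+ con (ι 15)) :* N)) (d ∷ N ∷ z ∷ []) {refl}

  ring-140 : ∀ s D d N z u → s ≡ ((1ℚ - ℚ.½ * d) * N - z) + ((D - (1ℚ - ℚ.½ * d) * N) + (z - u) + (u + s - D))
  ring-140 s D d N z u = decide 6 (λ s D d N z u → s := ((con 1ℚ :- con ℚ.½ :* d) :* N :- z) :+ ((D :- (con 1ℚ :- con ℚ.½ :* d) :* N) :+ (z :- u) :+ (u :+ s :- D))) (s ∷ D ∷ d ∷ N ∷ z ∷ u ∷ []) {refl}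

  ring-141 : ∀ d N q z → ι 48 * ((1ℚ - ℚ.½ * d) * N - z - 1ℚ - ((1ℚ - d) * (1ℚ - d) + ι 5 * q) * N) ≡ ι 48 * (d * N) + (ι 48 * (q * N - 1ℚ) + ι 3 * (d * N - ι 16 * z) + (ι 16 * (d * (1ℚ - ι 3 * d)) + ι 3 * (d - ι 100 * q) + ι 2 * d + ι 12 * q) * N)
  ring-141 d N q z = decide 4 (λ d N q z → con (ι 48) :* ((con 1ℚ :- con ℚ.½ :* d) :* N :- z :- con 1ℚ :- ((con 1ℚ :- d) :* (con 1ℚ :- d) :+ con (ι 5) :* q) :* N) := con (ι 48) :* (d :* N) :+ (con (ι 48) :* (q :* N :- con 1ℚ) :+ con (ι 3) :* (d :* N :- con (ι 16) :* z) :+ (con (ι 16) :* (d :* (con 1ℚ :- con (ι 3) :* d)) :+ con (ι 3) :* (d :- con (ι 100) :* q) :+ con (ι 2) :* d :+ con (ι 12) :* q) :* N)) (d ∷ N ∷ q ∷ z ∷ []) {refl}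

  ring-142 : ∀ s D d N z u q c → s ≡ ((1ℚ - ℚ.½ * d) * N - z - 1ℚ - ((1ℚ - d) * (1ℚ - d) + ι 5 * q) * N) + ((D - (1ℚ - ℚ.½ * d) * N) + (z - u) + (((1ℚ - d) * (1ℚ - d) + ι 5 * q) * N - c) + (u + (1ℚ + (c + s)) - D))
  ring-142 s D d N z u q c = decide 8 (λ s D d N z u q c → s := ((con 1ℚ :- con ℚ.½ :* d) :* N :- z :- con 1ℚ :- ((con 1ℚ :- d) :* (con 1ℚ :- d) :+ con (ι 5) :* q) :* N) :+ ((D :- (con 1ℚ :- con ℚ.½ :* d) :* N) :+ (z :- u) :+ (((con 1ℚ :- d) :* (con 1ℚ :- d) :+ con (ι 5) :* q) :* N :- c) :+ (u :+ (con 1ℚ :+ (c :+ s)) :- D))) (s ∷ D ∷ d ∷ N ∷ z ∷ u ∷ q ∷ c ∷ []) {refl}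

  ring-143 : ∀ s → 1ℚ * s ≡ 0ℚ * s + 1ℚ * s
  ring-143 s = decide 1 (λ s → con 1ℚ :* s := con 0ℚ :* s :+ con 1ℚ :* s) (s ∷ []) {refl}

  ring-144 : ∀ s → 1ℚ * s ≡ 1ℚ * s + 0ℚ * s
  ring-144 s = decide 1 (λ s → con 1ℚ :* s := con 1ℚ :* s :+ con 0ℚ :* s) (s ∷ []) {refl}

  ring-145 : ∀ s → 0ℚ * s ≡ 0ℚ * s + 0ℚ * s
  ring-145 s = decide 1 (λ s → con 0ℚ :* s := con 0ℚ :* s :+ con 0ℚ :* s) (s ∷ []) {refl}

  ring-146 : ∀ x w f q p d N → x ≡ ℚ.½ * ℚ.½ * d * N + ((x + w - f) + (f - (1ℚ - p) * N) + ((1ℚ - ℚ.½ * d) * N - w) + ((q - p) + ℚ.½ * ℚ.½ * (d - ι 100 * q) + ι 24 * q) * N)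
  ring-146 x w f q p d N = decide 7 (λ x w f q p d N → x := con ℚ.½ :* con ℚ.½ :* d :* N :+ ((x :+ w :- f) :+ (f :- (con 1ℚ :- p) :* N) :+ ((con 1ℚ :- con ℚ.½ :* d) :* N :- w) :+ ((q :- p) :+ con ℚ.½ :* con ℚ.½ :* (d :- con (ι 100) :* q) :+ con (ι 24) :* q) :* N)) (x ∷ w ∷ f ∷ q ∷ p ∷ d ∷ N ∷ []) {refl}

  ring-147 : ∀ q K → ι 4 * (K * K) ≡ (1ℚ + q) * K * ((1ℚ + q) * K) + ((1ℚ - q) * (ι 3 + q)) * (K * K)
  ring-147 q K = decide 2 (λ q K → con (ι 4) :* (K :* K) := (con 1ℚ :+ q) :* K :* ((con 1ℚ :+ q) :* K) :+ ((con 1ℚ :- q) :* (con (ι 3) :+ q)) :* (K :* K)) (q ∷ K ∷ []) {refl}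

  ring-148 : ∀ q → ι 10 * q ≡ q + ι 9 * q
  ring-148 q = decide 1 (λ q → con (ι 10) :* q := q :+ con (ι 9) :* q) (q ∷ []) {refl}

  ring-149 : ∀ i a g b → i * (a + g * b) ≡ i * a + i * g * b
  ring-149 i a g b = decide 4 (λ i a g b → i :* (a :+ g :* b) := i :* a :+ i :* g :* b) (i ∷ a ∷ g ∷ b ∷ []) {refl}

  ring-150 : ∀ N a b → (1ℚ + b) * N ≡ (1ℚ - a) * N + 1ℚ * ((a + b) * N)
  ring-150 N a b = decide 3 (λ N a b → (con 1ℚ :+ b) :* N := (con 1ℚ :- a) :* N :+ con 1ℚ :* ((a :+ b) :* N)) (N ∷ a ∷ b ∷ []) {refl}

  ring-151 : ∀ x y → x ≡ x + 0ℚ * y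
  ring-151 x y = decide 2 (λ x y → x := x :+ con 0ℚ :* y) (x ∷ y ∷ []) {refl}

  ring-152 : ∀ q p → 1ℚ - p - ι 2 * q ≡ (1ℚ - ι 3 * q) + (q - p)
  ring-152 q p = decide 2 (λ q p → con 1ℚ :- p :- con (ι 2) :* q := (con 1ℚ :- con (ι 3) :* q) :+ (q :- p)) (q ∷ p ∷ []) {refl}

  ring-153 : ∀ q → q * (q * q) * (ι 2 * q) ≡ (q * (q * (q * (q * q))) + q * (q * (q * q))) + (q * (q * (q * q)) - q * (q * (q * (q * q))))
  ring-153 q = decide 1 (λ q → q :* (q :* q) :* (con (ι 2) :* q) := (q :* (q :* (q :* (q :* q))) :+ q :* (q :* (q :* q))) :+ (q :* (q :* (q :* q)) :- q :* (q :* (q :* (q :* q))))) (q ∷ []) {refl}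

  ring-154 : ∀ r K d → r * (K * d) ≡ d * (r * K)
  ring-154 r K d = decide 3 (λ r K d → r :* (K :* d) := d :* (r :* K)) (r ∷ K ∷ d ∷ []) {refl}

  ring-155 : ∀ q p N → ι 10 * ((1ℚ - p) * ((1ℚ + ι 2 * q) * (1ℚ + ι 2 * q) * N)) ≡ ι 10 * ((1ℚ + q) * (1ℚ + q) * ((1ℚ + p) * N)) + (ι 20 * (q - p) + ι 6 * (q * (q - ι 10 * p)) + ι 5 * (q * q * (1ℚ - ι 10 * p)) + ι 19 * (q * q)) * N
  ring-155 q p N = decide 3 (λ q p N → con (ι 10) :* ((con 1ℚ :- p) :* ((con 1ℚ :+ con (ι 2) :* q) :* (con 1ℚ :+ con (ι 2) :* q) :* N)) := con (ι 10) :* ((con 1ℚ :+ q) :* (con 1ℚ :+ q) :* ((con 1ℚ :+ p) :* N)) :+ (con (ι 20) :* (q :- p) :+ con (ι 6) :* (q :* (q :- con (ι 10) :* p)) :+ con (ι 5) :* (q :* q :* (con 1ℚ :- con (ι 10) :* p)) :+ con (ι 19) :* (q :* q)) :* N) (q ∷ p ∷ N ∷ []) {refl}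

  ring-156 : ∀ a K → a * K * (a * K) ≡ a * a * (K * K)
  ring-156 a K = decide 2 (λ a K → a :* K :* (a :* K) := a :* a :* (K :* K)) (a ∷ K ∷ []) {refl}

  ring-157 : ∀ q p δ N → (1ℚ - p) * ((1ℚ - ι 9 * q) * N) ≡ (1ℚ + q) * ((1ℚ + p) * ((1ℚ - ι 3 * δ) * N)) + (ι 18 * q + (ι 3 * (δ - ι 10 * q) + ι 2 * (q - p) + ι 3 * (δ * (q + p + q * p)) + ι 8 * (q * p))) * N
  ring-157 q p δ N = decide 4 (λ q p δ N → (con 1ℚ :- p) :* ((con 1ℚ :- con (ι 9) :* q) :* N) := (con 1ℚ :+ q) :* ((con 1ℚ :+ p) :* ((con 1ℚ :- con (ι 3) :* δ) :* N)) :+ (con (ι 18) :* q :+ (con (ι 3) :* (δ :- con (ι 10) :* q) :+ con (ι 2) :* (q :- p) :+ con (ι 3) :* (δ :* (q :+ p :+ q :* p)) :+ con (ι 8) :* (q :* p))) :* N) (q ∷ p ∷ δ ∷ N ∷ []) {refl}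

  ring-158 : ∀ q p K N → K * ((1ℚ + ι 3 * q) * N) ≡ (1ℚ + q) * K * ((1ℚ + p) * N) + ((q - p) + q * (1ℚ - p)) * (K * N)
  ring-158 q p K N = decide 4 (λ q p K N → K :* ((con 1ℚ :+ con (ι 3) :* q) :* N) := (con 1ℚ :+ q) :* K :* ((con 1ℚ :+ p) :* N) :+ ((q :- p) :+ q :* (con 1ℚ :- p)) :* (K :* N)) (q ∷ p ∷ K ∷ N ∷ []) {refl}

  ring-159 : ∀ q N → q * ((1ℚ + 1ℚ) * N) ≡ ι 2 * q * N
  ring-159 q N = decide 2 (λ q N → q :* ((con 1ℚ :+ con 1ℚ) :* N) := con (ι 2) :* q :* N) (q ∷ N ∷ []) {refl}

  ring-160 : ∀ x w q p N → ι 10 * q * (N * N) ≡ x + ((N * ((1ℚ + p) * N) - (w + x)) + (w - (1ℚ - ι 9 * q) * (N * N)) + (q - p) * (N * N))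
  ring-160 x w q p N = decide 5 (λ x w q p N → con (ι 10) :* q :* (N :* N) := x :+ ((N :* ((con 1ℚ :+ p) :* N) :- (w :+ x)) :+ (w :- (con 1ℚ :- con (ι 9) :* q) :* (N :* N)) :+ (q :- p) :* (N :* N))) (x ∷ w ∷ q ∷ p ∷ N ∷ []) {refl}

  ring-161 : ∀ x w q M → ι 10 * q * M ≡ x + ((M - (w + x)) + (w - (1ℚ - ι 10 * q) * M))
  ring-161 x w q M = decide 4 (λ x w q M → con (ι 10) :* q :* M := x :+ ((M :- (w :+ x)) :+ (w :- (con 1ℚ :- con (ι 10) :* q) :* M))) (x ∷ w ∷ q ∷ M ∷ []) {refl}

  ring-162 : ∀ N d k w → ι 1 * (ℚ.½ * ℚ.½) * (N * (d * (k * w))) ≡ k * (w * (ℚ.½ * ℚ.½ * d * N))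
  ring-162 N d k w = decide 4 (λ N d k w → con (ι 1) :* (con ℚ.½ :* con ℚ.½) :* (N :* (d :* (k :* w))) := k :* (w :* (con ℚ.½ :* con ℚ.½ :* d :* N))) (N ∷ d ∷ k ∷ w ∷ []) {refl}

  ring-163 : ∀ q N → ι 10 * q * (N * N) * ((1ℚ + 1ℚ) * N) ≡ ι 1 * (ℚ.½ * ℚ.½) * (N * (ι 80 * q * (N * N)))
  ring-163 q N = decide 2 (λ q N → con (ι 10) :* q :* (N :* N) :* ((con 1ℚ :+ con 1ℚ) :* N) := con (ι 1) :* (con ℚ.½ :* con ℚ.½) :* (N :* (con (ι 80) :* q :* (N :* N)))) (q ∷ N ∷ []) {refl}

  ring-164 : ∀ d q M w k → d * (ι 10 * q * M + w * (ι 4 * k)) ≡ d * (ι 10 * q * M) + ι 4 * (d * (k * w))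
  ring-164 d q M w k = decide 5 (λ d q M w k → d :* (con (ι 10) :* q :* M :+ w :* (con (ι 4) :* k)) := d :* (con (ι 10) :* q :* M) :+ con (ι 4) :* (d :* (k :* w))) (d ∷ q ∷ M ∷ w ∷ k ∷ []) {refl}

  ring-165 : ∀ q d M t → ι 3 * (d * (ℚ.½ * M)) ≡ ι 3 * (1ℚ * (ι 10 * q * M) + ι 4 * (ι 80 * q * M)) + ((t - ι 990 * q) * M + ((d - t) * M + ℚ.½ * d * M))
  ring-165 q d M t = decide 4 (λ q d M t → con (ι 3) :* (d :* (con ℚ.½ :* M)) := con (ι 3) :* (con 1ℚ :* (con (ι 10) :* q :* M) :+ con (ι 4) :* (con (ι 80) :* q :* M)) :+ ((t :- con (ι 990) :* q) :* M :+ ((d :- t) :* M :+ con ℚ.½ :* d :* M))) (q ∷ d ∷ M ∷ t ∷ []) {refl}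

  ring-166 : ∀ s l a y N → s ≡ (1ℚ - a - y) * N + ((s + l - (1ℚ - a) * N) + (y * N - l))
  ring-166 s l a y N = decide 5 (λ s l a y N → s := (con 1ℚ :- a :- y) :* N :+ ((s :+ l :- (con 1ℚ :- a) :* N) :+ (y :* N :- l))) (s ∷ l ∷ a ∷ y ∷ N ∷ []) {refl}

  ring-167 : ∀ x e N d a → (e + a) * N ≡ x + (((1ℚ + e) * N - (d + x)) + (d - (1ℚ - a) * N))
  ring-167 x e N d a = decide 5 (λ x e N d a → (e :+ a) :* N := x :+ (((con 1ℚ :+ e) :* N :- (d :+ x)) :+ (d :- (con 1ℚ :- a) :* N))) (x ∷ e ∷ N ∷ d ∷ a ∷ []) {refl}

  ring-168 : ∀ k i d → i * d * k ≡ i * (k * d)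
  ring-168 k i d = decide 3 (λ k i d → i :* d :* k := i :* (k :* d)) (k ∷ i ∷ d ∷ []) {refl}

  ring-169 : ∀ K q p N → (1ℚ - q * p) * N * K ≡ K * ((1ℚ - p) * N) + K * N * (p * (1ℚ - q))
  ring-169 K q p N = decide 4 (λ K q p N → (con 1ℚ :- q :* p) :* N :* K := K :* ((con 1ℚ :- p) :* N) :+ K :* N :* (p :* (con 1ℚ :- q))) (K ∷ q ∷ p ∷ N ∷ []) {refl}

  ring-170 : ∀ p N c q K → (p - q * p) * N * K ≡ p * N * (1ℚ + c) * ((1ℚ - ι 2 * q) * K) + p * N * K * ((q - c) + ι 2 * (q * c))
  ring-170 p N c q K = decide 5 (λ p N c q K → (p :- q :* p) :* N :* K := p :* N :* (con 1ℚ :+ c) :* ((con 1ℚ :- con (ι 2) :* q) :* K) :+ p :* N :* K :* ((q :- c) :+ con (ι 2) :* (q :* c))) (p ∷ N ∷ c ∷ q ∷ K ∷ []) {refl}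

  ring-171 : ∀ q N K → (q * q - q * (q * q)) * N * K ≡ (1ℚ - q * (q * (q * (q * q)))) * N * K - (1ℚ + q * (q * q)) * K * ((1ℚ - q * q) * N)
  ring-171 q N K = decide 3 (λ q N K → (q :* q :- q :* (q :* q)) :* N :* K := (con 1ℚ :- q :* (q :* (q :* (q :* q)))) :* N :* K :- (con 1ℚ :+ q :* (q :* q)) :* K :* ((con 1ℚ :- q :* q) :* N)) (q ∷ N ∷ K ∷ []) {refl}

  ring-172 : ∀ s g q N → s + g * ((q * q + q * (q * (q * (q * q)))) * N) - s ≡ q * q * N * (1ℚ + q * (q * q)) * g
  ring-172 s g q N = decide 4 (λ s g q N → s :+ g :* ((q :* q :+ q :* (q :* (q :* (q :* q)))) :* N) :- s := q :* q :* N :* (con 1ℚ :+ q :* (q :* q)) :* g) (s ∷ g ∷ q ∷ N ∷ []) {refl}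

  ring-173 : ∀ q N → (1ℚ - ι 3 * q) * ((1ℚ - ι 3 * q) * N) * ((1ℚ - ι 3 * q) * N) ≡ (1ℚ - ι 9 * q) * (N * N) + ι 27 * (q * q * (1ℚ - q)) * (N * N)
  ring-173 q N = decide 2 (λ q N → (con 1ℚ :- con (ι 3) :* q) :* ((con 1ℚ :- con (ι 3) :* q) :* N) :* ((con 1ℚ :- con (ι 3) :* q) :* N) := (con 1ℚ :- con (ι 9) :* q) :* (N :* N) :+ con (ι 27) :* (q :* q :* (con 1ℚ :- q)) :* (N :* N)) (q ∷ N ∷ []) {refl}

  ring-174 : ∀ p e q → q * (ι 2 * q) ≡ (e + q * q) + (q * q - e)
  ring-174 p e q = decide 3 (λ p e q → q :* (con (ι 2) :* q) := (e :+ q :* q) :+ (q :* q :- e)) (p ∷ e ∷ q ∷ []) {refl}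

  ring-175 : ∀ q p M → (1ℚ - ι 9 * q) * M ≡ (1ℚ + p) * ((1ℚ - ι 10 * q) * M) + ((q - p) + ι 10 * (q * p)) * M
  ring-175 q p M = decide 3 (λ q p M → (con 1ℚ :- con (ι 9) :* q) :* M := (con 1ℚ :+ p) :* ((con 1ℚ :- con (ι 10) :* q) :* M) :+ ((q :- p) :+ con (ι 10) :* (q :* p)) :* M) (q ∷ p ∷ M ∷ []) {refl}

  ring-176 : ∀ k w s → k * (w * s) ≡ w * (s * k)
  ring-176 k w s = decide 3 (λ k w s → k :* (w :* s) := w :* (s :* k)) (k ∷ w ∷ s ∷ []) {refl}

  ring-177 : ∀ N a K → N * (a * (K * K)) ≡ a * N * (K * K)
  ring-177 N a K = decide 3 (λ N a K → N :* (a :* (K :* K)) := a :* N :* (K :* K)) (N ∷ a ∷ K ∷ []) {refl}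

  ring-178 : ∀ s K a → s * (K * (a * (K - 1ℚ))) ≡ a * (s * (K * (K - 1ℚ)))
  ring-178 s K a = decide 3 (λ s K a → s :* (K :* (a :* (K :- con 1ℚ))) := a :* (s :* (K :* (K :- con 1ℚ)))) (s ∷ K ∷ a ∷ []) {refl}

  ring-179 : ∀ a N → a * (N * N) ≡ N * (a * N)
  ring-179 a N = decide 2 (λ a N → a :* (N :* N) := N :* (a :* N)) (a ∷ N ∷ []) {refl}

  ring-180 : ∀ N a b → N * (a * (b * N)) ≡ a * (b * (N * N))
  ring-180 N a b = decide 3 (λ N a b → N :* (a :* (b :* N)) := a :* (b :* (N :* N))) (N ∷ a ∷ b ∷ []) {refl}

  ring-181 : ∀ a K s b → a * (K * (s * (b * K))) ≡ a * (K * K) * (b * s)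
  ring-181 a K s b = decide 4 (λ a K s b → a :* (K :* (s :* (b :* K))) := a :* (K :* K) :* (b :* s)) (a ∷ K ∷ s ∷ b ∷ []) {refl}

  ring-182 : ∀ a N b s → a * N * (b * s) ≡ N * (b * (a * s))
  ring-182 a N b s = decide 4 (λ a N b s → a :* N :* (b :* s) := N :* (b :* (a :* s))) (a ∷ N ∷ b ∷ s ∷ []) {refl}

  ring-183 : ∀ s c d → (s + c) - d ≡ c - (d - s)
  ring-183 s c d = decide 3 (λ s c d → (s :+ c) :- d := c :- (d :- s)) (s ∷ c ∷ d ∷ []) {refl}

  ring-184 : ∀ d u s → d - s ≡ u + (d - (u + s))
  ring-184 d u s = decide 3 (λ d u s → d :- s := u :+ (d :- (u :+ s))) (d ∷ u ∷ s ∷ []) {refl}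

  ring-185 : ∀ x → ι 10 * (ℚ.½ * x) ≡ ι 5 * x
  ring-185 x = decide 1 (λ x → con (ι 10) :* (con ℚ.½ :* x) := con (ι 5) :* x) (x ∷ []) {refl}

  ring-186 : ∀ x → ι 2 * (ι 2 * x) ≡ ι 4 * x
  ring-186 x = decide 1 (λ x → con (ι 2) :* (con (ι 2) :* x) := con (ι 4) :* x) (x ∷ []) {refl}

  ring-187 : ∀ x → x ≡ ι 2 * (ℚ.½ * x)
  ring-187 x = decide 1 (λ x → x := con (ι 2) :* (con ℚ.½ :* x)) (x ∷ []) {refl}

  ring-188 : ∀ x → 1ℚ * (x + x) ≡ ι 2 * x
  ring-188 x = decide 1 (λ x → con 1ℚ :* (x :+ x) := con (ι 2) :* x) (x ∷ []) {refl}

  ring-189 : ∀ p N → ι 6 * (p * (ι 2 * N)) ≡ ι 12 * (p * N)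
  ring-189 p N = decide 2 (λ p N → con (ι 6) :* (p :* (con (ι 2) :* N)) := con (ι 12) :* (p :* N)) (p ∷ N ∷ []) {refl}

  ring-190 : ∀ p N d → ι 1152 * (ℚ.½ * N * (d * N) * (p * (p * ℚ.½) * ℚ.½)) ≡ d * (ι 12 * (p * N) * (ι 12 * (p * N)))
  ring-190 p N d = decide 3 (λ p N d → con (ι 1152) :* (con ℚ.½ :* N :* (d :* N) :* (p :* (p :* con ℚ.½) :* con ℚ.½)) := d :* (con (ι 12) :* (p :* N) :* (con (ι 12) :* (p :* N)))) (p ∷ N ∷ d ∷ []) {refl}

  ring-191 : ∀ d → d * (1ℚ * 1ℚ) ≡ d
  ring-191 d = decide 1 (λ d → d :* (con 1ℚ :* con 1ℚ) := d) (d ∷ []) {refl}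

  ring-192 : ∀ s → ι 2304 * (1ℚ - ℚ.½ * s) ≡ ι 2304 - ι 1152 * s
  ring-192 s = decide 1 (λ s → con (ι 2304) :* (con 1ℚ :- con ℚ.½ :* s) := con (ι 2304) :- con (ι 1152) :* s) (s ∷ []) {refl}

  ring-193 : ∀ t → ι 2304 - ι 2304 * (1ℚ - t) ≡ ι 2304 * t
  ring-193 t = decide 1 (λ t → con (ι 2304) :- con (ι 2304) :* (con 1ℚ :- t) := con (ι 2304) :* t) (t ∷ []) {refl}

  ring-194 : ∀ m x → m * (ι 2 * x) ≡ ι 2 * m * x
  ring-194 m x = decide 2 (λ m x → m :* (con (ι 2) :* x) := con (ι 2) :* m :* x) (m ∷ x ∷ []) {refl}

  ring-195 : ∀ y c q f N → y + c ≡ (1ℚ + ι 3 * q) * N + ((y - (ι 3 * q + f) * N) + (c - (1ℚ - f) * N))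
  ring-195 y c q f N = decide 5 (λ y c q f N → y :+ c := (con 1ℚ :+ con (ι 3) :* q) :* N :+ ((y :- (con (ι 3) :* q :+ f) :* N) :+ (c :- (con 1ℚ :- f) :* N))) (y ∷ c ∷ q ∷ f ∷ N ∷ []) {refl}

  ring-196 : ∀ c s k f N → c - s ≡ (1ℚ - k) * N + ((c - (1ℚ - f) * N) + ((k - f) * N - s))
  ring-196 c s k f N = decide 5 (λ c s k f N → c :- s := (con 1ℚ :- k) :* N :+ ((c :- (con 1ℚ :- f) :* N) :+ ((k :- f) :* N :- s))) (c ∷ s ∷ k ∷ f ∷ N ∷ []) {refl}

  ring-197 : ∀ a d h → a * (1ℚ - (1ℚ - d * h)) ≡ d * (a * h)
  ring-197 a d h = decide 3 (λ a d h → a :* (con 1ℚ :- (con 1ℚ :- d :* h)) := d :* (a :* h)) (a ∷ d ∷ h ∷ []) {refl}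

  ring-198 : ∀ g → ι 5 * (ι 6 * g) ≡ ι 6 * (ι 5 * g)
  ring-198 g = decide 1 (λ g → con (ι 5) :* (con (ι 6) :* g) := con (ι 6) :* (con (ι 5) :* g)) (g ∷ []) {refl}

  ring-199 : ∀ y z m → 1ℚ + (m - (z + ι 2)) + (1ℚ + y - m) ≡ y - z
  ring-199 y z m = decide 3 (λ y z m → con 1ℚ :+ (m :- (z :+ con (ι 2))) :+ (con 1ℚ :+ y :- m) := y :- z) (y ∷ z ∷ m ∷ []) {refl}

  ring-200 : ∀ y z m → y ≡ 1ℚ + ((1ℚ + y - m) + (m - (z + ι 2)) + z)
  ring-200 y z m = decide 3 (λ y z m → y := con 1ℚ :+ ((con 1ℚ :+ y :- m) :+ (m :- (z :+ con (ι 2))) :+ z)) (y ∷ z ∷ m ∷ []) {refl}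

  ring-201 : ∀ N m u → N * (m * u) ≡ u * (m * N)
  ring-201 N m u = decide 3 (λ N m u → N :* (m :* u) := u :* (m :* N)) (N ∷ m ∷ u ∷ []) {refl}

  ring-202 : ∀ u y → u * (y + y) ≡ ι 2 * u * y
  ring-202 u y = decide 2 (λ u y → u :* (y :+ y) := con (ι 2) :* u :* y) (u ∷ y ∷ []) {refl}

  ring-203 : ∀ u y → ι 2 * (ι 2 * u * y * (ι 2 * u * y)) ≡ ι 8 * (u * u) * (y * y)
  ring-203 u y = decide 2 (λ u y → con (ι 2) :* (con (ι 2) :* u :* y :* (con (ι 2) :* u :* y)) := con (ι 8) :* (u :* u) :* (y :* y)) (u ∷ y ∷ []) {refl}

  ring-204 : ∀ a p N → a * (p * N) ≡ a * N * p
  ring-204 a p N = decide 3 (λ a p N → a :* (p :* N) := a :* N :* p) (a ∷ p ∷ N ∷ []) {refl}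

  ring-205 : ∀ k f q N → ι 16 * ((k - f) * N) ≡ k * N + (ι 14 * k + ι 16 * (q - f) + (k - ι 16 * q)) * N
  ring-205 k f q N = decide 4 (λ k f q N → con (ι 16) :* ((k :- f) :* N) := k :* N :+ (con (ι 14) :* k :+ con (ι 16) :* (q :- f) :+ (k :- con (ι 16) :* q)) :* N) (k ∷ f ∷ q ∷ N ∷ []) {refl}

  ring-206 : ∀ y m N z q f → ι 4 * y ≡ ι 4 * ((ι 3 * q + f) * N) + (ι 4 * (1ℚ + y - m * N) + (ι 3 * (m * N - (z + ι 2)) + ι 3 * z + (m - ι 16 * q) * N + ι 4 * (q - f) * N + ι 2))
  ring-206 y m N z q f = decide 6 (λ y m N z q f → con (ι 4) :* y := con (ι 4) :* ((con (ι 3) :* q :+ f) :* N) :+ (con (ι 4) :* (con 1ℚ :+ y :- m :* N) :+ (con (ι 3) :* (m :* N :- (z :+ con (ι 2))) :+ con (ι 3) :* z :+ (m :- con (ι 16) :* q) :* N :+ con (ι 4) :* (q :- f) :* N :+ con (ι 2)))) (y ∷ m ∷ N ∷ z ∷ q ∷ f ∷ []) {refl}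

  ring-207 : ∀ z d y → z - d ≡ ((z + y) - d) - y
  ring-207 z d y = decide 3 (λ z d y → z :- d := ((z :+ y) :- d) :- y) (z ∷ d ∷ y ∷ []) {refl}

  ring-208 : ∀ x y → y - (1ℚ + x) ≡ (y - 1ℚ) - x
  ring-208 x y = decide 2 (λ x y → y :- (con 1ℚ :+ x) := (y :- con 1ℚ) :- x) (x ∷ y ∷ []) {refl}

  ring-209 : ∀ s z t N → (ι 42 + s) * z ≡ (1ℚ - t) * N + (((ι 48 + s) * z - N) + (t * N - ι 6 * z))
  ring-209 s z t N = decide 4 (λ s z t N → (con (ι 42) :+ s) :* z := (con 1ℚ :- t) :* N :+ (((con (ι 48) :+ s) :* z :- N) :+ (t :* N :- con (ι 6) :* z))) (s ∷ z ∷ t ∷ N ∷ []) {refl}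

  ring-210 : ∀ s z d N → s * z ≡ (1ℚ - d) * N + (((ι 48 + s) * z - N) + (d * N - ι 48 * z))
  ring-210 s z d N = decide 4 (λ s z d N → s :* z := (con 1ℚ :- d) :* N :+ (((con (ι 48) :+ s) :* z :- N) :+ (d :* N :- con (ι 48) :* z))) (s ∷ z ∷ d ∷ N ∷ []) {refl}

  ring-211 : ∀ d N → N ≡ (1ℚ - d) * N + d * N
  ring-211 d N = decide 2 (λ d N → N := (con 1ℚ :- d) :* N :+ d :* N) (d ∷ N ∷ []) {refl}

  ring-212 : ∀ s z → (ι 47 + s) * z - 1ℚ * z ≡ ((ι 42 + s) * z + ι 2 * z) + ι 2 * z
  ring-212 s z = decide 2 (λ s z → (con (ι 47) :+ s) :* z :- con 1ℚ :* z := ((con (ι 42) :+ s) :* z :+ con (ι 2) :* z) :+ con (ι 2) :* z) (s ∷ z ∷ []) {refl}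

  ring-213 : ∀ S z q → S * z - S * q * z ≡ (1ℚ - q) * (z * S)
  ring-213 S z q = decide 3 (λ S z q → S :* z :- S :* q :* z := (con 1ℚ :- q) :* (z :* S)) (S ∷ z ∷ q ∷ []) {refl}

  ring-214 : ∀ t N → (t - 1ℚ) * N ≡ 0ℚ - (1ℚ - t) * N
  ring-214 t N = decide 2 (λ t N → (t :- con 1ℚ) :* N := con 0ℚ :- (con 1ℚ :- t) :* N) (t ∷ N ∷ []) {refl}

open ℚ-Identities

module ℕ-Identities where
  open ℕ-Solver.+-*-Solver

  private
    agree : ∀ {n} → Polynomial n × Polynomial n → Maybe ⊤
    agree (p , q) = Maybe.map (λ _ → tt) (normalise p ≟N normalise q)

    polynomials : ∀ n → N-ary n (Polynomial n) (Polynomial n × Polynomial n) → Polynomial n × Polynomial n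
    polynomials n f = f $ⁿ Vec.map var (Vec.allFin n)

    decide : ∀ n f (ρ : Vec ℕ n) {_ : agree (polynomials n f) ≡ just tt} → ⟦ proj₁ (polynomials n f) ⟧ ρ ≡ ⟦ proj₂ (polynomials n f) ⟧ ρ
    decide n f ρ {eq} = by (proj₁ (polynomials n f)) (proj₂ (polynomials n f)) eq
      where
      by : ∀ p q → agree (p , q) ≡ just tt → ⟦ p ⟧ ρ ≡ ⟦ q ⟧ ρ
      by p q eq with normalise p ≟N normalise q
      ... | just p≈q = trans (sym (correct p ρ)) (trans (⟦ p≈q ⟧N-cong ρ) (correct q ρ))
      ... | nothing = case eq of λ ()

  ring-n1 : ∀ D t y → D ℕ.* (t ℕ.+ y ℕ.* t) ≡ t ℕ.* D ℕ.+ t ℕ.* D ℕ.* y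
  ring-n1 D t y = decide 3 (λ D t y → D :* (t :+ y :* t) := t :* D :+ t :* D :* y) (D ∷ t ∷ y ∷ []) {refl}

  ring-n2 : ∀ t y → y ℕ.* t ℕ.+ y ℕ.* t ≡ 2 ℕ.* t ℕ.* y
  ring-n2 t y = decide 2 (λ t y → y :* t :+ y :* t := con 2 :* t :* y) (t ∷ y ∷ []) {refl}

  ring-n3 : ∀ t B y → t ℕ.* B ℕ.* y ≡ B ℕ.* (y ℕ.* t)
  ring-n3 t B y = decide 3 (λ t B y → t :* B :* y := B :* (y :* t)) (t ∷ B ∷ y ∷ []) {refl}

  ring-n4 : ∀ S Q → S ℕ.* Q ℕ.+ S ≡ S ℕ.* (Q ℕ.+ 1)
  ring-n4 S Q = decide 2 (λ S Q → S :* Q :+ S := S :* (Q :+ con 1)) (S ∷ Q ∷ []) {refl}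

  ring-n5 : ∀ k Q q → k ℕ.* Q ℕ.+ (q ℕ.+ k ℕ.+ 1) ≡ k ℕ.* (Q ℕ.+ 1) ℕ.+ q ℕ.+ 1
  ring-n5 k Q q = decide 3 (λ k Q q → k :* Q :+ (q :+ k :+ con 1) := k :* (Q :+ con 1) :+ q :+ con 1) (k ∷ Q ∷ q ∷ []) {refl}

  ring-n6 : ∀ k q → k ℕ.* q ℕ.+ q ℕ.+ 1 ≡ q ℕ.* (1 ℕ.+ k) ℕ.+ 1
  ring-n6 k q = decide 2 (λ k q → k :* q :+ q :+ con 1 := q :* (con 1 :+ k) :+ con 1) (k ∷ q ∷ []) {refl}

  ring-n7 : ∀ S q D → S ℕ.* q ℕ.* D ≡ q ℕ.* (S ℕ.* D)
  ring-n7 S q D = decide 3 (λ S q D → S :* q :* D := q :* (S :* D)) (S ∷ q ∷ D ∷ []) {refl}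

  ring-n8 : ∀ B q k → B ℕ.+ q ℕ.* ((1 ℕ.+ k) ℕ.* B) ≡ (q ℕ.* (1 ℕ.+ k) ℕ.+ 1) ℕ.* B
  ring-n8 B q k = decide 3 (λ B q k → B :+ q :* ((con 1 :+ k) :* B) := (q :* (con 1 :+ k) :+ con 1) :* B) (B ∷ q ∷ k ∷ []) {refl}

  ring-n9 : ∀ r c q → 2 ℕ.* r ℕ.* (c ℕ.* q) ≡ 2 ℕ.* (r ℕ.* c) ℕ.* q
  ring-n9 r c q = decide 3 (λ r c q → con 2 :* r :* (c :* q) := con 2 :* (r :* c) :* q) (r ∷ c ∷ q ∷ []) {refl}

  ring-n10 : ∀ S r D → S ℕ.* (D ℕ.* (r ℕ.* 2)) ≡ 2 ℕ.* r ℕ.* (S ℕ.* D)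
  ring-n10 S r D = decide 3 (λ S r D → S :* (D :* (r :* con 2)) := con 2 :* r :* (S :* D)) (S ∷ r ∷ D ∷ []) {refl}

  ring-n11 : ∀ S k Q B → S ℕ.* (k ℕ.* Q ℕ.* B) ≡ k ℕ.* (S ℕ.* Q ℕ.* B)
  ring-n11 S k Q B = decide 4 (λ S k Q B → S :* (k :* Q :* B) := k :* (S :* Q :* B)) (S ∷ k ∷ Q ∷ B ∷ []) {refl}

  ring-n12 : ∀ r D → r ℕ.* 300 ℕ.* D ≡ (D ℕ.* (r ℕ.* 2)) ℕ.* 150
  ring-n12 r D = decide 2 (λ r D → r :* con 300 :* D := (D :* (r :* con 2)) :* con 150) (r ∷ D ∷ []) {refl}

  ring-n13 : ∀ B → B ℕ.+ B ℕ.* 150 ≡ 151 ℕ.* B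
  ring-n13 B = decide 1 (λ B → B :+ B :* con 150 := con 151 :* B) (B ∷ []) {refl}

  ring-n14 : ∀ r V → r ℕ.* 300 ℕ.* V ≡ (V ℕ.* (r ℕ.* 30)) ℕ.* 10
  ring-n14 r V = decide 2 (λ r V → r :* con 300 :* V := (V :* (r :* con 30)) :* con 10) (r ∷ V ∷ []) {refl}

  ring-n15 : ∀ I B → B ℕ.+ (B ℕ.* (1 ℕ.+ I)) ℕ.* 10 ≡ (I ℕ.* 9 ℕ.+ (I ℕ.+ 11)) ℕ.* B
  ring-n15 I B = decide 2 (λ I B → B :+ (B :* (con 1 :+ I)) :* con 10 := (I :* con 9 :+ (I :+ con 11)) :* B) (I ∷ B ∷ []) {refl}

  ring-n16 : ∀ r → r ℕ.* r ℕ.* 724800 ≡ 16 ℕ.* ((r ℕ.* 270 ℕ.+ r ℕ.* 30) ℕ.* r ℕ.* 151)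
  ring-n16 r = decide 1 (λ r → r :* r :* con 724800 := con 16 :* ((r :* con 270 :+ r :* con 30) :* r :* con 151)) (r ∷ []) {refl}

  ring-n17 : ∀ r → r ℕ.* r ℕ.* 1057050 ≡ r ℕ.* 29 ℕ.* (135 ℕ.* (r ℕ.* 270))
  ring-n17 r = decide 1 (λ r → r :* r :* con 1057050 := r :* con 29 :* (con 135 :* (r :* con 270))) (r ∷ []) {refl}

  ring-n18 : ∀ r i → ((29 ℕ.+ i) ℕ.+ 11) ℕ.* ((r ℕ.* 270 ℕ.+ r ℕ.* 30) ℕ.* r ℕ.* 151) ≡ r ℕ.* r ℕ.* (i ℕ.* 45300 ℕ.+ 1812000)
  ring-n18 r i = decide 2 (λ r i → ((con 29 :+ i) :+ con 11) :* ((r :* con 270 :+ r :* con 30) :* r :* con 151) := r :* r :* (i :* con 45300 :+ con 1812000)) (r ∷ i ∷ []) {refl}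

  ring-n19 : ∀ r i → r ℕ.* 29 ℕ.* ((29 ℕ.+ i) ℕ.* 9 ℕ.* (r ℕ.* 270)) ≡ r ℕ.* r ℕ.* (i ℕ.* 70470 ℕ.+ 2043630)
  ring-n19 r i = decide 2 (λ r i → r :* con 29 :* ((con 29 :+ i) :* con 9 :* (r :* con 270)) := r :* r :* (i :* con 70470 :+ con 2043630)) (r ∷ i ∷ []) {refl}

  ring-n20 : ∀ r V → r ℕ.* V ℕ.* 30 ≡ V ℕ.* (r ℕ.* 30)
  ring-n20 r V = decide 2 (λ r V → r :* V :* con 30 := V :* (r :* con 30)) (r ∷ V ∷ []) {refl}

  ring-n21 : ∀ r B → (r ℕ.* 270 ℕ.+ r ℕ.* 30) ℕ.* B ≡ r ℕ.* 300 ℕ.* B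
  ring-n21 r B = decide 2 (λ r B → (r :* con 270 :+ r :* con 30) :* B := r :* con 300 :* B) (r ∷ B ∷ []) {refl}

  ring-n22 : ∀ r B → (135 ℕ.* B) ℕ.* (r ℕ.* 2) ≡ r ℕ.* 270 ℕ.* B
  ring-n22 r B = decide 2 (λ r B → (con 135 :* B) :* (r :* con 2) := r :* con 270 :* B) (r ∷ B ∷ []) {refl}

  ring-n23 : ∀ r I B → (I ℕ.* 9 ℕ.* B) ℕ.* (r ℕ.* 30) ≡ (r ℕ.* 270 ℕ.* B) ℕ.* I
  ring-n23 r I B = decide 3 (λ r I B → (I :* con 9 :* B) :* (r :* con 30) := (r :* con 270 :* B) :* I) (r ∷ I ∷ B ∷ []) {refl}

  ring-n24 : ∀ r b → (1 ℕ.+ b) ℕ.* (b ℕ.* (32 ℕ.* (r ℕ.* r) ℕ.* (1 ℕ.+ b))) ≡ b ℕ.* (2 ℕ.* (r ℕ.* (1 ℕ.+ b)) ℕ.* (16 ℕ.* (r ℕ.* (1 ℕ.+ b))))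
  ring-n24 r b = decide 2 (λ r b → (con 1 :+ b) :* (b :* (con 32 :* (r :* r) :* (con 1 :+ b))) := b :* (con 2 :* (r :* (con 1 :+ b)) :* (con 16 :* (r :* (con 1 :+ b))))) (r ∷ b ∷ []) {refl}

  ring-n25 : ∀ r b → 2 ℕ.* (r ℕ.* (1 ℕ.+ b)) ℕ.* (16 ℕ.* (r ℕ.* (1 ℕ.+ b))) ℕ.* b ≡ b ℕ.* (32 ℕ.* (r ℕ.* r) ℕ.* (1 ℕ.+ b)) ℕ.* (1 ℕ.+ b)
  ring-n25 r b = decide 2 (λ r b → con 2 :* (r :* (con 1 :+ b)) :* (con 16 :* (r :* (con 1 :+ b))) :* b := b :* (con 32 :* (r :* r) :* (con 1 :+ b)) :* (con 1 :+ b)) (r ∷ b ∷ []) {refl}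

  ring-n26 : ∀ a b c → a ℕ.+ b ℕ.+ c ≡ b ℕ.+ (a ℕ.+ c)
  ring-n26 a b c = decide 3 (λ a b c → a :+ b :+ c := b :+ (a :+ c)) (a ∷ b ∷ c ∷ []) {refl}

  ring-n27 : ∀ s x r → s ℕ.* (x ℕ.* r) ≡ x ℕ.* (s ℕ.* r)
  ring-n27 s x r = decide 3 (λ s x r → s :* (x :* r) := x :* (s :* r)) (s ∷ x ∷ r ∷ []) {refl}

open ℕ-Identities

-- Ordered field arithmetic

0≤1 : 0ℚ ≤ 1ℚ
0≤1 = ℚₚ.nonNegative⁻¹ 1ℚ

0<1 : 0ℚ < 1ℚ
0<1 = ℚₚ.positive⁻¹ 1ℚ

0≤+ : ∀ {a b} → 0ℚ ≤ a → 0ℚ ≤ b → 0ℚ ≤ a + b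
0≤+ p q = ≤-trans (≤-reflexive (sym (+-identityˡ 0ℚ))) (+-mono-≤ p q)

0<+ : ∀ {a b} → 0ℚ < a → 0ℚ ≤ b → 0ℚ < a + b
0<+ p q = ≤-<-trans (≤-reflexive (sym (+-identityˡ 0ℚ))) (+-mono-<-≤ p q)

*-monoʳ : ∀ {c a b} → 0ℚ ≤ c → a ≤ b → c * a ≤ c * b
*-monoʳ {c} 0≤c = ℚₚ.*-monoˡ-≤-nonNeg c {{ℚ.nonNegative 0≤c}}

*-monoˡ : ∀ {c a b} → 0ℚ ≤ c → a ≤ b → a * c ≤ b * c
*-monoˡ {c} 0≤c = ℚₚ.*-monoʳ-≤-nonNeg c {{ℚ.nonNegative 0≤c}}

*-mono-< : ∀ {c a b} → 0ℚ < c → a < b → c * a < c * b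
*-mono-< {c} 0<c = ℚₚ.*-monoʳ-<-pos c {{ℚ.positive 0<c}}

0≤* : ∀ {a b} → 0ℚ ≤ a → 0ℚ ≤ b → 0ℚ ≤ a * b
0≤* {a} p q = ≤-trans (≤-reflexive (sym (*-zeroʳ a))) (*-monoʳ p q)

0<* : ∀ {a b} → 0ℚ < a → 0ℚ < b → 0ℚ < a * b
0<* {a} p q = ≤-<-trans (≤-reflexive (sym (*-zeroʳ a))) (*-mono-< p q)

*-mono : ∀ {a b c d} → 0ℚ ≤ a → a ≤ b → 0ℚ ≤ c → c ≤ d → a * c ≤ b * d
*-mono 0≤a a≤b 0≤c c≤d = ≤-trans (*-monoˡ 0≤c a≤b) (*-monoʳ (≤-trans 0≤a a≤b) c≤d)

*-cancel-≤ : ∀ {c a b} → 0ℚ < c → c * a ≤ c * b → a ≤ b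
*-cancel-≤ {c} 0<c = ℚₚ.*-cancelˡ-≤-pos c {{ℚ.positive 0<c}}

*-cancel-< : ∀ {c a b} → 0ℚ < c → c * a < c * b → a < b
*-cancel-< {c} 0<c = ℚₚ.*-cancelˡ-<-nonNeg c {{ℚ.nonNegative (<⇒≤ 0<c)}}

≤-by : ∀ {a b} p → b ≡ a + p → 0ℚ ≤ p → a ≤ b
≤-by {a} p b≡ 0≤p = ≤-trans (≤-reflexive (sym (+-identityʳ a)))
  (≤-trans (+-monoʳ-≤ a 0≤p) (≤-reflexive (sym b≡)))

<-by : ∀ {a b} p → b ≡ a + p → 0ℚ < p → a < b
<-by {a} p b≡ 0<p = ≤-<-trans (≤-reflexive (sym (+-identityʳ a)))
  (<-≤-trans (+-mono-≤-< (≤-refl {a}) 0<p) (≤-reflexive (sym b≡)))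

0≤- : ∀ {a b} → a ≤ b → 0ℚ ≤ b - a
0≤- {a} {b} a≤b = ≤-trans (≤-reflexive (sym (ring-1 a))) (+-monoˡ-≤ (- a) a≤b)

0<- : ∀ {a b} → a < b → 0ℚ < b - a
0<- {a} {b} a<b = ≤-<-trans (≤-reflexive (sym (ring-1 a))) (+-mono-<-≤ a<b ≤-refl)

-≤0 : ∀ {a b} → 0ℚ ≤ b - a → a ≤ b
-≤0 {a} {b} = ≤-by (b - a) (ring-3 b a)

-<0 : ∀ {a b} → 0ℚ < b - a → a < b
-<0 {a} {b} = <-by (b - a) (ring-3 b a)

≤⊎> : ∀ a b → a ≤ b ⊎ b < a
≤⊎> a b with a ≤? b
... | yes p = inj₁ p
... | no ¬p = inj₂ (≰⇒> ¬p)

≤⇒≯ : ∀ {a b} → a ≤ b → ¬ (b < a)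
≤⇒≯ p q = <-irrefl refl (<-≤-trans q p)

recip : ∀ {a} → 0ℚ < a → Σ ℚ λ b → (0ℚ < b) × (a * b ≡ 1ℚ)
recip {a} 0<a = b , ℚₚ.positive⁻¹ b {{ℚₚ.1/pos⇒pos a {{ℚ.positive 0<a}}}} , ℚₚ.*-inverseʳ a {{nz}}
  where
  nz = ℚₚ.pos⇒nonZero a {{ℚ.positive 0<a}}
  b = ℚ.1/_ a {{nz}}

min : ∀ {a b} → 0ℚ < a → 0ℚ < b → Σ ℚ λ c → (0ℚ < c) × (c ≤ a) × (c ≤ b)
min {a} {b} 0<a 0<b with ≤⊎> a b
... | inj₁ p = a , 0<a , ≤-refl , p
... | inj₂ p = b , 0<b , <⇒≤ p , ≤-refl

-- The embedding of ℕ

ι-+ : ∀ a b → ι (a ℕ.+ b) ≡ ι a + ι b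
ι-+ zero b = sym (+-identityˡ (ι b))
ι-+ (suc a) b = trans (cong (1ℚ +_) (ι-+ a b)) (sym (+-assoc 1ℚ (ι a) (ι b)))

ι-* : ∀ a b → ι (a ℕ.* b) ≡ ι a * ι b
ι-* zero b = sym (*-zeroˡ (ι b))
ι-* (suc a) b = trans (ι-+ b (a ℕ.* b)) (trans (cong (ι b +_) (ι-* a b)) (ring-6 (ι a) (ι b)))

0≤ι : ∀ n → 0ℚ ≤ ι n
0≤ι zero = ≤-refl
0≤ι (suc n) = 0≤+ 0≤1 (0≤ι n)

0<ι : ∀ n → 0ℚ < ι (suc n)
0<ι n = 0<+ 0<1 (0≤ι n)

0<ι⁺ : ∀ {n} → 1 ℕ.≤ n → 0ℚ < ι n
0<ι⁺ {suc n} _ = 0<ι n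

ι-mono : ∀ {a b} → a ℕ.≤ b → ι a ≤ ι b
ι-mono {b = b} z≤n = 0≤ι b
ι-mono (s≤s p) = +-monoʳ-≤ 1ℚ (ι-mono p)

ι-mono-< : ∀ {a b} → a ℕ.< b → ι a < ι b
ι-mono-< {a} p = <-≤-trans (<-by 1ℚ (+-comm 1ℚ (ι a)) 0<1) (ι-mono p)

ι-cancel-≤ : ∀ {a b} → ι a ≤ ι b → a ℕ.≤ b
ι-cancel-≤ {a} {b} p with a ℕ.≤? b
... | yes q = q
... | no ¬q = ⊥-elim (≤⇒≯ p (ι-mono-< (ℕₚ.≰⇒> ¬q)))

ι-cancel-< : ∀ {a b} → ι a < ι b → a ℕ.< b
ι-cancel-< {a} {b} p with a ℕ.<? b
... | yes q = q
... | no ¬q = ⊥-elim (≤⇒≯ (ι-mono (ℕₚ.≮⇒≥ ¬q)) p)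

ι-∸ : ∀ {a b} → b ℕ.≤ a → ι (a ℕ.∸ b) ≡ ι a - ι b
ι-∸ {a} {b} p = trans (ring-7 (ι (a ℕ.∸ b)) (ι b))
  (cong (_- ι b) (trans (sym (ι-+ (a ℕ.∸ b) b)) (cong ι (ℕₚ.m∸n+n≡m p))))

-- `ℕ→ℚ` normalises a fraction by a gcd, whereas `ι` recurses on its argument and suits induction;
-- so all estimates use `ι`, and `ℕ→ℚ` occurs only at the interface. The successor step is checked
-- among unnormalised fractions, by cross multiplication.
ℕ→ℚ≡ι : ∀ n → ℕ→ℚ n ≡ ι n
ℕ→ℚ≡ι zero = refl
ℕ→ℚ≡ι (suc n) = trans step (cong (1ℚ +_) (ℕ→ℚ≡ι n))
  where
  step : ℕ→ℚ (suc n) ≡ 1ℚ + ℕ→ℚ n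
  step = ℚₚ.toℚᵘ-injective (ℚᵘₚ.≃-trans (ℚₚ.toℚᵘ-fromℚᵘ (ℚᵘ.mkℚᵘ (ℤ.+ suc n) 0))
    (ℚᵘₚ.≃-trans (ℚᵘ.*≡* (trans (ℤₚ.*-identityʳ (ℤ.+ suc n)) (sym (trans (ℤₚ.*-identityʳ _) (cong (λ k → (ℤ.+ 1) ℤ.+ k) (ℤₚ.*-identityʳ (ℤ.+ n)))))))
    (ℚᵘₚ.≃-trans (ℚᵘₚ.+-congʳ ℚᵘ.1ℚᵘ (ℚᵘₚ.≃-sym (ℚₚ.toℚᵘ-fromℚᵘ (ℚᵘ.mkℚᵘ (ℤ.+ n) 0))))
      (ℚᵘₚ.≃-sym (ℚₚ.toℚᵘ-homo-+ 1ℚ (ℕ→ℚ n))))))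

-- A nonnegative fraction is at most its numerator, since its denominator is a successor.
archimedean : ∀ q → Σ ℕ λ n → q ≤ ι n
archimedean q@(ℚ.mkℚ (ℤ.-[1+ k ]) d c) = 0 , ℚₚ.nonPositive⁻¹ q
archimedean q@(ℚ.mkℚ (ℤ.+ k) d c) = k , ≤-trans q≤k (≤-reflexive (ℕ→ℚ≡ι k))
  where
  q≤k : q ≤ ℕ→ℚ k
  q≤k = ℚₚ.toℚᵘ-cancel-≤ (ℚᵘₚ.≤-respʳ-≃ (ℚᵘₚ.≃-sym (ℚₚ.toℚᵘ-fromℚᵘ (ℚᵘ.mkℚᵘ (ℤ.+ k) 0)))
    (ℚᵘ.*≤* (subst₂ ℤ._≤_ (ℤₚ.pos-* k 1) (ℤₚ.pos-* k (suc d))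
      (ℤ.+≤+ (ℕₚ.*-monoʳ-≤ k (s≤s z≤n))))))

archimedean⁺ : ∀ q → Σ ℕ λ n → (1 ℕ.≤ n) × (q ≤ ι n)
archimedean⁺ q with archimedean q
... | n , p = suc n , s≤s z≤n , ≤-trans p (ι-mono (ℕₚ.n≤1+n n))

floor : ∀ q → 0ℚ ≤ q → Σ ℕ λ n → (ι n ≤ q) × (q < 1ℚ + ι n)
floor q 0≤q = search (proj₁ (archimedean q)) (proj₂ (archimedean q))
  where
  search : ∀ n → q ≤ ι n → Σ ℕ λ n → (ι n ≤ q) × (q < 1ℚ + ι n)
  search zero p = 0 , 0≤q , ≤-<-trans p (<-by 1ℚ (trans (+-identityʳ 1ℚ) (sym (+-identityˡ 1ℚ))) 0<1)
  search (suc n) p with ≤⊎> q (ι n)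
  ... | inj₁ q≤n = search n q≤n
  ... | inj₂ n<q with ≤⊎> (ι (suc n)) q
  ...   | inj₁ sn≤q = suc n , sn≤q , ≤-<-trans p (<-by 1ℚ (+-comm 1ℚ (ι (suc n))) 0<1)
  ...   | inj₂ q<sn = n , <⇒≤ n<q , q<sn

-- Powers

infixr 8 _^_
_^_ : ℚ → ℕ → ℚ
x ^ zero = 1ℚ
x ^ suc n = x * x ^ n

^-+ : ∀ x a b → x ^ (a ℕ.+ b) ≡ x ^ a * x ^ b
^-+ x zero b = sym (*-identityˡ _)
^-+ x (suc a) b = trans (cong (x *_) (^-+ x a b)) (sym (*-assoc x _ _))

^-* : ∀ x a b → x ^ (a ℕ.* b) ≡ (x ^ b) ^ a
^-* x zero b = refl
^-* x (suc a) b = trans (^-+ x b (a ℕ.* b)) (cong (x ^ b *_) (^-* x a b))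

*-^ : ∀ x y n → (x * y) ^ n ≡ x ^ n * y ^ n
*-^ x y zero = refl
*-^ x y (suc n) = trans (cong (x * y *_) (*-^ x y n)) (ring-8 x y (x ^ n) (y ^ n))

1^ : ∀ n → 1ℚ ^ n ≡ 1ℚ
1^ zero = refl
1^ (suc n) = trans (*-identityˡ _) (1^ n)

0<^ : ∀ {x} n → 0ℚ < x → 0ℚ < x ^ n
0<^ zero p = 0<1
0<^ (suc n) p = 0<* p (0<^ n p)

0≤^ : ∀ {x} n → 0ℚ ≤ x → 0ℚ ≤ x ^ n
0≤^ zero p = 0≤1
0≤^ (suc n) p = 0≤* p (0≤^ n p)

^-mono : ∀ {x y} n → 0ℚ ≤ x → x ≤ y → x ^ n ≤ y ^ n
^-mono zero p q = ≤-refl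
^-mono (suc n) p q = *-mono p q (0≤^ n p) (^-mono n p q)

1≤^ : ∀ {x} n → 1ℚ ≤ x → 1ℚ ≤ x ^ n
1≤^ n p = ≤-trans (≤-reflexive (sym (1^ n))) (^-mono n 0≤1 p)

^≤1 : ∀ {x} n → 0ℚ ≤ x → x ≤ 1ℚ → x ^ n ≤ 1ℚ
^≤1 n p q = ≤-trans (^-mono n p q) (≤-reflexive (1^ n))

^-monoʳ : ∀ {x a b} → 1ℚ ≤ x → a ℕ.≤ b → x ^ a ≤ x ^ b
^-monoʳ {x} {a} {b} 1≤x a≤b = ≤-trans (≤-reflexive (sym (*-identityʳ _)))
  (≤-trans (*-monoʳ (0≤^ a (≤-trans 0≤1 1≤x)) (1≤^ (b ℕ.∸ a) 1≤x))
    (≤-reflexive (trans (sym (^-+ x a (b ℕ.∸ a))) (cong (x ^_) (ℕₚ.m+[n∸m]≡n a≤b)))))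

-- The induction discards the term n x². The disjunction fixes the sign of x, from which x² ≥ 0
-- follows.
bernoulli : ∀ {x} n → 0ℚ ≤ 1ℚ + x → 1ℚ ≤ 1ℚ + x ⊎ x ≤ 0ℚ → 1ℚ + ι n * x ≤ (1ℚ + x) ^ n
bernoulli {x} zero _ _ = ≤-reflexive (ring-9 x)
bernoulli {x} (suc n) p s = ≤-trans (≤-by (ι n * (x * x)) (ring-10 (ι n) x) (0≤* (0≤ι n) (sq s)))
  (*-monoʳ p (bernoulli n p s))
  where
  sq : 1ℚ ≤ 1ℚ + x ⊎ x ≤ 0ℚ → 0ℚ ≤ x * x
  sq (inj₁ q) = 0≤* 0≤x 0≤x where 0≤x = subst (0ℚ ≤_) (ring-12 x) (0≤- q)
  sq (inj₂ q) = subst (0ℚ ≤_) (ring-11 x) (0≤* (0≤- q) (0≤- q))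

bernoulli⁺ : ∀ {x} n → 0ℚ ≤ x → 1ℚ + ι n * x ≤ (1ℚ + x) ^ n
bernoulli⁺ {x} n 0≤x = bernoulli n (0≤+ 0≤1 0≤x) (inj₁ (≤-by x refl 0≤x))

bernoulli⁻ : ∀ {x} n → 0ℚ ≤ x → x ≤ 1ℚ → 1ℚ - ι n * x ≤ (1ℚ - x) ^ n
bernoulli⁻ {x} n 0≤x x≤1 = ≤-trans (≤-reflexive (ring-13 (ι n) x))
  (bernoulli {0ℚ - x} n (subst (0ℚ ≤_) (ring-14 x) (0≤- x≤1)) (inj₂ (≤-by x (ring-15 x) 0≤x)))
    ⟨≤⟩ ≤-reflexive (cong (_^ n) (sym (ring-14 x)))
  where
  infixl 4 _⟨≤⟩_
  _⟨≤⟩_ : ∀ {a b c} → a ≤ b → b ≤ c → a ≤ c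
  _⟨≤⟩_ = ≤-trans

-- Sums and counting

∑ : ∀ {n} → (Fin n → ℚ) → ℚ
∑ {zero} f = 0ℚ
∑ {suc n} f = f zero + ∑ (f ∘ suc)

∑-cong : ∀ {n} {f g : Fin n → ℚ} → (∀ i → f i ≡ g i) → ∑ f ≡ ∑ g
∑-cong {zero} p = refl
∑-cong {suc n} p = cong₂ _+_ (p zero) (∑-cong (p ∘ suc))

∑-mono : ∀ {n} {f g : Fin n → ℚ} → (∀ i → f i ≤ g i) → ∑ f ≤ ∑ g
∑-mono {zero} p = ≤-refl
∑-mono {suc n} p = +-mono-≤ (p zero) (∑-mono (p ∘ suc))

∑-0 : ∀ n → ∑ {n} (λ _ → 0ℚ) ≡ 0ℚ
∑-0 zero = refl
∑-0 (suc n) = trans (+-identityˡ _) (∑-0 n)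

0≤∑ : ∀ {n} {f : Fin n → ℚ} → (∀ i → 0ℚ ≤ f i) → 0ℚ ≤ ∑ f
0≤∑ {n} p = ≤-trans (≤-reflexive (sym (∑-0 n))) (∑-mono p)

∑-+ : ∀ {n} (f g : Fin n → ℚ) → ∑ (λ i → f i + g i) ≡ ∑ f + ∑ g
∑-+ {zero} f g = refl
∑-+ {suc n} f g = trans (cong (f zero + g zero +_) (∑-+ (f ∘ suc) (g ∘ suc))) (ring-25 (f zero) (g zero) _ _)

∑-*ˡ : ∀ {n} c (f : Fin n → ℚ) → ∑ (λ i → c * f i) ≡ c * ∑ f
∑-*ˡ {zero} c f = sym (*-zeroʳ c)
∑-*ˡ {suc n} c f = trans (cong (c * f zero +_) (∑-*ˡ c (f ∘ suc))) (sym (*-distribˡ-+ c _ _))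

∑-*ʳ : ∀ {n} c (f : Fin n → ℚ) → ∑ (λ i → f i * c) ≡ ∑ f * c
∑-*ʳ c f = trans (∑-cong (λ i → *-comm (f i) c)) (trans (∑-*ˡ c f) (*-comm c _))

∑-- : ∀ {n} (f g : Fin n → ℚ) → ∑ (λ i → f i - g i) ≡ ∑ f - ∑ g
∑-- {zero} f g = refl
∑-- {suc n} f g = trans (cong (f zero - g zero +_) (∑-- (f ∘ suc) (g ∘ suc))) (ring-26 (f zero) (g zero) _ _)

∑-const : ∀ n c → ∑ {n} (λ _ → c) ≡ ι n * c
∑-const zero c = sym (*-zeroˡ c)
∑-const (suc n) c = trans (cong (c +_) (∑-const n c)) (ring-27 c (ι n))

∑-swap : ∀ {m n} (f : Fin m → Fin n → ℚ) → ∑ (λ i → ∑ (f i)) ≡ ∑ (λ j → ∑ (λ i → f i j))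
∑-swap {zero} {n} f = sym (∑-0 n)
∑-swap {suc m} f = trans (cong (∑ (f zero) +_) (∑-swap (f ∘ suc)))
  (sym (∑-+ (f zero) (λ j → ∑ (λ i → f (suc i) j))))

term≤∑ : ∀ {n} {f : Fin n → ℚ} → (∀ i → 0ℚ ≤ f i) → ∀ i → f i ≤ ∑ f
term≤∑ {f = f} p zero = ≤-trans (≤-reflexive (sym (+-identityʳ (f zero)))) (+-monoʳ-≤ (f zero) (0≤∑ (p ∘ suc)))
term≤∑ {f = f} p (suc i) = ≤-trans (term≤∑ (p ∘ suc) i)
  (≤-trans (≤-reflexive (sym (+-identityˡ (∑ (f ∘ suc))))) (+-monoˡ-≤ (∑ (f ∘ suc)) (p zero)))

-- The effective form of "some object is better than average": the entries are compared one by one.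
-- Free colours, moves and central vertices are all found this way.
∑<∑⇒∃< : ∀ {n} {f g : Fin n → ℚ} → ∑ f < ∑ g → Σ (Fin n) λ i → f i < g i
∑<∑⇒∃< {zero} p = ⊥-elim (<-irrefl refl p)
∑<∑⇒∃< {suc n} {f} {g} p with ≤⊎> (g zero) (f zero)
... | inj₂ q = zero , q
... | inj₁ q with ≤⊎> (∑ (g ∘ suc)) (∑ (f ∘ suc))
...   | inj₁ r = ⊥-elim (≤⇒≯ (+-mono-≤ q r) p)
...   | inj₂ r with ∑<∑⇒∃< {n} r
...     | i , s = suc i , s

-- Indicators, Boolean tests and cardinalities

𝟙 : Bool → ℚ
𝟙 true = 1ℚ
𝟙 false = 0ℚ

0≤𝟙 : ∀ b → 0ℚ ≤ 𝟙 b
0≤𝟙 true = 0≤1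
0≤𝟙 false = ≤-refl

𝟙≤1 : ∀ b → 𝟙 b ≤ 1ℚ
𝟙≤1 true = ≤-refl
𝟙≤1 false = 0≤1

𝟙-∧ : ∀ a b → 𝟙 (a ∧ b) ≡ 𝟙 a * 𝟙 b
𝟙-∧ true b = sym (*-identityˡ _)
𝟙-∧ false b = sym (*-zeroˡ (𝟙 b))

𝟙-not : ∀ b → 𝟙 (not b) ≡ 1ℚ - 𝟙 b
𝟙-not true = refl
𝟙-not false = refl

𝟙-mono : ∀ {a b} → (a ≡ true → b ≡ true) → 𝟙 a ≤ 𝟙 b
𝟙-mono {false} {b} _ = 0≤𝟙 b
𝟙-mono {true} h = ≤-reflexive (cong 𝟙 (sym (h refl)))

𝟙-guard : ∀ b {x y} → (b ≡ true → x ≤ y) → 𝟙 b * x ≤ 𝟙 b * y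
𝟙-guard true h = *-monoʳ 0≤1 (h refl)
𝟙-guard false {x} {y} h = ≤-reflexive (trans (*-zeroˡ x) (sym (*-zeroˡ y)))

bool : ∀ b → b ≡ true ⊎ b ≡ false
bool true = inj₁ refl
bool false = inj₂ refl

true≢false : ∀ {b} → b ≡ true → b ≡ false → ⊥
true≢false refl ()

∧-fst : ∀ {a b} → a ∧ b ≡ true → a ≡ true
∧-fst {true} _ = refl

∧-snd : ∀ {a b} → a ∧ b ≡ true → b ≡ true
∧-snd {true} p = p

∧-intro : ∀ {a b} → a ≡ true → b ≡ true → a ∧ b ≡ true
∧-intro refl q = q

∨-elim : ∀ {a b} → a ∨ b ≡ true → a ≡ true ⊎ b ≡ true
∨-elim {true} _ = inj₁ refl
∨-elim {false} p = inj₂ p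

∨-inl : ∀ {a b} → a ≡ true → a ∨ b ≡ true
∨-inl refl = refl

∨-inr : ∀ {a b} → b ≡ true → a ∨ b ≡ true
∨-inr {true} _ = refl
∨-inr {false} p = p

not-elim : ∀ {a} → not a ≡ true → a ≡ false
not-elim {false} _ = refl

not-intro : ∀ {a} → a ≡ false → not a ≡ true
not-intro refl = refl

≡false : ∀ {b} → ¬ (b ≡ true) → b ≡ false
≡false {true} h = ⊥-elim (h refl)
≡false {false} _ = refl

infix 4 _==_
_==_ : ∀ {n} → Fin n → Fin n → Bool
i == j = does (i Finₚ.≟ j)

==⇒≡ : ∀ {n} (i j : Fin n) → (i == j) ≡ true → i ≡ j
==⇒≡ i j p with i Finₚ.≟ j
... | yes q = q
... | no _ = case p of λ ()

≢⇒== : ∀ {n} {i j : Fin n} → i ≢ j → (i == j) ≡ false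
≢⇒== {i = i} {j} p with i Finₚ.≟ j
... | yes q = ⊥-elim (p q)
... | no _ = refl

==-refl : ∀ {n} (i : Fin n) → (i == i) ≡ true
==-refl i with i Finₚ.≟ i
... | yes _ = refl
... | no p = ⊥-elim (p refl)

==false⇒≢ : ∀ {n} (i j : Fin n) → (i == j) ≡ false → i ≢ j
==false⇒≢ i .i p refl = true≢false (==-refl i) p

==-sym : ∀ {n} (i j : Fin n) → (i == j) ≡ (j == i)
==-sym i j with bool (i == j)
... | inj₁ p = trans p (sym (subst (λ k → (k == i) ≡ true) (==⇒≡ i j p) (==-refl i)))
... | inj₂ p = trans p (sym (≢⇒== (λ q → ==false⇒≢ i j p (sym q))))

∑-δ : ∀ {n} (i : Fin n) (f : Fin n → ℚ) → ∑ (λ j → 𝟙 (i == j) * f j) ≡ f i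
∑-δ {suc n} zero f = trans (cong₂ _+_ (*-identityˡ (f zero)) (trans (∑-cong (λ j → *-zeroˡ (f (suc j)))) (∑-0 n))) (+-identityʳ (f zero))
∑-δ {suc n} (suc i) f = trans (cong₂ _+_ (*-zeroˡ (f zero))
  (trans (∑-cong (λ j → cong (λ b → 𝟙 b * f (suc j)) (suc== i j))) (∑-δ i (f ∘ suc)))) (+-identityˡ _)
  where
  suc== : ∀ {n} (i j : Fin n) → (Fin.suc i == suc j) ≡ (i == j)
  suc== i j with i Finₚ.≟ j
  ... | yes _ = refl
  ... | no _ = refl

#_ : ∀ {n} → (Fin n → Bool) → ℕ
#_ {zero} b = 0
#_ {suc n} b with b zero
... | true = suc (# (b ∘ suc))
... | false = # (b ∘ suc)

ι# : ∀ {n} (b : Fin n → Bool) → ι (# b) ≡ ∑ (𝟙 ∘ b)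
ι# {zero} b = refl
ι# {suc n} b with b zero
... | true = cong (1ℚ +_) (ι# (b ∘ suc))
... | false = trans (ι# (b ∘ suc)) (sym (+-identityˡ _))

#-mono : ∀ {n} {a b : Fin n → Bool} → (∀ i → a i ≡ true → b i ≡ true) → # a ℕ.≤ # b
#-mono {a = a} {b} h = ι-cancel-≤ (subst₂ _≤_ (sym (ι# a)) (sym (ι# b)) (∑-mono (λ i → 𝟙-mono (h i))))

#-drop : ∀ {n} {a b : Fin n → Bool} i → (∀ j → a j ≡ true → b j ≡ true) → a i ≡ false → b i ≡ true →
  # a ℕ.< # b
#-drop {a = a} {b} i h ai bi = ι-cancel-≤ (≤-trans (≤-reflexive lhs) (≤-trans (∑-mono pt) (≤-reflexive (sym (ι# b)))))
  where
  lhs : ι (suc (# a)) ≡ ∑ (λ j → 𝟙 (i == j) * 1ℚ + 𝟙 (a j))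
  lhs = trans (cong₂ _+_ (sym (∑-δ i (λ _ → 1ℚ))) (ι# a)) (sym (∑-+ (λ j → 𝟙 (i == j) * 1ℚ) (𝟙 ∘ a)))
  pt : ∀ j → 𝟙 (i == j) * 1ℚ + 𝟙 (a j) ≤ 𝟙 (b j)
  pt j with bool (i == j)
  ... | inj₁ p = ≤-reflexive (trans (cong₂ (λ x y → 𝟙 x * 1ℚ + 𝟙 y) p (subst (λ k → a k ≡ false) (==⇒≡ i j p) ai))
                   (cong 𝟙 (sym (subst (λ k → b k ≡ true) (==⇒≡ i j p) bi))))
  ... | inj₂ p = ≤-trans (≤-reflexive (trans (cong (λ x → 𝟙 x * 1ℚ + 𝟙 (a j)) p) (+-identityˡ _))) (𝟙-mono (h j))

#≡0 : ∀ {n} {b : Fin n → Bool} → # b ≡ 0 → ∀ i → b i ≡ false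
#≡0 {suc n} {b} p i with b zero in eq
#≡0 {suc n} {b} () i | true
#≡0 {suc n} {b} p zero | false = eq
#≡0 {suc n} {b} p (suc i) | false = #≡0 {n} p i

#≢0 : ∀ {n} {b : Fin n → Bool} {k} → # b ≡ suc k → Σ (Fin n) λ i → b i ≡ true
#≢0 {suc n} {b} p with b zero in eq
... | true = zero , eq
... | false with #≢0 {n} p
...   | i , q = suc i , q

truncate : ∀ {n} (b : Fin n → Bool) k → k ℕ.≤ # b →
  Σ (Fin n → Bool) λ b′ → (∀ i → b′ i ≡ true → b i ≡ true) × (# b′ ≡ k)
truncate {zero} b zero p = b , (λ _ q → q) , refl
truncate {suc n} b k p with b zero in eq
truncate {suc n} b zero p | true with truncate (b ∘ suc) zero z≤n
... | b′ , q , r = (λ { zero → false ; (suc i) → b′ i }) , (λ { (suc i) s → q i s }) , r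
truncate {suc n} b (suc k) (s≤s p) | true with truncate (b ∘ suc) k p
... | b′ , q , r = (λ { zero → true ; (suc i) → b′ i }) , (λ { zero _ → eq ; (suc i) s → q i s }) , cong suc r
truncate {suc n} b k p | false with truncate (b ∘ suc) k p
... | b′ , q , r = (λ { zero → false ; (suc i) → b′ i }) , (λ { (suc i) s → q i s }) , r

any : ∀ {n} → (Fin n → Bool) → Bool
any {zero} b = false
any {suc n} b = b zero ∨ any (b ∘ suc)

any-elim : ∀ {n} {b : Fin n → Bool} → any b ≡ true → Σ (Fin n) λ i → b i ≡ true
any-elim {suc n} {b} p with ∨-elim {b zero} p
... | inj₁ q = zero , q
... | inj₂ q with any-elim q
...   | i , r = suc i , r

any-intro : ∀ {n} {b : Fin n → Bool} i → b i ≡ true → any b ≡ true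
any-intro zero p = ∨-inl p
any-intro {b = b} (suc i) p = ∨-inr {b zero} (any-intro i p)

any-false : ∀ {n} {b : Fin n → Bool} → any b ≡ false → ∀ i → b i ≡ false
any-false p i = ≡false (λ q → true≢false (any-intro i q) p)

𝟙any≤∑ : ∀ {n} (b : Fin n → Bool) → 𝟙 (any b) ≤ ∑ (𝟙 ∘ b)
𝟙any≤∑ b with bool (any b)
... | inj₂ p = ≤-trans (≤-reflexive (cong 𝟙 p)) (0≤∑ (0≤𝟙 ∘ b))
... | inj₁ p with any-elim p
...   | i , q = ≤-trans (≤-reflexive (trans (cong 𝟙 p) (cong 𝟙 (sym q)))) (term≤∑ (0≤𝟙 ∘ b) i)

-- For a = 1 - g and b = a/7 one has (1 + b)³ ≤ 1 + 7b = 1 + a and g(1 + a) ≤ 1. Bernoulli bounds zb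
-- by (1 + b)^z, hence (zb)³ g^z ≤ 1. So even a cubic is beaten, and the spare factor z absorbs the
-- constant `P`.
geometric-beats-square : ∀ {g} → 0ℚ < g → g < 1ℚ → ∀ P →
  Σ ℕ λ z₀ → ∀ z → z ≥ z₀ → P * (ι z * ι z) * g ^ z < 1ℚ
geometric-beats-square {g} 0<g g<1 P = suc z₁ , bound
  where
  a = 1ℚ - g
  0<a = 0<- g<1
  -- `0<ι k` speaks of `ι (suc k)`, so this is the reciprocal of 7; the same shift occurs in all
  -- later uses.
  seventh = proj₁ (recip (0<ι 6))
  0<seventh = proj₁ (proj₂ (recip (0<ι 6)))
  b = a * seventh
  0<b : 0ℚ < b
  0<b = 0<* 0<a 0<seventh
  7b≡a : ι 7 * b ≡ a
  7b≡a = trans (ring-17 a seventh (ι 7)) (trans (cong (a *_) (proj₂ (proj₂ (recip (0<ι 6))))) (*-identityʳ a))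
  b≤1 : b ≤ 1ℚ
  b≤1 = ≤-trans (≤-by (ι 6 * b) (ring-18 b) (0≤* (0≤ι 6) (<⇒≤ 0<b)))
    (≤-trans (≤-reflexive 7b≡a) (≤-by g (ring-19 g) (<⇒≤ 0<g)))
  cube : (1ℚ + b) ^ 3 ≤ 1ℚ + a
  cube = ≤-trans (≤-by (ι 3 * (b * (1ℚ - b)) + b * ((1ℚ - b) * (1ℚ + b))) (ring-20 b)
      (0≤+ (0≤* (0≤ι 3) (0≤* (<⇒≤ 0<b) (0≤- b≤1))) (0≤* (<⇒≤ 0<b) (0≤* (0≤- b≤1) (0≤+ 0≤1 (<⇒≤ 0<b))))))
    (≤-reflexive (cong (1ℚ +_) 7b≡a))
  g[1+a]≤1 : g * (1ℚ + a) ≤ 1ℚ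
  g[1+a]≤1 = ≤-by (a * a) (ring-21 g) (0≤* (<⇒≤ 0<a) (<⇒≤ 0<a))
  0≤1+b = 0≤+ 0≤1 (<⇒≤ 0<b)
  cubic : ∀ z → (ι z * b) ^ 3 * g ^ z ≤ 1ℚ
  cubic z = begin
    (ι z * b) ^ 3 * g ^ z ≤⟨ *-monoˡ (0≤^ z (<⇒≤ 0<g)) (^-mono 3 (0≤* (0≤ι z) (<⇒≤ 0<b)) zb≤) ⟩
    ((1ℚ + b) ^ z) ^ 3 * g ^ z ≡⟨ cong (_* g ^ z) (trans (sym (^-* (1ℚ + b) 3 z)) (trans (cong ((1ℚ + b) ^_) (ℕₚ.*-comm 3 z)) (^-* (1ℚ + b) z 3))) ⟩
    ((1ℚ + b) ^ 3) ^ z * g ^ z ≤⟨ *-monoˡ (0≤^ z (<⇒≤ 0<g)) (^-mono z (0≤^ 3 0≤1+b) cube) ⟩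
    (1ℚ + a) ^ z * g ^ z ≡⟨ trans (*-comm ((1ℚ + a) ^ z) (g ^ z)) (sym (*-^ g (1ℚ + a) z)) ⟩
    (g * (1ℚ + a)) ^ z ≤⟨ ^≤1 z (0≤* (<⇒≤ 0<g) (0≤+ 0≤1 (<⇒≤ 0<a))) g[1+a]≤1 ⟩
    1ℚ ∎
    where
    open ℚₚ.≤-Reasoning
    zb≤ : ι z * b ≤ (1ℚ + b) ^ z
    zb≤ = ≤-trans (≤-by 1ℚ (+-comm 1ℚ (ι z * b)) 0≤1) (bernoulli⁺ z (<⇒≤ 0<b))
  0<b³ = 0<^ 3 0<b
  c = proj₁ (recip 0<b³)
  z₁ = proj₁ (archimedean (P * c))
  bound : ∀ z → z ≥ suc z₁ → P * (ι z * ι z) * g ^ z < 1ℚ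
  bound z z≥ = begin-strict
    P * (ι z * ι z) * g ^ z <⟨ subst₂ _<_ (ring-22 P (ι z) (g ^ z)) (ring-23 (b ^ 3) (ι z) (g ^ z)) (*-mono-< (0<* (0<* 0<z 0<z) (0<^ z 0<g)) P<) ⟩
    b ^ 3 * (ι z * (ι z * ι z)) * g ^ z ≡⟨ cong (_* g ^ z) (ring-24 b (ι z)) ⟩
    (ι z * b) ^ 3 * g ^ z ≤⟨ cubic z ⟩
    1ℚ ∎
    where
    open ℚₚ.≤-Reasoning
    0<z : 0ℚ < ι z
    0<z = 0<ι⁺ (ℕₚ.≤-trans (s≤s z≤n) z≥)
    P< : P < b ^ 3 * ι z
    P< = begin-strict
      P ≡⟨ trans (sym (*-identityʳ P)) (trans (cong (P *_) (sym (proj₂ (proj₂ (recip 0<b³))))) (ring-16 P (b ^ 3) c)) ⟩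
      b ^ 3 * (P * c) <⟨ *-mono-< 0<b³ (≤-<-trans (proj₂ (archimedean (P * c))) (ι-mono-< z≥)) ⟩
      b ^ 3 * ι z ∎

≡⊎≢ : ∀ {n} (i j : Fin n) → i ≡ j ⊎ i ≢ j
≡⊎≢ i j with i Finₚ.≟ j
... | yes p = inj₁ p
... | no p = inj₂ p

-- List colouring of graphs

infixl 7 _∖_
_∖_ : ∀ {m} → (Fin m → Bool) → Fin m → Fin m → Bool
(U ∖ e) f = U f ∧ not (f == e)

∖-⊆ : ∀ {m} {U : Fin m → Bool} {e} f → (U ∖ e) f ≡ true → U f ≡ true
∖-⊆ {U = U} f p = ∧-fst {U f} p

∖-≢ : ∀ {m} {U : Fin m → Bool} {e} f → (U ∖ e) f ≡ true → f ≢ e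
∖-≢ {U = U} {e} f p = ==false⇒≢ f e (not-elim (∧-snd {U f} p))

∖-self : ∀ {m} {U : Fin m → Bool} e → (U ∖ e) e ≡ false
∖-self {U = U} e = ≡false (λ p → ∖-≢ {U = U} e p refl)

∖-intro : ∀ {m} {U : Fin m → Bool} {e} f → U f ≡ true → f ≢ e → (U ∖ e) f ≡ true
∖-intro f p q = ∧-intro p (not-intro (≢⇒== q))

∖-# : ∀ {m} {U : Fin m → Bool} {k} e → U e ≡ true → # U ≡ suc k → # (U ∖ e) ℕ.≤ k
∖-# {U = U} e p q = ℕₚ.≤-pred (subst (# (U ∖ e) ℕ.<_) q (#-drop e (∖-⊆ {U = U}) (∖-self {U = U} e) p))

-- At some colour the indicator of being blocked lies below the indicator of being listed, which
-- leaves only the values 0 and 1.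
free-colour : ∀ {m C} (χ : Fin m → Fin C) (N : Fin m → Bool) (A : Fin C → Bool) →
  ∑ (λ c → 𝟙 (any (λ f → N f ∧ (χ f == c)))) < ∑ (𝟙 ∘ A) →
  Σ (Fin C) λ c → (A c ≡ true) × (∀ f → N f ≡ true → χ f ≢ c)
free-colour χ N A p with ∑<∑⇒∃< p
... | c , q with bool (A c) | bool (any (λ f → N f ∧ (χ f == c)))
...   | inj₂ Ac | _ = ⊥-elim (≤⇒≯ (≤-trans (≤-reflexive (cong 𝟙 Ac)) (0≤𝟙 (any (λ f → N f ∧ (χ f == c))))) q)
...   | inj₁ Ac | inj₁ used = ⊥-elim (≤⇒≯ (≤-trans (𝟙≤1 (A c)) (≤-reflexive (sym (cong 𝟙 used)))) q)
...   | inj₁ Ac | inj₂ unused = c , Ac , λ f Nf χf≡c →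
  true≢false (∧-intro Nf (subst (λ d → (χ f == d) ≡ true) χf≡c (==-refl (χ f)))) (any-false unused f)

colours≤ : ∀ {m C} (χ : Fin m → Fin C) (N : Fin m → Bool) →
  ∑ (λ c → 𝟙 (any (λ f → N f ∧ (χ f == c)))) ≤ ∑ (𝟙 ∘ N)
colours≤ χ N = begin
  ∑ (λ c → 𝟙 (any (λ f → N f ∧ (χ f == c)))) ≤⟨ ∑-mono (λ c → 𝟙any≤∑ (λ f → N f ∧ (χ f == c))) ⟩
  ∑ (λ c → ∑ (λ f → 𝟙 (N f ∧ (χ f == c)))) ≡⟨ ∑-swap (λ c f → 𝟙 (N f ∧ (χ f == c))) ⟩
  ∑ (λ f → ∑ (λ c → 𝟙 (N f ∧ (χ f == c)))) ≡⟨ ∑-cong (λ f → trans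
      (∑-cong (λ c → trans (𝟙-∧ (N f) (χ f == c)) (*-comm (𝟙 (N f)) (𝟙 (χ f == c))))) (∑-δ (χ f) (λ _ → 𝟙 (N f)))) ⟩
  ∑ (𝟙 ∘ N) ∎
  where open ℚₚ.≤-Reasoning

module ListColouring {m C : ℕ} (adj : Fin m → Fin m → Bool) (adj-sym : ∀ e f → adj e f ≡ adj f e) where

  -- The colour function is total and constrained only on `U`. Restriction thus keeps the function,
  -- at the price that even colouring nothing requires some colour to exist.
  record Colourable (U : Fin m → Bool) (A : Fin m → Fin C → Bool) : Set where
    constructor colouring
    field
      colour  : Fin m → Fin C
      allowed : ∀ e → U e ≡ true → A e (colour e) ≡ true
      proper  : ∀ e f → U e ≡ true → U f ≡ true → e ≢ f → adj e f ≡ true → colour e ≢ colour f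

  open Colourable public

  nbr : (Fin m → Bool) → Fin m → Fin m → Bool
  nbr U e f = U f ∧ (not (f == e) ∧ adj e f)

  deg : (Fin m → Bool) → Fin m → ℚ
  deg U e = ∑ (𝟙 ∘ nbr U e)

  deg-mono : ∀ {U V} e → (∀ f → U f ≡ true → V f ≡ true) → deg U e ≤ deg V e
  deg-mono {U} e h = ∑-mono (λ f → 𝟙-mono (λ p → ∧-intro (h f (∧-fst {U f} p)) (∧-snd {U f} p)))

  weaken : ∀ {U V A B} → (∀ e → V e ≡ true → U e ≡ true) →
    (∀ e c → V e ≡ true → A e c ≡ true → B e c ≡ true) → Colourable U A → Colourable V B
  weaken V⊆U A⊆B (colouring χ inA prop) = colouring χ (λ e p → A⊆B e (χ e) p (inA e (V⊆U e p)))
    (λ e f p q → prop e f (V⊆U e p) (V⊆U f q))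

  extend : ∀ {U A} e → (κ : Colourable (U ∖ e) A) →
    (Σ (Fin C) λ c → (A e c ≡ true) × (∀ f → nbr U e f ≡ true → colour κ f ≢ c)) → Colourable U A
  extend {U} {A} e (colouring χ inA prop) (c , Aec , free) = colouring χ′ inA′ proper′
    where
    χ′ : Fin m → Fin C
    χ′ f with f Finₚ.≟ e
    ... | yes _ = c
    ... | no _ = χ f
    inA′ : ∀ f → U f ≡ true → A f (χ′ f) ≡ true
    inA′ f Uf with f Finₚ.≟ e
    ... | yes refl = Aec
    ... | no f≢e = inA f (∖-intro {U = U} f Uf f≢e)
    proper′ : ∀ f g → U f ≡ true → U g ≡ true → f ≢ g → adj f g ≡ true → χ′ f ≢ χ′ g
    proper′ f g Uf Ug f≢g fg with f Finₚ.≟ e | g Finₚ.≟ e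
    ... | yes refl | yes refl = ⊥-elim (f≢g refl)
    ... | yes refl | no g≢e = λ p → free g (∧-intro Ug (∧-intro (not-intro (≢⇒== g≢e)) fg)) (sym p)
    ... | no f≢e | yes refl = free f (∧-intro Uf (∧-intro (not-intro (≢⇒== f≢e)) (trans (adj-sym e f) fg)))
    ... | no f≢e | no g≢e = prop f g (∖-intro {U = U} f Uf f≢e) (∖-intro {U = U} g Ug g≢e) f≢g fg

  -- `A′` are the lists after e has received c. Since c is missing there from the neighbours of e,
  -- any colouring of the rest from `A′` is automatically compatible with c at e.
  colour-step : ∀ {U A A′} e c → A e c ≡ true →
    (∀ f d → A′ f d ≡ true → A f d ≡ true) → (∀ f → f ≢ e → adj e f ≡ true → A′ f c ≡ false) →
    Colourable (U ∖ e) A′ → Colourable U A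
  colour-step {U} {A} {A′} e c Aec A′⊆A blocked (colouring χ inA prop) =
    extend e (weaken (λ _ p → p) (λ f d _ → A′⊆A f d) (colouring χ inA prop)) (c , Aec , λ f p χf≡c →
      let f≢e = ==false⇒≢ f e (not-elim (∧-fst {not (f == e)} (∧-snd {U f} p)))
      in true≢false (inA f (∖-intro {U = U} f (∧-fst {U f} p) f≢e))
           (trans (cong (A′ f) χf≡c) (blocked f f≢e (∧-snd {not (f == e)} (∧-snd {U f} p)))))

  colourable-∅ : Fin C → ∀ {U A} → # U ≡ 0 → Colourable U A
  colourable-∅ c₀ p = colouring (λ _ → c₀) (λ e q → ⊥-elim (true≢false q (#≡0 p e)))
    (λ e f q → ⊥-elim (true≢false q (#≡0 p e)))

  -- The edge of low degree is set aside, the others are coloured first, and then fewer colours are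
  -- blocked at it than its list contains. Only degrees within the current set count.
  degenerate : Fin C → ∀ {A} U → (∀ V → (∀ e → V e ≡ true → U e ≡ true) → ∀ i → V i ≡ true →
    Σ (Fin m) λ e → (V e ≡ true) × (deg V e < ∑ (𝟙 ∘ A e))) → Colourable U A
  degenerate c₀ {A} U = go (# U) U ℕₚ.≤-refl
    where
    go : ∀ k U → # U ℕ.≤ k → (∀ V → (∀ e → V e ≡ true → U e ≡ true) → ∀ i → V i ≡ true →
      Σ (Fin m) λ e → (V e ≡ true) × (deg V e < ∑ (𝟙 ∘ A e))) → Colourable U A
    go zero U #U h = colourable-∅ c₀ (ℕₚ.n≤0⇒n≡0 #U)
    go (suc k) U #U h with # U in eq
    ... | zero = colourable-∅ c₀ eq
    ... | suc j with #≢0 eq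
    ...   | i , Ui with h U (λ _ p → p) i Ui
    ...     | e , Ue , lt = extend e κ (free-colour (colour κ) (nbr U e) (A e) (≤-<-trans (colours≤ (colour κ) (nbr U e)) lt))
      where
      κ : Colourable (U ∖ e) A
      κ = go k (U ∖ e) (ℕₚ.≤-trans (∖-# {U = U} e Ue eq) (ℕₚ.≤-pred #U))
        (λ V V⊆ → h V (λ f p → ∖-⊆ {U = U} f (V⊆ f p)))

  greedy : Fin C → ∀ {U A} → (∀ e → U e ≡ true → deg U e < ∑ (𝟙 ∘ A e)) → Colourable U A
  greedy c₀ {U} h = degenerate c₀ U
    (λ V V⊆U i Vi → i , Vi , ≤-<-trans (deg-mono {V} {U} i V⊆U) (h i (V⊆U i Vi)))

-- The guided greedy process on a linear hypergraph

#-almost : ∀ {n} {a b : Fin n → Bool} i → (∀ j → j ≢ i → a j ≡ true → b j ≡ true) → # a ℕ.≤ suc (# b)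
#-almost {a = a} {b} i h = ι-cancel-≤ (begin
  ι (# a) ≡⟨ ι# a ⟩
  ∑ (𝟙 ∘ a) ≤⟨ ∑-mono pt ⟩
  ∑ (λ j → 𝟙 (i == j) * 1ℚ + 𝟙 (b j)) ≡⟨ ∑-+ (λ j → 𝟙 (i == j) * 1ℚ) (𝟙 ∘ b) ⟩
  ∑ (λ j → 𝟙 (i == j) * 1ℚ) + ∑ (𝟙 ∘ b) ≡⟨ cong₂ _+_ (∑-δ i (λ _ → 1ℚ)) (sym (ι# b)) ⟩
  ι (suc (# b)) ∎)
  where
  open ℚₚ.≤-Reasoning
  pt : ∀ j → 𝟙 (a j) ≤ 𝟙 (i == j) * 1ℚ + 𝟙 (b j)
  pt j with bool (i == j)
  ... | inj₁ p = ≤-trans (𝟙≤1 (a j)) (≤-by (𝟙 (b j)) (cong (λ x → 𝟙 x * 1ℚ + 𝟙 (b j)) p) (0≤𝟙 (b j)))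
  ... | inj₂ p = ≤-trans (𝟙-mono (h j (λ q → ==false⇒≢ i j p (sym q))))
    (≤-reflexive (sym (trans (cong (λ x → 𝟙 x * 1ℚ + 𝟙 (b j)) p) (+-identityˡ (𝟙 (b j))))))

#-split : ∀ {n} {a b c : Fin n → Bool} → (∀ i → b i ≡ true → a i ≡ true) → (∀ i → c i ≡ true → a i ≡ true) →
  (∀ i → b i ≡ true → c i ≡ true → ⊥) → # b ℕ.+ # c ℕ.≤ # a
#-split {a = a} {b} {c} b⊆a c⊆a disj = ι-cancel-≤ (begin
  ι (# b ℕ.+ # c) ≡⟨ trans (ι-+ (# b) (# c)) (cong₂ _+_ (ι# b) (ι# c)) ⟩
  ∑ (𝟙 ∘ b) + ∑ (𝟙 ∘ c) ≡⟨ sym (∑-+ (𝟙 ∘ b) (𝟙 ∘ c)) ⟩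
  ∑ (λ i → 𝟙 (b i) + 𝟙 (c i)) ≤⟨ ∑-mono pt ⟩
  ∑ (𝟙 ∘ a) ≡⟨ sym (ι# a) ⟩
  ι (# a) ∎)
  where
  open ℚₚ.≤-Reasoning
  pt : ∀ i → 𝟙 (b i) + 𝟙 (c i) ≤ 𝟙 (a i)
  pt i with bool (b i) | bool (c i)
  ... | inj₁ p | inj₁ q = ⊥-elim (disj i p q)
  ... | inj₁ p | inj₂ q = ≤-trans (≤-reflexive (trans (cong (λ x → 𝟙 (b i) + 𝟙 x) q) (+-identityʳ (𝟙 (b i))))) (𝟙-mono (b⊆a i))
  ... | inj₂ p | _ = ≤-trans (≤-reflexive (trans (cong (λ x → 𝟙 x + 𝟙 (c i)) p) (+-identityˡ (𝟙 (c i))))) (𝟙-mono (c⊆a i))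

-- An injection given as a relation: partners exist and are never shared. Counting related pairs by
-- rows and by columns gives the inequality without choosing a function.
#-inj : ∀ {m n} (a : Fin m → Bool) (b : Fin n → Bool) (x : Fin m → Fin n → Bool) →
  (∀ f → a f ≡ true → Σ (Fin n) λ v → (b v ≡ true) × (x f v ≡ true)) →
  (∀ f g v → a f ≡ true → a g ≡ true → x f v ≡ true → x g v ≡ true → f ≡ g) → # a ℕ.≤ # b
#-inj {m} {n} a b x ex inj = ι-cancel-≤ (begin
  ι (# a) ≡⟨ ι# a ⟩
  ∑ (𝟙 ∘ a) ≤⟨ ∑-mono lower ⟩
  ∑ (λ f → ∑ (λ v → 𝟙 (a f ∧ (b v ∧ x f v)))) ≡⟨ ∑-swap (λ f v → 𝟙 (a f ∧ (b v ∧ x f v))) ⟩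
  ∑ (λ v → ∑ (λ f → 𝟙 (a f ∧ (b v ∧ x f v)))) ≤⟨ ∑-mono upper ⟩
  ∑ (𝟙 ∘ b) ≡⟨ sym (ι# b) ⟩
  ι (# b) ∎)
  where
  open ℚₚ.≤-Reasoning
  lower : ∀ f → 𝟙 (a f) ≤ ∑ (λ v → 𝟙 (a f ∧ (b v ∧ x f v)))
  lower f with bool (a f)
  ... | inj₂ p = ≤-trans (≤-reflexive (cong 𝟙 p)) (0≤∑ (λ v → 0≤𝟙 (a f ∧ (b v ∧ x f v))))
  ... | inj₁ p with ex f p
  ...   | v , bv , xv = ≤-trans (𝟙-mono {a f} (λ _ → ∧-intro p (∧-intro bv xv))) (term≤∑ (λ v → 0≤𝟙 (a f ∧ (b v ∧ x f v))) v)
  upper : ∀ v → ∑ (λ f → 𝟙 (a f ∧ (b v ∧ x f v))) ≤ 𝟙 (b v)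
  upper v with bool (any (λ f → a f ∧ (b v ∧ x f v)))
  ... | inj₂ p = ≤-trans (≤-reflexive (trans (∑-cong (λ f → cong 𝟙 (any-false {b = λ g → a g ∧ (b v ∧ x g v)} p f))) (∑-0 m))) (0≤𝟙 (b v))
  ... | inj₁ p with any-elim p
  ...   | g , q = ≤-trans (∑-mono (λ f → 𝟙-mono (same f))) (≤-trans
      (≤-reflexive (trans (∑-cong (λ f → sym (*-identityʳ (𝟙 (g == f))))) (∑-δ g (λ _ → 1ℚ)))) (≤-reflexive (cong 𝟙 (sym bv))))
    where
    bv : b v ≡ true
    bv = ∧-fst {b v} (∧-snd {a g} q)
    same : ∀ f → a f ∧ (b v ∧ x f v) ≡ true → (g == f) ≡ true
    same f r with inj g f v (∧-fst {a g} q) (∧-fst {a f} r) (∧-snd {b v} (∧-snd {a g} q)) (∧-snd {b v} (∧-snd {a f} r))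
    ... | refl = ==-refl g

-- The missing weight, `N` minus the sum of all weights, belongs to doing nothing. If idling does
-- not reach `F`, then F - F₀ is negative and replacing the factor `N` by the smaller total weight
-- only raises the bound. So some pair has a weighted change below its share, and there a move of
-- positive weight reaches `F`.
averaging : ∀ {m C} {w₁ w₂ F₁ F₂ : Fin m → Fin C → ℚ} {F₀ F N} →
  (∀ e c → 0ℚ ≤ w₁ e c) → (∀ e c → 0ℚ ≤ w₂ e c) →
  ∑ (λ e → ∑ (λ c → w₁ e c + w₂ e c)) < N →
  ∑ (λ e → ∑ (λ c → w₁ e c * (F₁ e c - F₀) + w₂ e c * (F₂ e c - F₀))) ≤ N * (F - F₀) →
  F₀ ≤ F ⊎ Σ (Fin m) λ e → Σ (Fin C) λ c → ((0ℚ < w₁ e c) × (F₁ e c ≤ F)) ⊎ ((0ℚ < w₂ e c) × (F₂ e c ≤ F))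
averaging {w₁ = w₁} {w₂} {F₁} {F₂} {F₀} {F} {N} 0≤w₁ 0≤w₂ W<N drift with ≤⊎> F₀ F
... | inj₁ p = inj₁ p
... | inj₂ F<F₀ with ∑<∑⇒∃< total
  where
  g = F₀ - F
  total : ∑ (λ e → ∑ (λ c → w₁ e c * (F₁ e c - F₀) + w₂ e c * (F₂ e c - F₀))) < ∑ (λ e → ∑ (λ c → (w₁ e c + w₂ e c) * (F - F₀)))
  total = ≤-<-trans drift (<-≤-trans
    (<-by ((N - ∑ (λ e → ∑ (λ c → w₁ e c + w₂ e c))) * g) (ring-28 N _ F F₀) (0<* (0<- W<N) (0<- F<F₀)))
    (≤-reflexive (sym (trans (∑-cong (λ e → ∑-*ʳ (F - F₀) (λ c → w₁ e c + w₂ e c))) (∑-*ʳ (F - F₀) (λ e → ∑ (λ c → w₁ e c + w₂ e c)))))))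
...   | e , q with ∑<∑⇒∃< q
...     | c , s = inj₂ (e , c , pick (≤⊎> (F₁ e c) F) (≤⊎> (F₂ e c) F) (pos? (w₁ e c) (0≤w₁ e c)) (pos? (w₂ e c) (0≤w₂ e c)))
  where
  pos? : ∀ x → 0ℚ ≤ x → (0ℚ < x) ⊎ x ≡ 0ℚ
  pos? x 0≤x with ≤⊎> x 0ℚ
  ... | inj₁ p = inj₂ (ℚₚ.≤-antisym p 0≤x)
  ... | inj₂ p = inj₁ p
  neg : w₁ e c * (F₁ e c - F) + w₂ e c * (F₂ e c - F) < 0ℚ
  neg = -<0 (subst (0ℚ <_) (ring-29 (w₁ e c) (w₂ e c) (F₁ e c) (F₂ e c) F F₀) (0<- s))
  0≤w₁[] : (0ℚ < w₁ e c → F ≤ F₁ e c) → 0ℚ ≤ w₁ e c * (F₁ e c - F)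
  0≤w₁[] h with pos? (w₁ e c) (0≤w₁ e c)
  ... | inj₁ p = 0≤* (<⇒≤ p) (0≤- (h p))
  ... | inj₂ p = ≤-reflexive (sym (trans (cong (_* (F₁ e c - F)) p) (*-zeroˡ (F₁ e c - F))))
  0≤w₂[] : (0ℚ < w₂ e c → F ≤ F₂ e c) → 0ℚ ≤ w₂ e c * (F₂ e c - F)
  0≤w₂[] h with pos? (w₂ e c) (0≤w₂ e c)
  ... | inj₁ p = 0≤* (<⇒≤ p) (0≤- (h p))
  ... | inj₂ p = ≤-reflexive (sym (trans (cong (_* (F₂ e c - F)) p) (*-zeroˡ (F₂ e c - F))))
  absurd : ∀ {X : Set} → (0ℚ < w₁ e c → F ≤ F₁ e c) → (0ℚ < w₂ e c → F ≤ F₂ e c) → X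
  absurd h k = ⊥-elim (≤⇒≯ (0≤+ (0≤w₁[] h) (0≤w₂[] k)) neg)
  pick : F₁ e c ≤ F ⊎ F < F₁ e c → F₂ e c ≤ F ⊎ F < F₂ e c → (0ℚ < w₁ e c) ⊎ w₁ e c ≡ 0ℚ → (0ℚ < w₂ e c) ⊎ w₂ e c ≡ 0ℚ →
    ((0ℚ < w₁ e c) × (F₁ e c ≤ F)) ⊎ ((0ℚ < w₂ e c) × (F₂ e c ≤ F))
  pick (inj₁ p) _ (inj₁ q) _ = inj₁ (q , p)
  pick _ (inj₁ p) _ (inj₁ q) = inj₂ (q , p)
  pick (inj₂ p) (inj₂ q) _ _ = absurd (λ _ → <⇒≤ p) (λ _ → <⇒≤ q)
  pick (inj₂ p) _ _ (inj₂ q) = absurd (λ _ → <⇒≤ p) (λ r → ⊥-elim (<-irrefl (sym q) r))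
  pick _ (inj₂ p) (inj₂ q) _ = absurd (λ r → ⊥-elim (<-irrefl (sym q) r)) (λ _ → <⇒≤ p)
  pick _ _ (inj₂ p) (inj₂ q) = absurd (λ r → ⊥-elim (<-irrefl (sym p) r)) (λ r → ⊥-elim (<-irrefl (sym q) r))

-- Incidence structures and the two moves of the process

record Linearᴮ {m n} (inc : Fin m → Fin n → Bool) : Set where
  field
    linear : ∀ e f u v → e ≢ f → u ≢ v → inc e u ≡ true → inc e v ≡ true → inc f u ≡ true → inc f v ≡ true → ⊥

module Incidence {m n} (inc : Fin m → Fin n → Bool) where

  adj : Fin m → Fin m → Bool
  adj e f = any (λ v → inc e v ∧ inc f v)

  adj-intro : ∀ {e f} v → inc e v ≡ true → inc f v ≡ true → adj e f ≡ true
  adj-intro v p q = any-intro v (∧-intro p q)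

  adj-elim : ∀ e f → adj e f ≡ true → Σ (Fin n) λ v → (inc e v ≡ true) × (inc f v ≡ true)
  adj-elim e f p with any-elim p
  ... | v , q = v , ∧-fst {inc e v} q , ∧-snd {inc e v} q

  adj-sym : ∀ e f → adj e f ≡ adj f e
  adj-sym e f with bool (adj e f) | bool (adj f e)
  ... | inj₁ p | inj₁ q = trans p (sym q)
  ... | inj₂ p | inj₂ q = trans p (sym q)
  ... | inj₁ p | inj₂ q with adj-elim e f p
  ...   | v , a , b = ⊥-elim (true≢false (adj-intro {f} {e} v b a) q)
  adj-sym e f | inj₂ p | inj₁ q with adj-elim f e q
  ...   | v , a , b = ⊥-elim (true≢false (adj-intro {e} {f} v b a) p)

  size : Fin m → ℕ
  size e = # (inc e)

module Nibble {n m C : ℕ} (inc : Fin m → Fin n → Bool) (lin : Linearᴮ inc) where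
  open Linearᴮ lin
  open Incidence inc
  open ListColouring {m} {C} adj adj-sym

  record State : Set where
    constructor state
    field
      uncoloured : Fin m → Bool
      available  : Fin m → Fin C → Bool

  open State public

  lists : State → Fin m → ℕ
  lists s e = # (available s e)

  colourDegree : State → Fin n → Fin C → ℕ
  colourDegree s v c = # (λ e → inc e v ∧ available s e c)

  openDegree : State → Fin n → ℕ
  openDegree s v = # (λ e → inc e v ∧ uncoloured s e)

  colourMove : Fin m → Fin C → State → State
  colourMove e c (state U A) = state (U ∖ e) (λ f d → A f d ∧ (not (f == e) ∧ not ((d == c) ∧ adj e f)))

  removeMove : Fin m → Fin C → State → State
  removeMove e c (state U A) = state U (λ f d → A f d ∧ not ((f == e) ∧ (d == c)))

  conflicts : State → Fin m → Fin C → ℚ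
  conflicts s e c = deg (λ f → available s f c) e

  colourMove-⊆ : ∀ s e c f d → available (colourMove e c s) f d ≡ true → available s f d ≡ true
  colourMove-⊆ s e c f d = ∧-fst {available s f d}

  removeMove-⊆ : ∀ s e c f d → available (removeMove e c s) f d ≡ true → available s f d ≡ true
  removeMove-⊆ s e c f d = ∧-fst {available s f d}

  module Drift (s : State) (κ : ℚ) where
    U = uncoloured s
    A = available s

    -- `w₂` tops the conflicts up to `κ`. A colour c listed at e disappears at the rate `conflicts`
    -- because a neighbour takes it, and at the remaining rate by deletion, hence always at the rate
    -- `κ`.
    w₁ w₂ : Fin m → Fin C → ℚ
    w₁ e c = 𝟙 (A e c)
    w₂ e c = 𝟙 (A e c) * (κ - conflicts s e c)

    term : (State → ℚ) → Fin m → Fin C → ℚ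
    term φ e c = w₁ e c * (φ (colourMove e c s) - φ s) + w₂ e c * (φ (removeMove e c s) - φ s)

    -- The weights are not normalised: this is a total rate of change, to be compared with `N` times
    -- the change permitted per step.
    drift : (State → ℚ) → ℚ
    drift φ = ∑ (λ e → ∑ (λ c → term φ e c))

    drift-+ : ∀ φ ψ → drift (λ t → φ t + ψ t) ≡ drift φ + drift ψ
    drift-+ φ ψ = trans (∑-cong (λ e → trans (∑-cong (λ c → ring-39 (w₁ e c) (w₂ e c) (φ (colourMove e c s)) (ψ (colourMove e c s))
        (φ s) (ψ s) (φ (removeMove e c s)) (ψ (removeMove e c s)))) (∑-+ (term φ e) (term ψ e))))
      (∑-+ (λ e → ∑ (term φ e)) (λ e → ∑ (term ψ e)))

    drift-*ˡ : ∀ k φ → drift (λ t → k * φ t) ≡ k * drift φ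
    drift-*ˡ k φ = trans (∑-cong (λ e → trans (∑-cong (λ c → ring-40 k (w₁ e c) (w₂ e c) (φ (colourMove e c s)) (φ s)
        (φ (removeMove e c s)))) (∑-*ˡ k (term φ e)))) (∑-*ˡ k (λ e → ∑ (term φ e)))

    drift-0 : drift (λ _ → 0ℚ) ≡ 0ℚ
    drift-0 = trans (∑-cong (λ e → trans (∑-cong (λ c → ring-41 (w₁ e c) (w₂ e c))) (∑-0 C))) (∑-0 m)

    drift-∑ : ∀ {k} (φ : Fin k → State → ℚ) → drift (λ t → ∑ (λ i → φ i t)) ≡ ∑ (λ i → drift (φ i))
    drift-∑ {zero} φ = drift-0
    drift-∑ {suc k} φ = trans (drift-+ (φ zero) (λ t → ∑ (λ i → φ (suc i) t))) (cong (drift (φ zero) +_) (drift-∑ (φ ∘ suc)))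

    drift-≤ : ∀ φ (j₁ j₂ : Fin m → Fin C → ℚ) → (∀ e c → A e c ≡ true → conflicts s e c ≤ κ) →
      (∀ e c → A e c ≡ true → φ (colourMove e c s) - φ s ≤ j₁ e c) →
      (∀ e c → A e c ≡ true → φ (removeMove e c s) - φ s ≤ j₂ e c) →
      drift φ ≤ ∑ (λ e → ∑ (λ c → w₁ e c * j₁ e c + w₂ e c * j₂ e c))
    drift-≤ φ j₁ j₂ cap h₁ h₂ = ∑-mono (λ e → ∑-mono (λ c → +-mono-≤ (𝟙-guard (A e c) (h₁ e c))
      (≤-trans (≤-reflexive (*-assoc (𝟙 (A e c)) (κ - conflicts s e c) (φ (removeMove e c s) - φ s)))
        (≤-trans (𝟙-guard (A e c) (λ p → *-monoʳ (0≤- (cap e c p)) (h₂ e c p)))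
          (≤-reflexive (sym (*-assoc (𝟙 (A e c)) (κ - conflicts s e c) (j₂ e c))))))))

  -- One step of a list loses at most one colour, so μ^(list size) grows at most by the factor λ = 1 + η.
  module Weights {λ′ μ η : ℚ} (0<μ : 0ℚ < μ) (μ≤1 : μ ≤ 1ℚ) (λ≡ : λ′ ≡ 1ℚ + η) (0≤η : 0ℚ ≤ η) (λμ≡1 : λ′ * μ ≡ 1ℚ) where

    μ^-antitone : ∀ {a b} → a ℕ.≤ b → μ ^ b ≤ μ ^ a
    μ^-antitone {a} {b} a≤b = ≤-trans (≤-reflexive (trans (cong (μ ^_) (sym (ℕₚ.m+[n∸m]≡n a≤b))) (^-+ μ a (b ℕ.∸ a))))
      (≤-trans (*-monoʳ (0≤^ a (<⇒≤ 0<μ)) (^≤1 (b ℕ.∸ a) (<⇒≤ 0<μ) μ≤1)) (≤-reflexive (*-identityʳ (μ ^ a))))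

    -- From a ≤ b + 1 follows μ · μ^b ≤ μ^a, and multiplication by `λ′`, the reciprocal of `μ`,
    -- isolates μ^b.
    μ^-loss : ∀ {a b} → a ℕ.≤ suc b → μ ^ b - μ ^ a ≤ η * μ ^ a
    μ^-loss {a} {b} a≤ = ≤-by (λ′ * (μ ^ a - μ * μ ^ b)) eq (0≤* 0≤λ (0≤- (μ^-antitone a≤)))
      where
      0≤λ : 0ℚ ≤ λ′
      0≤λ = subst (0ℚ ≤_) (sym λ≡) (0≤+ 0≤1 0≤η)
      eq : η * μ ^ a ≡ (μ ^ b - μ ^ a) + λ′ * (μ ^ a - μ * μ ^ b)
      eq = trans (ring-34 η (μ ^ a) (μ ^ b)) (trans (cong₂ (λ x y → (x - 1ℚ) * μ ^ a + (1ℚ - y) * μ ^ b) (sym λ≡) (sym λμ≡1))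
        (ring-35 λ′ μ (μ ^ a) (μ ^ b)))

    module ListDrift (s : State) (κ : ℚ) (A⊆U : ∀ e c → available s e c ≡ true → uncoloured s e ≡ true)
      (cap : ∀ e c → available s e c ≡ true → conflicts s e c ≤ κ) (f : Fin m) where
      open Drift s κ

      weight : State → ℚ
      weight t = 𝟙 (uncoloured t f) * μ ^ lists t f

      private
        L = lists s f

        keep : ∀ e c d → f ≢ e → (A f c ≡ true → adj e f ≡ true → ⊥) ⊎ d ≢ c →
          A f d ≡ true → available (colourMove e c s) f d ≡ true
        keep e c d f≢e h p = ∧-intro p (∧-intro (not-intro (≢⇒== f≢e)) (not-intro (≡false (λ q → clash h q))))
          where
          clash : (A f c ≡ true → adj e f ≡ true → ⊥) ⊎ d ≢ c → (d == c) ∧ adj e f ≡ true → ⊥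
          clash (inj₁ k) q = k (subst (λ x → A f x ≡ true) (==⇒≡ d c (∧-fst {d == c} q)) p) (∧-snd {d == c} q)
          clash (inj₂ k) q = k (==⇒≡ d c (∧-fst {d == c} q))

        0≤weight : 0ℚ ≤ weight s
        0≤weight = 0≤* (0≤𝟙 (U f)) (0≤^ L (<⇒≤ 0<μ))

        0≤gain : ∀ b → 0ℚ ≤ η * weight s * 𝟙 b
        0≤gain b = 0≤* (0≤* 0≤η 0≤weight) (0≤𝟙 b)

        -- An edge that is coloured after the move weighs nothing, so its weight cannot have
        -- increased; this covers both old and freshly coloured edges.
        vanish : ∀ {t} → uncoloured t f ≡ false → ∀ b → weight t - weight s ≤ η * weight s * 𝟙 b
        vanish {t} p b = ≤-trans (≤-by (weight s) (lem (weight s) (μ ^ lists t f) (𝟙 (uncoloured t f)) (cong 𝟙 p)) 0≤weight) (0≤gain b)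
          where
          lem : ∀ w x u → u ≡ 0ℚ → 0ℚ ≡ (u * x - w) + w
          lem w x u refl = ring-30 w x

        scale : ∀ (b : Bool) {x} → uncoloured s f ≡ true → (b ≡ true → L ℕ.≤ suc x) → (b ≡ false → L ℕ.≤ x) →
          1ℚ * μ ^ x - weight s ≤ η * weight s * 𝟙 b
        scale b {x} p h h′ = ≤-trans (≤-reflexive (trans (cong (λ u → 1ℚ * μ ^ x - u * μ ^ L) (cong 𝟙 p)) (ring-31 (μ ^ x) (μ ^ L))))
          (≤-trans (go b h h′) (≤-reflexive (trans (ring-32 η (μ ^ L) (𝟙 b)) (cong (λ u → η * (u * μ ^ L) * 𝟙 b) (cong 𝟙 (sym p))))))
          where
          go : ∀ b → (b ≡ true → L ℕ.≤ suc x) → (b ≡ false → L ℕ.≤ x) → μ ^ x - μ ^ L ≤ η * μ ^ L * 𝟙 b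
          go true h _ = ≤-trans (μ^-loss (h refl)) (≤-reflexive (sym (*-identityʳ (η * μ ^ L))))
          go false _ h = ≤-trans (≤-by (μ ^ L - μ ^ x) (ring-33 (μ ^ x) (μ ^ L)) (0≤- (μ^-antitone (h refl))))
            (≤-reflexive (sym (*-zeroʳ (η * μ ^ L))))

        after-colour : ∀ e c → A e c ≡ true → weight (colourMove e c s) - weight s ≤ η * weight s * 𝟙 (nbr (λ g → A g c) e f)
        after-colour e c Aec with bool (U f) | ≡⊎≢ f e
        ... | inj₂ p | _ = vanish {colourMove e c s} (≡false (λ q → true≢false (∖-⊆ {U = U} f q) p)) (nbr (λ g → A g c) e f)
        ... | inj₁ p | inj₁ refl = vanish {colourMove f c s} (∖-self {U = U} f) (nbr (λ g → A g c) f f)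
        ... | inj₁ p | inj₂ f≢e = ≤-trans (≤-reflexive (cong (λ u → u * μ ^ lists (colourMove e c s) f - weight s) (cong 𝟙 (∖-intro {U = U} f p f≢e))))
          -- Only c can leave the list of f, and only if f is a neighbour of e that lists c.
          (scale (nbr (λ g → A g c) e f) p (λ _ → #-almost c (λ d d≢c → keep e c d f≢e (inj₂ d≢c)))
            (λ q → #-mono (λ d → keep e c d f≢e (inj₁ (λ a b → true≢false (∧-intro a (∧-intro (not-intro (≢⇒== f≢e)) b)) q)))))

        after-remove : ∀ e c → A e c ≡ true → weight (removeMove e c s) - weight s ≤ η * weight s * 𝟙 (f == e)
        after-remove e c Aec with bool (U f)
        ... | inj₂ p = vanish {removeMove e c s} p (f == e)
        ... | inj₁ p = ≤-trans (≤-reflexive (cong (λ u → u * μ ^ lists (removeMove e c s) f - weight s) (cong 𝟙 p)))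
          (scale (f == e) p
            (λ _ → #-almost {a = A f} {available (removeMove e c s) f} c (λ d d≢c Afd → ∧-intro Afd (not-intro {(f == e) ∧ (d == c)} (≡false (λ q → d≢c (==⇒≡ d c (∧-snd {f == e} q)))))))
            (λ q → #-mono (λ d Afd → ∧-intro Afd (not-intro {(f == e) ∧ (d == c)} (≡false (λ r → true≢false (∧-fst {f == e} r) q))))))

        flip : ∀ e c → 𝟙 (A e c) * 𝟙 (nbr (λ g → A g c) e f) ≡ 𝟙 (A f c) * 𝟙 (nbr (λ g → A g c) f e)
        flip e c = trans (cong (𝟙 (A e c) *_) (𝟙-∧ (A f c) (not (f == e) ∧ adj e f)))
          (trans (ring-16 (𝟙 (A e c)) (𝟙 (A f c)) (𝟙 (not (f == e) ∧ adj e f)))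
          (trans (cong (λ b → 𝟙 (A f c) * (𝟙 (A e c) * 𝟙 b)) (cong₂ (λ x y → not x ∧ y) (==-sym f e) (adj-sym e f)))
            (cong (𝟙 (A f c) *_) (sym (𝟙-∧ (A e c) (not (e == f) ∧ adj f e))))))

      -- For a fixed colour c listed at f, colour moves at the neighbours hit the pair `conflicts`
      -- times and the deletion hits it with weight `κ` minus that. The sum is exactly `κ` for each
      -- of the `L` listed colours; `flip` uses that conflicts are symmetric.
      listDrift : drift weight ≤ κ * η * ι L * weight s
      listDrift = begin
        drift weight ≤⟨ drift-≤ weight (λ e c → g * 𝟙 (nbr (λ h → A h c) e f)) (λ e c → g * 𝟙 (f == e)) cap after-colour after-remove ⟩
        ∑ (λ e → ∑ (λ c → w₁ e c * (g * 𝟙 (nbr (λ h → A h c) e f)) + w₂ e c * (g * 𝟙 (f == e))))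
          ≡⟨ ∑-swap (λ e c → w₁ e c * (g * 𝟙 (nbr (λ h → A h c) e f)) + w₂ e c * (g * 𝟙 (f == e))) ⟩
        ∑ (λ c → ∑ (λ e → w₁ e c * (g * 𝟙 (nbr (λ h → A h c) e f)) + w₂ e c * (g * 𝟙 (f == e)))) ≡⟨ ∑-cong perColour ⟩
        ∑ (λ c → g * κ * 𝟙 (A f c)) ≡⟨ ∑-*ˡ (g * κ) (𝟙 ∘ A f) ⟩
        g * κ * ∑ (𝟙 ∘ A f) ≡⟨ trans (cong (g * κ *_) (sym (ι# (A f)))) (ring-36 η κ (weight s) (ι L)) ⟩
        κ * η * ι L * weight s ∎
        where
        open ℚₚ.≤-Reasoning
        g = η * weight s
        perColour : ∀ c → ∑ (λ e → w₁ e c * (g * 𝟙 (nbr (λ h → A h c) e f)) + w₂ e c * (g * 𝟙 (f == e))) ≡ g * κ * 𝟙 (A f c)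
        perColour c = trans (∑-cong (λ e → trans (ring-37 (w₁ e c) (𝟙 (nbr (λ h → A h c) e f)) g (w₂ e c) (𝟙 (f == e)))
            (cong (λ x → g * x + 𝟙 (f == e) * (g * w₂ e c)) (flip e c))))
          (trans (∑-+ (λ e → g * (𝟙 (A f c) * 𝟙 (nbr (λ h → A h c) f e))) (λ e → 𝟙 (f == e) * (g * w₂ e c)))
          (trans (cong₂ _+_ (trans (∑-*ˡ g (λ e → 𝟙 (A f c) * 𝟙 (nbr (λ h → A h c) f e)))
                     (cong (g *_) (∑-*ˡ (𝟙 (A f c)) (λ e → 𝟙 (nbr (λ h → A h c) f e)))))
                   (∑-δ f (λ e → g * w₂ e c)))
            (ring-38 g (𝟙 (A f c)) κ (conflicts s f c))))

-- Decrease of open degrees and colour degrees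

geq : ℕ → ℕ → Bool
geq θ x with θ ℕ.≤? x
... | yes _ = true
... | no _ = false

geq-elim : ∀ θ x → geq θ x ≡ true → θ ℕ.≤ x
geq-elim θ x p with θ ℕ.≤? x
... | yes q = q
... | no _ = case p of λ ()

geq-intro : ∀ {θ x} → θ ℕ.≤ x → geq θ x ≡ true
geq-intro {θ} {x} p with θ ℕ.≤? x
... | yes _ = refl
... | no ¬p = ⊥-elim (¬p p)

module DegreeDrift {n m C : ℕ} (inc : Fin m → Fin n → Bool) (lin : Linearᴮ inc)
  {λ′ μ β : ℚ} {r : ℕ} (1≤λ : 1ℚ ≤ λ′) (0<μ : 0ℚ < μ) (λμ≡1 : λ′ * μ ≡ 1ℚ) (0≤β : 0ℚ ≤ β)
  (μ^≤ : ∀ j → j ℕ.≤ r → μ ^ j ≤ 1ℚ - ι j * β) (1≤r : 1 ℕ.≤ r)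
  (s : Nibble.State {C = C} inc lin) (κ : ℚ) where
  open Linearᴮ lin
  open Incidence inc
  open ListColouring {m} {C} adj adj-sym
  open Nibble {C = C} inc lin
  open Drift s κ

  -- Counts below the threshold θ are no longer tracked.
  tail : ℕ → ℕ → ℚ
  tail θ x = 𝟙 (geq θ x) * λ′ ^ x

  0≤λ : 0ℚ ≤ λ′
  0≤λ = ≤-trans 0≤1 1≤λ

  0≤tail : ∀ θ x → 0ℚ ≤ tail θ x
  0≤tail θ x = 0≤* (0≤𝟙 (geq θ x)) (0≤^ x 0≤λ)

  -- Losing j costs a factor μ^j, since `λ′` and `μ` are reciprocal, and `μ^≤` makes this linear in
  -- j up to r, the largest drop caused by one move. Passing below `θ` can only help.
  tail-drop : ∀ θ x y j → y ℕ.+ j ℕ.≤ x → j ℕ.≤ r → tail θ y - tail θ x ≤ 0ℚ - ι j * (β * tail θ x)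
  tail-drop θ x y j y+j≤x j≤r = ≤-by (𝟙 (geq θ x) * λ′ ^ x * (1ℚ - ι j * β) - 𝟙 (geq θ y) * λ′ ^ y)
    (ring-54 (𝟙 (geq θ y) * λ′ ^ y) (𝟙 (geq θ x) * λ′ ^ x) (ι j) β) (0≤- main)
    where
    μλ^ : ∀ j → λ′ ^ j * μ ^ j ≡ 1ℚ
    μλ^ j = trans (sym (*-^ λ′ μ j)) (trans (cong (_^ j) λμ≡1) (1^ j))
    powers : λ′ ^ y ≤ λ′ ^ x * (1ℚ - ι j * β)
    powers = begin
      λ′ ^ y ≡⟨ trans (sym (*-identityʳ (λ′ ^ y))) (trans (cong (λ′ ^ y *_) (sym (μλ^ j))) (sym (*-assoc (λ′ ^ y) (λ′ ^ j) (μ ^ j)))) ⟩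
      λ′ ^ y * λ′ ^ j * μ ^ j ≡⟨ cong (_* μ ^ j) (sym (^-+ λ′ y j)) ⟩
      λ′ ^ (y ℕ.+ j) * μ ^ j ≤⟨ *-mono (0≤^ (y ℕ.+ j) 0≤λ) (^-monoʳ 1≤λ y+j≤x) (0≤^ j (<⇒≤ 0<μ)) (μ^≤ j j≤r) ⟩
      λ′ ^ x * (1ℚ - ι j * β) ∎
      where open ℚₚ.≤-Reasoning
    main : 𝟙 (geq θ y) * λ′ ^ y ≤ 𝟙 (geq θ x) * λ′ ^ x * (1ℚ - ι j * β)
    main = ≤-trans (*-mono (0≤𝟙 (geq θ y)) (𝟙-mono {geq θ y} {geq θ x} (λ p → geq-intro (ℕₚ.≤-trans (geq-elim θ y p) (ℕₚ.≤-trans (ℕₚ.m≤m+n y j) y+j≤x))))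
      (0≤^ y 0≤λ) powers) (≤-reflexive (sym (*-assoc (𝟙 (geq θ x)) (λ′ ^ x) (1ℚ - ι j * β))))

  -- This is the purpose of the threshold: the rate of decrease is proportional to the count, and
  -- wherever the tail is nonzero the count may be replaced by the constant `θ`.
  θ≤x·tail : ∀ θ x → ι θ * tail θ x ≤ ι x * tail θ x
  θ≤x·tail θ x = ≤-trans (≤-reflexive (ring-16 (ι θ) (𝟙 (geq θ x)) (λ′ ^ x))) (≤-trans
    (𝟙-guard (geq θ x) (λ p → *-monoˡ (0≤^ x 0≤λ) (ι-mono (geq-elim θ x p))))
    (≤-reflexive (sym (ring-16 (ι x) (𝟙 (geq θ x)) (λ′ ^ x)))))

  module _ (A⊆U : ∀ e c → available s e c ≡ true → uncoloured s e ≡ true)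
    (cap : ∀ e c → available s e c ≡ true → conflicts s e c ≤ κ)
    (rank : ∀ e → uncoloured s e ≡ true → size e ℕ.≤ r)
    (ℓ′ : ℕ) (ℓ′≤ : ∀ e → uncoloured s e ≡ true → ℓ′ ℕ.≤ lists s e) where

    -- A drop of the count by j in each move, weighted, adds up to a decrease of the tail.
    tail-drift : ∀ θ (x : State → ℕ) (j₁ j₂ : Fin m → Fin C → ℕ) R →
      (∀ e c → A e c ≡ true → x (colourMove e c s) ℕ.+ j₁ e c ℕ.≤ x s) → (∀ e c → A e c ≡ true → j₁ e c ℕ.≤ r) →
      (∀ e c → A e c ≡ true → x (removeMove e c s) ℕ.+ j₂ e c ℕ.≤ x s) → (∀ e c → A e c ≡ true → j₂ e c ℕ.≤ r) →
      0ℚ ≤ R → ι (x s) * R ≤ ∑ (λ e → ∑ (λ c → w₁ e c * ι (j₁ e c) + w₂ e c * ι (j₂ e c))) →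
      drift (λ t → tail θ (x t)) ≤ 0ℚ - β * ι θ * R * tail θ (x s)
    tail-drift θ x j₁ j₂ R d₁ b₁ d₂ b₂ 0≤R lower = begin
      drift (λ t → tail θ (x t)) ≤⟨ drift-≤ (λ t → tail θ (x t)) (λ e c → 0ℚ - ι (j₁ e c) * g) (λ e c → 0ℚ - ι (j₂ e c) * g) cap
          (λ e c p → tail-drop θ (x s) (x (colourMove e c s)) (j₁ e c) (d₁ e c p) (b₁ e c p))
          (λ e c p → tail-drop θ (x s) (x (removeMove e c s)) (j₂ e c) (d₂ e c p) (b₂ e c p)) ⟩
      ∑ (λ e → ∑ (λ c → w₁ e c * (0ℚ - ι (j₁ e c) * g) + w₂ e c * (0ℚ - ι (j₂ e c) * g)))
        ≡⟨ trans (∑-cong (λ e → trans (∑-cong (λ c → ring-51 (w₁ e c) (w₂ e c) (ι (j₁ e c)) (ι (j₂ e c)) g)) (∑-*ˡ (0ℚ - g) (λ c → w₁ e c * ι (j₁ e c) + w₂ e c * ι (j₂ e c)))))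
             (∑-*ˡ (0ℚ - g) (λ e → ∑ (λ c → w₁ e c * ι (j₁ e c) + w₂ e c * ι (j₂ e c)))) ⟩
      (0ℚ - g) * S ≤⟨ ≤-by (g * (S - ι (x s) * R)) (ring-52 g S (ι (x s) * R)) (0≤* (0≤* 0≤β (0≤tail θ (x s))) (0≤- lower)) ⟩
      (0ℚ - g) * (ι (x s) * R) ≤⟨ ≤-by (β * R * (ι (x s) * T - ι θ * T)) (ring-53 β R (ι (x s)) (ι θ) T) (0≤* (0≤* 0≤β 0≤R) (0≤- (θ≤x·tail θ (x s)))) ⟩
      0ℚ - β * ι θ * R * T ∎
      where
      open ℚₚ.≤-Reasoning
      T = tail θ (x s)
      g = β * T
      S = ∑ (λ e → ∑ (λ c → w₁ e c * ι (j₁ e c) + w₂ e c * ι (j₂ e c)))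

    w₂≥0 : ∀ e c → 0ℚ ≤ w₂ e c
    w₂≥0 e c = ≤-trans (≤-reflexive (sym (*-zeroʳ (𝟙 (A e c))))) (𝟙-guard (A e c) (λ p → 0≤- (cap e c p)))

    ∑A : ∀ e → ∑ (λ c → 𝟙 (A e c)) ≡ ι (lists s e)
    ∑A e = sym (ι# (A e))

    module _ (v : Fin n) where

      -- An edge at v stops being open when it is coloured, which has the weight of its list, at
      -- least `ℓ′`. Deletions contribute nothing.
      openDrift : ∀ θ → drift (λ t → tail θ (openDegree t v)) ≤ 0ℚ - β * ι θ * ι ℓ′ * tail θ (openDegree s v)
      openDrift θ = tail-drift θ (λ t → openDegree t v) j (λ _ _ → 0) (ι ℓ′) drop
          (λ e c p → j≤r (inc e v)) (λ e c p → ℕₚ.≤-reflexive (ℕₚ.+-identityʳ (openDegree s v))) (λ _ _ _ → z≤n) (0≤ι ℓ′) lower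
        where
        b→ℕ : Bool → ℕ
        b→ℕ true = 1
        b→ℕ false = 0
        ι-b→ℕ : ∀ b → ι (b→ℕ b) ≡ 𝟙 b
        ι-b→ℕ true = refl
        ι-b→ℕ false = refl
        j : Fin m → Fin C → ℕ
        j e c = b→ℕ (inc e v)
        j≤r : ∀ b → b→ℕ b ℕ.≤ r
        j≤r true = 1≤r
        j≤r false = z≤n
        drop : ∀ e c → A e c ≡ true → openDegree (colourMove e c s) v ℕ.+ j e c ℕ.≤ openDegree s v
        drop e c p with bool (inc e v)
        ... | inj₁ q = subst (λ k → openDegree (colourMove e c s) v ℕ.+ b→ℕ k ℕ.≤ openDegree s v) (sym q)
          (subst (ℕ._≤ openDegree s v) (ℕₚ.+-comm 1 (openDegree (colourMove e c s) v))
            (#-drop e (λ f h → ∧-intro (∧-fst {inc f v} h) (∖-⊆ {U = U} f (∧-snd {inc f v} h)))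
              (≡false (λ h → true≢false (∧-snd {inc e v} h) (∖-self {U = U} e))) (∧-intro q (A⊆U e c p))))
        ... | inj₂ q = subst (λ k → openDegree (colourMove e c s) v ℕ.+ b→ℕ k ℕ.≤ openDegree s v) (sym q)
          (subst (ℕ._≤ openDegree s v) (sym (ℕₚ.+-identityʳ (openDegree (colourMove e c s) v)))
            (#-mono (λ f h → ∧-intro (∧-fst {inc f v} h) (∖-⊆ {U = U} f (∧-snd {inc f v} h)))))
        lower : ι (openDegree s v) * ι ℓ′ ≤ ∑ (λ e → ∑ (λ c → w₁ e c * ι (j e c) + w₂ e c * 0ℚ))
        lower = begin
          ι (openDegree s v) * ι ℓ′ ≡⟨ trans (cong (_* ι ℓ′) (ι# (λ e → inc e v ∧ U e))) (sym (∑-*ʳ (ι ℓ′) (λ e → 𝟙 (inc e v ∧ U e)))) ⟩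
          ∑ (λ e → 𝟙 (inc e v ∧ U e) * ι ℓ′) ≤⟨ ∑-mono (λ e → ≤-trans (𝟙-guard (inc e v ∧ U e) (λ p → ι-mono (ℓ′≤ e (∧-snd {inc e v} p))))
              (*-monoˡ (0≤ι (lists s e)) (𝟙-mono {inc e v ∧ U e} (∧-fst {inc e v})))) ⟩
          ∑ (λ e → 𝟙 (inc e v) * ι (lists s e)) ≡⟨ ∑-cong (λ e → trans (cong (𝟙 (inc e v) *_) (sym (∑A e)))
              (trans (sym (∑-*ˡ (𝟙 (inc e v)) (λ c → 𝟙 (A e c)))) (∑-cong (λ c → trans (cong (_* 𝟙 (A e c)) (sym (ι-b→ℕ (inc e v))))
                (ring-49 (ι (j e c)) (𝟙 (A e c)) (w₂ e c)))))) ⟩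
          ∑ (λ e → ∑ (λ c → w₁ e c * ι (j e c) + w₂ e c * 0ℚ)) ∎
          where
          open ℚₚ.≤-Reasoning

      -- An edge f at v listing c₀ leaves the count when it is coloured (weight at least `ℓ′`), when
      -- c₀ is deleted from it (`κ` minus its conflicts), or when an adjacent edge not through v
      -- takes c₀. The conflicts among the edges at v, at most d, are the only ones not regained,
      -- hence ℓ′ + κ - d.
      colourDrift : ∀ c₀ θ {d : ℚ} → ι (colourDegree s v c₀) ≤ d → d ≤ κ →
        drift (λ t → tail θ (colourDegree t v c₀)) ≤ 0ℚ - β * ι θ * (ι ℓ′ + κ - d) * tail θ (colourDegree s v c₀)
      colourDrift c₀ θ {d} X≤d d≤κ = tail-drift θ (λ t → colourDegree t v c₀) j₁ j₂ (ι ℓ′ + κ - d) drop₁ bound₁ drop₂ bound₂ 0≤R lower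
        where
        X = colourDegree s v c₀
        at : Fin m → Bool
        at e = inc e v ∧ A e c₀
        hit : Fin m → Fin m → Bool
        hit e f = at f ∧ adj e f
        j₁ j₂ : Fin m → Fin C → ℕ
        j₁ e c with inc e v | A e c₀ | c == c₀
        -- A coloured edge at v is credited with its own departure only, even if the colour is c₀
        -- and all others at v lose it; this generosity costs the term d.
        ... | true | true | _ = 1
        ... | true | false | _ = 0
        ... | false | _ | true = # (hit e)
        ... | false | _ | false = 0
        j₂ e c with inc e v ∧ (c == c₀)
        ... | true = 1
        ... | false = 0
        0≤R : 0ℚ ≤ ι ℓ′ + κ - d
        0≤R = subst (0ℚ ≤_) (sym (+-assoc (ι ℓ′) κ (- d))) (0≤+ (0≤ι ℓ′) (0≤- d≤κ))

        mono₁ : ∀ e c → colourDegree (colourMove e c s) v c₀ ℕ.≤ X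
        mono₁ e c = #-mono (λ f p → ∧-intro (∧-fst {inc f v} p) (colourMove-⊆ s e c f c₀ (∧-snd {inc f v} p)))
        mono₂ : ∀ e c → colourDegree (removeMove e c s) v c₀ ℕ.≤ X
        mono₂ e c = #-mono (λ f p → ∧-intro (∧-fst {inc f v} p) (removeMove-⊆ s e c f c₀ (∧-snd {inc f v} p)))

        drop₁ : ∀ e c → A e c ≡ true → colourDegree (colourMove e c s) v c₀ ℕ.+ j₁ e c ℕ.≤ X
        drop₁ e c Aec with inc e v in iv | A e c₀ in Ac₀ | c == c₀ in cc
        ... | true | true | _ = subst (ℕ._≤ X) (ℕₚ.+-comm 1 (colourDegree (colourMove e c s) v c₀))
          (#-drop e (λ f p → ∧-intro (∧-fst {inc f v} p) (colourMove-⊆ s e c f c₀ (∧-snd {inc f v} p)))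
            (≡false (λ p → ==false⇒≢ e e (not-elim (∧-fst {not (e == e)} (∧-snd {A e c₀} (∧-snd {inc e v} p)))) refl)) (∧-intro iv Ac₀))
        ... | true | false | _ = subst (ℕ._≤ X) (sym (ℕₚ.+-identityʳ (colourDegree (colourMove e c s) v c₀))) (mono₁ e c)
        ... | false | _ | false = subst (ℕ._≤ X) (sym (ℕₚ.+-identityʳ (colourDegree (colourMove e c s) v c₀))) (mono₁ e c)
        ... | false | _ | true = #-split
          (λ f p → ∧-intro (∧-fst {inc f v} p) (colourMove-⊆ s e c f c₀ (∧-snd {inc f v} p)))
          (λ f p → ∧-fst {at f} p)
          (λ f p q → true≢false
            (∧-intro (subst (λ k → (c₀ == k) ≡ true) (sym (==⇒≡ c c₀ cc)) (==-refl c₀)) (∧-snd {at f} q))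
            (not-elim (∧-snd {not (f == e)} (∧-snd {A f c₀} (∧-snd {inc f v} p)))))

        bound₁ : ∀ e c → A e c ≡ true → j₁ e c ℕ.≤ r
        bound₁ e c Aec with inc e v in iv | A e c₀ | c == c₀
        ... | true | true | _ = 1≤r
        ... | true | false | _ = z≤n
        ... | false | _ | false = z≤n
        -- Edges at v meeting e, which misses v, meet e in different vertices by linearity; so at
        -- most r of them lose c₀.
        ... | false | _ | true = ℕₚ.≤-trans (#-inj (hit e) (inc e) (λ f w → inc e w ∧ inc f w)
            (λ f p → let w , ew , fw = adj-elim e f (∧-snd {at f} p) in w , ew , ∧-intro ew fw) inj) (rank e (A⊆U e c Aec))
          where
          inj : ∀ f g w → hit e f ≡ true → hit e g ≡ true → inc e w ∧ inc f w ≡ true → inc e w ∧ inc g w ≡ true → f ≡ g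
          inj f g w p q fw gw with ≡⊎≢ f g
          ... | inj₁ eq = eq
          ... | inj₂ f≢g = ⊥-elim (linear f g v w f≢g
            (λ v≡w → true≢false (subst (λ x → inc e x ≡ true) (sym v≡w) (∧-fst {inc e w} fw)) iv)
            (∧-fst {inc f v} (∧-fst {at f} p)) (∧-snd {inc e w} fw) (∧-fst {inc g v} (∧-fst {at g} q)) (∧-snd {inc e w} gw))

        drop₂ : ∀ e c → A e c ≡ true → colourDegree (removeMove e c s) v c₀ ℕ.+ j₂ e c ℕ.≤ X
        drop₂ e c Aec with inc e v ∧ (c == c₀) in eq
        ... | false = subst (ℕ._≤ X) (sym (ℕₚ.+-identityʳ (colourDegree (removeMove e c s) v c₀))) (mono₂ e c)
        ... | true = subst (ℕ._≤ X) (ℕₚ.+-comm 1 (colourDegree (removeMove e c s) v c₀))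
          (#-drop e (λ f p → ∧-intro (∧-fst {inc f v} p) (removeMove-⊆ s e c f c₀ (∧-snd {inc f v} p)))
            (≡false (λ p → true≢false (∧-intro (==-refl e) (subst (λ k → (c₀ == k) ≡ true) (sym c≡c₀) (==-refl c₀)))
              (not-elim (∧-snd {A e c₀} (∧-snd {inc e v} p))))) (∧-intro (∧-fst {inc e v} eq) (subst (λ k → A e k ≡ true) c≡c₀ Aec)))
          where
          c≡c₀ : c ≡ c₀
          c≡c₀ = ==⇒≡ c c₀ (∧-snd {inc e v} eq)

        bound₂ : ∀ e c → A e c ≡ true → j₂ e c ℕ.≤ r
        bound₂ e c _ with inc e v ∧ (c == c₀)
        ... | true = 1≤r
        ... | false = z≤n

        lower : ι X * (ι ℓ′ + κ - d) ≤ ∑ (λ e → ∑ (λ c → w₁ e c * ι (j₁ e c) + w₂ e c * ι (j₂ e c)))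
        lower = begin
          ι X * (ι ℓ′ + κ - d) ≡⟨ trans (cong (_* (ι ℓ′ + κ - d)) (ι# at)) (sym (∑-*ʳ (ι ℓ′ + κ - d) (𝟙 ∘ at))) ⟩
          ∑ (λ f → 𝟙 (at f) * (ι ℓ′ + κ - d)) ≤⟨ ∑-mono (λ f → 𝟙-guard (at f) (perEdge f)) ⟩
          ∑ (λ f → 𝟙 (at f) * (ι (lists s f) + Y f + (κ - conflicts s f c₀))) ≡⟨ ∑-cong (λ f → ring-50 (𝟙 (at f)) (ι (lists s f)) (Y f) (κ - conflicts s f c₀)) ⟩
          ∑ (λ f → (𝟙 (at f) * ι (lists s f) + 𝟙 (at f) * (κ - conflicts s f c₀)) + 𝟙 (at f) * Y f)
            ≡⟨ ∑-+ (λ f → 𝟙 (at f) * ι (lists s f) + 𝟙 (at f) * (κ - conflicts s f c₀)) (λ f → 𝟙 (at f) * Y f) ⟩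
          ∑ (λ f → 𝟙 (at f) * ι (lists s f) + 𝟙 (at f) * (κ - conflicts s f c₀)) + ∑ (λ f → 𝟙 (at f) * Y f)
            ≡⟨ cong (∑ (λ f → 𝟙 (at f) * ι (lists s f) + 𝟙 (at f) * (κ - conflicts s f c₀)) +_) swapped ⟩
          ∑ (λ f → 𝟙 (at f) * ι (lists s f) + 𝟙 (at f) * (κ - conflicts s f c₀)) + ∑ (λ e → 𝟙 (out e) * ι (# (hit e)))
            ≡⟨ sym (∑-+ (λ f → 𝟙 (at f) * ι (lists s f) + 𝟙 (at f) * (κ - conflicts s f c₀)) (λ e → 𝟙 (out e) * ι (# (hit e)))) ⟩
          ∑ (λ e → (𝟙 (at e) * ι (lists s e) + 𝟙 (at e) * (κ - conflicts s e c₀)) + 𝟙 (out e) * ι (# (hit e))) ≡⟨ ∑-cong (λ e → sym (perMove e)) ⟩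
          ∑ (λ e → ∑ (λ c → w₁ e c * ι (j₁ e c) + w₂ e c * ι (j₂ e c))) ∎
          where
          open ℚₚ.≤-Reasoning
          out : Fin m → Bool
          out e = not (inc e v) ∧ A e c₀
          Y : Fin m → ℚ
          Y f = ∑ (λ e → 𝟙 (out e) * 𝟙 (adj e f))
          conflict≤ : ∀ f → conflicts s f c₀ ≤ Y f + ι X
          conflict≤ f = ≤-trans (∑-mono pt) (≤-reflexive (trans (∑-+ (λ e → 𝟙 (out e) * 𝟙 (adj e f)) (𝟙 ∘ at)) (cong (Y f +_) (sym (ι# at)))))
            where
            pt : ∀ e → 𝟙 (nbr (λ g → A g c₀) f e) ≤ 𝟙 (out e) * 𝟙 (adj e f) + 𝟙 (at e)
            pt e with bool (inc e v)
            ... | inj₁ p = ≤-trans (𝟙-mono {nbr (λ g → A g c₀) f e} {at e} (λ q → ∧-intro p (∧-fst {A e c₀} q)))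
              (≤-by (𝟙 (out e) * 𝟙 (adj e f)) (+-comm (𝟙 (out e) * 𝟙 (adj e f)) (𝟙 (at e))) (0≤* (0≤𝟙 (out e)) (0≤𝟙 (adj e f))))
            ... | inj₂ p = ≤-trans (𝟙-mono {nbr (λ g → A g c₀) f e} {out e ∧ adj e f} (λ q → ∧-intro (∧-intro (not-intro p) (∧-fst {A e c₀} q))
                (trans (adj-sym e f) (∧-snd {not (e == f)} (∧-snd {A e c₀} q)))))
              (≤-by (𝟙 (at e)) (cong (_+ 𝟙 (at e)) (sym (𝟙-∧ (out e) (adj e f)))) (0≤𝟙 (at e)))
          perEdge : ∀ f → at f ≡ true → ι ℓ′ + κ - d ≤ ι (lists s f) + Y f + (κ - conflicts s f c₀)
          perEdge f p = ≤-by ((ι (lists s f) - ι ℓ′) + ((Y f + ι X) - conflicts s f c₀) + (d - ι X))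
            (ring-42 (ι (lists s f)) (ι ℓ′) (Y f) (ι X) (conflicts s f c₀) d κ)
            (0≤+ (0≤+ (0≤- (ι-mono (ℓ′≤ f (A⊆U f c₀ (∧-snd {inc f v} p))))) (0≤- (conflict≤ f))) (0≤- X≤d))
          swapped : ∑ (λ f → 𝟙 (at f) * Y f) ≡ ∑ (λ e → 𝟙 (out e) * ι (# (hit e)))
          swapped = trans (∑-cong (λ f → sym (∑-*ˡ (𝟙 (at f)) (λ e → 𝟙 (out e) * 𝟙 (adj e f)))))
            (trans (∑-swap (λ f e → 𝟙 (at f) * (𝟙 (out e) * 𝟙 (adj e f))))
            (∑-cong (λ e → trans (∑-cong (λ f → trans (ring-16 (𝟙 (at f)) (𝟙 (out e)) (𝟙 (adj e f))) (cong (𝟙 (out e) *_) (sym (𝟙-∧ (at f) (adj e f))))))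
              (trans (∑-*ˡ (𝟙 (out e)) (λ f → 𝟙 (hit e f))) (cong (𝟙 (out e) *_) (sym (ι# (hit e))))))))
          j₁≡ : ∀ e c → ι (j₁ e c) ≡ 𝟙 (at e) + 𝟙 (c₀ == c) * (𝟙 (not (inc e v)) * ι (# (hit e)))
          j₁≡ e c with inc e v | A e c₀ | c == c₀ in cc
          ... | true | true | _ = ring-43 (𝟙 (c₀ == c)) (ι (# (hit e)))
          ... | true | false | _ = ring-44 (𝟙 (c₀ == c)) (ι (# (hit e)))
          ... | false | _ | true = trans (ring-45 (ι (# (hit e)))) (cong (λ b → 0ℚ + 𝟙 b * (1ℚ * ι (# (hit e)))) (sym (trans (==-sym c₀ c) cc)))
          ... | false | _ | false = trans (ring-46 (ι (# (hit e)))) (cong (λ b → 0ℚ + 𝟙 b * (1ℚ * ι (# (hit e)))) (sym (trans (==-sym c₀ c) cc)))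
          j₂≡ : ∀ e c → ι (j₂ e c) ≡ 𝟙 (c₀ == c) * 𝟙 (inc e v)
          j₂≡ e c = trans j₂≡𝟙 (trans (𝟙-∧ (inc e v) (c == c₀)) (trans (*-comm (𝟙 (inc e v)) (𝟙 (c == c₀))) (cong (λ b → 𝟙 b * 𝟙 (inc e v)) (==-sym c c₀))))
            where
            j₂≡𝟙 : ι (j₂ e c) ≡ 𝟙 (inc e v ∧ (c == c₀))
            j₂≡𝟙 with inc e v ∧ (c == c₀)
            ... | true = refl
            ... | false = refl
          perMove : ∀ e → ∑ (λ c → w₁ e c * ι (j₁ e c) + w₂ e c * ι (j₂ e c)) ≡
            (𝟙 (at e) * ι (lists s e) + 𝟙 (at e) * (κ - conflicts s e c₀)) + 𝟙 (out e) * ι (# (hit e))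
          perMove e = begin-equality
            ∑ (λ c → w₁ e c * ι (j₁ e c) + w₂ e c * ι (j₂ e c))
              ≡⟨ ∑-cong (λ c → trans (cong₂ (λ x y → w₁ e c * x + w₂ e c * y) (j₁≡ e c) (j₂≡ e c))
                   (ring-47 (w₁ e c) (w₂ e c) (𝟙 (at e)) (𝟙 (c₀ == c)) (𝟙 (not (inc e v)) * ι (# (hit e))) (𝟙 (inc e v)))) ⟩
            ∑ (λ c → 𝟙 (at e) * 𝟙 (A e c) + 𝟙 (c₀ == c) * G c) ≡⟨ ∑-+ (λ c → 𝟙 (at e) * 𝟙 (A e c)) (λ c → 𝟙 (c₀ == c) * G c) ⟩
            ∑ (λ c → 𝟙 (at e) * 𝟙 (A e c)) + ∑ (λ c → 𝟙 (c₀ == c) * G c)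
              ≡⟨ cong₂ _+_ (trans (∑-*ˡ (𝟙 (at e)) (λ c → 𝟙 (A e c))) (cong (𝟙 (at e) *_) (∑A e))) (∑-δ c₀ G) ⟩
            𝟙 (at e) * ι (lists s e) + (𝟙 (A e c₀) * (𝟙 (not (inc e v)) * ι (# (hit e))) + 𝟙 (A e c₀) * (κ - conflicts s e c₀) * 𝟙 (inc e v))
              ≡⟨ ring-48 (𝟙 (at e) * ι (lists s e)) (𝟙 (A e c₀)) (𝟙 (not (inc e v))) (ι (# (hit e))) (κ - conflicts s e c₀) (𝟙 (inc e v)) ⟩
            (𝟙 (at e) * ι (lists s e) + 𝟙 (inc e v) * 𝟙 (A e c₀) * (κ - conflicts s e c₀)) + 𝟙 (not (inc e v)) * 𝟙 (A e c₀) * ι (# (hit e))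
              ≡⟨ cong₂ (λ x y → (𝟙 (at e) * ι (lists s e) + x * (κ - conflicts s e c₀)) + y * ι (# (hit e))) (sym (𝟙-∧ (inc e v) (A e c₀))) (sym (𝟙-∧ (not (inc e v)) (A e c₀))) ⟩
            (𝟙 (at e) * ι (lists s e) + 𝟙 (at e) * (κ - conflicts s e c₀)) + 𝟙 (out e) * ι (# (hit e)) ∎
            where
            G : Fin C → ℚ
            G c = w₁ e c * (𝟙 (not (inc e v)) * ι (# (hit e))) + w₂ e c * 𝟙 (inc e v)

-- The process guided by a potential

module Process {n m C : ℕ} (inc : Fin m → Fin n → Bool) (lin : Linearᴮ inc)
  {λ′ μ η β : ℚ} {r : ℕ} (λ≡ : λ′ ≡ 1ℚ + η) (0≤η : 0ℚ ≤ η) (0<μ : 0ℚ < μ) (μ≤1 : μ ≤ 1ℚ) (λμ≡1 : λ′ * μ ≡ 1ℚ) (0≤β : 0ℚ ≤ β)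
  (μ^≤ : ∀ j → j ℕ.≤ r → μ ^ j ≤ 1ℚ - ι j * β) (1≤r : 1 ℕ.≤ r)
  (ℓ ℓ′ d θ₁ θ₂ : ℕ)
  {N G H I c₁ c₂ c₃ : ℚ}
  (0≤G : 0ℚ ≤ G) (0≤H : 0ℚ ≤ H) (0≤I : 0ℚ ≤ I) (1≤G : 1ℚ ≤ G) (0≤c₁ : 0ℚ ≤ c₁) (0≤c₂ : 0ℚ ≤ c₂) (0≤c₃ : 0ℚ ≤ c₃)
  (1≤c₁ : 1ℚ ≤ c₁ * μ ^ ℓ′) (1≤c₂ : 1ℚ ≤ c₂ * λ′ ^ θ₁) (1≤c₃ : 1ℚ ≤ c₃ * λ′ ^ θ₂)
  (rateG : ι r * ι d * η * ι ℓ ≤ N * (G - 1ℚ))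
  (rateH : N * (1ℚ - H) ≤ β * ι θ₁ * (ι ℓ′ + ι r * ι d - ι d))
  (rateI : N * (1ℚ - I) ≤ β * ι θ₂ * ι ℓ′)
  (weight<N : ι m * (ι C * (1ℚ + ι r * ι d)) < N) where
  open Incidence inc
  open ListColouring {m} {C} adj adj-sym
  open Nibble {C = C} inc lin

  κ = ι r * ι d

  1≤λ : 1ℚ ≤ λ′
  1≤λ = ≤-by η λ≡ 0≤η

  listWeight : Fin m → State → ℚ
  listWeight f t = 𝟙 (uncoloured t f) * μ ^ lists t f

  tail : ℕ → ℕ → ℚ
  tail θ x = 𝟙 (geq θ x) * λ′ ^ x

  Φ₁ Φ₂ Φ₃ : State → ℚ
  Φ₁ t = ∑ (λ f → listWeight f t)
  Φ₂ t = ∑ (λ v → ∑ (λ c → tail θ₁ (colourDegree t v c)))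
  Φ₃ t = ∑ (λ v → tail θ₂ (openDegree t v))

  -- `T` is the number of steps still to come and each power pays for the expected factor of those
  -- steps. As G ≥ 1, the list part yields its bound at every time; the degree parts yield theirs at
  -- the end, when the powers of `H` and `I` are gone.
  Φ : ℕ → State → ℚ
  Φ T t = c₁ * G ^ T * Φ₁ t + (c₂ * H ^ T * Φ₂ t + c₃ * I ^ T * Φ₃ t)

  record Inv (s : State) : Set where
    field
      A⊆U  : ∀ e c → available s e c ≡ true → uncoloured s e ≡ true
      rank : ∀ e → uncoloured s e ≡ true → size e ℕ.≤ r
      L≤ℓ  : ∀ e → lists s e ℕ.≤ ℓ
      X≤d  : ∀ v c → colourDegree s v c ℕ.≤ d

  record Post (s : State) : Set where
    field
      A⊆U  : ∀ e c → available s e c ≡ true → uncoloured s e ≡ true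
      rank : ∀ e → uncoloured s e ≡ true → size e ℕ.≤ r
      ℓ′≤L : ∀ e → uncoloured s e ≡ true → ℓ′ ℕ.≤ lists s e
      X<θ  : ∀ v c → colourDegree s v c ℕ.< θ₁
      u<θ  : ∀ v → openDegree s v ℕ.< θ₂

  0≤listWeight : ∀ f t → 0ℚ ≤ listWeight f t
  0≤listWeight f t = 0≤* (0≤𝟙 (uncoloured t f)) (0≤^ (lists t f) (<⇒≤ 0<μ))

  0≤tail : ∀ θ x → 0ℚ ≤ tail θ x
  0≤tail θ x = 0≤* (0≤𝟙 (geq θ x)) (0≤^ x (≤-trans 0≤1 1≤λ))

  0≤Φ₁ : ∀ t → 0ℚ ≤ Φ₁ t
  0≤Φ₁ t = 0≤∑ (λ f → 0≤listWeight f t)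

  0≤Φ₂ : ∀ t → 0ℚ ≤ Φ₂ t
  0≤Φ₂ t = 0≤∑ (λ v → 0≤∑ (λ c → 0≤tail θ₁ (colourDegree t v c)))

  0≤Φ₃ : ∀ t → 0ℚ ≤ Φ₃ t
  0≤Φ₃ t = 0≤∑ (λ v → 0≤tail θ₂ (openDegree t v))

  -- At each of the at most r vertices of e, at most d edges list c. This makes the deletion weights
  -- nonnegative.
  cap : ∀ s → Inv s → ∀ e c → available s e c ≡ true → conflicts s e c ≤ κ
  cap s inv e c p = begin
    ∑ (λ f → 𝟙 (nbr (λ g → A g c) e f)) ≤⟨ ∑-mono pt ⟩
    ∑ (λ f → ∑ (λ v → 𝟙 (inc e v) * 𝟙 (inc f v ∧ A f c))) ≡⟨ ∑-swap (λ f v → 𝟙 (inc e v) * 𝟙 (inc f v ∧ A f c)) ⟩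
    ∑ (λ v → ∑ (λ f → 𝟙 (inc e v) * 𝟙 (inc f v ∧ A f c))) ≡⟨ ∑-cong (λ v → trans (∑-*ˡ (𝟙 (inc e v)) (λ f → 𝟙 (inc f v ∧ A f c)))
        (cong (𝟙 (inc e v) *_) (sym (ι# (λ f → inc f v ∧ A f c))))) ⟩
    ∑ (λ v → 𝟙 (inc e v) * ι (colourDegree s v c)) ≤⟨ ∑-mono (λ v → *-monoʳ (0≤𝟙 (inc e v)) (ι-mono (Inv.X≤d inv v c))) ⟩
    ∑ (λ v → 𝟙 (inc e v) * ι d) ≡⟨ trans (∑-*ʳ (ι d) (λ v → 𝟙 (inc e v))) (cong (_* ι d) (sym (ι# (inc e)))) ⟩
    ι (size e) * ι d ≤⟨ *-monoˡ (0≤ι d) (ι-mono (Inv.rank inv e (Inv.A⊆U inv e c p))) ⟩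
    ι r * ι d ∎
    where
    open ℚₚ.≤-Reasoning
    A = available s
    pt : ∀ f → 𝟙 (nbr (λ g → A g c) e f) ≤ ∑ (λ v → 𝟙 (inc e v) * 𝟙 (inc f v ∧ A f c))
    pt f with bool (nbr (λ g → A g c) e f)
    ... | inj₂ q = ≤-trans (≤-reflexive (cong 𝟙 q)) (0≤∑ (λ v → 0≤* (0≤𝟙 (inc e v)) (0≤𝟙 (inc f v ∧ A f c))))
    ... | inj₁ q with adj-elim e f (∧-snd {not (f == e)} (∧-snd {A f c} q))
    ...   | v , ev , fv = ≤-trans (≤-reflexive (trans (cong 𝟙 q) (sym (cong₂ _*_ (cong 𝟙 ev) (cong 𝟙 (∧-intro fv (∧-fst {A f c} q)))))))
      (term≤∑ (λ v → 0≤* (0≤𝟙 (inc e v)) (0≤𝟙 (inc f v ∧ A f c))) v)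

  -- A single list shorter than `ℓ′` would contribute at least c₁ μ^ℓ′ ≥ 1. It must hold during the
  -- whole run because the decrease of the degrees relies on long lists.
  list-bound : ∀ T s → Φ T s < 1ℚ → ∀ e → uncoloured s e ≡ true → ℓ′ ℕ.≤ lists s e
  list-bound T s Φ<1 e Ue with ℓ′ ℕ.≤? lists s e
  ... | yes p = p
  ... | no ¬p = ⊥-elim (≤⇒≯ big Φ<1)
    where
    open ℚₚ.≤-Reasoning
    0≤rest : 0ℚ ≤ c₂ * H ^ T * Φ₂ s + c₃ * I ^ T * Φ₃ s
    0≤rest = 0≤+ (0≤* (0≤* 0≤c₂ (0≤^ T 0≤H)) (0≤Φ₂ s)) (0≤* (0≤* 0≤c₃ (0≤^ T 0≤I)) (0≤Φ₃ s))
    open Weights {λ′} {μ} {η} 0<μ μ≤1 λ≡ 0≤η λμ≡1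
    big : 1ℚ ≤ Φ T s
    big = begin
      1ℚ ≤⟨ 1≤c₁ ⟩
      c₁ * μ ^ ℓ′ ≤⟨ *-mono 0≤c₁ (≤-trans (≤-reflexive (sym (*-identityʳ c₁))) (*-monoʳ 0≤c₁ (1≤^ T 1≤G)))
          (0≤^ ℓ′ (<⇒≤ 0<μ)) (μ^-antitone (ℕₚ.<⇒≤ (ℕₚ.≰⇒> ¬p))) ⟩
      c₁ * G ^ T * μ ^ lists s e ≡⟨ cong (c₁ * G ^ T *_) (trans (sym (*-identityˡ (μ ^ lists s e))) (cong (λ b → b * μ ^ lists s e) (cong 𝟙 (sym Ue)))) ⟩
      c₁ * G ^ T * listWeight e s ≤⟨ *-monoʳ (0≤* 0≤c₁ (0≤^ T 0≤G)) (term≤∑ (λ f → 0≤listWeight f s) e) ⟩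
      c₁ * G ^ T * Φ₁ s ≤⟨ ≤-by (c₂ * H ^ T * Φ₂ s + c₃ * I ^ T * Φ₃ s) refl 0≤rest ⟩
      Φ T s ∎

  tail<θ : ∀ {c} θ x {Ψ rest} → 0ℚ ≤ c → 1ℚ ≤ c * λ′ ^ θ → tail θ x ≤ Ψ → 0ℚ ≤ rest → c * 1ℚ * Ψ + rest < 1ℚ → x ℕ.< θ
  tail<θ {c} θ x {Ψ} {rest} 0≤c 1≤ t≤ 0≤rest lt with x ℕ.<? θ
  ... | yes p = p
  ... | no ¬p = ⊥-elim (≤⇒≯ big lt)
    where
    open ℚₚ.≤-Reasoning
    θ≤x = ℕₚ.≮⇒≥ ¬p
    big : 1ℚ ≤ c * 1ℚ * Ψ + rest
    big = begin
      1ℚ ≤⟨ 1≤ ⟩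
      c * λ′ ^ θ ≤⟨ *-monoʳ 0≤c (^-monoʳ 1≤λ θ≤x) ⟩
      c * λ′ ^ x ≡⟨ cong₂ _*_ (sym (*-identityʳ c)) (trans (sym (*-identityˡ (λ′ ^ x))) (cong (λ b → b * λ′ ^ x) (cong 𝟙 (sym (geq-intro θ≤x))))) ⟩
      c * 1ℚ * tail θ x ≤⟨ *-monoʳ (0≤* 0≤c 0≤1) t≤ ⟩
      c * 1ℚ * Ψ ≤⟨ ≤-by rest refl 0≤rest ⟩
      c * 1ℚ * Ψ + rest ∎

  post : ∀ s → Inv s → Φ 0 s < 1ℚ → Post s
  post s inv Φ<1 = record
    { A⊆U = Inv.A⊆U inv ; rank = Inv.rank inv ; ℓ′≤L = list-bound 0 s Φ<1
    ; X<θ = λ v c → tail<θ {c₂} θ₁ (colourDegree s v c) {Φ₂ s} {c₁ * 1ℚ * Φ₁ s + c₃ * 1ℚ * Φ₃ s} 0≤c₂ 1≤c₂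
        (≤-trans (term≤∑ (λ c → 0≤tail θ₁ (colourDegree s v c)) c) (term≤∑ (λ v → 0≤∑ (λ c → 0≤tail θ₁ (colourDegree s v c))) v))
        (0≤+ 0≤1st 0≤3rd) (subst (_< 1ℚ) (ring-59 (c₁ * 1ℚ * Φ₁ s) (c₂ * 1ℚ * Φ₂ s) (c₃ * 1ℚ * Φ₃ s)) Φ<1)
    ; u<θ = λ v → tail<θ {c₃} θ₂ (openDegree s v) {Φ₃ s} {c₁ * 1ℚ * Φ₁ s + c₂ * 1ℚ * Φ₂ s} 0≤c₃ 1≤c₃
        (term≤∑ (λ v → 0≤tail θ₂ (openDegree s v)) v)
        (0≤+ 0≤1st 0≤2nd) (subst (_< 1ℚ) (ring-60 (c₁ * 1ℚ * Φ₁ s) (c₂ * 1ℚ * Φ₂ s) (c₃ * 1ℚ * Φ₃ s)) Φ<1) }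
    where
    0≤1st : 0ℚ ≤ c₁ * 1ℚ * Φ₁ s
    0≤1st = 0≤* (0≤* 0≤c₁ 0≤1) (0≤Φ₁ s)
    0≤2nd : 0ℚ ≤ c₂ * 1ℚ * Φ₂ s
    0≤2nd = 0≤* (0≤* 0≤c₂ 0≤1) (0≤Φ₂ s)
    0≤3rd : 0ℚ ≤ c₃ * 1ℚ * Φ₃ s
    0≤3rd = 0≤* (0≤* 0≤c₃ 0≤1) (0≤Φ₃ s)

  -- The expected decrease of the potential over one time unit covers the loss of one power of G, H and I.
  module Step (T : ℕ) (s : State) (inv : Inv s) (Φ<1 : Φ (suc T) s < 1ℚ) where
    open Drift s κ
    open Inv inv
    open Weights {λ′} {μ} {η} 0<μ μ≤1 λ≡ 0≤η λμ≡1 using (module ListDrift)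
    module DD = DegreeDrift {C = C} inc lin {λ′} {μ} {β} {r} 1≤λ 0<μ λμ≡1 0≤β μ^≤ 1≤r s κ

    ℓ′≤ : ∀ e → uncoloured s e ≡ true → ℓ′ ℕ.≤ lists s e
    ℓ′≤ = list-bound (suc T) s Φ<1

    1≤ιr : 1ℚ ≤ ι r
    1≤ιr = ι-mono 1≤r

    d≤κ : ι d ≤ κ
    d≤κ = ≤-trans (≤-reflexive (sym (*-identityˡ (ι d)))) (*-monoˡ (0≤ι d) 1≤ιr)

    drift₁ : drift Φ₁ ≤ N * (G - 1ℚ) * Φ₁ s
    drift₁ = begin
      drift Φ₁ ≡⟨ drift-∑ listWeight ⟩
      ∑ (λ f → drift (listWeight f)) ≤⟨ ∑-mono (λ f → ≤-trans (ListDrift.listDrift s κ A⊆U (cap s inv) f) (*-monoˡ (0≤listWeight f s) (rate f))) ⟩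
      ∑ (λ f → N * (G - 1ℚ) * listWeight f s) ≡⟨ ∑-*ˡ (N * (G - 1ℚ)) (λ f → listWeight f s) ⟩
      N * (G - 1ℚ) * Φ₁ s ∎
      where
      open ℚₚ.≤-Reasoning
      rate : ∀ f → κ * η * ι (lists s f) ≤ N * (G - 1ℚ)
      rate f = ≤-trans (*-monoʳ (0≤* (0≤* (0≤ι r) (0≤ι d)) 0≤η) (ι-mono (L≤ℓ f))) rateG

    shrink : ∀ {a x k} → N * (1ℚ - k) ≤ a → 0ℚ ≤ x → 0ℚ - a * x ≤ N * (k - 1ℚ) * x
    shrink {a} {x} {k} p 0≤x = ≤-by ((a - N * (1ℚ - k)) * x) (ring-56 a N k x) (0≤* (0≤- p) 0≤x)

    drift₂ : drift Φ₂ ≤ N * (H - 1ℚ) * Φ₂ s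
    drift₂ = begin
      drift Φ₂ ≡⟨ trans (drift-∑ (λ v t → ∑ (λ c → tail θ₁ (colourDegree t v c)))) (∑-cong (λ v → drift-∑ (λ c t → tail θ₁ (colourDegree t v c)))) ⟩
      ∑ (λ v → ∑ (λ c → drift (λ t → tail θ₁ (colourDegree t v c)))) ≤⟨ ∑-mono (λ v → ∑-mono (λ c → ≤-trans
          (DD.colourDrift A⊆U (cap s inv) rank ℓ′ ℓ′≤ v c θ₁ (ι-mono (X≤d v c)) d≤κ) (shrink {k = H} rateH (0≤tail θ₁ (colourDegree s v c))))) ⟩
      ∑ (λ v → ∑ (λ c → N * (H - 1ℚ) * tail θ₁ (colourDegree s v c)))
        ≡⟨ trans (∑-cong (λ v → ∑-*ˡ (N * (H - 1ℚ)) (λ c → tail θ₁ (colourDegree s v c)))) (∑-*ˡ (N * (H - 1ℚ)) (λ v → ∑ (λ c → tail θ₁ (colourDegree s v c)))) ⟩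
      N * (H - 1ℚ) * Φ₂ s ∎
      where open ℚₚ.≤-Reasoning

    drift₃ : drift Φ₃ ≤ N * (I - 1ℚ) * Φ₃ s
    drift₃ = begin
      drift Φ₃ ≡⟨ drift-∑ (λ v t → tail θ₂ (openDegree t v)) ⟩
      ∑ (λ v → drift (λ t → tail θ₂ (openDegree t v))) ≤⟨ ∑-mono (λ v → ≤-trans
          (DD.openDrift A⊆U (cap s inv) rank ℓ′ ℓ′≤ v θ₂) (shrink {k = I} rateI (0≤tail θ₂ (openDegree s v)))) ⟩
      ∑ (λ v → N * (I - 1ℚ) * tail θ₂ (openDegree s v)) ≡⟨ ∑-*ˡ (N * (I - 1ℚ)) (λ v → tail θ₂ (openDegree s v)) ⟩
      N * (I - 1ℚ) * Φ₃ s ∎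
      where open ℚₚ.≤-Reasoning

    total : drift (Φ T) ≤ N * (Φ (suc T) s - Φ T s)
    total = begin
      drift (Φ T) ≡⟨ trans (drift-+ (λ t → c₁ * G ^ T * Φ₁ t) (λ t → c₂ * H ^ T * Φ₂ t + c₃ * I ^ T * Φ₃ t))
          (cong₂ _+_ (drift-*ˡ (c₁ * G ^ T) Φ₁) (trans (drift-+ (λ t → c₂ * H ^ T * Φ₂ t) (λ t → c₃ * I ^ T * Φ₃ t))
            (cong₂ _+_ (drift-*ˡ (c₂ * H ^ T) Φ₂) (drift-*ˡ (c₃ * I ^ T) Φ₃)))) ⟩
      c₁ * G ^ T * drift Φ₁ + (c₂ * H ^ T * drift Φ₂ + c₃ * I ^ T * drift Φ₃)
        ≤⟨ +-mono-≤ (*-monoʳ (0≤* 0≤c₁ (0≤^ T 0≤G)) drift₁) (+-mono-≤ (*-monoʳ (0≤* 0≤c₂ (0≤^ T 0≤H)) drift₂) (*-monoʳ (0≤* 0≤c₃ (0≤^ T 0≤I)) drift₃)) ⟩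
      c₁ * G ^ T * (N * (G - 1ℚ) * Φ₁ s) + (c₂ * H ^ T * (N * (H - 1ℚ) * Φ₂ s) + c₃ * I ^ T * (N * (I - 1ℚ) * Φ₃ s))
        ≡⟨ trans (cong₂ _+_ (ring-57 N c₁ G (G ^ T) (Φ₁ s)) (cong₂ _+_ (ring-57 N c₂ H (H ^ T) (Φ₂ s)) (ring-57 N c₃ I (I ^ T) (Φ₃ s))))
             (ring-58 N (c₁ * (G * G ^ T) * Φ₁ s) (c₁ * G ^ T * Φ₁ s) (c₂ * (H * H ^ T) * Φ₂ s) (c₂ * H ^ T * Φ₂ s) (c₃ * (I * I ^ T) * Φ₃ s) (c₃ * I ^ T * Φ₃ s)) ⟩
      N * (Φ (suc T) s - Φ T s) ∎
      where
      open ℚₚ.≤-Reasoning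

    0≤w₂ : ∀ e c → 0ℚ ≤ w₂ e c
    0≤w₂ = DD.w₂≥0 A⊆U (cap s inv) rank ℓ′ ℓ′≤

    weights : ∑ (λ e → ∑ (λ c → w₁ e c + w₂ e c)) < N
    weights = ≤-<-trans (≤-trans (∑-mono (λ e → ≤-trans (∑-mono (λ c → bound e c)) (≤-reflexive (∑-const C (1ℚ + κ))))) (≤-reflexive (∑-const m (ι C * (1ℚ + κ))))) weight<N
      where
      bound : ∀ e c → w₁ e c + w₂ e c ≤ 1ℚ + κ
      bound e c = +-mono-≤ (𝟙≤1 (A e c)) (≤-trans (𝟙-guard (A e c) (λ _ → ≤-by (conflicts s e c) (ring-2 κ (conflicts s e c)) (0≤∑ (λ f → 0≤𝟙 (nbr (λ g → A g c) e f)))))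
        (≤-trans (*-monoˡ (0≤* (0≤ι r) (0≤ι d)) (𝟙≤1 (A e c))) (≤-reflexive (*-identityˡ κ))))

    move : Φ T s ≤ Φ (suc T) s ⊎ Σ (Fin m) λ e → Σ (Fin C) λ c →
      ((0ℚ < w₁ e c) × (Φ T (colourMove e c s) ≤ Φ (suc T) s)) ⊎ ((0ℚ < w₂ e c) × (Φ T (removeMove e c s) ≤ Φ (suc T) s))
    move = averaging {w₁ = w₁} {w₂} {λ e c → Φ T (colourMove e c s)} {λ e c → Φ T (removeMove e c s)} {Φ T s} {Φ (suc T) s} {N}
      (λ e c → 0≤𝟙 (A e c)) 0≤w₂ weights total

    A-of-w₁ : ∀ e c → 0ℚ < w₁ e c → A e c ≡ true
    A-of-w₁ e c p with bool (A e c)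
    ... | inj₁ q = q
    ... | inj₂ q = ⊥-elim (<-irrefl (sym (cong 𝟙 q)) p)

  inv-colour : ∀ s e c → Inv s → Inv (colourMove e c s)
  inv-colour s e c inv = record
    { A⊆U = λ f d p → ∖-intro {U = uncoloured s} f (A⊆U f d (colourMove-⊆ s e c f d p))
        (==false⇒≢ f e (not-elim (∧-fst {not (f == e)} (∧-snd {available s f d} p))))
    ; rank = λ f p → rank f (∖-⊆ {U = uncoloured s} f p)
    ; L≤ℓ = λ f → ℕₚ.≤-trans (#-mono (colourMove-⊆ s e c f)) (L≤ℓ f)
    ; X≤d = λ v k → ℕₚ.≤-trans (#-mono (λ f p → ∧-intro (∧-fst {inc f v} p) (colourMove-⊆ s e c f k (∧-snd {inc f v} p)))) (X≤d v k) }
    where open Inv inv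

  inv-remove : ∀ s e c → Inv s → Inv (removeMove e c s)
  inv-remove s e c inv = record
    { A⊆U = λ f d p → A⊆U f d (removeMove-⊆ s e c f d p)
    ; rank = rank
    ; L≤ℓ = λ f → ℕₚ.≤-trans (#-mono (removeMove-⊆ s e c f)) (L≤ℓ f)
    ; X≤d = λ v k → ℕₚ.≤-trans (#-mono (λ f p → ∧-intro (∧-fst {inc f v} p) (removeMove-⊆ s e c f k (∧-snd {inc f v} p)))) (X≤d v k) }
    where open Inv inv

  Solved : State → Set
  Solved s = Colourable (uncoloured s) (available s)

  undo-colour : ∀ s e c → available s e c ≡ true → Solved (colourMove e c s) → Solved s
  undo-colour s e c Aec = colour-step {uncoloured s} {available s} {available (colourMove e c s)} e c Aec (colourMove-⊆ s e c)
    (λ f f≢e ef → ≡false (λ q → true≢false (∧-intro (==-refl c) ef) (not-elim (∧-snd {not (f == e)} (∧-snd {available s f c} q)))))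

  undo-remove : ∀ s e c → Solved (removeMove e c s) → Solved s
  undo-remove s e c = weaken {uncoloured s} {uncoloured s} {available (removeMove e c s)} {available s} (λ _ q → q) (λ f d _ → removeMove-⊆ s e c f d)

  -- An idle step spends time and leaves the state alone, so the recursion is on `T`. Colourings are
  -- carried back through the moves that were made.
  run : (∀ s → Post s → Solved s) → ∀ T s → Inv s → Φ T s < 1ℚ → Solved s
  run finish zero s inv Φ<1 = finish s (post s inv Φ<1)
  run finish (suc T) s inv Φ<1 = continue (Step.move T s inv Φ<1)
    where
    open Drift s κ using (w₁; w₂)
    continue : Φ T s ≤ Φ (suc T) s ⊎ Σ (Fin m) (λ e → Σ (Fin C) λ c →
      ((0ℚ < w₁ e c) × (Φ T (colourMove e c s) ≤ Φ (suc T) s)) ⊎ ((0ℚ < w₂ e c) × (Φ T (removeMove e c s) ≤ Φ (suc T) s))) → Solved s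
    continue (inj₁ p) = run finish T s inv (≤-<-trans p Φ<1)
    continue (inj₂ (e , c , inj₁ (w , p))) = undo-colour s e c (Step.A-of-w₁ T s inv Φ<1 e c w)
      (run finish T (colourMove e c s) (inv-colour s e c inv) (≤-<-trans p Φ<1))
    continue (inj₂ (e , c , inj₂ (w , p))) = undo-remove s e c
      (run finish T (removeMove e c s) (inv-remove s e c inv) (≤-<-trans p Φ<1))

-- One round of the process, with all parameters proportional to z

-- The witness g/(1 + k) avoids division by a k that may be 0 and makes the inequality strict.
small : ∀ {g} k → 0ℚ < g → 0ℚ ≤ k → Σ ℚ λ η → (0ℚ < η) × (∀ ε → 0ℚ ≤ ε → ε ≤ η → ε * k < g)
small {g} k 0<g 0≤k = η , 0<* 0<g 0<h , bound
  where
  0<1+k = 0<+ 0<1 0≤k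
  h = proj₁ (recip 0<1+k)
  0<h = proj₁ (proj₂ (recip 0<1+k))
  η = g * h
  bound : ∀ ε → 0ℚ ≤ ε → ε ≤ η → ε * k < g
  bound ε 0≤ε ε≤η = ≤-<-trans (*-monoˡ 0≤k ε≤η) (<-by (g * h) (trans (sym (*-identityʳ g)) (trans (cong (g *_) (sym (proj₂ (proj₂ (recip 0<1+k))))) (ring-71 g k h))) (0<* 0<g 0<h))

module Base {η : ℚ} (0<η : 0ℚ < η) (η<1 : η < 1ℚ) where
  0≤η = <⇒≤ 0<η
  λ′ = 1ℚ + η
  0<λ : 0ℚ < λ′
  0<λ = 0<+ 0<1 0≤η
  1≤λ : 1ℚ ≤ λ′
  1≤λ = ≤-by η refl 0≤η
  μ = proj₁ (recip 0<λ)
  0<μ : 0ℚ < μ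
  0<μ = proj₁ (proj₂ (recip 0<λ))
  λμ≡1 : λ′ * μ ≡ 1ℚ
  λμ≡1 = proj₂ (proj₂ (recip 0<λ))
  μ≤1 : μ ≤ 1ℚ
  μ≤1 = ≤-trans (≤-trans (≤-reflexive (sym (*-identityˡ μ))) (*-monoˡ (<⇒≤ 0<μ) 1≤λ)) (≤-reflexive λμ≡1)
  λ^μ^ : ∀ j → λ′ ^ j * μ ^ j ≡ 1ℚ
  λ^μ^ j = trans (sym (*-^ λ′ μ j)) (trans (cong (_^ j) λμ≡1) (1^ j))
  μ^λ^ : ∀ j → μ ^ j * λ′ ^ j ≡ 1ℚ
  μ^λ^ j = trans (*-comm (μ ^ j) (λ′ ^ j)) (λ^μ^ j)

  module _ (r : ℕ) where
    0<1+rη : 0ℚ < 1ℚ + ι r * η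
    0<1+rη = 0<+ 0<1 (0≤* (0≤ι r) 0≤η)
    β = η * proj₁ (recip 0<1+rη)
    0<β : 0ℚ < β
    0<β = 0<* 0<η (proj₁ (proj₂ (recip 0<1+rη)))
    β[1+rη]≡η : β * (1ℚ + ι r * η) ≡ η
    β[1+rη]≡η = trans (ring-62 η (proj₁ (recip 0<1+rη)) (ι r)) (trans (cong (η *_) (proj₂ (proj₂ (recip 0<1+rη)))) (*-identityʳ η))
    -- `β` is η/(1 + rη), and with it (1 + jη)(1 - jβ) equals 1 + jβ(r - j)η, which is at least 1
    -- exactly because j ≤ r. Bernoulli replaces 1 + jη by λ′^j.
    μ^≤ : ∀ j → j ℕ.≤ r → μ ^ j ≤ 1ℚ - ι j * β
    μ^≤ j j≤r = *-cancel-≤ (0<+ 0<1 (0≤* (0≤ι j) 0≤η)) (begin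
      (1ℚ + ι j * η) * μ ^ j ≤⟨ *-monoˡ (0≤^ j (<⇒≤ 0<μ)) (bernoulli⁺ j 0≤η) ⟩
      λ′ ^ j * μ ^ j ≡⟨ λ^μ^ j ⟩
      1ℚ ≤⟨ ≤-by (ι j * β * ((ι r - ι j) * η)) eq (0≤* (0≤* (0≤ι j) (<⇒≤ 0<β)) (0≤* (0≤- (ι-mono j≤r)) 0≤η)) ⟩
      (1ℚ + ι j * η) * (1ℚ - ι j * β) ∎)
      where
      open ℚₚ.≤-Reasoning
      eq : (1ℚ + ι j * η) * (1ℚ - ι j * β) ≡ 1ℚ + ι j * β * ((ι r - ι j) * η)
      eq = trans (ring-64 (ι j) β η) (trans (cong (λ t → (1ℚ + ι j * t) - (ι j * β * (1ℚ + ι j * η))) (sym β[1+rη]≡η)) (ring-63 (ι j) β η (ι r)))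

  -- λ^x is at most the reciprocal of 1 - xη, hence below any (1 + a)^Y whose first-order expansion exceeds that.
  λ^<  : ∀ {a} x Y → 0ℚ ≤ a → 0ℚ < 1ℚ - ι x * η → 1ℚ < (1ℚ + ι Y * a) * (1ℚ - ι x * η) → λ′ ^ x < (1ℚ + a) ^ Y
  λ^< {a} x Y 0≤a pos gt = *-cancel-< pos (begin-strict
    (1ℚ - ι x * η) * λ′ ^ x ≤⟨ *-monoˡ (0≤^ x (<⇒≤ 0<λ)) (bernoulli⁻ x 0≤η (<⇒≤ η<1)) ⟩
    (1ℚ - η) ^ x * λ′ ^ x ≡⟨ sym (*-^ (1ℚ - η) λ′ x) ⟩
    ((1ℚ - η) * λ′) ^ x ≤⟨ ^≤1 x (0≤* (0≤- (<⇒≤ η<1)) (<⇒≤ 0<λ)) (≤-by (η * η) (ring-72 η) (0≤* 0≤η 0≤η)) ⟩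
    1ℚ <⟨ gt ⟩
    (1ℚ + ι Y * a) * (1ℚ - ι x * η) ≤⟨ *-monoˡ (<⇒≤ pos) (bernoulli⁺ Y 0≤a) ⟩
    (1ℚ + a) ^ Y * (1ℚ - ι x * η) ≡⟨ *-comm ((1ℚ + a) ^ Y) (1ℚ - ι x * η) ⟩
    (1ℚ - ι x * η) * (1ℚ + a) ^ Y ∎)
    where
    open ℚₚ.≤-Reasoning

-- A rational stand-in for (1 + x/K)^K ≤ e^x, with 1/(1 - x) in place of e^x: Bernoulli gives 1 - x
-- ≤ (1 - x/K)^K, and (1 + x/K)(1 - x/K) ≤ 1.
[1+x/K]^K≤ : ∀ {x k} K → ι K * k ≡ 1ℚ → 0ℚ ≤ x → 0ℚ ≤ k → x * k ≤ 1ℚ → (1ℚ + x * k) ^ K * (1ℚ - x) ≤ 1ℚ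
[1+x/K]^K≤ {x} {k} K Kk≡1 0≤x 0≤k xk≤1 = begin
  (1ℚ + x * k) ^ K * (1ℚ - x) ≤⟨ *-monoʳ (0≤^ K (0≤+ 0≤1 0≤xk)) (≤-trans (≤-reflexive (cong (λ t → 1ℚ - t) (sym K[xk]))) (bernoulli⁻ K 0≤xk xk≤1)) ⟩
  (1ℚ + x * k) ^ K * (1ℚ - x * k) ^ K ≡⟨ sym (*-^ (1ℚ + x * k) (1ℚ - x * k) K) ⟩
  ((1ℚ + x * k) * (1ℚ - x * k)) ^ K ≤⟨ ^≤1 K (0≤* (0≤+ 0≤1 0≤xk) (0≤- xk≤1)) (≤-by (x * k * (x * k)) (ring-74 (x * k)) (0≤* 0≤xk 0≤xk)) ⟩
  1ℚ ∎
  where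
  open ℚₚ.≤-Reasoning
  0≤xk = 0≤* 0≤x 0≤k
  K[xk] : ι K * (x * k) ≡ x
  K[xk] = trans (ring-16 (ι K) x k) (trans (cong (x *_) Kk≡1) (*-identityʳ x))

-- The mirror image, with 1/(1 + x) in place of e^(-x). Both bounds are uniform in the number K of
-- subdivisions.
[1-x/K]^K≤ : ∀ {x k} K → ι K * k ≡ 1ℚ → 0ℚ ≤ x → 0ℚ ≤ k → x * k ≤ 1ℚ → (1ℚ - x * k) ^ K * (1ℚ + x) ≤ 1ℚ
[1-x/K]^K≤ {x} {k} K Kk≡1 0≤x 0≤k xk≤1 = begin
  (1ℚ - x * k) ^ K * (1ℚ + x) ≤⟨ *-monoʳ (0≤^ K (0≤- xk≤1)) (≤-trans (≤-reflexive (cong (1ℚ +_) (sym K[xk]))) (bernoulli⁺ K 0≤xk)) ⟩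
  (1ℚ - x * k) ^ K * (1ℚ + x * k) ^ K ≡⟨ sym (*-^ (1ℚ - x * k) (1ℚ + x * k) K) ⟩
  ((1ℚ - x * k) * (1ℚ + x * k)) ^ K ≤⟨ ^≤1 K (0≤* (0≤- xk≤1) (0≤+ 0≤1 0≤xk)) (≤-by (x * k * (x * k)) (ring-72 (x * k)) (0≤* 0≤xk 0≤xk)) ⟩
  1ℚ ∎
  where
  open ℚₚ.≤-Reasoning
  0≤xk = 0≤* 0≤x 0≤k
  K[xk] : ι K * (x * k) ≡ x
  K[xk] = trans (ring-16 (ι K) x k) (trans (cong (x *_) Kk≡1) (*-identityʳ x))

≤-recip : ∀ {a b} (0<b : 0ℚ < b) → a * b ≤ 1ℚ → a ≤ proj₁ (recip 0<b)
≤-recip {a} {b} 0<b ab≤1 = *-cancel-≤ 0<b (≤-trans (≤-reflexive (*-comm b a)) (≤-trans ab≤1 (≤-reflexive (sym (proj₂ (proj₂ (recip 0<b)))))))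

record Pre (r B D V z : ℕ) {n m C} (inc : Fin m → Fin n → Bool) (lin : Linearᴮ inc) (s : Nibble.State {C = C} inc lin) : Set where
  open Incidence inc
  open Nibble {C = C} inc lin
  field
    rank  : ∀ e → uncoloured s e ≡ true → size e ℕ.≤ r
    lists≥ : ∀ e → uncoloured s e ≡ true → B ℕ.* z ℕ.≤ lists s e
    colourDegree≤ : ∀ v c → # (λ e → inc e v ∧ (uncoloured s e ∧ available s e c)) ℕ.≤ D ℕ.* z
    openDegree≤ : ∀ v → openDegree s v ℕ.≤ V ℕ.* z

-- All sizes are multiples of the scale `z`. The number of events to be controlled (edges, pairs of
-- a vertex and a colour, vertices) is at most P z², while their weights will decay exponentially in
-- `z`.
CompletableAt : (r B D V P z : ℕ) → Set
CompletableAt r B D V P z = ∀ {n m C} (inc : Fin m → Fin n → Bool) (lin : Linearᴮ inc) → Fin C →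
  ι m ≤ ι P * (ι z * ι z) → ι n * ι C ≤ ι P * (ι z * ι z) → ι n ≤ ι P * (ι z * ι z) →
  (s : Nibble.State {C = C} inc lin) → Pre r B D V z inc lin s →
  ListColouring.Colourable (Incidence.adj inc) (Incidence.adj-sym inc) (Nibble.State.uncoloured s) (Nibble.State.available s)

Completable : (r B D V : ℕ) → Set
Completable r B D V = ∀ P → Σ ℕ λ z₀ → ∀ z → z ≥ z₀ → CompletableAt r B D V P z

-- A round takes (B′ + w, D′ + x, V′ + y) to (B′, D′, V′). In a unit of time a full list is expected
-- to lose one colour, and a round lasts Yz units, so Y < w keeps the lists long enough. In units of
-- `z`, `a₀` and `b₀` are the guaranteed losses of colour degree and open degree while `Y` advances
-- by one.
module RoundConstants (r B′ w Y D′ x V′ y : ℕ) (1≤r : 1 ℕ.≤ r) (1≤B : 1 ℕ.≤ B′ ℕ.+ w) (1≤D : 1 ℕ.≤ D′ ℕ.+ x)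
  (Y<w : Y ℕ.< w) where
  B = B′ ℕ.+ w
  D = D′ ℕ.+ x

  R = ι B * ι r * ι D
  0<R : 0ℚ < R
  0<R = 0<* (0<* (0<ι⁺ 1≤B) (0<ι⁺ 1≤r)) (0<ι⁺ 1≤D)
  1/R = proj₁ (recip 0<R)
  0<1/R = proj₁ (proj₂ (recip 0<R))
  R/R≡1 = proj₂ (proj₂ (recip 0<R))
  a₁ = ι D′ * (ι B′ + ι r * ι D - ι D)
  a₀ = a₁ * 1/R
  b₁ = ι V′ * ι B′
  b₀ = b₁ * 1/R
  0≤a₁ : 0ℚ ≤ a₁
  0≤a₁ = 0≤* (0≤ι D′) (subst (0ℚ ≤_) (sym (+-assoc (ι B′) (ι r * ι D) (- ι D))) (0≤+ (0≤ι B′) (0≤- (≤-trans (≤-reflexive (sym (*-identityˡ (ι D)))) (*-monoˡ (0≤ι D) (ι-mono 1≤r))))))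
  0≤a₀ : 0ℚ ≤ a₀
  0≤a₀ = 0≤* 0≤a₁ (<⇒≤ 0<1/R)
  0≤b₁ : 0ℚ ≤ b₁
  0≤b₁ = 0≤* (0≤ι V′) (0≤ι B′)
  0≤b₀ : 0ℚ ≤ b₀
  0≤b₀ = 0≤* 0≤b₁ (<⇒≤ 0<1/R)

  divide : ∀ {p q} → p * R < q → p < q * 1/R
  divide {p} {q} lt = *-cancel-< 0<R (≤-<-trans (≤-reflexive (*-comm R p)) (<-≤-trans lt (≤-reflexive (trans (sym (*-identityʳ q)) (trans (cong (q *_) (sym R/R≡1)) (ring-16 q R 1/R))))))

  undivide : ∀ q → R * (q * 1/R) ≡ q
  undivide q = trans (ring-73 q R 1/R) (trans (cong (q *_) R/R≡1) (*-identityʳ q))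

  -- The gaps say that the first-order losses Y a₀ and Y b₀ exceed the required x and y. `η` is so
  -- small that the second-order terms with `k₁`, `k₂`, `k₃` do not close the gaps; `k₄` keeps η,
  -- xη, yη and Yη below 1.
  module WithGaps (gap₁ : ι x * R < ι Y * a₁) (gap₂ : ι y * R < ι Y * b₁) where
    gap₁′ : 0ℚ < ι Y * a₀ - ι x
    gap₁′ = 0<- (<-≤-trans (divide gap₁) (≤-reflexive (*-assoc (ι Y) a₁ 1/R)))
    gap₂′ : 0ℚ < ι Y * b₀ - ι y
    gap₂′ = 0<- (<-≤-trans (divide gap₂) (≤-reflexive (*-assoc (ι Y) b₁ 1/R)))
    gap₃ : 0ℚ < ι w - ι Y
    gap₃ = 0<- (ι-mono-< Y<w)

    k₁ = ι x * (ι Y * a₀ + ι r)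
    k₂ = ι y * (ι Y * b₀ + ι r)
    k₃ = ι Y * ι w
    0≤k₁ : 0ℚ ≤ k₁
    0≤k₁ = 0≤* (0≤ι x) (0≤+ (0≤* (0≤ι Y) 0≤a₀) (0≤ι r))
    0≤k₂ : 0ℚ ≤ k₂
    0≤k₂ = 0≤* (0≤ι y) (0≤+ (0≤* (0≤ι Y) 0≤b₀) (0≤ι r))
    0≤k₃ : 0ℚ ≤ k₃
    0≤k₃ = 0≤* (0≤ι Y) (0≤ι w)
    k₄ = 1ℚ + ι x + ι y + ι Y
    0≤k₄ : 0ℚ ≤ k₄
    0≤k₄ = 0≤+ (0≤+ (0≤+ 0≤1 (0≤ι x)) (0≤ι y)) (0≤ι Y)

    s₁ = small k₁ gap₁′ 0≤k₁
    s₂ = small k₂ gap₂′ 0≤k₂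
    s₃ = small k₃ gap₃ 0≤k₃
    s₄ = small k₄ 0<1 0≤k₄
    m₁ = min (proj₁ (proj₂ s₁)) (proj₁ (proj₂ s₂))
    m₂ = min (proj₁ (proj₂ s₃)) (proj₁ (proj₂ s₄))
    m₃ = min (proj₁ (proj₂ m₁)) (proj₁ (proj₂ m₂))
    η : ℚ
    η = proj₁ m₃
    0<η : 0ℚ < η
    0<η = proj₁ (proj₂ m₃)
    η₁ : η * k₁ < ι Y * a₀ - ι x
    η₁ = proj₂ (proj₂ s₁) η (<⇒≤ 0<η) (≤-trans (proj₁ (proj₂ (proj₂ m₃))) (proj₁ (proj₂ (proj₂ m₁))))
    η₂ : η * k₂ < ι Y * b₀ - ι y
    η₂ = proj₂ (proj₂ s₂) η (<⇒≤ 0<η) (≤-trans (proj₁ (proj₂ (proj₂ m₃))) (proj₂ (proj₂ (proj₂ m₁))))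
    η₃ : η * k₃ < ι w - ι Y
    η₃ = proj₂ (proj₂ s₃) η (<⇒≤ 0<η) (≤-trans (proj₂ (proj₂ (proj₂ m₃))) (proj₁ (proj₂ (proj₂ m₂))))
    η₄ : η * k₄ < 1ℚ
    η₄ = proj₂ (proj₂ s₄) η (<⇒≤ 0<η) (≤-trans (proj₂ (proj₂ (proj₂ m₃))) (proj₂ (proj₂ (proj₂ m₂))))

    private
      part : ∀ {p q} → k₄ ≡ p + q → 0ℚ ≤ q → p * η < 1ℚ
      part {p} {q} eq 0≤q = ≤-<-trans (≤-by (η * q) (trans (cong (η *_) eq) (ring-61 η p q)) (0≤* (<⇒≤ 0<η) 0≤q)) η₄
    η<1 : η < 1ℚ
    η<1 = subst (_< 1ℚ) (*-identityˡ η) (part {1ℚ} {ι x + ι y + ι Y} (ring-65 (ι x) (ι y) (ι Y)) (0≤+ (0≤+ (0≤ι x) (0≤ι y)) (0≤ι Y)))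
    xη<1 : ι x * η < 1ℚ
    xη<1 = part {ι x} {1ℚ + ι y + ι Y} (ring-66 (ι x) (ι y) (ι Y)) (0≤+ (0≤+ 0≤1 (0≤ι y)) (0≤ι Y))
    yη<1 : ι y * η < 1ℚ
    yη<1 = part {ι y} {1ℚ + ι x + ι Y} (ring-67 (ι x) (ι y) (ι Y)) (0≤+ (0≤+ 0≤1 (0≤ι x)) (0≤ι Y))
    Yη<1 : ι Y * η < 1ℚ
    Yη<1 = part {ι Y} {1ℚ + ι x + ι y} (+-comm (1ℚ + ι x + ι y) (ι Y)) (0≤+ (0≤+ 0≤1 (0≤ι x)) (0≤ι y))

    open Base 0<η η<1 public
    β′ = β r
    a = β′ * a₀
    b = β′ * b₀
    0≤a : 0ℚ ≤ a
    0≤a = 0≤* (<⇒≤ (0<β r)) 0≤a₀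
    0≤b : 0ℚ ≤ b
    0≤b = 0≤* (<⇒≤ (0<β r)) 0≤b₀

    -- Writing η as β(1 + rη) makes everything beyond 1 divisible by β; the cofactor is the gap
    -- minus its second-order correction.
    first-order : ∀ {c₀} x → η * (ι x * (ι Y * c₀ + ι r)) < ι Y * c₀ - ι x →
      1ℚ < (1ℚ + ι Y * (β′ * c₀)) * (1ℚ - ι x * η)
    first-order {c₀} x lt = <-by (β′ * ((ι Y * c₀ - ι x) - η * (ι x * (ι Y * c₀ + ι r)))) eq (0<* (0<β r) (0<- lt))
      where
      eq : (1ℚ + ι Y * (β′ * c₀)) * (1ℚ - ι x * η) ≡ 1ℚ + β′ * ((ι Y * c₀ - ι x) - η * (ι x * (ι Y * c₀ + ι r)))
      eq = trans (ring-69 _ (ι x) η) (trans (cong (λ t → (1ℚ + ι Y * (β′ * c₀)) * (1ℚ - ι x * η) + ι x * (η - t)) (sym (β[1+rη]≡η r)))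
        (ring-68 β′ (ι Y) c₀ (ι x) η (ι r)))

    0<1-η = 0<- η<1
    0<1+a = 0<+ 0<1 0≤a
    0<1+b = 0<+ 0<1 0≤b
    g = proj₁ (recip 0<1-η)
    h = proj₁ (recip 0<1+a)
    i = proj₁ (recip 0<1+b)
    0<g = proj₁ (proj₂ (recip 0<1-η))
    0<h = proj₁ (proj₂ (recip 0<1+a))
    0<i = proj₁ (proj₂ (recip 0<1+b))

    -- The z-th powers of these three numbers bound one summand of each part of the initial
    -- potential: the first factor is the allowed change of the count, the second the effect of Y
    -- units of time.
    base₁ = μ ^ w * g ^ Y
    base₂ = λ′ ^ x * h ^ Y
    base₃ = λ′ ^ y * i ^ Y
    private
      cancel^ : ∀ {p q} n → p * q ≡ 1ℚ → p ^ n * q ^ n ≡ 1ℚ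
      cancel^ {p} {q} n eq = trans (sym (*-^ p q n)) (trans (cong (_^ n) eq) (1^ n))

      quotient<1 : ∀ {p c d} n → 0ℚ < c → c * d ≡ 1ℚ → p < c ^ n → p * d ^ n < 1ℚ
      quotient<1 {p} {c} {d} n 0<c cd≡1 p<c = *-cancel-< (0<^ n 0<c) (≤-<-trans (≤-reflexive (trans (ring-16 (c ^ n) p (d ^ n)) (trans (cong (p *_) (cancel^ n cd≡1)) (*-identityʳ p))))
        (<-≤-trans p<c (≤-reflexive (sym (*-identityʳ (c ^ n))))))

    base₁<1 : base₁ < 1ℚ
    base₁<1 = quotient<1 {μ ^ w} Y 0<1-η (proj₂ (proj₂ (recip 0<1-η))) (*-cancel-< (0<^ w 0<λ) (≤-<-trans (≤-reflexive (λ^μ^ w)) (begin-strict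
      1ℚ <⟨ <-by (η * ((ι w - ι Y) - η * (ι Y * ι w))) (ring-70 η (ι w) (ι Y)) (0<* 0<η (0<- η₃)) ⟩
      (1ℚ + ι w * η) * (1ℚ - ι Y * η) ≤⟨ *-mono (0≤+ 0≤1 (0≤* (0≤ι w) 0≤η)) (bernoulli⁺ w 0≤η) (0≤- (<⇒≤ Yη<1)) (bernoulli⁻ Y 0≤η (<⇒≤ η<1)) ⟩
      λ′ ^ w * (1ℚ - η) ^ Y ∎)))
      where
      open ℚₚ.≤-Reasoning
    base₂<1 : base₂ < 1ℚ
    base₂<1 = quotient<1 Y 0<1+a (proj₂ (proj₂ (recip 0<1+a))) (λ^< {a} x Y 0≤a (0<- xη<1) (first-order {a₀} x η₁))
    base₃<1 : base₃ < 1ℚ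
    base₃<1 = quotient<1 Y 0<1+b (proj₂ (proj₂ (recip 0<1+b))) (λ^< {b} y Y 0≤b (0<- yη<1) (first-order {b₀} y η₂))

ratio^ : ∀ {p q} → p * q ≡ 1ℚ → ∀ a w z → p ^ (a ℕ.* z) * q ^ ((a ℕ.+ w) ℕ.* z) ≡ (q ^ w) ^ z
ratio^ {p} {q} pq≡1 a w z = trans (cong (p ^ (a ℕ.* z) *_) (trans (cong (q ^_) (ℕₚ.*-distribʳ-+ z a w)) (^-+ q (a ℕ.* z) (w ℕ.* z))))
  (trans (sym (*-assoc (p ^ (a ℕ.* z)) (q ^ (a ℕ.* z)) (q ^ (w ℕ.* z))))
  (trans (cong₂ _*_ (trans (sym (*-^ p q (a ℕ.* z))) (trans (cong (_^ (a ℕ.* z)) pq≡1) (1^ (a ℕ.* z)))) (trans (cong (q ^_) (ℕₚ.*-comm w z)) (^-* q z w)))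
    (*-identityˡ ((q ^ w) ^ z))))

-- p bounds the K-th power of the factor u lost in each of the (Yz)K steps.
decay^ : ∀ {u p} K Y z → 0ℚ ≤ u → u ^ K ≤ p → u ^ (Y ℕ.* z ℕ.* K) ≤ (p ^ Y) ^ z
decay^ {u} {p} K Y z 0≤u uK≤p = ≤-trans (≤-reflexive (^-* u (Y ℕ.* z) K))
  (≤-trans (^-mono (Y ℕ.* z) (0≤^ K 0≤u) uK≤p) (≤-reflexive (trans (cong (p ^_) (ℕₚ.*-comm Y z)) (^-* p z Y))))

-- An interface between the choice of the constants and their use: the round sees the rationals only
-- through these properties.
record RoundParameters (r B′ w Y D′ x V′ y : ℕ) : Set where
  field
    η λ′ μ β a b g h i 1/R : ℚ
  R = ι (B′ ℕ.+ w) * ι r * ι (D′ ℕ.+ x)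
  a₁ = ι D′ * (ι B′ + ι r * ι (D′ ℕ.+ x) - ι (D′ ℕ.+ x))
  b₁ = ι V′ * ι B′
  base₁ = μ ^ w * g ^ Y
  base₂ = λ′ ^ x * h ^ Y
  base₃ = λ′ ^ y * i ^ Y
  field
    0≤η : 0ℚ ≤ η
    η<1 : η < 1ℚ
    λ≡ : λ′ ≡ 1ℚ + η
    0<λ : 0ℚ < λ′
    1≤λ : 1ℚ ≤ λ′
    0<μ : 0ℚ < μ
    μ≤1 : μ ≤ 1ℚ
    λμ≡1 : λ′ * μ ≡ 1ℚ
    0≤β : 0ℚ ≤ β
    μ^≤ : ∀ j → j ℕ.≤ r → μ ^ j ≤ 1ℚ - ι j * β
    R/R≡1 : R * 1/R ≡ 1ℚ
    a≡ : a ≡ β * (a₁ * 1/R)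
    b≡ : b ≡ β * (b₁ * 1/R)
    0≤a : 0ℚ ≤ a
    0≤b : 0ℚ ≤ b
    0<g : 0ℚ < g
    0<h : 0ℚ < h
    0<i : 0ℚ < i
    ≤g : ∀ t → t * (1ℚ - η) ≤ 1ℚ → t ≤ g
    ≤h : ∀ t → t * (1ℚ + a) ≤ 1ℚ → t ≤ h
    ≤i : ∀ t → t * (1ℚ + b) ≤ 1ℚ → t ≤ i
    base₁<1 : base₁ < 1ℚ
    base₂<1 : base₂ < 1ℚ
    base₃<1 : base₃ < 1ℚ

  λ^μ^ : ∀ j → λ′ ^ j * μ ^ j ≡ 1ℚ
  λ^μ^ j = trans (sym (*-^ λ′ μ j)) (trans (cong (_^ j) λμ≡1) (1^ j))

  undivide : ∀ q → R * (q * 1/R) ≡ q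
  undivide q = trans (ring-73 q R 1/R) (trans (cong (q *_) R/R≡1) (*-identityʳ q))

roundParameters : ∀ r B′ w Y D′ x V′ y → 1 ℕ.≤ r → 1 ℕ.≤ B′ ℕ.+ w → 1 ℕ.≤ D′ ℕ.+ x → Y ℕ.< w →
  ι x * (ι (B′ ℕ.+ w) * ι r * ι (D′ ℕ.+ x)) < ι Y * (ι D′ * (ι B′ + ι r * ι (D′ ℕ.+ x) - ι (D′ ℕ.+ x))) →
  ι y * (ι (B′ ℕ.+ w) * ι r * ι (D′ ℕ.+ x)) < ι Y * (ι V′ * ι B′) →
  RoundParameters r B′ w Y D′ x V′ y
roundParameters r B′ w Y D′ x V′ y 1≤r 1≤B 1≤D Y<w gap₁ gap₂ = record
  { η = η ; λ′ = λ′ ; μ = μ ; β = β′ ; a = a ; b = b ; g = g ; h = h ; i = i ; 1/R = 1/R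
  ; 0≤η = 0≤η ; η<1 = η<1 ; λ≡ = refl ; 0<λ = 0<λ ; 1≤λ = 1≤λ ; 0<μ = 0<μ ; μ≤1 = μ≤1 ; λμ≡1 = λμ≡1
  ; 0≤β = <⇒≤ (0<β r) ; μ^≤ = μ^≤ r ; R/R≡1 = R/R≡1 ; a≡ = refl ; b≡ = refl ; 0≤a = 0≤a ; 0≤b = 0≤b
  ; 0<g = 0<g ; 0<h = 0<h ; 0<i = 0<i
  ; ≤g = λ t → ≤-recip 0<1-η ; ≤h = λ t → ≤-recip 0<1+a ; ≤i = λ t → ≤-recip 0<1+b
  ; base₁<1 = base₁<1 ; base₂<1 = base₂<1 ; base₃<1 = base₃<1 }
  where
  open RoundConstants r B′ w Y D′ x V′ y 1≤r 1≤B 1≤D Y<w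
  open WithGaps gap₁ gap₂

module RoundAt (r B′ w Y D′ x V′ y : ℕ) (1≤r : 1 ℕ.≤ r) (1≤B : 1 ℕ.≤ B′ ℕ.+ w) (1≤D : 1 ℕ.≤ D′ ℕ.+ x)
  (params : RoundParameters r B′ w Y D′ x V′ y) (P z : ℕ) (1≤z : 1 ℕ.≤ z)
  (lt₁ : ι 3 * ι P * (ι z * ι z) * RoundParameters.base₁ params ^ z < 1ℚ)
  (lt₂ : ι 3 * ι P * (ι z * ι z) * RoundParameters.base₂ params ^ z < 1ℚ)
  (lt₃ : ι 3 * ι P * (ι z * ι z) * RoundParameters.base₃ params ^ z < 1ℚ)
  (next : CompletableAt r B′ D′ V′ P z) where
  open RoundParameters params
  B = B′ ℕ.+ w
  D = D′ ℕ.+ x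
  μλ≡1 : μ * λ′ ≡ 1ℚ
  μλ≡1 = trans (*-comm μ λ′) λμ≡1
  μ^λ^ : ∀ j → μ ^ j * λ′ ^ j ≡ 1ℚ
  μ^λ^ j = trans (*-comm (μ ^ j) (λ′ ^ j)) (λ^μ^ j)

  module _ {n m C : ℕ} (inc : Fin m → Fin n → Bool) (lin : Linearᴮ inc) (c₀ : Fin C)
    (m≤ : ι m ≤ ι P * (ι z * ι z)) (nC≤ : ι n * ι C ≤ ι P * (ι z * ι z)) (n≤ : ι n ≤ ι P * (ι z * ι z))
    (s : Nibble.State {C = C} inc lin) (pre : Pre r B D (V′ ℕ.+ y) z inc lin s)
    (K : ℕ) (K> : m ℕ.* (C ℕ.* (1 ℕ.+ r ℕ.* (D ℕ.* z))) ℕ.< K) (a≤K : RoundParameters.a params ≤ ι K) (b≤K : RoundParameters.b params ≤ ι K)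
    (k : ℚ) (0≤k : 0ℚ ≤ k) (Kk≡1 : ι K * k ≡ 1ℚ) where
    open Incidence inc
    open ListColouring {m} {C} adj adj-sym
    open Nibble {C = C} inc lin
    open Pre pre
    ℓ = B ℕ.* z
    ℓ′ = B′ ℕ.* z
    d = D ℕ.* z
    U = uncoloured s

    -- Lists are cut down to exactly `ℓ` colours and emptied on coloured edges. An upper bound on
    -- the lists is as necessary as a lower one, because it bounds the rate at which they shrink.
    sel : ∀ e → Σ (Fin C → Bool) λ t → (∀ c → t c ≡ true → (U e ≡ true) × (available s e c ≡ true)) × (# t ℕ.≤ ℓ) × (U e ≡ true → # t ≡ ℓ)
    sel e with bool (U e)
    ... | inj₁ p with truncate (available s e) ℓ (lists≥ e p)
    ...   | t , t⊆ , #t = t , (λ c q → p , t⊆ c q) , ℕₚ.≤-reflexive #t , λ _ → #t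
    sel e | inj₂ p with truncate (available s e) 0 z≤n
    ... | t , t⊆ , #t = t , (λ c q → ⊥-elim (true≢false q (#≡0 #t c))) , ℕₚ.≤-trans (ℕₚ.≤-reflexive #t) z≤n , λ q → ⊥-elim (true≢false q p)

    s₀ : State
    s₀ = state U (λ e → proj₁ (sel e))

    0<K : 0ℚ < ι K
    0<K = 0<ι⁺ (ℕₚ.≤-trans (s≤s z≤n) K>)
    bounded : ∀ {t} → t ≤ ι K → t * k ≤ 1ℚ
    bounded p = ≤-trans (*-monoˡ 0≤k p) (≤-reflexive Kk≡1)
    ak≤1 : a * k ≤ 1ℚ
    ak≤1 = bounded a≤K
    bk≤1 : b * k ≤ 1ℚ
    bk≤1 = bounded b≤K
    ηk≤1 : η * k ≤ 1ℚ
    ηk≤1 = bounded (≤-trans (<⇒≤ η<1) (ι-mono (ℕₚ.≤-trans (s≤s z≤n) K>)))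
    G = 1ℚ + η * k
    H = 1ℚ - a * k
    I = 1ℚ - b * k
    0≤ηk : 0ℚ ≤ η * k
    0≤ηk = 0≤* 0≤η 0≤k
    0≤G : 0ℚ ≤ G
    0≤G = 0≤+ 0≤1 0≤ηk
    1≤G : 1ℚ ≤ G
    1≤G = ≤-by (η * k) refl 0≤ηk
    0≤H : 0ℚ ≤ H
    0≤H = 0≤- ak≤1
    0≤I : 0ℚ ≤ I
    0≤I = 0≤- bk≤1
    1≤λ^μ^ : ∀ j → 1ℚ ≤ λ′ ^ j * μ ^ j
    1≤λ^μ^ j = ≤-reflexive (sym (λ^μ^ j))
    1≤μ^λ^ : ∀ j → 1ℚ ≤ μ ^ j * λ′ ^ j
    1≤μ^λ^ j = ≤-reflexive (sym (μ^λ^ j))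
    -- `κ` times a full list, the rate at which such a list loses colours; with N = QK, a block of K
    -- steps is one unit of time.
    Q = ι ℓ * ι r * ι d
    N = Q * ι K

    1≤Q : 1ℚ ≤ Q
    1≤Q = ≤-trans (ι-mono 1≤) (≤-reflexive (trans (ι-* (ℓ ℕ.* r) d) (cong (_* ι d) (ι-* ℓ r))))
      where
      1≤ : 1 ℕ.≤ ℓ ℕ.* r ℕ.* d
      1≤ = ℕₚ.*-mono-≤ (ℕₚ.*-mono-≤ (ℕₚ.*-mono-≤ 1≤B 1≤z) 1≤r) (ℕₚ.*-mono-≤ 1≤D 1≤z)

    weight<N : ι m * (ι C * (1ℚ + ι r * ι d)) < N
    weight<N = <-≤-trans (≤-<-trans (≤-reflexive eq) (ι-mono-< K>))
      (≤-trans (≤-reflexive (sym (*-identityˡ (ι K)))) (*-monoˡ (<⇒≤ 0<K) 1≤Q))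
      where
      eq : ι m * (ι C * (1ℚ + ι r * ι d)) ≡ ι (m ℕ.* (C ℕ.* (1 ℕ.+ r ℕ.* d)))
      eq = sym (trans (ι-* m (C ℕ.* (1 ℕ.+ r ℕ.* d))) (cong (ι m *_) (trans (ι-* C (1 ℕ.+ r ℕ.* d)) (cong (λ t → ι C * (1ℚ + t)) (ι-* r d)))))

    N*[k] : ∀ t → N * (t * k) ≡ Q * t
    N*[k] t = trans (ring-8 Q (ι K) t k) (trans (cong (Q * t *_) Kk≡1) (*-identityʳ (Q * t)))

    rateG : ι r * ι d * η * ι ℓ ≤ N * (G - 1ℚ)
    rateG = ≤-reflexive (trans (ring-75 (ι r) (ι d) η (ι ℓ)) (trans (sym (N*[k] η)) (cong (N *_) (ring-76 (η * k)))))

    -- Q = z² R, so that the scaled rates a and b reproduce the rates at size z.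
    Q≡ : Q ≡ ι z * ι z * R
    Q≡ = trans (cong₂ (λ p q → p * ι r * q) (ι-* B z) (ι-* D z)) (ring-77 (ι B) (ι D) (ι z) (ι r))

    scaled : ∀ c → Q * (β * (c * 1/R)) ≡ β * (ι z * ι z * c)
    scaled c = trans (cong (_* (β * (c * 1/R))) Q≡) (trans (ring-78 (ι z) R β (c * 1/R)) (cong (λ t → β * (ι z * ι z * t)) (undivide c)))

    rateH : N * (1ℚ - H) ≤ β * ι (D′ ℕ.* z) * (ι ℓ′ + ι r * ι d - ι d)
    rateH = ≤-reflexive (trans (cong (N *_) (ring-4 (a * k))) (trans (N*[k] a) (trans (trans (cong (Q *_) a≡) (scaled a₁))
      (trans (ring-79 β (ι z) (ι D′) (ι B′) (ι r) (ι D)) (sym (cong₂ (λ p q → β * p * q) (ι-* D′ z) (cong₂ (λ p q → p + ι r * q - q) (ι-* B′ z) (ι-* D z))))))))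

    rateI : N * (1ℚ - I) ≤ β * ι (V′ ℕ.* z) * ι ℓ′
    rateI = ≤-reflexive (trans (cong (N *_) (ring-4 (b * k))) (trans (N*[k] b) (trans (trans (cong (Q *_) b≡) (scaled b₁))
      (trans (ring-80 β (ι z) (ι V′) (ι B′)) (sym (cong₂ (λ p q → β * p * q) (ι-* V′ z) (ι-* B′ z)))))))

    open Process {C = C} inc lin {λ′} {μ} {η} {β} {r} λ≡ 0≤η 0<μ μ≤1 λμ≡1 0≤β μ^≤ 1≤r
      ℓ ℓ′ d (D′ ℕ.* z) (V′ ℕ.* z) {N} {G} {H} {I} {λ′ ^ ℓ′} {μ ^ (D′ ℕ.* z)} {μ ^ (V′ ℕ.* z)}
      0≤G 0≤H 0≤I 1≤G (0≤^ ℓ′ (<⇒≤ 0<λ)) (0≤^ (D′ ℕ.* z) (<⇒≤ 0<μ)) (0≤^ (V′ ℕ.* z) (<⇒≤ 0<μ))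
      (1≤λ^μ^ ℓ′) (1≤μ^λ^ (D′ ℕ.* z)) (1≤μ^λ^ (V′ ℕ.* z))
      rateG rateH rateI weight<N

    inv₀ : Inv s₀
    inv₀ = record
      { A⊆U = λ e c p → proj₁ (proj₁ (proj₂ (sel e)) c p)
      ; rank = rank
      ; L≤ℓ = λ e → proj₁ (proj₂ (proj₂ (sel e)))
      ; X≤d = λ v c → ℕₚ.≤-trans (#-mono (λ e p → let q = proj₁ (proj₂ (sel e)) c (∧-snd {inc e v} p) in
          ∧-intro (∧-fst {inc e v} p) (∧-intro (proj₁ q) (proj₂ q)))) (colourDegree≤ v c) }

    -- The round lasts Yz units of K steps.
    M = Y ℕ.* z ℕ.* K

    tail≤ : ∀ θ t T → t ℕ.≤ T → tail θ t ≤ λ′ ^ T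
    tail≤ θ t T t≤T = ≤-trans (*-mono (0≤𝟙 (geq θ t)) (𝟙≤1 (geq θ t)) (0≤^ t (<⇒≤ 0<λ)) (^-monoʳ (RoundParameters.1≤λ params) t≤T)) (≤-reflexive (*-identityˡ (λ′ ^ T)))

    Φ₁≤ : Φ₁ s₀ ≤ ι m * μ ^ ℓ
    Φ₁≤ = ≤-trans (∑-mono each) (≤-reflexive (∑-const m (μ ^ ℓ)))
      where
      each : ∀ e → listWeight e s₀ ≤ μ ^ ℓ
      each e = go (bool (U e))
        where
        go : U e ≡ true ⊎ U e ≡ false → listWeight e s₀ ≤ μ ^ ℓ
        go (inj₁ p) = ≤-reflexive (trans (cong₂ (λ u t → 𝟙 u * μ ^ t) p (proj₂ (proj₂ (proj₂ (sel e))) p)) (*-identityˡ (μ ^ ℓ)))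
        go (inj₂ p) = ≤-trans (≤-reflexive (trans (cong (λ u → 𝟙 u * μ ^ lists s₀ e) p) (*-zeroˡ (μ ^ lists s₀ e)))) (0≤^ ℓ (<⇒≤ 0<μ))

    Φ₂≤ : Φ₂ s₀ ≤ ι n * ι C * λ′ ^ d
    Φ₂≤ = ≤-trans (∑-mono (λ v → ≤-trans (∑-mono (λ c → tail≤ (D′ ℕ.* z) (colourDegree s₀ v c) d (Inv.X≤d inv₀ v c))) (≤-reflexive (∑-const C (λ′ ^ d)))))
      (≤-reflexive (trans (∑-const n (ι C * λ′ ^ d)) (sym (*-assoc (ι n) (ι C) (λ′ ^ d)))))

    Φ₃≤ : Φ₃ s₀ ≤ ι n * λ′ ^ ((V′ ℕ.+ y) ℕ.* z)
    Φ₃≤ = ≤-trans (∑-mono (λ v → tail≤ (V′ ℕ.* z) (openDegree s₀ v) ((V′ ℕ.+ y) ℕ.* z) (openDegree≤ v))) (≤-reflexive (∑-const n (λ′ ^ ((V′ ℕ.+ y) ℕ.* z))))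

    -- The normalising power p^(Az) and the initial weight q^((A + w)z) of a summand combine to
    -- (q^w)^z, and the factor for the whole round is at most (v^Y)^z. The factor 3 lets three such
    -- parts add up to less than 1.
    third : ∀ {p q u e w Y v Ψ count} A → p * q ≡ 1ℚ → 0ℚ ≤ p → 0ℚ ≤ q → 0ℚ ≤ u → u ^ K ≤ v → 0ℚ ≤ v →
      0ℚ ≤ Ψ → Ψ ≤ count * q ^ ((A ℕ.+ w) ℕ.* z) → count ≤ ι P * (ι z * ι z) → e ≡ q ^ w * v ^ Y →
      ι 3 * ι P * (ι z * ι z) * e ^ z < 1ℚ → ι 3 * (p ^ (A ℕ.* z) * u ^ (Y ℕ.* z ℕ.* K) * Ψ) < 1ℚ
    third {p} {q} {u} {e} {w} {Y} {v} {Ψ} {count} A pq≡1 0≤p 0≤q 0≤u uK≤v 0≤v 0≤Ψ Ψ≤ count≤ e≡ lt = ≤-<-trans (begin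
      ι 3 * (p ^ (A ℕ.* z) * u ^ (Y ℕ.* z ℕ.* K) * Ψ) ≤⟨ *-monoʳ (0≤ι 3) (*-mono (0≤* (0≤^ (A ℕ.* z) 0≤p) (0≤^ (Y ℕ.* z ℕ.* K) 0≤u))
          (*-monoʳ (0≤^ (A ℕ.* z) 0≤p) (decay^ K Y z 0≤u uK≤v)) 0≤Ψ (≤-trans Ψ≤ (*-monoˡ (0≤^ ((A ℕ.+ w) ℕ.* z) 0≤q) count≤))) ⟩
      ι 3 * (p ^ (A ℕ.* z) * (v ^ Y) ^ z * (ι P * (ι z * ι z) * q ^ ((A ℕ.+ w) ℕ.* z)))
        ≡⟨ ring-81 (ι 3) (p ^ (A ℕ.* z)) ((v ^ Y) ^ z) (ι P) (ι z * ι z) (q ^ ((A ℕ.+ w) ℕ.* z)) ⟩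
      ι 3 * ι P * (ι z * ι z) * (p ^ (A ℕ.* z) * q ^ ((A ℕ.+ w) ℕ.* z) * (v ^ Y) ^ z)
        ≡⟨ cong (ι 3 * ι P * (ι z * ι z) *_) (trans (cong (_* (v ^ Y) ^ z) (ratio^ pq≡1 A w z)) (trans (sym (*-^ (q ^ w) (v ^ Y) z)) (cong (_^ z) (sym e≡)))) ⟩
      ι 3 * ι P * (ι z * ι z) * e ^ z ∎) lt
      where
      open ℚₚ.≤-Reasoning

    Φ₀<1 : Φ M s₀ < 1ℚ
    Φ₀<1 = *-cancel-< (0<ι 2) (≤-<-trans (≤-reflexive (ring-82 (λ′ ^ ℓ′ * G ^ M * Φ₁ s₀) (μ ^ (D′ ℕ.* z) * H ^ M * Φ₂ s₀) (μ ^ (V′ ℕ.* z) * I ^ M * Φ₃ s₀)))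
      (<-≤-trans (ℚₚ.+-mono-< t₁ (ℚₚ.+-mono-< t₂ t₃)) (≤-reflexive three)))
      where
      three : 1ℚ + (1ℚ + 1ℚ) ≡ ι 3 * 1ℚ
      three = refl
      t₁ = third {λ′} {μ} {G} {base₁} {w} {Y} {g} {Φ₁ s₀} {ι m} B′ λμ≡1 (<⇒≤ 0<λ) (<⇒≤ 0<μ) 0≤G
        (≤g (G ^ K) ([1+x/K]^K≤ K Kk≡1 0≤η 0≤k ηk≤1)) (<⇒≤ 0<g) (0≤Φ₁ s₀) Φ₁≤ m≤ refl lt₁
      t₂ = third {μ} {λ′} {H} {base₂} {x} {Y} {h} {Φ₂ s₀} {ι n * ι C} D′ μλ≡1 (<⇒≤ 0<μ) (<⇒≤ 0<λ) 0≤H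
        (≤h (H ^ K) ([1-x/K]^K≤ K Kk≡1 0≤a 0≤k ak≤1)) (<⇒≤ 0<h) (0≤Φ₂ s₀) Φ₂≤ nC≤ refl lt₂
      t₃ = third {μ} {λ′} {I} {base₃} {y} {Y} {i} {Φ₃ s₀} {ι n} V′ μλ≡1 (<⇒≤ 0<μ) (<⇒≤ 0<λ) 0≤I
        (≤i (I ^ K) ([1-x/K]^K≤ K Kk≡1 0≤b 0≤k bk≤1)) (<⇒≤ 0<i) (0≤Φ₃ s₀) Φ₃≤ n≤ refl lt₃

    finish : ∀ t → Post t → Solved t
    finish t p = next inc lin c₀ m≤ nC≤ n≤ t (record
      { rank = Post.rank p
      ; lists≥ = Post.ℓ′≤L p
      ; colourDegree≤ = λ v c → ℕₚ.≤-trans (#-mono (λ e q → ∧-intro (∧-fst {inc e v} q) (∧-snd {uncoloured t e} (∧-snd {inc e v} q)))) (ℕₚ.<⇒≤ (Post.X<θ p v c))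
      ; openDegree≤ = λ v → ℕₚ.<⇒≤ (Post.u<θ p v) })

    result : Colourable U (available s)
    result = weaken {U} {U} {available s₀} {available s} (λ _ p → p) (λ e c _ p → proj₂ (proj₁ (proj₂ (sel e)) c p)) (run finish M s₀ inv₀ Φ₀<1)

round : ∀ r B′ w Y D′ x V′ y → 1 ℕ.≤ r → 1 ℕ.≤ B′ ℕ.+ w → 1 ℕ.≤ D′ ℕ.+ x → RoundParameters r B′ w Y D′ x V′ y →
  Completable r B′ D′ V′ → Completable r (B′ ℕ.+ w) (D′ ℕ.+ x) (V′ ℕ.+ y)
round r B′ w Y D′ x V′ y 1≤r 1≤B 1≤D params next P = combine (next P)
  (geometric-beats-square (0<* (0<^ w 0<μ) (0<^ Y 0<g)) base₁<1 (ι 3 * ι P))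
  (geometric-beats-square (0<* (0<^ x 0<λ) (0<^ Y 0<h)) base₂<1 (ι 3 * ι P))
  (geometric-beats-square (0<* (0<^ y 0<λ) (0<^ Y 0<i)) base₃<1 (ι 3 * ι P))
  where
  open RoundParameters params
  combine : (Σ ℕ λ z₀ → ∀ z → z ≥ z₀ → CompletableAt r B′ D′ V′ P z) →
    (Σ ℕ λ z₀ → ∀ z → z ≥ z₀ → ι 3 * ι P * (ι z * ι z) * base₁ ^ z < 1ℚ) →
    (Σ ℕ λ z₀ → ∀ z → z ≥ z₀ → ι 3 * ι P * (ι z * ι z) * base₂ ^ z < 1ℚ) →
    (Σ ℕ λ z₀ → ∀ z → z ≥ z₀ → ι 3 * ι P * (ι z * ι z) * base₃ ^ z < 1ℚ) →
    Σ ℕ λ z₀ → ∀ z → z ≥ z₀ → CompletableAt r (B′ ℕ.+ w) (D′ ℕ.+ x) (V′ ℕ.+ y) P z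
  combine (z₁ , f₁) (z₂ , f₂) (z₃ , f₃) (z₄ , f₄) = suc (z₁ ℕ.+ (z₂ ℕ.+ (z₃ ℕ.+ z₄))) , at
    where
    at : ∀ z → z ≥ suc (z₁ ℕ.+ (z₂ ℕ.+ (z₃ ℕ.+ z₄))) → CompletableAt r (B′ ℕ.+ w) (D′ ℕ.+ x) (V′ ℕ.+ y) P z
    at z z≥ {n} {m} {C} inc lin c₀ m≤ nC≤ n≤ s pre = discretise (archimedean a) (archimedean b)
      where
      z≥₀ = ℕₚ.≤-trans (ℕₚ.n≤1+n (z₁ ℕ.+ (z₂ ℕ.+ (z₃ ℕ.+ z₄)))) z≥
      z≥₂ = ℕₚ.≤-trans (ℕₚ.m≤n+m (z₂ ℕ.+ (z₃ ℕ.+ z₄)) z₁) z≥₀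
      z≥₃ = ℕₚ.≤-trans (ℕₚ.m≤n+m (z₃ ℕ.+ z₄) z₂) z≥₂
      k₀ = m ℕ.* (C ℕ.* (1 ℕ.+ r ℕ.* ((D′ ℕ.+ x) ℕ.* z)))
      -- `K` must exceed the total weight of all moves, and also `a` and `b`, so that 1 - a/K and 1
      -- - b/K are nonnegative factors.
      discretise : (Σ ℕ λ k → a ≤ ι k) → (Σ ℕ λ k → b ≤ ι k) →
        ListColouring.Colourable (Incidence.adj inc) (Incidence.adj-sym inc) (Nibble.State.uncoloured s) (Nibble.State.available s)
      discretise (ka , a≤) (kb , b≤) = split (recip (0<ι (k₀ ℕ.+ (ka ℕ.+ kb))))
        where
        split : (Σ ℚ λ k → (0ℚ < k) × (ι (suc (k₀ ℕ.+ (ka ℕ.+ kb))) * k ≡ 1ℚ)) →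
          ListColouring.Colourable (Incidence.adj inc) (Incidence.adj-sym inc) (Nibble.State.uncoloured s) (Nibble.State.available s)
        split (k , 0<k , Kk≡1) = RoundAt.result r B′ w Y D′ x V′ y 1≤r 1≤B 1≤D params P z (ℕₚ.≤-trans (s≤s z≤n) z≥)
          (f₂ z (ℕₚ.≤-trans (ℕₚ.m≤m+n z₂ (z₃ ℕ.+ z₄)) z≥₂)) (f₃ z (ℕₚ.≤-trans (ℕₚ.m≤m+n z₃ z₄) z≥₃)) (f₄ z (ℕₚ.≤-trans (ℕₚ.m≤n+m z₄ z₃) z≥₃))
          (f₁ z (ℕₚ.≤-trans (ℕₚ.m≤m+n z₁ (z₂ ℕ.+ (z₃ ℕ.+ z₄))) z≥₀))
          inc lin c₀ m≤ nC≤ n≤ s pre (suc (k₀ ℕ.+ (ka ℕ.+ kb))) (s≤s (ℕₚ.m≤m+n k₀ (ka ℕ.+ kb)))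
          (≤-trans a≤ (ι-mono (ℕₚ.≤-trans (ℕₚ.≤-trans (ℕₚ.m≤m+n ka kb) (ℕₚ.m≤n+m (ka ℕ.+ kb) k₀)) (ℕₚ.n≤1+n (k₀ ℕ.+ (ka ℕ.+ kb))))))
          (≤-trans b≤ (ι-mono (ℕₚ.≤-trans (ℕₚ.≤-trans (ℕₚ.m≤n+m kb ka) (ℕₚ.m≤n+m (ka ℕ.+ kb) k₀)) (ℕₚ.n≤1+n (k₀ ℕ.+ (ka ℕ.+ kb))))))
          k (<⇒≤ 0<k) Kk≡1

-- Iterating the rounds

completable-mono : ∀ {r B D V B₁ D₁ V₁} → B₁ ℕ.≤ B → D ℕ.≤ D₁ → V ℕ.≤ V₁ → Completable r B₁ D₁ V₁ → Completable r B D V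
completable-mono {r} {B} {D} {V} {B₁} {D₁} {V₁} B≤ D≤ V≤ comp P = proj₁ (comp P) , λ z z≥ inc lin c₀ m≤ nC≤ n≤ s pre → proj₂ (comp P) z z≥ inc lin c₀ m≤ nC≤ n≤ s (record
  { rank = Pre.rank pre
  ; lists≥ = λ e p → ℕₚ.≤-trans (ℕₚ.*-monoˡ-≤ z B≤) (Pre.lists≥ pre e p)
  ; colourDegree≤ = λ v c → ℕₚ.≤-trans (Pre.colourDegree≤ pre v c) (ℕₚ.*-monoˡ-≤ z D≤)
  ; openDegree≤ = λ v → ℕₚ.≤-trans (Pre.openDegree≤ pre v) (ℕₚ.*-monoˡ-≤ z V≤) })

-- Passing to the scale y = z/t, rounded down, allows fractions of z. From z ≤ t + yt one gets Dz ≤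
-- tD + tDy, and one additional unit y absorbs tD once z is large; the same holds for V. For the
-- lists, rounding goes the right way. As z ≤ 2ty, the constant `P` grows by (2t)².
refine : ∀ {r B D V} t → 1 ℕ.≤ t → Completable r (t ℕ.* B) (suc (t ℕ.* D)) (suc (t ℕ.* V)) → Completable r B D V
refine {r} {B} {D} {V} (suc t′) _ comp P = z₀ , at
  where
  t = suc t′
  P′ = P ℕ.* ((2 ℕ.* t) ℕ.* (2 ℕ.* t))
  y₀ = suc (proj₁ (comp P′) ℕ.+ (t ℕ.* D ℕ.+ t ℕ.* V))
  z₀ = y₀ ℕ.* t
  at : ∀ z → z ≥ z₀ → CompletableAt r B D V P z
  at z z≥ inc lin c₀ m≤ nC≤ n≤ s pre = proj₂ (comp P′) y y≥comp inc lin c₀ (widen m≤) (widen nC≤) (widen n≤) s (record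
    { rank = Pre.rank pre
    ; lists≥ = λ e p → ℕₚ.≤-trans (ℕₚ.≤-trans (ℕₚ.≤-reflexive (ring-n3 t B y)) (ℕₚ.*-monoʳ-≤ B ty≤z)) (Pre.lists≥ pre e p)
    ; colourDegree≤ = λ v c → ℕₚ.≤-trans (Pre.colourDegree≤ pre v c) (absorb D y≥D)
    ; openDegree≤ = λ v → ℕₚ.≤-trans (Pre.openDegree≤ pre v) (absorb V y≥V) })
    where
    y = z ℕ-DivMod./ t
    ty≤z : y ℕ.* t ℕ.≤ z
    ty≤z = ℕ-DivMod.m/n*n≤m z t
    z≤ : z ℕ.≤ t ℕ.+ y ℕ.* t
    z≤ = ℕₚ.≤-trans (ℕₚ.≤-reflexive (ℕ-DivMod.m≡m%n+[m/n]*n z t)) (ℕₚ.+-monoˡ-≤ (y ℕ.* t) (ℕₚ.<⇒≤ (ℕ-DivMod.m%n<n z t)))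
    y≥ : y₀ ℕ.≤ y
    y≥ = ℕₚ.≤-trans (ℕₚ.≤-reflexive (sym (ℕ-DivMod.m*n/n≡m y₀ t))) (ℕ-DivMod./-monoˡ-≤ t z≥)
    y≥comp : proj₁ (comp P′) ℕ.≤ y
    y≥comp = ℕₚ.≤-trans (ℕₚ.≤-trans (ℕₚ.m≤m+n (proj₁ (comp P′)) (t ℕ.* D ℕ.+ t ℕ.* V)) (ℕₚ.n≤1+n _)) y≥
    y≥DV : t ℕ.* D ℕ.+ t ℕ.* V ℕ.≤ y
    y≥DV = ℕₚ.≤-trans (ℕₚ.≤-trans (ℕₚ.m≤n+m (t ℕ.* D ℕ.+ t ℕ.* V) (proj₁ (comp P′))) (ℕₚ.n≤1+n _)) y≥
    y≥D = ℕₚ.≤-trans (ℕₚ.m≤m+n (t ℕ.* D) (t ℕ.* V)) y≥DV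
    y≥V = ℕₚ.≤-trans (ℕₚ.m≤n+m (t ℕ.* V) (t ℕ.* D)) y≥DV
    absorb : ∀ D → t ℕ.* D ℕ.≤ y → D ℕ.* z ℕ.≤ suc (t ℕ.* D) ℕ.* y
    absorb D tD≤y = ℕₚ.≤-trans (ℕₚ.*-monoʳ-≤ D z≤) (ℕₚ.≤-trans (ℕₚ.≤-reflexive (ring-n1 D t y)) (ℕₚ.+-monoˡ-≤ (t ℕ.* D ℕ.* y) tD≤y))
    z≤2ty : z ℕ.≤ 2 ℕ.* t ℕ.* y
    z≤2ty = ℕₚ.≤-trans z≤ (ℕₚ.≤-trans (ℕₚ.+-monoˡ-≤ (y ℕ.* t) (ℕₚ.≤-trans (ℕₚ.≤-reflexive (sym (ℕₚ.*-identityˡ t))) (ℕₚ.*-monoˡ-≤ t (ℕₚ.≤-trans (s≤s z≤n) y≥))))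
      (ℕₚ.≤-reflexive (ring-n2 t y)))
    widen : ∀ {q} → q ≤ ι P * (ι z * ι z) → q ≤ ι P′ * (ι y * ι y)
    widen q≤ = ≤-trans q≤ (≤-trans (*-monoʳ (0≤ι P) (*-mono (0≤ι z) (ι-mono z≤2ty) (0≤ι z) (ι-mono z≤2ty)))
      (≤-reflexive (trans (cong (ι P *_) (cong₂ _*_ (ι-* (2 ℕ.* t) y) (ι-* (2 ℕ.* t) y)))
        (trans (ring-83 (ι P) (ι (2 ℕ.* t)) (ι y)) (cong (_* (ι y * ι y)) (sym (trans (ι-* P ((2 ℕ.* t) ℕ.* (2 ℕ.* t))) (cong (ι P *_) (ι-* (2 ℕ.* t) (2 ℕ.* t)))))))))) 

-- Greedy completion

module _ {n m} (inc : Fin m → Fin n → Bool) where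
  open Incidence inc
  open ListColouring {m} {0} adj adj-sym using (deg; nbr)

  deg≤ : ∀ U e → deg U e ≤ ∑ (λ v → 𝟙 (inc e v) * ι (# (λ f → inc f v ∧ U f)))
  deg≤ U e = begin
    ∑ (λ f → 𝟙 (nbr U e f)) ≤⟨ ∑-mono pt ⟩
    ∑ (λ f → ∑ (λ v → 𝟙 (inc e v) * 𝟙 (inc f v ∧ U f))) ≡⟨ ∑-swap (λ f v → 𝟙 (inc e v) * 𝟙 (inc f v ∧ U f)) ⟩
    ∑ (λ v → ∑ (λ f → 𝟙 (inc e v) * 𝟙 (inc f v ∧ U f))) ≡⟨ ∑-cong (λ v → trans (∑-*ˡ (𝟙 (inc e v)) (λ f → 𝟙 (inc f v ∧ U f)))
        (cong (𝟙 (inc e v) *_) (sym (ι# (λ f → inc f v ∧ U f))))) ⟩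
    ∑ (λ v → 𝟙 (inc e v) * ι (# (λ f → inc f v ∧ U f))) ∎
    where
    open ℚₚ.≤-Reasoning
    pt : ∀ f → 𝟙 (nbr U e f) ≤ ∑ (λ v → 𝟙 (inc e v) * 𝟙 (inc f v ∧ U f))
    pt f with bool (nbr U e f)
    ... | inj₂ q = ≤-trans (≤-reflexive (cong 𝟙 q)) (0≤∑ (λ v → 0≤* (0≤𝟙 (inc e v)) (0≤𝟙 (inc f v ∧ U f))))
    ... | inj₁ q with adj-elim e f (∧-snd {not (f == e)} (∧-snd {U f} q))
    ...   | v , ev , fv = ≤-trans (≤-reflexive (trans (cong 𝟙 q) (sym (cong₂ _*_ (cong 𝟙 ev) (cong 𝟙 (∧-intro fv (∧-fst {U f} q)))))))
      (term≤∑ (λ v → 0≤* (0≤𝟙 (inc e v)) (0≤𝟙 (inc f v ∧ U f))) v)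

  deg≤size* : ∀ U e d → (∀ v → # (λ f → inc f v ∧ U f) ℕ.≤ d) → deg U e ≤ ι (size e) * ι d
  deg≤size* U e d h = ≤-trans (deg≤ U e) (≤-trans (∑-mono (λ v → *-monoʳ (0≤𝟙 (inc e v)) (ι-mono (h v))))
    (≤-reflexive (trans (∑-*ʳ (ι d) (λ v → 𝟙 (inc e v))) (cong (_* ι d) (sym (ι# (inc e)))))))

-- An open edge meets at most r · Vz open edges, fewer than the Bz colours in its list. This is the
-- goal of all rounds.
completable-greedy : ∀ {r B D V} → r ℕ.* V ℕ.< B → Completable r B D V
completable-greedy {r} {B} {D} {V} rV<B P = 1 , at
  where
  at : ∀ z → z ≥ 1 → CompletableAt r B D V P z
  at z 1≤z {n} {m} {C} inc lin c₀ _ _ _ s pre = greedy c₀ small-degree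
    where
    open Incidence inc
    open ListColouring {m} {C} adj adj-sym
    open Nibble {C = C} inc lin
    small-degree : ∀ e → uncoloured s e ≡ true → deg (uncoloured s) e < ∑ (𝟙 ∘ available s e)
    small-degree e Ue = begin-strict
      deg (uncoloured s) e ≤⟨ deg≤size* inc (uncoloured s) e (V ℕ.* z) (Pre.openDegree≤ pre) ⟩
      ι (size e) * ι (V ℕ.* z) ≤⟨ *-monoˡ (0≤ι (V ℕ.* z)) (ι-mono (Pre.rank pre e Ue)) ⟩
      ι r * ι (V ℕ.* z) ≡⟨ trans (sym (ι-* r (V ℕ.* z))) (cong ι (sym (ℕₚ.*-assoc r V z))) ⟩
      ι (r ℕ.* V ℕ.* z) <⟨ ι-mono-< (ℕₚ.*-monoˡ-< z {{ℕ.>-nonZero 1≤z}} rV<B) ⟩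
      ι (B ℕ.* z) ≤⟨ ι-mono (Pre.lists≥ pre e Ue) ⟩
      ι (lists s e) ≡⟨ ι# (available s e) ⟩
      ∑ (𝟙 ∘ available s e) ∎
      where open ℚₚ.≤-Reasoning

-- The step i/S → (i-1)/S of the ratio D/B in the first phase, for q = 16rc, S = 2rcq and i = k + 1.
ratio-gap : ∀ {r c k q S} → 1ℚ ≤ r → 1ℚ ≤ c → ι 3 ≤ k → q ≡ ι 16 * (r * c) → S ≡ ι 2 * (r * c) * q →
  c * (k + 1ℚ) ≤ (c - 1ℚ) * S →
  (q + k + 1ℚ) * (S * q * r * (q * (k + 1ℚ) + 1ℚ)) <
  (S - 1ℚ) * (k * (q - 1ℚ) * (S * (q - 1ℚ) + r * (q * (k + 1ℚ) + 1ℚ) - (q * (k + 1ℚ) + 1ℚ)))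
ratio-gap {r} {c} {k} {q} {S} 1≤r 1≤c 3≤k q≡ S≡ room = begin-strict
  (q + k + 1ℚ) * (S * q * r * (q * (k + 1ℚ) + 1ℚ)) <⟨ <-by (S * q * r * E) (ring-92 q k S r) (0<* (0<* (0<* 0<S 0<q) 0<r) 0<E) ⟩
  S * q * r * (q * k * (ι 2 * q + (k + 1ℚ)) - k * (ι 2 * S + q)) ≡⟨ ring-93 S q r k ⟩
  q * (k * (S * q * (r * (ι 2 * q + (k + 1ℚ)))) - k * (ι 2 * S + q) * (r * S)) ≤⟨ *-monoʳ (<⇒≤ 0<q) (-mono (*-monoʳ 0≤k (*-monoʳ (0≤* (<⇒≤ 0<S) (<⇒≤ 0<q)) A≥))
      (*-monoʳ (0≤* 0≤k (0≤+ (0≤* (0≤ι 2) (<⇒≤ 0<S)) (<⇒≤ 0<q))) A≤)) ⟩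
  q * (k * (S * q * A) - k * (ι 2 * S + q) * A) ≤⟨ ≤-by (k * A * (S + q + (q - 1ℚ))) (ring-94 q k S A) (0≤* (0≤* 0≤k 0≤A) (0≤+ (0≤+ (<⇒≤ 0<S) (<⇒≤ 0<q)) 0≤q-1)) ⟩
  (S - 1ℚ) * (k * (q - 1ℚ) * ((q - 1ℚ) * A)) ≤⟨ ≤-by ((S - 1ℚ) * (k * (q - 1ℚ) * ((r - 1ℚ) * (k + 1ℚ + 1ℚ)))) (ring-95 S k q r)
      (0≤* 0≤S-1 (0≤* (0≤* 0≤k 0≤q-1) (0≤* (0≤- 1≤r) (0≤+ (0≤+ 0≤k 0≤1) 0≤1)))) ⟩
  (S - 1ℚ) * (k * (q - 1ℚ) * (S * (q - 1ℚ) + r * (q * (k + 1ℚ) + 1ℚ) - (q * (k + 1ℚ) + 1ℚ))) ∎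
  where
  open ℚₚ.≤-Reasoning
  0<r = <-≤-trans 0<1 1≤r
  0<c = <-≤-trans 0<1 1≤c
  0≤k = ≤-trans (0≤ι 3) 3≤k
  1≤rc : 1ℚ ≤ r * c
  1≤rc = *-mono 0≤1 1≤r 0≤1 1≤c
  16≤q : ι 16 ≤ q
  16≤q = ≤-trans (≤-reflexive (sym (*-identityʳ (ι 16)))) (≤-trans (*-monoʳ (0≤ι 16) 1≤rc) (≤-reflexive (sym q≡)))
  1≤q : 1ℚ ≤ q
  1≤q = ≤-trans (ι-mono {1} {16} (s≤s z≤n)) 16≤q
  0≤q-1 = 0≤- 1≤q
  0<q = <-≤-trans 0<1 1≤q
  -- q² = 8S
  8S≡ : ι 8 * S ≡ q * q
  8S≡ = trans (cong (ι 8 *_) S≡) (trans (ring-85 (r * c) q) (cong (_* q) (sym q≡)))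
  1≤S : 1ℚ ≤ S
  1≤S = ≤-trans (*-mono 0≤1 (≤-trans (ι-mono {1} {2} (s≤s z≤n)) (≤-trans (≤-reflexive (sym (*-identityʳ (ι 2)))) (*-monoʳ (0≤ι 2) 1≤rc))) 0≤1 1≤q) (≤-reflexive (sym S≡))
  0≤S-1 = 0≤- 1≤S
  0<S = <-≤-trans 0<1 1≤S
  -- (q - 1)A is the rate factor B′ + rD - D without its small remainder (r - 1)(k + 2). Since S/c =
  -- 2rq, `room` says k + 1 ≤ S - 2rq, and this bounds A from below by r(2q + k + 1).
  A = S + (r - 1ℚ) * (k + 1ℚ)
  0≤A : 0ℚ ≤ A
  0≤A = 0≤+ (<⇒≤ 0<S) (0≤* (0≤- 1≤r) (0≤+ 0≤k 0≤1))
  j≤S-2rq : k + 1ℚ ≤ S - ι 2 * r * q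
  j≤S-2rq = *-cancel-≤ 0<c (≤-trans room (≤-reflexive (trans (ring-86 c S) (trans (cong (λ t → c * S - t) S≡) (ring-87 c S r q)))))
  A≥ : r * (ι 2 * q + (k + 1ℚ)) ≤ A
  A≥ = ≤-by ((S - ι 2 * r * q) - (k + 1ℚ)) (ring-88 S r q (k + 1ℚ)) (0≤- j≤S-2rq)
  A≤ : A ≤ r * S
  A≤ = ≤-by ((r - 1ℚ) * (((S - ι 2 * r * q) - (k + 1ℚ)) + ι 2 * r * q)) (ring-89 S r q (k + 1ℚ)) (0≤* (0≤- 1≤r) (0≤+ (0≤- j≤S-2rq) (0≤* (0≤* (0≤ι 2) (<⇒≤ 0<r)) (<⇒≤ 0<q))))
  -- After removal of the factor S q r this is the margin. Four times it, with 8S replaced by q², is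
  -- a sum of terms whose signs are clear from q ≥ 16 and k ≥ 3.
  E = (q * k * (ι 2 * q + (k + 1ℚ)) - k * (ι 2 * S + q)) - (q + k + 1ℚ) * (q * (k + 1ℚ) + 1ℚ)
  0<E : 0ℚ < E
  0<E = *-cancel-< (0<ι 3) (≤-<-trans (≤-reflexive (*-zeroʳ (ι 4))) (<-≤-trans
      (0<+ (0<+ (0<* 0<q (0<+ (0<+ 0<q (0≤ι 31)) (0≤* (0≤ι 4) (0≤- 16≤q)))) (0≤- 16≤q))
        (0≤* (0≤- 3≤k) (0≤+ (0≤* (<⇒≤ 0<q) (0≤+ (0≤* (0≤ι 2) (0≤- 16≤q)) (0≤+ (<⇒≤ 0<q) (0≤ι 23)))) (0≤+ (0≤- 16≤q) (0≤ι 12)))))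
      (≤-reflexive (sym eq))))
    where
    eq : ι 4 * E ≡ q * (q + ι 31 + ι 4 * (q - ι 16)) + (q - ι 16) + (k - ι 3) * (q * (ι 2 * (q - ι 16) + (q + ι 23)) + ((q - ι 16) + ι 12))
    eq = trans (ring-90 q k S) (trans (cong (λ t → (q * (q + ι 31 + ι 4 * (q - ι 16)) + (q - ι 16) + (k - ι 3) * (q * (ι 2 * (q - ι 16) + (q + ι 23)) + ((q - ι 16) + ι 12))) + k * (q * q - t)) 8S≡)
      (ring-84 (q * (q + ι 31 + ι 4 * (q - ι 16)) + (q - ι 16) + (k - ι 3) * (q * (ι 2 * (q - ι 16) + (q + ι 23)) + ((q - ι 16) + ι 12))) k (q * q)))
  -mono : ∀ {a b c d} → a ≤ b → d ≤ c → a - c ≤ b - d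
  -mono {a} {b} {c} {d} p q = ≤-by ((b - a) + (c - d)) (ring-91 a b c d) (0≤+ (0≤- p) (0≤- q))

-- A round whose parameters are multiples of a common unit h; only the ratios matter.
scaled-round : ∀ {B D V} t h r b w Y d x v y → 1 ℕ.≤ t → 1 ℕ.≤ h → 1 ℕ.≤ r → 1 ℕ.≤ b ℕ.+ w → 1 ℕ.≤ d ℕ.+ x → Y ℕ.< w →
  ι x * ((ι b + ι w) * ι r * (ι d + ι x)) < ι Y * (ι d * (ι b + ι r * (ι d + ι x) - (ι d + ι x))) →
  ι y * ((ι b + ι w) * ι r * (ι d + ι x)) < ι Y * (ι v * ι b) →
  (b ℕ.+ w) ℕ.* h ℕ.≤ t ℕ.* B → suc (t ℕ.* D) ℕ.≤ (d ℕ.+ x) ℕ.* h → suc (t ℕ.* V) ℕ.≤ (v ℕ.+ y) ℕ.* h →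
  Completable r (b ℕ.* h) (d ℕ.* h) (v ℕ.* h) → Completable r B D V
scaled-round {B} {D} {V} t h r b w Y d x v y 1≤t 1≤h 1≤r 1≤B 1≤D Y<w gap₁ gap₂ B≤ D≤ V≤ next =
  refine t 1≤t (completable-mono (≤-resp b w B≤) (resp-≤ d x D≤) (resp-≤ v y V≤)
    (round r (b ℕ.* h) (w ℕ.* h) (Y ℕ.* h) (d ℕ.* h) (x ℕ.* h) (v ℕ.* h) (y ℕ.* h) 1≤r (big b w 1≤B) (big d x 1≤D) params next))
  where
  0<h = 0<ι⁺ 1≤h
  ≤-resp : ∀ b w {N} → (b ℕ.+ w) ℕ.* h ℕ.≤ N → b ℕ.* h ℕ.+ w ℕ.* h ℕ.≤ N
  ≤-resp b w = ℕₚ.≤-trans (ℕₚ.≤-reflexive (sym (ℕₚ.*-distribʳ-+ h b w)))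
  resp-≤ : ∀ b w {N} → N ℕ.≤ (b ℕ.+ w) ℕ.* h → N ℕ.≤ b ℕ.* h ℕ.+ w ℕ.* h
  resp-≤ b w p = ℕₚ.≤-trans p (ℕₚ.≤-reflexive (ℕₚ.*-distribʳ-+ h b w))
  big : ∀ b w → 1 ℕ.≤ b ℕ.+ w → 1 ℕ.≤ b ℕ.* h ℕ.+ w ℕ.* h
  big b w p = resp-≤ b w (ℕₚ.*-mono-≤ p 1≤h)
  ι+ : ∀ b w → ι (b ℕ.* h ℕ.+ w ℕ.* h) ≡ (ι b + ι w) * ι h
  ι+ b w = trans (ι-+ (b ℕ.* h) (w ℕ.* h)) (trans (cong₂ _+_ (ι-* b h) (ι-* w h)) (sym (*-distribʳ-+ (ι h) (ι b) (ι w))))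
  H = ι h * (ι h * ι h)
  0<H : 0ℚ < H
  0<H = 0<* 0<h (0<* 0<h 0<h)
  params : RoundParameters r (b ℕ.* h) (w ℕ.* h) (Y ℕ.* h) (d ℕ.* h) (x ℕ.* h) (v ℕ.* h) (y ℕ.* h)
  params = roundParameters r (b ℕ.* h) (w ℕ.* h) (Y ℕ.* h) (d ℕ.* h) (x ℕ.* h) (v ℕ.* h) (y ℕ.* h) 1≤r (big b w 1≤B) (big d x 1≤D)
    (ℕₚ.*-monoˡ-< h {{ℕ.>-nonZero 1≤h}} Y<w)
    (≤-<-trans (≤-reflexive (lhs x)) (<-≤-trans (*-mono-< 0<H gap₁) (≤-reflexive (sym rhs₁))))
    (≤-<-trans (≤-reflexive (lhs y)) (<-≤-trans (*-mono-< 0<H gap₂) (≤-reflexive (sym rhs₂))))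
    where
    lhs : ∀ x′ → ι (x′ ℕ.* h) * (ι (b ℕ.* h ℕ.+ w ℕ.* h) * ι r * ι (d ℕ.* h ℕ.+ x ℕ.* h)) ≡ H * (ι x′ * ((ι b + ι w) * ι r * (ι d + ι x)))
    lhs x′ = trans (cong₂ _*_ (ι-* x′ h) (cong₂ (λ p q → p * ι r * q) (ι+ b w) (ι+ d x))) (ring-96 (ι x′) (ι h) (ι b + ι w) (ι r) (ι d + ι x))
    rhs₁ : ι (Y ℕ.* h) * (ι (d ℕ.* h) * (ι (b ℕ.* h) + ι r * ι (d ℕ.* h ℕ.+ x ℕ.* h) - ι (d ℕ.* h ℕ.+ x ℕ.* h))) ≡
      H * (ι Y * (ι d * (ι b + ι r * (ι d + ι x) - (ι d + ι x))))
    rhs₁ = trans (cong₂ _*_ (ι-* Y h) (cong₂ _*_ (ι-* d h) (cong₂ (λ p q → p + ι r * q - q) (ι-* b h) (ι+ d x))))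
      (ring-97 (ι Y) (ι h) (ι d) (ι b) (ι r) (ι d + ι x))
    rhs₂ : ι (Y ℕ.* h) * (ι (v ℕ.* h) * ι (b ℕ.* h)) ≡ H * (ι Y * (ι v * ι b))
    rhs₂ = trans (cong₂ _*_ (ι-* Y h) (cong₂ _*_ (ι-* v h) (ι-* b h))) (ring-98 (ι Y) (ι h) (ι v) (ι b))

-- Second phase: with D/B ≤ 1/2r fixed, each round takes 30rV/B from i + 1 to i.
second-phase : ∀ i r B D V → 1 ℕ.≤ r → 1 ℕ.≤ B → D ℕ.* (r ℕ.* 2) ℕ.≤ B → V ℕ.* (r ℕ.* 30) ℕ.≤ B ℕ.* (29 ℕ.+ i) → Completable r B D V
-- 30rV ≤ 29B leaves rV < B, and greedy colouring finishes.
second-phase zero r B D V 1≤r 1≤B _ V≤ = completable-greedy (ℕₚ.*-cancelʳ-< 30 (r ℕ.* V) B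
  (ℕₚ.≤-<-trans (ℕₚ.≤-reflexive (ring-n20 r V)) (ℕₚ.≤-<-trans V≤ (ℕₚ.*-monoʳ-< B {{ℕ.>-nonZero 1≤B}} (ℕₚ.≤-refl {30})))))
second-phase (suc i) r B D V 1≤r 1≤B D≤ V≤ =
  -- Lists go from 300r to 270r, colour degrees from 151 to 135 and open degrees from 10I + 11 to
  -- 9I. Exact values at the start would be 150 and 10(I + 1); the additional 1 pays for rounding.
  -- So D/B stays at 1/2r, while 30rV/B falls from I + 1 to I.
  scaled-round (r ℕ.* 300) B r (r ℕ.* 270) (r ℕ.* 30) (r ℕ.* 29) 135 16 (I ℕ.* 9) (I ℕ.+ 11)
    (r* 300 (s≤s z≤n)) 1≤B 1≤r (ℕₚ.≤-trans (r* 270 (s≤s z≤n)) (ℕₚ.m≤m+n (r ℕ.* 270) (r ℕ.* 30))) (s≤s z≤n)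
    (ℕₚ.*-monoʳ-< r {{ℕ.>-nonZero 1≤r}} (ℕₚ.≤-refl {30})) gap₁ gap₂
    (ℕₚ.≤-reflexive (ring-n21 r B)) boundD boundV
    (second-phase i r (r ℕ.* 270 ℕ.* B) (135 ℕ.* B) (I ℕ.* 9 ℕ.* B) 1≤r (ℕₚ.*-mono-≤ (r* 270 (s≤s z≤n)) 1≤B)
      (ℕₚ.≤-reflexive (ring-n22 r B)) (ℕₚ.≤-reflexive (ring-n23 r I B)))
  where
  I = 29 ℕ.+ i
  r* : ∀ k → 1 ℕ.≤ k → 1 ℕ.≤ r ℕ.* k
  r* k 1≤k = ℕₚ.*-mono-≤ 1≤r 1≤k
  boundD : suc (r ℕ.* 300 ℕ.* D) ℕ.≤ 151 ℕ.* B
  boundD = ℕₚ.≤-trans (ℕₚ.+-mono-≤ 1≤B (ℕₚ.≤-trans (ℕₚ.≤-reflexive (ring-n12 r D)) (ℕₚ.*-monoˡ-≤ 150 D≤))) (ℕₚ.≤-reflexive (ring-n13 B))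
  boundV : suc (r ℕ.* 300 ℕ.* V) ℕ.≤ (I ℕ.* 9 ℕ.+ (I ℕ.+ 11)) ℕ.* B
  boundV = ℕₚ.≤-trans (ℕₚ.+-mono-≤ 1≤B (ℕₚ.≤-trans (ℕₚ.≤-reflexive (ring-n14 r V)) (ℕₚ.*-monoˡ-≤ 10 (ℕₚ.≤-trans V≤ (ℕₚ.≤-reflexive (cong (B ℕ.*_) (ℕₚ.+-suc 29 i))))))) (ℕₚ.≤-reflexive (ring-n15 I B))
  ι-lhs : ∀ y → ι (y ℕ.* ((r ℕ.* 270 ℕ.+ r ℕ.* 30) ℕ.* r ℕ.* (135 ℕ.+ 16))) ≡ ι y * ((ι (r ℕ.* 270) + ι (r ℕ.* 30)) * ι r * (ι 135 + ι 16))
  ι-lhs y = trans (ι-* y ((r ℕ.* 270 ℕ.+ r ℕ.* 30) ℕ.* r ℕ.* (135 ℕ.+ 16))) (cong (ι y *_) (trans (ι-* ((r ℕ.* 270 ℕ.+ r ℕ.* 30) ℕ.* r) (135 ℕ.+ 16))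
    (cong₂ _*_ (trans (ι-* (r ℕ.* 270 ℕ.+ r ℕ.* 30) r) (cong (_* ι r) (ι-+ (r ℕ.* 270) (r ℕ.* 30)))) (ι-+ 135 16))))
  ι-rhs : ∀ v → ι (r ℕ.* 29 ℕ.* (v ℕ.* (r ℕ.* 270))) ≡ ι (r ℕ.* 29) * (ι v * ι (r ℕ.* 270))
  ι-rhs v = trans (ι-* (r ℕ.* 29) (v ℕ.* (r ℕ.* 270))) (cong (ι (r ℕ.* 29) *_) (ι-* v (r ℕ.* 270)))
  instance
    r²≢0 : ℕ.NonZero (r ℕ.* r)
    r²≢0 = ℕ.>-nonZero (ℕₚ.*-mono-≤ 1≤r 1≤r)
  compare : ∀ {p q} → p ℕ.< q → r ℕ.* r ℕ.* p ℕ.< r ℕ.* r ℕ.* q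
  compare = ℕₚ.*-monoʳ-< (r ℕ.* r)
  gap₁ : ι 16 * ((ι (r ℕ.* 270) + ι (r ℕ.* 30)) * ι r * (ι 135 + ι 16)) < ι (r ℕ.* 29) * (ι 135 * (ι (r ℕ.* 270) + ι r * (ι 135 + ι 16) - (ι 135 + ι 16)))
  gap₁ = <-≤-trans (subst₂ _<_ (ι-lhs 16) (ι-rhs 135) (ι-mono-< (subst₂ ℕ._<_ (ring-n16 r) (ring-n17 r) (compare (ℕₚ.<ᵇ⇒< 724800 1057050 tt)))))
    (*-monoʳ (0≤ι (r ℕ.* 29)) (*-monoʳ (0≤ι 135) (≤-by {ι (r ℕ.* 270)} ((ι r - 1ℚ) * (ι 135 + ι 16)) (ring-99 (ι (r ℕ.* 270)) (ι r) (ι 135 + ι 16)) (0≤* (0≤- (ι-mono 1≤r)) (0≤+ (0≤ι 135) (0≤ι 16))))))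
  gap₂ : ι (I ℕ.+ 11) * ((ι (r ℕ.* 270) + ι (r ℕ.* 30)) * ι r * (ι 135 + ι 16)) < ι (r ℕ.* 29) * (ι (I ℕ.* 9) * ι (r ℕ.* 270))
  gap₂ = subst₂ _<_ (ι-lhs (I ℕ.+ 11)) (ι-rhs (I ℕ.* 9)) (ι-mono-< (subst₂ ℕ._<_ (sym (ring-n18 r i)) (sym (ring-n19 r i)) (compare
      (ℕₚ.+-mono-≤-< (ℕₚ.*-monoʳ-≤ i (ℕₚ.≤ᵇ⇒≤ 45300 70470 tt)) (ℕₚ.<ᵇ⇒< 1812000 2043630 tt)))))

-- The number of rounds may be any constant, so i = 30rV is taken, for which the bound on V is
-- immediate.
second-phase′ : ∀ r B D V → 1 ℕ.≤ r → 1 ℕ.≤ B → D ℕ.* (r ℕ.* 2) ℕ.≤ B → Completable r B D V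
second-phase′ r B D V 1≤r 1≤B D≤ = second-phase (V ℕ.* (r ℕ.* 30)) r B D V 1≤r 1≤B D≤
  (ℕₚ.≤-trans (ℕₚ.≤-reflexive (sym (ℕₚ.*-identityˡ (V ℕ.* (r ℕ.* 30))))) (ℕₚ.*-mono-≤ 1≤B (ℕₚ.m≤n+m (V ℕ.* (r ℕ.* 30)) 29)))

-- First phase: lowering the ratio of colour degree to list size to 1/2r

module FirstPhase (r c : ℕ) (1≤r : 1 ℕ.≤ r) (1≤c : 1 ℕ.≤ c) where
  q S : ℕ
  q = 16 ℕ.* (r ℕ.* c)
  S = 2 ℕ.* (r ℕ.* c) ℕ.* q
  1≤rc = ℕₚ.*-mono-≤ 1≤r 1≤c
  1≤q : 1 ℕ.≤ q
  1≤q = ℕₚ.*-mono-≤ (s≤s (z≤n {15})) 1≤rc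
  2≤S : 2 ℕ.≤ S
  2≤S = ℕₚ.*-mono-≤ (ℕₚ.*-mono-≤ (ℕₚ.≤-refl {2}) 1≤rc) 1≤q
  2≤q : 2 ℕ.≤ q
  2≤q = ℕₚ.*-mono-≤ (s≤s (s≤s (z≤n {14}))) 1≤rc

  -- The ratio D/B is at most i/S, and one round lowers i by 1 as long as the ratio is not yet 1/2r.
  -- The first hypothesis keeps i/S at most 1 - 1/c, and this distance from 1 is what makes the
  -- ratio fall.
  first-phase : ∀ i → c ℕ.* i ℕ.≤ (c ℕ.∸ 1) ℕ.* S → ∀ B D V → 1 ℕ.≤ B → S ℕ.* D ℕ.≤ i ℕ.* B → Completable r B D V
  first-phase zero _ B D V 1≤B D≤ = second-phase′ r B D V 1≤r 1≤B (ℕₚ.≤-trans (ℕₚ.≤-reflexive (cong (ℕ._* (r ℕ.* 2)) D≡0)) z≤n)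
    where
    D≡0 : D ≡ 0
    D≡0 with ℕₚ.m*n≡0⇒m≡0∨n≡0 S (ℕₚ.n≤0⇒n≡0 D≤)
    ... | inj₂ p = p
    ... | inj₁ p = case subst (2 ℕ.≤_) p 2≤S of λ ()
  first-phase (suc k) room B D V 1≤B D≤ = decide (ℕₚ.≤-total (2 ℕ.* r ℕ.* suc k) S)
    where
    instance
      S≢0 : ℕ.NonZero S
      S≢0 = ℕ.>-nonZero (ℕₚ.≤-trans (s≤s z≤n) 2≤S)
    Q′ = q ℕ.∸ 1
    Q′+1 : Q′ ℕ.+ 1 ≡ q
    Q′+1 = ℕₚ.m∸n+n≡m 1≤q
    decide : 2 ℕ.* r ℕ.* suc k ℕ.≤ S ⊎ S ℕ.≤ 2 ℕ.* r ℕ.* suc k → Completable r B D V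
    decide (inj₁ small-ratio) = second-phase′ r B D V 1≤r 1≤B (ℕₚ.*-cancelˡ-≤ S
      (ℕₚ.≤-trans (ℕₚ.≤-reflexive (ring-n10 S r D)) (ℕₚ.≤-trans (ℕₚ.*-monoʳ-≤ (2 ℕ.* r) D≤)
        (ℕₚ.≤-trans (ℕₚ.≤-reflexive (sym (ℕₚ.*-assoc (2 ℕ.* r) (suc k) B))) (ℕₚ.*-monoˡ-≤ B small-ratio)))))
    -- In the unit B after refinement by Sq, lists go from Sq to S(q - 1) and colour degrees from
    -- q(k + 1) + 1, with 1 for rounding, to k(q - 1); the ratio becomes k/S. Open degrees are
    -- merely kept bounded.
    decide (inj₂ large-ratio) = scaled-round (S ℕ.* q) B r (S ℕ.* Q′) S (S ℕ.∸ 1) (k ℕ.* Q′) (q ℕ.+ k ℕ.+ 1) (suc (S ℕ.* q ℕ.* V)) 0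
        (ℕₚ.*-mono-≤ 1≤S 1≤q) 1≤B 1≤r (ℕₚ.≤-trans 1≤S (ℕₚ.m≤n+m S (S ℕ.* Q′))) (ℕₚ.≤-trans (ℕₚ.m≤n+m 1 (q ℕ.+ k)) (ℕₚ.m≤n+m (q ℕ.+ k ℕ.+ 1) (k ℕ.* Q′)))
        (ℕₚ.≤-reflexive (trans (ℕₚ.+-comm 1 (S ℕ.∸ 1)) (ℕₚ.m∸n+n≡m 1≤S))) gap₁ gap₂
        (ℕₚ.≤-reflexive (cong (ℕ._* B) SQ)) boundD (ℕₚ.≤-trans (ℕₚ.≤-reflexive (trans (sym (ℕₚ.+-identityʳ (suc (S ℕ.* q ℕ.* V)))) (sym (ℕₚ.*-identityʳ _)))) (ℕₚ.*-monoʳ-≤ (suc (S ℕ.* q ℕ.* V) ℕ.+ 0) 1≤B))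
        (first-phase k (ℕₚ.≤-trans (ℕₚ.*-monoʳ-≤ c (ℕₚ.n≤1+n k)) room) (S ℕ.* Q′ ℕ.* B) (k ℕ.* Q′ ℕ.* B) (suc (S ℕ.* q ℕ.* V) ℕ.* B)
          (ℕₚ.*-mono-≤ 1≤SQ′ 1≤B) (ℕₚ.≤-reflexive (ring-n11 S k Q′ B)))
      where
      1≤S = ℕₚ.≤-trans (s≤s z≤n) 2≤S
      1≤Q′ : 1 ℕ.≤ Q′
      1≤Q′ = ℕₚ.∸-monoˡ-≤ 1 2≤q
      1≤SQ′ = ℕₚ.*-mono-≤ 1≤S 1≤Q′
      SQ : S ℕ.* Q′ ℕ.+ S ≡ S ℕ.* q
      SQ = trans (ring-n4 S Q′) (cong (S ℕ.*_) Q′+1)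
      dx : k ℕ.* Q′ ℕ.+ (q ℕ.+ k ℕ.+ 1) ≡ q ℕ.* suc k ℕ.+ 1
      dx = trans (ring-n5 k Q′ q) (trans (cong (λ t → k ℕ.* t ℕ.+ q ℕ.+ 1) Q′+1) (ring-n6 k q))
      boundD : suc (S ℕ.* q ℕ.* D) ℕ.≤ (k ℕ.* Q′ ℕ.+ (q ℕ.+ k ℕ.+ 1)) ℕ.* B
      boundD = ℕₚ.≤-trans (ℕₚ.+-mono-≤ 1≤B (ℕₚ.≤-trans (ℕₚ.≤-reflexive (ring-n7 S q D)) (ℕₚ.*-monoʳ-≤ q D≤)))
        (ℕₚ.≤-reflexive (trans (ring-n8 B q k) (cong (ℕ._* B) (sym dx))))
      ι-1 : ∀ {p} → 1 ℕ.≤ p → ι (p ℕ.∸ 1) ≡ ι p - 1ℚ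
      ι-1 h = ι-∸ h
      ιbw : ι (S ℕ.* Q′) + ι S ≡ ι S * ι q
      ιbw = trans (sym (ι-+ (S ℕ.* Q′) S)) (trans (cong ι SQ) (ι-* S q))
      ιdx : ι (k ℕ.* Q′) + ι (q ℕ.+ k ℕ.+ 1) ≡ ι q * (ι k + 1ℚ) + 1ℚ
      ιdx = trans (sym (ι-+ (k ℕ.* Q′) (q ℕ.+ k ℕ.+ 1))) (trans (cong ι dx) (trans (ι-+ (q ℕ.* suc k) 1) (cong (_+ 1ℚ) (trans (ι-* q (suc k)) (cong (ι q *_) (+-comm 1ℚ (ι k)))))))
      -- In this case S ≤ 2r(k + 1), and S = 2rcq gives k + 1 ≥ cq ≥ 4.
      3≤k : 3 ℕ.≤ k
      3≤k = ℕₚ.≤-pred (ℕₚ.*-cancelˡ-≤ (2 ℕ.* r) {{ℕ.>-nonZero (ℕₚ.*-mono-≤ (s≤s (z≤n {1})) 1≤r)}} (ℕₚ.≤-trans (ℕₚ.*-mono-≤ (ℕₚ.≤-reflexive (refl {x = 2 ℕ.* r})) 4≤cq)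
          (ℕₚ.≤-trans (ℕₚ.≤-reflexive (ring-n9 r c q)) large-ratio)))
        where
        4≤cq : 4 ℕ.≤ c ℕ.* q
        4≤cq = ℕₚ.*-mono-≤ 1≤c (ℕₚ.*-mono-≤ (s≤s (s≤s (s≤s (s≤s (z≤n {12}))))) 1≤rc)
      roomℚ : ι c * (ι k + 1ℚ) ≤ (ι c - 1ℚ) * ι S
      roomℚ = ≤-trans (≤-reflexive (trans (cong (ι c *_) (+-comm (ι k) 1ℚ)) (sym (ι-* c (suc k)))))
        (≤-trans (ι-mono room) (≤-reflexive (trans (ι-* (c ℕ.∸ 1) S) (cong (_* ι S) (ι-1 1≤c)))))
      gap₁ : ι (q ℕ.+ k ℕ.+ 1) * ((ι (S ℕ.* Q′) + ι S) * ι r * (ι (k ℕ.* Q′) + ι (q ℕ.+ k ℕ.+ 1))) <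
        ι (S ℕ.∸ 1) * (ι (k ℕ.* Q′) * (ι (S ℕ.* Q′) + ι r * (ι (k ℕ.* Q′) + ι (q ℕ.+ k ℕ.+ 1)) - (ι (k ℕ.* Q′) + ι (q ℕ.+ k ℕ.+ 1))))
      gap₁ = subst₂ _<_
        (sym (cong₂ _*_ (trans (ι-+ (q ℕ.+ k) 1) (cong (_+ 1ℚ) (ι-+ q k))) (cong₂ (λ p s → p * ι r * s) ιbw ιdx)))
        (sym (cong₂ _*_ (ι-1 1≤S) (cong₂ _*_ (trans (ι-* k Q′) (cong (ι k *_) (ι-1 1≤q))) (cong₂ (λ p s → p + ι r * s - s) (trans (ι-* S Q′) (cong (ι S *_) (ι-1 1≤q))) ιdx))))
        (ratio-gap (ι-mono 1≤r) (ι-mono 1≤c) (ι-mono 3≤k) (trans (ι-* 16 (r ℕ.* c)) (cong (ι 16 *_) (ι-* r c)))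
          (trans (ι-* (2 ℕ.* (r ℕ.* c)) q) (cong (_* ι q) (trans (ι-* 2 (r ℕ.* c)) (cong (ι 2 *_) (ι-* r c))))) roomℚ)
      gap₂ : 0ℚ * ((ι (S ℕ.* Q′) + ι S) * ι r * (ι (k ℕ.* Q′) + ι (q ℕ.+ k ℕ.+ 1))) < ι (S ℕ.∸ 1) * (ι (suc (S ℕ.* q ℕ.* V)) * ι (S ℕ.* Q′))
      gap₂ = ≤-<-trans (≤-reflexive (*-zeroˡ ((ι (S ℕ.* Q′) + ι S) * ι r * (ι (k ℕ.* Q′) + ι (q ℕ.+ k ℕ.+ 1)))))
        (0<* (0<ι⁺ (ℕₚ.∸-monoˡ-≤ 1 2≤S)) (0<* (0<ι (S ℕ.* q ℕ.* V)) (0<ι⁺ 1≤SQ′)))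

-- With c = B the hypothesis D ≤ B - 1 reads D/B ≤ 1 - 1/c. Since c divides S, the starting index (c
-- - 1)S/c is an integer.
completable : ∀ r B D V → 1 ℕ.≤ r → D ℕ.< B → Completable r B D V
completable r (suc b) D V 1≤r (s≤s D≤b) = first-phase i (ℕₚ.≤-reflexive (ring-n24 r b)) (suc b) D V (s≤s z≤n)
  (ℕₚ.≤-trans (ℕₚ.*-monoʳ-≤ S D≤b) (ℕₚ.≤-reflexive (ring-n25 r b)))
  where
  open FirstPhase r (suc b) 1≤r (s≤s z≤n)
  i = b ℕ.* (32 ℕ.* (r ℕ.* r) ℕ.* suc b)

-- Independent Bernoulli bits and the method of conditional expectations

∏ : ∀ {n} → (Fin n → ℚ) → ℚ
∏ {zero} f = 1ℚ
∏ {suc n} f = f zero * ∏ (f ∘ suc)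

∏-cong : ∀ {n} {f g : Fin n → ℚ} → (∀ i → f i ≡ g i) → ∏ f ≡ ∏ g
∏-cong {zero} h = refl
∏-cong {suc n} h = cong₂ _*_ (h zero) (∏-cong (h ∘ suc))

0≤∏ : ∀ {n} {f : Fin n → ℚ} → (∀ i → 0ℚ ≤ f i) → 0ℚ ≤ ∏ f
0≤∏ {zero} h = 0≤1
0≤∏ {suc n} h = 0≤* (h zero) (0≤∏ (h ∘ suc))

∏-mono : ∀ {n} {f g : Fin n → ℚ} → (∀ i → 0ℚ ≤ f i) → (∀ i → f i ≤ g i) → ∏ f ≤ ∏ g
∏-mono {zero} h k = ≤-refl
∏-mono {suc n} h k = *-mono (h zero) (k zero) (0≤∏ (h ∘ suc)) (∏-mono (h ∘ suc) (k ∘ suc))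

∏-* : ∀ {n} (f g : Fin n → ℚ) → ∏ (λ i → f i * g i) ≡ ∏ f * ∏ g
∏-* {zero} f g = refl
∏-* {suc n} f g = trans (cong (f zero * g zero *_) (∏-* (f ∘ suc) (g ∘ suc))) (ring-8 (f zero) (g zero) (∏ (f ∘ suc)) (∏ (g ∘ suc)))

∏≤1 : ∀ {n} {f : Fin n → ℚ} → (∀ i → 0ℚ ≤ f i) → (∀ i → f i ≤ 1ℚ) → ∏ f ≤ 1ℚ
∏≤1 {zero} h k = ≤-refl
∏≤1 {suc n} h k = ≤-trans (*-mono (h zero) (k zero) (0≤∏ (h ∘ suc)) (∏≤1 (h ∘ suc) (k ∘ suc))) (≤-reflexive (*-identityˡ 1ℚ))

weierstrass : ∀ {n} {f : Fin n → ℚ} → (∀ i → 0ℚ ≤ f i) → (∀ i → f i ≤ 1ℚ) → 1ℚ - ∑ f ≤ ∏ (λ i → 1ℚ - f i)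
weierstrass {zero} h k = ≤-reflexive refl
weierstrass {suc n} {f} h k = ≤-trans (≤-by (f zero * ∑ (f ∘ suc)) (ring-106 (f zero) (∑ (f ∘ suc))) (0≤* (h zero) (0≤∑ (h ∘ suc))))
  (*-monoʳ (0≤- (k zero)) (weierstrass (h ∘ suc) (k ∘ suc)))

∏-at : ∀ {n} (i : Fin n) p → ∏ (λ j → 1ℚ + 𝟙 (i == j) * (p - 1ℚ)) ≡ p
∏-at {suc n} zero p = trans (cong₂ _*_ (ring-107 p) (trans (∏-cong {n} (λ j → ring-108 p)) (ones n))) (*-identityʳ p)
  where
  ones : ∀ n → ∏ {n} (λ _ → 1ℚ) ≡ 1ℚ
  ones zero = refl
  ones (suc n) = trans (*-identityˡ (∏ {n} (λ _ → 1ℚ))) (ones n)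
∏-at {suc n} (suc i) p = trans (cong₂ _*_ (ring-108 p) (trans (∏-cong (λ j → cong (λ b → 1ℚ + 𝟙 b * (p - 1ℚ)) (suc== i j))) (∏-at i p))) (*-identityˡ p)
  where
  suc== : ∀ {n} (i j : Fin n) → (Fin.suc i == suc j) ≡ (i == j)
  suc== i j with i Finₚ.≟ j
  ... | yes _ = refl
  ... | no _ = refl

module Expectation (p : ℚ) (0≤p : 0ℚ ≤ p) (p≤1 : p ≤ 1ℚ) where

  cons : ∀ {n} → Bool → (Fin n → Bool) → Fin (suc n) → Bool
  cons b y zero = b
  cons b y (suc i) = y i

  -- Expectation over independent bits that are true with probability p, defined by conditioning on
  -- the first bit. `attained` then fixes the bits one at a time.
  𝔼 : ∀ {n} → ((Fin n → Bool) → ℚ) → ℚ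
  𝔼 {zero} F = F (λ ())
  𝔼 {suc n} F = (1ℚ - p) * 𝔼 (λ y → F (cons false y)) + p * 𝔼 (λ y → F (cons true y))

  attained : ∀ {n} (F : (Fin n → Bool) → ℚ) → Σ (Fin n → Bool) λ y → F y ≤ 𝔼 F
  attained {zero} F = (λ ()) , ≤-refl
  attained {suc n} F with ≤⊎> (𝔼 (λ y → F (cons false y))) (𝔼 (λ y → F (cons true y)))
  ... | inj₁ f≤t with attained (λ y → F (cons false y))
  ...   | y , q = cons false y , ≤-trans q (≤-by (p * (𝔼 (λ y → F (cons true y)) - 𝔼 (λ y → F (cons false y)))) (ring-100 p _ _) (0≤* 0≤p (0≤- f≤t)))
  attained {suc n} F | inj₂ t<f with attained (λ y → F (cons true y))
  ...   | y , q = cons true y , ≤-trans q (≤-by ((1ℚ - p) * (𝔼 (λ y → F (cons false y)) - 𝔼 (λ y → F (cons true y)))) (ring-101 p _ _) (0≤* (0≤- p≤1) (0≤- (<⇒≤ t<f))))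

  𝔼-mono : ∀ {n} {F G : (Fin n → Bool) → ℚ} → (∀ y → F y ≤ G y) → 𝔼 F ≤ 𝔼 G
  𝔼-mono {zero} h = h (λ ())
  𝔼-mono {suc n} h = +-mono-≤ (*-monoʳ (0≤- p≤1) (𝔼-mono (λ y → h (cons false y)))) (*-monoʳ 0≤p (𝔼-mono (λ y → h (cons true y))))

  𝔼-const : ∀ n c → 𝔼 {n} (λ _ → c) ≡ c
  𝔼-const zero c = refl
  𝔼-const (suc n) c = trans (cong (λ t → (1ℚ - p) * t + p * t) (𝔼-const n c)) (ring-102 p c)

  𝔼-+ : ∀ {n} (F G : (Fin n → Bool) → ℚ) → 𝔼 (λ y → F y + G y) ≡ 𝔼 F + 𝔼 G
  𝔼-+ {zero} F G = refl
  𝔼-+ {suc n} F G = trans (cong₂ (λ a b → (1ℚ - p) * a + p * b) (𝔼-+ (λ y → F (cons false y)) (λ y → G (cons false y))) (𝔼-+ (λ y → F (cons true y)) (λ y → G (cons true y))))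
    (ring-103 p (𝔼 (λ y → F (cons false y))) (𝔼 (λ y → G (cons false y))) (𝔼 (λ y → F (cons true y))) (𝔼 (λ y → G (cons true y))))

  𝔼-* : ∀ {n} c (F : (Fin n → Bool) → ℚ) → 𝔼 (λ y → c * F y) ≡ c * 𝔼 F
  𝔼-* {zero} c F = refl
  𝔼-* {suc n} c F = trans (cong₂ (λ a b → (1ℚ - p) * a + p * b) (𝔼-* c (λ y → F (cons false y))) (𝔼-* c (λ y → F (cons true y))))
    (ring-104 p c (𝔼 (λ y → F (cons false y))) (𝔼 (λ y → F (cons true y))))

  𝔼-∑ : ∀ {n k} (F : Fin k → (Fin n → Bool) → ℚ) → 𝔼 (λ y → ∑ (λ i → F i y)) ≡ ∑ (λ i → 𝔼 (F i))
  𝔼-∑ {n} {zero} F = 𝔼-const n 0ℚ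
  𝔼-∑ {n} {suc k} F = trans (𝔼-+ (F zero) (λ y → ∑ (λ i → F (suc i) y))) (cong (𝔼 (F zero) +_) (𝔼-∑ (F ∘ suc)))

  𝔼-∏ : ∀ {n} (φ : Fin n → Bool → ℚ) → 𝔼 (λ y → ∏ (λ i → φ i (y i))) ≡ ∏ (λ i → (1ℚ - p) * φ i false + p * φ i true)
  𝔼-∏ {zero} φ = refl
  𝔼-∏ {suc n} φ = trans (cong₂ (λ a b → (1ℚ - p) * a + p * b) (trans (𝔼-* (φ zero false) rest) (cong (φ zero false *_) (𝔼-∏ (φ ∘ suc)))) (trans (𝔼-* (φ zero true) rest) (cong (φ zero true *_) (𝔼-∏ (φ ∘ suc)))))
    (ring-105 p (φ zero false) (φ zero true) (∏ (λ i → (1ℚ - p) * φ (suc i) false + p * φ (suc i) true)))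
    where
    rest : (Fin n → Bool) → ℚ
    rest y = ∏ (λ i → φ (suc i) (y i))

-- An exponential of a count becomes a product over the entries, which `𝔼-∏` can evaluate.
2^# : ∀ {n} (b : Fin n → Bool) → ι 2 ^ (# b) ≡ ∏ (λ i → 1ℚ + 𝟙 (b i))
2^# {zero} b = refl
2^# {suc n} b with b zero
... | true = cong (ι 2 *_) (2^# (b ∘ suc))
... | false = trans (2^# (b ∘ suc)) (sym (*-identityˡ (∏ (λ i → 1ℚ + 𝟙 (b (suc i))))))

∏-zero : ∀ {n} {f : Fin n → ℚ} i → f i ≡ 0ℚ → ∏ f ≡ 0ℚ
∏-zero {suc n} {f} zero p = trans (cong (_* ∏ (f ∘ suc)) p) (*-zeroˡ (∏ (f ∘ suc)))
∏-zero {suc n} {f} (suc i) p = trans (cong (f zero *_) (∏-zero {f = f ∘ suc} i p)) (*-zeroʳ (f zero))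

#-∨ : ∀ {n} (a b : Fin n → Bool) → # (λ i → a i ∨ b i) ℕ.≤ # a ℕ.+ # b
#-∨ a b = ι-cancel-≤ (≤-trans (≤-reflexive (ι# (λ i → a i ∨ b i))) (≤-trans (∑-mono (λ i → pt (a i) (b i)))
  (≤-reflexive (trans (∑-+ (𝟙 ∘ a) (𝟙 ∘ b)) (sym (trans (ι-+ (# a) (# b)) (cong₂ _+_ (ι# a) (ι# b))))))))
  where
  pt : ∀ x y → 𝟙 (x ∨ y) ≤ 𝟙 x + 𝟙 y
  pt true y = ≤-by (𝟙 y) refl (0≤𝟙 y)
  pt false y = ≤-reflexive (sym (+-identityˡ (𝟙 y)))

½·2≡1 : ℚ.½ * ι 2 ≡ 1ℚ
½·2≡1 = refl

0≤½ : 0ℚ ≤ ℚ.½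
0≤½ = ℚₚ.nonNegative⁻¹ ℚ.½

½≤1 : ℚ.½ ≤ 1ℚ
½≤1 = ≤-by ℚ.½ refl 0≤½

½^-antitone : ∀ {a b} → a ℕ.≤ b → ℚ.½ ^ b ≤ ℚ.½ ^ a
½^-antitone {a} {b} a≤b = ≤-trans (≤-reflexive (trans (cong (ℚ.½ ^_) (sym (ℕₚ.m+[n∸m]≡n a≤b))) (^-+ ℚ.½ a (b ℕ.∸ a))))
  (≤-trans (*-monoʳ (0≤^ a 0≤½) (^≤1 (b ℕ.∸ a) 0≤½ ½≤1)) (≤-reflexive (*-identityʳ (ℚ.½ ^ a))))

½^2^ : ∀ k → ℚ.½ ^ k * ι 2 ^ k ≡ 1ℚ
½^2^ k = trans (sym (*-^ ℚ.½ (ι 2) k)) (trans (cong (_^ k) ½·2≡1) (1^ k))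

-- Colour classes that repeat a colour in many neighbourhoods

module Savings {m} (adj : Fin m → Fin m → Bool) (adj-sym : ∀ e f → adj e f ≡ adj f e) (W T : Fin m → Bool) where
  open ListColouring {m} {0} adj adj-sym using (nbr; deg)

  -- `Z` marks the members of earlier classes. These are the pairs that could still receive a common
  -- colour and so save one at e.
  ok : (Fin m → Bool) → Fin m → Fin m → Fin m → Bool
  ok Z e f g = (nbr W e f ∧ not (Z f)) ∧ ((nbr W e g ∧ not (Z g)) ∧ (not (g == f) ∧ not (adj f g)))

  -- Selected candidates with a selected neighbour are dropped, so the class is independent for
  -- every choice y of the bits.
  class : (Fin m → Bool) → (Fin m → Bool) → Fin m → Bool
  class Z y f = (W f ∧ not (Z f)) ∧ (y f ∧ not (any (λ g → nbr W f g ∧ y g)))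

  twice : Fin m → (Fin m → Bool) → Fin m → Fin m → Bool
  twice e M f g = (nbr W e f ∧ M f) ∧ ((nbr W e g ∧ M g) ∧ not (g == f))

  saved : Fin m → (Fin m → Bool) → Bool
  saved e M = any (λ f → any (λ g → twice e M f g))

  module _ (D Γ p ω : ℚ) (0≤p : 0ℚ ≤ p) (6pD≤1 : ι 6 * (p * D) ≤ 1ℚ) (p≤1 : p ≤ 1ℚ) (5ω≡6 : ι 5 * ω ≡ ι 6)
    (T⊆W : ∀ e → T e ≡ true → W e ≡ true) (deg≤D : ∀ e → W e ≡ true → deg W e ≤ D)
    (z₀ : ℕ) (pairs : ∀ Z e → T e ≡ true → # (λ f → nbr W e f ∧ Z f) ℕ.≤ z₀ → Γ ≤ ∑ (λ f → ∑ (λ g → 𝟙 (ok Z e f g)))) where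
    open Expectation p 0≤p p≤1

    near : Fin m → Fin m → Fin m → Fin m → Bool
    near e f g h = (not (h == f) ∧ not (h == g)) ∧ (nbr W e h ∨ (nbr W f h ∨ nbr W g h))

    -- The event that f and g are the only selected vertices near e, f and g, as a product over vertices.
    factor : Fin m → Fin m → Fin m → Fin m → Bool → ℚ
    factor e f g h b = (1ℚ + 𝟙 (f == h) * (𝟙 b - 1ℚ)) * ((1ℚ + 𝟙 (g == h) * (𝟙 b - 1ℚ)) * (1ℚ - 𝟙 (near e f g h) * 𝟙 b))

    alone : Fin m → Fin m → Fin m → (Fin m → Bool) → Bool
    alone e f g y = (y f ∧ y g) ∧ not (any (λ h → near e f g h ∧ y h))

    01-factor : ∀ a b → (0ℚ ≤ 1ℚ + 𝟙 a * (𝟙 b - 1ℚ)) × (1ℚ + 𝟙 a * (𝟙 b - 1ℚ) ≤ 1ℚ)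
    01-factor true true = 0≤1 , ≤-refl
    01-factor true false = ≤-refl , 0≤1
    01-factor false true = 0≤1 , ≤-refl
    01-factor false false = 0≤1 , ≤-refl

    01-factor′ : ∀ a b → (0ℚ ≤ 1ℚ - 𝟙 a * 𝟙 b) × (1ℚ - 𝟙 a * 𝟙 b ≤ 1ℚ)
    01-factor′ true true = ≤-refl , 0≤1
    01-factor′ true false = 0≤1 , ≤-refl
    01-factor′ false true = 0≤1 , ≤-refl
    01-factor′ false false = 0≤1 , ≤-refl

    0≤factor : ∀ e f g h b → 0ℚ ≤ factor e f g h b
    0≤factor e f g h b = 0≤* (proj₁ (01-factor (f == h) b)) (0≤* (proj₁ (01-factor (g == h) b)) (proj₁ (01-factor′ (near e f g h) b)))

    factor≤1 : ∀ e f g h b → factor e f g h b ≤ 1ℚ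
    factor≤1 e f g h b = ≤-trans (*-mono (proj₁ (01-factor (f == h) b)) (proj₂ (01-factor (f == h) b))
      (0≤* (proj₁ (01-factor (g == h) b)) (proj₁ (01-factor′ (near e f g h) b)))
      (≤-trans (*-mono (proj₁ (01-factor (g == h) b)) (proj₂ (01-factor (g == h) b)) (proj₁ (01-factor′ (near e f g h) b)) (proj₂ (01-factor′ (near e f g h) b)))
        (≤-reflexive (*-identityˡ 1ℚ)))) (≤-reflexive (*-identityˡ 1ℚ))

    ∏≤alone : ∀ e f g y → ∏ (λ h → factor e f g h (y h)) ≤ 𝟙 (alone e f g y)
    ∏≤alone e f g y with bool (alone e f g y)
    ... | inj₁ p = ≤-trans (∏≤1 (λ h → 0≤factor e f g h (y h)) (λ h → factor≤1 e f g h (y h))) (≤-reflexive (cong 𝟙 (sym p)))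
    ... | inj₂ p = ≤-trans (≤-reflexive vanish) (0≤𝟙 (alone e f g y))
      where
      vanish : ∏ (λ h → factor e f g h (y h)) ≡ 0ℚ
      vanish with bool (y f) | bool (y g) | bool (any (λ h → near e f g h ∧ y h))
      ... | inj₂ yf | _ | _ = ∏-zero f (trans (cong₂ (λ a b → (1ℚ + 𝟙 a * (𝟙 b - 1ℚ)) * ((1ℚ + 𝟙 (g == f) * (𝟙 b - 1ℚ)) * (1ℚ - 𝟙 (near e f g f) * 𝟙 b))) (==-refl f) yf)
          (ring-115 ((1ℚ + 𝟙 (g == f) * (0ℚ - 1ℚ)) * (1ℚ - 𝟙 (near e f g f) * 0ℚ))))
      ... | inj₁ _ | inj₂ yg | _ = ∏-zero g (trans (cong₂ (λ a b → (1ℚ + 𝟙 (f == g) * (𝟙 b - 1ℚ)) * ((1ℚ + 𝟙 a * (𝟙 b - 1ℚ)) * (1ℚ - 𝟙 (near e f g g) * 𝟙 b))) (==-refl g) yg)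
          (ring-116 (1ℚ + 𝟙 (f == g) * (0ℚ - 1ℚ)) (1ℚ - 𝟙 (near e f g g) * 0ℚ)))
      ... | inj₁ yf | inj₁ yg | inj₂ q = ⊥-elim (true≢false (∧-intro (∧-intro yf yg) (not-intro q)) p)
      ... | inj₁ _ | inj₁ _ | inj₁ q with any-elim q
      ...   | h , r = ∏-zero h (trans (cong₂ (λ a b → (1ℚ + 𝟙 (f == h) * (𝟙 b - 1ℚ)) * ((1ℚ + 𝟙 (g == h) * (𝟙 b - 1ℚ)) * (1ℚ - 𝟙 a * 𝟙 b))) (∧-fst {near e f g h} r) (∧-snd {near e f g h} r))
          (ring-117 (1ℚ + 𝟙 (f == h) * (1ℚ - 1ℚ)) (1ℚ + 𝟙 (g == h) * (1ℚ - 1ℚ))))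

    ∑near≤ : ∀ e f g → W e ≡ true → W f ≡ true → W g ≡ true → ∑ (λ h → 𝟙 (near e f g h)) ≤ D + (D + D)
    ∑near≤ e f g We Wf Wg = begin
      ∑ (λ h → 𝟙 (near e f g h)) ≤⟨ ∑-mono pt ⟩
      ∑ (λ h → 𝟙 (nbr W e h) + (𝟙 (nbr W f h) + 𝟙 (nbr W g h))) ≡⟨ trans (∑-+ (𝟙 ∘ nbr W e) (λ h → 𝟙 (nbr W f h) + 𝟙 (nbr W g h))) (cong (deg W e +_) (∑-+ (𝟙 ∘ nbr W f) (𝟙 ∘ nbr W g))) ⟩
      deg W e + (deg W f + deg W g) ≤⟨ +-mono-≤ (deg≤D e We) (+-mono-≤ (deg≤D f Wf) (deg≤D g Wg)) ⟩
      D + (D + D) ∎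
      where
      open ℚₚ.≤-Reasoning
      or : ∀ a b c → 𝟙 (a ∨ (b ∨ c)) ≤ 𝟙 a + (𝟙 b + 𝟙 c)
      or true b c = ≤-by (𝟙 b + 𝟙 c) refl (0≤+ (0≤𝟙 b) (0≤𝟙 c))
      or false true c = ≤-by (𝟙 c) (+-identityˡ (1ℚ + 𝟙 c)) (0≤𝟙 c)
      or false false c = ≤-reflexive (sym (trans (+-identityˡ (0ℚ + 𝟙 c)) (+-identityˡ (𝟙 c))))
      pt : ∀ h → 𝟙 (near e f g h) ≤ 𝟙 (nbr W e h) + (𝟙 (nbr W f h) + 𝟙 (nbr W g h))
      pt h = ≤-trans (𝟙-mono {near e f g h} (∧-snd {not (h == f) ∧ not (h == g)})) (or (nbr W e h) (nbr W f h) (nbr W g h))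

    p²/2 = p * (p * ℚ.½)
    0≤p²/2 : 0ℚ ≤ p²/2
    0≤p²/2 = 0≤* 0≤p (0≤* 0≤p 0≤½)

    -- Both f and g are selected with probability p². At most 3D others are near e, f or g, and by
    -- 6pD ≤ 1 none of them is selected with probability at least 1 - 3pD ≥ ½. The three kinds of
    -- factors concern different bits, hence the product.
    𝔼-alone : ∀ e f g → W e ≡ true → W f ≡ true → W g ≡ true → f ≢ g → p²/2 ≤ 𝔼 (λ y → ∏ (λ h → factor e f g h (y h)))
    𝔼-alone e f g We Wf Wg f≢g = begin
      p * (p * ℚ.½) ≤⟨ *-monoʳ 0≤p (*-monoʳ 0≤p half) ⟩
      p * (p * (1ℚ - ∑ (λ h → p * 𝟙 (near e f g h)))) ≤⟨ *-monoʳ 0≤p (*-monoʳ 0≤p (weierstrass (λ h → 0≤* 0≤p (0≤𝟙 (near e f g h))) p𝟙≤1)) ⟩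
      p * (p * ∏ (λ h → 1ℚ - p * 𝟙 (near e f g h))) ≡⟨ cong₂ (λ a b → a * (b * ∏ (λ h → 1ℚ - p * 𝟙 (near e f g h)))) (sym (∏-at f p)) (sym (∏-at g p)) ⟩
      ∏ at-f * (∏ at-g * ∏ (λ h → 1ℚ - p * 𝟙 (near e f g h))) ≡⟨ trans (cong (∏ at-f *_) (sym (∏-* at-g (λ h → 1ℚ - p * 𝟙 (near e f g h)))))
          (sym (∏-* at-f (λ h → at-g h * (1ℚ - p * 𝟙 (near e f g h))))) ⟩
      ∏ (λ h → at-f h * (at-g h * (1ℚ - p * 𝟙 (near e f g h)))) ≡⟨ ∏-cong mean ⟩
      ∏ (λ h → (1ℚ - p) * factor e f g h false + p * factor e f g h true) ≡⟨ sym (𝔼-∏ (factor e f g)) ⟩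
      𝔼 (λ y → ∏ (λ h → factor e f g h (y h))) ∎
      where
      open ℚₚ.≤-Reasoning
      at-f at-g : Fin m → ℚ
      at-f h = 1ℚ + 𝟙 (f == h) * (p - 1ℚ)
      at-g h = 1ℚ + 𝟙 (g == h) * (p - 1ℚ)
      p𝟙≤1 : ∀ h → p * 𝟙 (near e f g h) ≤ 1ℚ
      p𝟙≤1 h = ≤-trans (*-monoʳ 0≤p (𝟙≤1 (near e f g h))) (≤-trans (≤-reflexive (*-identityʳ p)) p≤1)
      half : ℚ.½ ≤ 1ℚ - ∑ (λ h → p * 𝟙 (near e f g h))
      half = ≤-by (ℚ.½ * (1ℚ - ι 6 * (p * D)) + p * (D + (D + D) - ∑ (λ h → 𝟙 (near e f g h)))) (trans (cong (λ t → 1ℚ - t) (∑-*ˡ p (λ h → 𝟙 (near e f g h)))) (ring-118 p D (∑ (λ h → 𝟙 (near e f g h)))))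
        (0≤+ (0≤* 0≤½ (0≤- 6pD≤1)) (0≤* 0≤p (0≤- (∑near≤ e f g We Wf Wg))))
      mean : ∀ h → at-f h * (at-g h * (1ℚ - p * 𝟙 (near e f g h))) ≡ (1ℚ - p) * factor e f g h false + p * factor e f g h true
      mean h = mean′ (f == h) (g == h) (near e f g h) (λ a b → f≢g (trans (==⇒≡ f h a) (sym (==⇒≡ g h b))))
          (λ a c → true≢false (trans (==-sym h f) a) (not-elim (∧-fst {not (h == f)} (∧-fst {not (h == f) ∧ not (h == g)} c))))
          (λ b c → true≢false (trans (==-sym h g) b) (not-elim (∧-snd {not (h == f)} (∧-fst {not (h == f) ∧ not (h == g)} c))))
        where
        L R : Bool → Bool → Bool → ℚ → ℚ
        L a b c p = (1ℚ + 𝟙 a * (p - 1ℚ)) * ((1ℚ + 𝟙 b * (p - 1ℚ)) * (1ℚ - p * 𝟙 c))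
        R a b c p = (1ℚ - p) * ((1ℚ + 𝟙 a * (0ℚ - 1ℚ)) * ((1ℚ + 𝟙 b * (0ℚ - 1ℚ)) * (1ℚ - 𝟙 c * 0ℚ))) +
          p * ((1ℚ + 𝟙 a * (1ℚ - 1ℚ)) * ((1ℚ + 𝟙 b * (1ℚ - 1ℚ)) * (1ℚ - 𝟙 c * 1ℚ)))
        mean′ : ∀ a b c → (a ≡ true → b ≡ true → ⊥) → (a ≡ true → c ≡ true → ⊥) → (b ≡ true → c ≡ true → ⊥) → L a b c p ≡ R a b c p
        mean′ true true c h _ _ = ⊥-elim (h refl refl)
        mean′ true false true _ h _ = ⊥-elim (h refl refl)
        mean′ false true true _ _ h = ⊥-elim (h refl refl)
        mean′ true false false _ _ _ = ring-119 p
        mean′ false true false _ _ _ = ring-120 p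
        mean′ false false true _ _ _ = ring-121 p
        mean′ false false false _ _ _ = ring-122 p

    hit : (Fin m → Bool) → (Fin m → Bool) → Fin m → Fin m → Fin m → Bool
    hit Z y e f g = ok Z e f g ∧ alone e f g y

    nbr-W : ∀ e f → nbr W e f ≡ true → W f ≡ true
    nbr-W e f = ∧-fst {W f}

    ok-≢ : ∀ Z e f g → ok Z e f g ≡ true → f ≢ g
    ok-≢ Z e f g p f≡g = ==false⇒≢ g f (not-elim (∧-fst {not (g == f)} (∧-snd {nbr W e g ∧ not (Z g)} (∧-snd {nbr W e f ∧ not (Z f)} p)))) (sym f≡g)

    -- If a pair is hit, then its members are the only selected neighbours of e, so just its two
    -- orders are hit. Both members survive into the class: they are not adjacent and nothing else
    -- near them is selected.
    ∑hit≤ : ∀ Z y e → ∑ (λ f → ∑ (λ g → 𝟙 (hit Z y e f g))) ≤ ι 2 * 𝟙 (saved e (class Z y))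
    ∑hit≤ Z y e with bool (any (λ f → any (λ g → hit Z y e f g)))
    ... | inj₂ none = ≤-trans (≤-reflexive (trans (∑-cong (λ f → trans (∑-cong (λ g → cong 𝟙 (any-false {b = λ g → hit Z y e f g} (any-false {b = λ f → any (λ g → hit Z y e f g)} none f) g))) (∑-0 m))) (∑-0 m)))
      (0≤* (0≤ι 2) (0≤𝟙 (saved e (class Z y))))
    ... | inj₁ some with any-elim some
    ...   | f₀ , some′ with any-elim {b = λ g → hit Z y e f₀ g} some′
    ...     | g₀ , hit₀ = begin
      ∑ (λ f → ∑ (λ g → 𝟙 (hit Z y e f g))) ≤⟨ ∑-mono (λ f → ∑-mono (λ g → only f g)) ⟩
      ∑ (λ f → ∑ (λ g → 𝟙 (f₀ == f) * 𝟙 (g₀ == g) + 𝟙 (g₀ == f) * 𝟙 (f₀ == g)))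
        ≡⟨ trans (∑-cong (λ f → trans (∑-+ (λ g → 𝟙 (f₀ == f) * 𝟙 (g₀ == g)) (λ g → 𝟙 (g₀ == f) * 𝟙 (f₀ == g)))
             (cong₂ _+_ (row f₀ g₀ f) (row g₀ f₀ f)))) (trans (∑-+ (λ f → 𝟙 (f₀ == f) * 1ℚ) (λ f → 𝟙 (g₀ == f) * 1ℚ)) (cong₂ _+_ (∑-δ f₀ (λ _ → 1ℚ)) (∑-δ g₀ (λ _ → 1ℚ)))) ⟩
      1ℚ + 1ℚ ≡⟨ refl ⟩
      ι 2 * 1ℚ ≡⟨ cong (λ b → ι 2 * 𝟙 b) (sym is-saved) ⟩
      ι 2 * 𝟙 (saved e (class Z y)) ∎
      where
      open ℚₚ.≤-Reasoning
      row : ∀ a b f → ∑ (λ g → 𝟙 (a == f) * 𝟙 (b == g)) ≡ 𝟙 (a == f) * 1ℚ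
      row a b f = trans (∑-*ˡ (𝟙 (a == f)) (λ g → 𝟙 (b == g))) (cong (𝟙 (a == f) *_) (trans (∑-cong (λ g → sym (*-identityʳ (𝟙 (b == g))))) (∑-δ b (λ _ → 1ℚ))))
      ok₀ = ∧-fst {ok Z e f₀ g₀} hit₀
      alone₀ = ∧-snd {ok Z e f₀ g₀} hit₀
      f₀≢g₀ = ok-≢ Z e f₀ g₀ ok₀
      ef₀ = ∧-fst {nbr W e f₀} (∧-fst {nbr W e f₀ ∧ not (Z f₀)} ok₀)
      eg₀ = ∧-fst {nbr W e g₀} (∧-fst {nbr W e g₀ ∧ not (Z g₀)} (∧-snd {nbr W e f₀ ∧ not (Z f₀)} ok₀))
      apart : adj f₀ g₀ ≡ false
      apart = not-elim (∧-snd {not (g₀ == f₀)} (∧-snd {nbr W e g₀ ∧ not (Z g₀)} (∧-snd {nbr W e f₀ ∧ not (Z f₀)} ok₀)))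
      quiet : ∀ h → h ≢ f₀ → h ≢ g₀ → nbr W e h ∨ (nbr W f₀ h ∨ nbr W g₀ h) ≡ true → y h ≡ true → ⊥
      quiet h h≢f h≢g n yh = true≢false (∧-intro (∧-intro (∧-intro (not-intro (≢⇒== h≢f)) (not-intro (≢⇒== h≢g))) n) yh)
        (any-false {b = λ h → near e f₀ g₀ h ∧ y h} (not-elim (∧-snd {y f₀ ∧ y g₀} alone₀)) h)
      among : ∀ h → nbr W e h ≡ true → y h ≡ true → h ≡ f₀ ⊎ h ≡ g₀
      among h n yh with ≡⊎≢ h f₀ | ≡⊎≢ h g₀
      ... | inj₁ p | _ = inj₁ p
      ... | _ | inj₁ p = inj₂ p
      ... | inj₂ p | inj₂ q = ⊥-elim (quiet h p q (∨-inl n) yh)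
      only : ∀ f g → 𝟙 (hit Z y e f g) ≤ 𝟙 (f₀ == f) * 𝟙 (g₀ == g) + 𝟙 (g₀ == f) * 𝟙 (f₀ == g)
      only f g with bool (hit Z y e f g)
      ... | inj₂ p = ≤-trans (≤-reflexive (cong 𝟙 p)) (0≤+ (0≤* (0≤𝟙 (f₀ == f)) (0≤𝟙 (g₀ == g))) (0≤* (0≤𝟙 (g₀ == f)) (0≤𝟙 (f₀ == g))))
      ... | inj₁ p = locate (among f (∧-fst {nbr W e f} (∧-fst {nbr W e f ∧ not (Z f)} okp)) (∧-fst {y f} (∧-fst {y f ∧ y g} alonep)))
          (among g (∧-fst {nbr W e g} (∧-fst {nbr W e g ∧ not (Z g)} (∧-snd {nbr W e f ∧ not (Z f)} okp))) (∧-snd {y f} (∧-fst {y f ∧ y g} alonep)))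
        where
        okp = ∧-fst {ok Z e f g} p
        alonep = ∧-snd {ok Z e f g} p
        locate : f ≡ f₀ ⊎ f ≡ g₀ → g ≡ f₀ ⊎ g ≡ g₀ → 𝟙 (hit Z y e f g) ≤ 𝟙 (f₀ == f) * 𝟙 (g₀ == g) + 𝟙 (g₀ == f) * 𝟙 (f₀ == g)
        locate (inj₁ a) (inj₁ b) = ⊥-elim (ok-≢ Z e f g okp (trans a (sym b)))
        locate (inj₂ a) (inj₂ b) = ⊥-elim (ok-≢ Z e f g okp (trans a (sym b)))
        locate (inj₁ refl) (inj₂ refl) = ≤-trans (𝟙≤1 (hit Z y e f g)) (≤-by (𝟙 (g₀ == f) * 𝟙 (f₀ == g))
          (cong₂ (λ a b → 𝟙 a * 𝟙 b + 𝟙 (g₀ == f) * 𝟙 (f₀ == g)) (==-refl f₀) (==-refl g₀)) (0≤* (0≤𝟙 (g₀ == f)) (0≤𝟙 (f₀ == g))))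
        locate (inj₂ refl) (inj₁ refl) = ≤-trans (𝟙≤1 (hit Z y e f g)) (≤-by (𝟙 (f₀ == f) * 𝟙 (g₀ == g))
          (trans (cong₂ (λ a b → 𝟙 (f₀ == f) * 𝟙 (g₀ == g) + 𝟙 a * 𝟙 b) (==-refl g₀) (==-refl f₀)) (+-comm (𝟙 (f₀ == f) * 𝟙 (g₀ == g)) (1ℚ * 1ℚ))) (0≤* (0≤𝟙 (f₀ == f)) (0≤𝟙 (g₀ == g))))
      in-class : ∀ f g → nbr W e f ≡ true → Z f ≡ false → y f ≡ true → (∀ h → nbr W f h ≡ true → h ≢ f → h ≢ g → y h ≡ true → ⊥) →
        adj f g ≡ false → class Z y f ≡ true
      in-class f g ef Zf yf quiet′ fg = ∧-intro (∧-intro (nbr-W e f ef) (not-intro Zf)) (∧-intro yf (not-intro (≡false crowded)))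
        where
        crowded : any (λ h → nbr W f h ∧ y h) ≡ true → ⊥
        crowded p with any-elim p
        ... | h , q = quiet′ h (∧-fst {nbr W f h} q) (==false⇒≢ h f (not-elim (∧-fst {not (h == f)} (∧-snd {W h} (∧-fst {nbr W f h} q)))))
          (λ h≡g → true≢false (subst (λ k → adj f k ≡ true) h≡g (∧-snd {not (h == f)} (∧-snd {W h} (∧-fst {nbr W f h} q)))) fg) (∧-snd {nbr W f h} q)
      is-saved : saved e (class Z y) ≡ true
      is-saved = any-intro f₀ (any-intro {b = twice e (class Z y) f₀} g₀ (∧-intro (∧-intro ef₀ class-f₀) (∧-intro (∧-intro eg₀ class-g₀) (not-intro (≢⇒== (λ q → f₀≢g₀ (sym q)))))))
        where
        class-f₀ = in-class f₀ g₀ ef₀ (not-elim (∧-snd {nbr W e f₀} (∧-fst {nbr W e f₀ ∧ not (Z f₀)} ok₀))) (∧-fst {y f₀} (∧-fst {y f₀ ∧ y g₀} alone₀))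
          (λ h n h≢f h≢g → quiet h h≢f h≢g (∨-inr {nbr W e h} (∨-inl n))) apart
        class-g₀ = in-class g₀ f₀ eg₀ (not-elim (∧-snd {nbr W e g₀} (∧-fst {nbr W e g₀ ∧ not (Z g₀)} (∧-snd {nbr W e f₀ ∧ not (Z f₀)} ok₀)))) (∧-snd {y f₀} (∧-fst {y f₀ ∧ y g₀} alone₀))
          (λ h n h≢g h≢f → quiet h h≢f h≢g (∨-inr {nbr W e h} (∨-inr {nbr W f₀ h} n))) (trans (adj-sym g₀ f₀) apart)

    σ = Γ * (p²/2 * ℚ.½)

    -- At least `Γ` ordered pairs are hit with probability p²/2 each, and these events overlap at
    -- most twice.
    𝔼-saved : ∀ Z e → T e ≡ true → # (λ f → nbr W e f ∧ Z f) ℕ.≤ z₀ → σ ≤ 𝔼 (λ y → 𝟙 (saved e (class Z y)))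
    𝔼-saved Z e Te used = *-cancel-≤ (0<ι 1) (begin
      ι 2 * (Γ * (p²/2 * ℚ.½)) ≡⟨ ring-126 Γ p²/2 ⟩
      Γ * p²/2 ≤⟨ *-monoˡ 0≤p²/2 (pairs Z e Te used) ⟩
      ∑ (λ f → ∑ (λ g → 𝟙 (ok Z e f g))) * p²/2 ≡⟨ sym (trans (∑-cong (λ f → ∑-*ʳ p²/2 (λ g → 𝟙 (ok Z e f g)))) (∑-*ʳ p²/2 (λ f → ∑ (λ g → 𝟙 (ok Z e f g))))) ⟩
      ∑ (λ f → ∑ (λ g → 𝟙 (ok Z e f g) * p²/2)) ≤⟨ ∑-mono (λ f → ∑-mono (λ g → 𝟙-guard (ok Z e f g) (each f g))) ⟩
      ∑ (λ f → ∑ (λ g → 𝟙 (ok Z e f g) * 𝔼 (λ y → ∏ (λ h → factor e f g h (y h))))) ≤⟨ ∑-mono (λ f → ∑-mono (λ g → *-monoʳ (0≤𝟙 (ok Z e f g)) (𝔼-mono (∏≤alone e f g)))) ⟩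
      ∑ (λ f → ∑ (λ g → 𝟙 (ok Z e f g) * 𝔼 (λ y → 𝟙 (alone e f g y)))) ≡⟨ ∑-cong (λ f → trans (∑-cong (λ g → sym (𝔼-* (𝟙 (ok Z e f g)) (λ y → 𝟙 (alone e f g y)))))
          (sym (𝔼-∑ (λ g y → 𝟙 (ok Z e f g) * 𝟙 (alone e f g y))))) ⟩
      ∑ (λ f → 𝔼 (λ y → ∑ (λ g → 𝟙 (ok Z e f g) * 𝟙 (alone e f g y)))) ≡⟨ sym (𝔼-∑ (λ f y → ∑ (λ g → 𝟙 (ok Z e f g) * 𝟙 (alone e f g y)))) ⟩
      𝔼 (λ y → ∑ (λ f → ∑ (λ g → 𝟙 (ok Z e f g) * 𝟙 (alone e f g y)))) ≤⟨ 𝔼-mono (λ y → ≤-trans (≤-reflexive (∑-cong (λ f → ∑-cong (λ g → sym (𝟙-∧ (ok Z e f g) (alone e f g y)))))) (∑hit≤ Z y e)) ⟩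
      𝔼 (λ y → ι 2 * 𝟙 (saved e (class Z y))) ≡⟨ 𝔼-* (ι 2) (λ y → 𝟙 (saved e (class Z y))) ⟩
      ι 2 * 𝔼 (λ y → 𝟙 (saved e (class Z y))) ∎)
      where
      open ℚₚ.≤-Reasoning
      each : ∀ f g → ok Z e f g ≡ true → p²/2 ≤ 𝔼 (λ y → ∏ (λ h → factor e f g h (y h)))
      each f g q = 𝔼-alone e f g (T⊆W e Te) (nbr-W e f (∧-fst {nbr W e f} (∧-fst {nbr W e f ∧ not (Z f)} q)))
        (nbr-W e g (∧-fst {nbr W e g} (∧-fst {nbr W e g ∧ not (Z g)} (∧-snd {nbr W e f ∧ not (Z f)} q)))) (ok-≢ Z e f g q)

    -- The mean is the product of the factors 1 + p over the neighbours. Multiplied by the product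
    -- of 1 - p, it is at most 1, and the latter is at least 1 - pD ≥ 5/6, so 6/5 is an upper bound.
    𝔼-2^ : ∀ e → W e ≡ true → 𝔼 (λ y → ι 2 ^ (# (λ f → nbr W e f ∧ y f))) ≤ ω
    𝔼-2^ e We = begin
      𝔼 (λ y → ι 2 ^ (# (λ f → nbr W e f ∧ y f))) ≤⟨ 𝔼-mono (λ y → ≤-reflexive (2^# (λ f → nbr W e f ∧ y f))) ⟩
      𝔼 (λ y → ∏ (λ f → 1ℚ + 𝟙 (nbr W e f ∧ y f))) ≡⟨ 𝔼-∏ (λ f b → 1ℚ + 𝟙 (nbr W e f ∧ b)) ⟩
      ∏ (λ f → (1ℚ - p) * (1ℚ + 𝟙 (nbr W e f ∧ false)) + p * (1ℚ + 𝟙 (nbr W e f ∧ true))) ≡⟨ ∏-cong (λ f → mean (nbr W e f)) ⟩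
      ∏ up ≤⟨ *-cancel-≤ (0<ι 4) (begin
        ι 5 * ∏ up ≤⟨ *-monoˡ (0≤∏ 0≤up) five ⟩
        ι 6 * (1ℚ - ∑ (λ f → p * 𝟙 (nbr W e f))) * ∏ up ≤⟨ *-monoˡ (0≤∏ 0≤up) (*-monoʳ (0≤ι 6) (weierstrass (λ f → 0≤* 0≤p (0≤𝟙 (nbr W e f))) p𝟙≤1)) ⟩
        ι 6 * ∏ (λ f → 1ℚ - p * 𝟙 (nbr W e f)) * ∏ up ≡⟨ trans (*-assoc (ι 6) (∏ (λ f → 1ℚ - p * 𝟙 (nbr W e f))) (∏ up)) (cong (ι 6 *_) (sym (∏-* (λ f → 1ℚ - p * 𝟙 (nbr W e f)) up))) ⟩
        ι 6 * ∏ (λ f → (1ℚ - p * 𝟙 (nbr W e f)) * up f) ≤⟨ *-monoʳ (0≤ι 6) (∏≤1 (λ f → 0≤* (0≤- (p𝟙≤1 f)) (0≤up f))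
            (λ f → ≤-by (p * 𝟙 (nbr W e f) * (p * 𝟙 (nbr W e f))) (ring-72 (p * 𝟙 (nbr W e f))) (0≤* (0≤p𝟙 f) (0≤p𝟙 f)))) ⟩
        ι 6 * 1ℚ ≡⟨ trans (*-identityʳ (ι 6)) (sym 5ω≡6) ⟩
        ι 5 * ω ∎) ⟩
      ω ∎
      where
      open ℚₚ.≤-Reasoning
      up : Fin m → ℚ
      up f = 1ℚ + p * 𝟙 (nbr W e f)
      0≤p𝟙 : ∀ f → 0ℚ ≤ p * 𝟙 (nbr W e f)
      0≤p𝟙 f = 0≤* 0≤p (0≤𝟙 (nbr W e f))
      0≤up : ∀ f → 0ℚ ≤ up f
      0≤up f = 0≤+ 0≤1 (0≤p𝟙 f)
      p𝟙≤1 : ∀ f → p * 𝟙 (nbr W e f) ≤ 1ℚ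
      p𝟙≤1 f = ≤-trans (*-monoʳ 0≤p (𝟙≤1 (nbr W e f))) (≤-trans (≤-reflexive (*-identityʳ p)) p≤1)
      mean : ∀ b → (1ℚ - p) * (1ℚ + 𝟙 (b ∧ false)) + p * (1ℚ + 𝟙 (b ∧ true)) ≡ 1ℚ + p * 𝟙 b
      mean true = ring-123 p
      mean false = ring-124 p
      five : ι 5 ≤ ι 6 * (1ℚ - ∑ (λ f → p * 𝟙 (nbr W e f)))
      five = ≤-by ((1ℚ - ι 6 * (p * D)) + ι 6 * (p * (D - deg W e))) (trans (cong (λ t → ι 6 * (1ℚ - t)) (∑-*ˡ p (𝟙 ∘ nbr W e))) (ring-125 p D (deg W e)))
        (0≤+ (0≤- 6pD≤1) (0≤* (0≤ι 6) (0≤* 0≤p (0≤- (deg≤D e We)))))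

    module _ (S₀ : ℕ) (ω≥0 : 0ℚ ≤ ω) (σ≤1 : σ ≤ 1ℚ) where

      τ = 1ℚ - ℚ.½ * σ
      0≤τ : 0ℚ ≤ τ
      0≤τ = 0≤- (≤-trans (*-monoʳ 0≤½ σ≤1) (≤-trans (≤-reflexive (*-identityʳ ℚ.½)) ½≤1))

      used : (Fin m → Bool) → Fin m → ℕ
      used Z e = # (λ f → nbr W e f ∧ Z f)

      -- With t classes still to come, two dangers at e are weighed: each saving halves the first
      -- part, which reaches 1 if the final number is below `S₀`; each used neighbour doubles the
      -- second, which reaches 1 if more than `z₀` are used. `τ` and `ω` bound the expected factors
      -- per class.
      Φ : ℕ → (Fin m → Bool) → (Fin m → ℕ) → ℚ
      Φ t Z S = ∑ (λ e → 𝟙 (T e) * (ι 2 ^ S₀ * τ ^ t * ℚ.½ ^ S e + ℚ.½ ^ z₀ * ω ^ t * ι 2 ^ used Z e))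

      0≤A : ∀ t (S : Fin m → ℕ) (e : Fin m) → 0ℚ ≤ ι 2 ^ S₀ * τ ^ t * ℚ.½ ^ S e
      0≤A t S e = 0≤* (0≤* (0≤^ S₀ (0≤ι 2)) (0≤^ t 0≤τ)) (0≤^ (S e) 0≤½)

      0≤B : ∀ t (Z : Fin m → Bool) (e : Fin m) → 0ℚ ≤ ℚ.½ ^ z₀ * ω ^ t * ι 2 ^ used Z e
      0≤B t Z e = 0≤* (0≤* (0≤^ z₀ 0≤½) (0≤^ t ω≥0)) (0≤^ (used Z e) (0≤ι 2))

      Φ-term : ∀ t Z S → Φ t Z S < 1ℚ → ∀ e → T e ≡ true → ι 2 ^ S₀ * τ ^ t * ℚ.½ ^ S e + ℚ.½ ^ z₀ * ω ^ t * ι 2 ^ used Z e < 1ℚ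
      Φ-term t Z S Φ<1 e Te = ≤-<-trans (≤-trans (≤-reflexive (trans (sym (*-identityˡ _)) (cong (λ b → 𝟙 b * (ι 2 ^ S₀ * τ ^ t * ℚ.½ ^ S e + ℚ.½ ^ z₀ * ω ^ t * ι 2 ^ used Z e)) (sym Te))))
        (term≤∑ (λ e → 0≤* (0≤𝟙 (T e)) (0≤+ (0≤A t S e) (0≤B t Z e))) e)) Φ<1

      -- Since ω ≥ 1, the second part of the potential keeps the used neighbours below z₀.
      used≤z₀ : 1ℚ ≤ ω → ∀ t Z S → Φ t Z S < 1ℚ → ∀ e → T e ≡ true → used Z e ℕ.≤ z₀
      used≤z₀ 1≤ω t Z S Φ<1 e Te with used Z e ℕ.≤? z₀
      ... | yes p = p
      ... | no ¬p = ⊥-elim (≤⇒≯ big (Φ-term t Z S Φ<1 e Te))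
        where
        open ℚₚ.≤-Reasoning
        big : 1ℚ ≤ ι 2 ^ S₀ * τ ^ t * ℚ.½ ^ S e + ℚ.½ ^ z₀ * ω ^ t * ι 2 ^ used Z e
        big = begin
          1ℚ ≡⟨ sym (½^2^ z₀) ⟩
          ℚ.½ ^ z₀ * ι 2 ^ z₀ ≤⟨ *-mono (0≤^ z₀ 0≤½) (≤-trans (≤-reflexive (sym (*-identityʳ (ℚ.½ ^ z₀)))) (*-monoʳ (0≤^ z₀ 0≤½) (1≤^ t 1≤ω)))
              (0≤^ z₀ (0≤ι 2)) (^-monoʳ (ι-mono {1} {2} (s≤s z≤n)) (ℕₚ.<⇒≤ (ℕₚ.≰⇒> ¬p))) ⟩
          ℚ.½ ^ z₀ * ω ^ t * ι 2 ^ used Z e ≤⟨ ≤-by (ι 2 ^ S₀ * τ ^ t * ℚ.½ ^ S e) (+-comm (ι 2 ^ S₀ * τ ^ t * ℚ.½ ^ S e) (ℚ.½ ^ z₀ * ω ^ t * ι 2 ^ used Z e)) (0≤A t S e) ⟩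
          ι 2 ^ S₀ * τ ^ t * ℚ.½ ^ S e + ℚ.½ ^ z₀ * ω ^ t * ι 2 ^ used Z e ∎

      S₀≤ : ∀ Z S → Φ 0 Z S < 1ℚ → ∀ e → T e ≡ true → S₀ ℕ.≤ S e
      S₀≤ Z S Φ<1 e Te with S₀ ℕ.≤? S e
      ... | yes p = p
      ... | no ¬p = ⊥-elim (≤⇒≯ big (Φ-term 0 Z S Φ<1 e Te))
        where
        open ℚₚ.≤-Reasoning
        big : 1ℚ ≤ ι 2 ^ S₀ * 1ℚ * ℚ.½ ^ S e + ℚ.½ ^ z₀ * 1ℚ * ι 2 ^ used Z e
        big = begin
          1ℚ ≡⟨ sym (½^2^ S₀) ⟩
          ℚ.½ ^ S₀ * ι 2 ^ S₀ ≤⟨ *-monoˡ (0≤^ S₀ (0≤ι 2)) (½^-antitone (ℕₚ.<⇒≤ (ℕₚ.≰⇒> ¬p))) ⟩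
          ℚ.½ ^ S e * ι 2 ^ S₀ ≡⟨ trans (*-comm (ℚ.½ ^ S e) (ι 2 ^ S₀)) (cong (_* ℚ.½ ^ S e) (sym (*-identityʳ (ι 2 ^ S₀)))) ⟩
          ι 2 ^ S₀ * 1ℚ * ℚ.½ ^ S e ≤⟨ ≤-by (ℚ.½ ^ z₀ * 1ℚ * ι 2 ^ used Z e) refl (0≤B 0 Z e) ⟩
          ι 2 ^ S₀ * 1ℚ * ℚ.½ ^ S e + ℚ.½ ^ z₀ * 1ℚ * ι 2 ^ used Z e ∎

      b→ℕ : Bool → ℕ
      b→ℕ true = 1
      b→ℕ false = 0

      next : (Fin m → Bool) → (Fin m → Bool) → Fin m → Bool
      next Z M f = Z f ∨ M f

      -- Used neighbours are overestimated by all selected neighbours, whether or not they enter the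
      -- class, because only these are independent. The factor for savings is 1 - ½ with probability
      -- at least `σ`, hence `τ` on average.
      advance : 1ℚ ≤ ω → ∀ t Z S → Φ (suc t) Z S < 1ℚ →
        Σ (Fin m → Bool) λ y → Φ t (next Z (class Z y)) (λ e → b→ℕ (saved e (class Z y)) ℕ.+ S e) < 1ℚ
      advance 1≤ω t Z S Φ<1 = y , ≤-<-trans (≤-trans (pointwise y) (≤-trans (proj₂ best) mean)) Φ<1
        where
        open ℚₚ.≤-Reasoning
        α β : Fin m → ℚ
        α e = ι 2 ^ S₀ * τ ^ t * ℚ.½ ^ S e
        β e = ℚ.½ ^ z₀ * ω ^ t * ι 2 ^ used Z e
        F : (Fin m → Bool) → ℚ
        F y = ∑ (λ e → 𝟙 (T e) * α e + (0ℚ - 𝟙 (T e) * α e * ℚ.½) * 𝟙 (saved e (class Z y)) + 𝟙 (T e) * β e * ι 2 ^ (# (λ f → nbr W e f ∧ y f)))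
        best = attained F
        y = proj₁ best
        pointwise : ∀ y → Φ t (next Z (class Z y)) (λ e → b→ℕ (saved e (class Z y)) ℕ.+ S e) ≤ F y
        pointwise y = ∑-mono each
          where
          each : ∀ e → 𝟙 (T e) * (ι 2 ^ S₀ * τ ^ t * ℚ.½ ^ (b→ℕ (saved e (class Z y)) ℕ.+ S e) + ℚ.½ ^ z₀ * ω ^ t * ι 2 ^ used (next Z (class Z y)) e) ≤
            𝟙 (T e) * α e + (0ℚ - 𝟙 (T e) * α e * ℚ.½) * 𝟙 (saved e (class Z y)) + 𝟙 (T e) * β e * ι 2 ^ (# (λ f → nbr W e f ∧ y f))
          each e = begin
            𝟙 (T e) * (ι 2 ^ S₀ * τ ^ t * ℚ.½ ^ (b→ℕ (saved e (class Z y)) ℕ.+ S e) + ℚ.½ ^ z₀ * ω ^ t * ι 2 ^ used (next Z (class Z y)) e)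
              ≤⟨ *-monoʳ (0≤𝟙 (T e)) (+-mono-≤ (≤-reflexive (halve (saved e (class Z y)) (ι 2 ^ S₀ * τ ^ t) (S e))) (*-monoʳ (0≤* (0≤^ z₀ 0≤½) (0≤^ t ω≥0)) grow)) ⟩
            𝟙 (T e) * (α e * (1ℚ - ℚ.½ * 𝟙 (saved e (class Z y))) + ℚ.½ ^ z₀ * ω ^ t * (ι 2 ^ used Z e * ι 2 ^ (# (λ f → nbr W e f ∧ y f))))
              ≡⟨ ring-111 (𝟙 (T e)) (α e) (𝟙 (saved e (class Z y))) (ℚ.½ ^ z₀ * ω ^ t) (ι 2 ^ used Z e) (ι 2 ^ (# (λ f → nbr W e f ∧ y f))) ⟩
            𝟙 (T e) * α e + (0ℚ - 𝟙 (T e) * α e * ℚ.½) * 𝟙 (saved e (class Z y)) + 𝟙 (T e) * β e * ι 2 ^ (# (λ f → nbr W e f ∧ y f)) ∎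
            where
            halve : ∀ b c k → c * ℚ.½ ^ (b→ℕ b ℕ.+ k) ≡ c * ℚ.½ ^ k * (1ℚ - ℚ.½ * 𝟙 b)
            halve true c k = ring-109 c (ℚ.½ ^ k)
            halve false c k = ring-110 c (ℚ.½ ^ k)
            grow : ι 2 ^ used (next Z (class Z y)) e ≤ ι 2 ^ used Z e * ι 2 ^ (# (λ f → nbr W e f ∧ y f))
            grow = ≤-trans (^-monoʳ (ι-mono {1} {2} (s≤s z≤n)) (ℕₚ.≤-trans (#-mono (λ f → split f)) (#-∨ (λ f → nbr W e f ∧ Z f) (λ f → nbr W e f ∧ y f))))
              (≤-reflexive (^-+ (ι 2) (used Z e) (# (λ f → nbr W e f ∧ y f))))
              where
              split : ∀ f → nbr W e f ∧ (Z f ∨ class Z y f) ≡ true → (nbr W e f ∧ Z f) ∨ (nbr W e f ∧ y f) ≡ true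
              split f q with ∨-elim {Z f} (∧-snd {nbr W e f} q)
              ... | inj₁ z = ∨-inl (∧-intro (∧-fst {nbr W e f} q) z)
              ... | inj₂ c = ∨-inr {nbr W e f ∧ Z f} (∧-intro (∧-fst {nbr W e f} q) (∧-fst {y f} (∧-snd {W f ∧ not (Z f)} c)))
        mean : 𝔼 F ≤ Φ (suc t) Z S
        mean = begin
          𝔼 F ≡⟨ 𝔼-∑ (λ e y → 𝟙 (T e) * α e + (0ℚ - 𝟙 (T e) * α e * ℚ.½) * 𝟙 (saved e (class Z y)) + 𝟙 (T e) * β e * ι 2 ^ (# (λ f → nbr W e f ∧ y f))) ⟩
          ∑ (λ e → 𝔼 (λ y → 𝟙 (T e) * α e + (0ℚ - 𝟙 (T e) * α e * ℚ.½) * 𝟙 (saved e (class Z y)) + 𝟙 (T e) * β e * ι 2 ^ (# (λ f → nbr W e f ∧ y f))))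
            ≡⟨ ∑-cong linear ⟩
          ∑ (λ e → 𝟙 (T e) * α e + (0ℚ - 𝟙 (T e) * α e * ℚ.½) * 𝔼 (λ y → 𝟙 (saved e (class Z y))) + 𝟙 (T e) * β e * 𝔼 (λ y → ι 2 ^ (# (λ f → nbr W e f ∧ y f))))
            ≤⟨ ∑-mono (λ e → ≤-trans (≤-reflexive (ring-113 (𝟙 (T e)) (α e) (𝔼 (λ y → 𝟙 (saved e (class Z y)))) (β e) (𝔼 (λ y → ι 2 ^ (# (λ f → nbr W e f ∧ y f))))))
                (≤-trans (𝟙-guard (T e) (bound e)) (≤-reflexive (cong (𝟙 (T e) *_) (cong₂ _+_ (ring-114 (ι 2 ^ S₀) (τ ^ t) (ℚ.½ ^ S e) τ) (ring-114 (ℚ.½ ^ z₀) (ω ^ t) (ι 2 ^ used Z e) ω)))))) ⟩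
          Φ (suc t) Z S ∎
          where
          bound : ∀ e → T e ≡ true → α e * (1ℚ - ℚ.½ * 𝔼 (λ y → 𝟙 (saved e (class Z y)))) + β e * 𝔼 (λ y → ι 2 ^ (# (λ f → nbr W e f ∧ y f))) ≤ α e * τ + β e * ω
          bound e Te = +-mono-≤ (*-monoʳ {α e} (0≤A t S e) (≤-by {1ℚ - ℚ.½ * 𝔼 (λ y → 𝟙 (saved e (class Z y)))} (ℚ.½ * (𝔼 (λ y → 𝟙 (saved e (class Z y))) - σ)) (ring-112 σ (𝔼 (λ y → 𝟙 (saved e (class Z y)))))
              (0≤* 0≤½ (0≤- (𝔼-saved Z e Te (used≤z₀ 1≤ω (suc t) Z S Φ<1 e Te)))))) (*-monoʳ (0≤B t Z e) (𝔼-2^ e (T⊆W e Te)))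
          linear : ∀ e → 𝔼 (λ y → 𝟙 (T e) * α e + (0ℚ - 𝟙 (T e) * α e * ℚ.½) * 𝟙 (saved e (class Z y)) + 𝟙 (T e) * β e * ι 2 ^ (# (λ f → nbr W e f ∧ y f))) ≡
            𝟙 (T e) * α e + (0ℚ - 𝟙 (T e) * α e * ℚ.½) * 𝔼 (λ y → 𝟙 (saved e (class Z y))) + 𝟙 (T e) * β e * 𝔼 (λ y → ι 2 ^ (# (λ f → nbr W e f ∧ y f)))
          linear e = trans (𝔼-+ (λ y → 𝟙 (T e) * α e + (0ℚ - 𝟙 (T e) * α e * ℚ.½) * 𝟙 (saved e (class Z y))) (λ y → 𝟙 (T e) * β e * ι 2 ^ (# (λ f → nbr W e f ∧ y f))))
            (cong₂ _+_ (trans (𝔼-+ (λ y → 𝟙 (T e) * α e) (λ y → (0ℚ - 𝟙 (T e) * α e * ℚ.½) * 𝟙 (saved e (class Z y))))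
              (cong₂ _+_ (𝔼-const m (𝟙 (T e) * α e)) (𝔼-* (0ℚ - 𝟙 (T e) * α e * ℚ.½) (λ y → 𝟙 (saved e (class Z y))))))
              (𝔼-* (𝟙 (T e) * β e) (λ y → ι 2 ^ (# (λ f → nbr W e f ∧ y f)))))

      record Classes (t : ℕ) (Z : Fin m → Bool) (S : Fin m → ℕ) : Set where
        field
          member      : Fin t → Fin m → Bool
          inside      : ∀ c f → member c f ≡ true → (W f ≡ true) × (Z f ≡ false)
          independent : ∀ c f g → member c f ≡ true → member c g ≡ true → f ≢ g → adj f g ≡ false
          disjoint    : ∀ c d f → member c f ≡ true → member d f ≡ true → c ≡ d
          savings     : ∀ e → T e ≡ true → S₀ ℕ.≤ S e ℕ.+ # (λ c → saved e (member c))

      #-suc : ∀ {k} (b : Fin (suc k) → Bool) → # b ≡ b→ℕ (b zero) ℕ.+ # (b ∘ suc)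
      #-suc b with b zero
      ... | true = refl
      ... | false = refl

      prepend : ∀ t Z S y → Classes t (next Z (class Z y)) (λ e → b→ℕ (saved e (class Z y)) ℕ.+ S e) → Classes (suc t) Z S
      prepend t Z S y rest = record { member = member ; inside = inside ; independent = independent ; disjoint = disjoint ; savings = savings }
        where
        M = class Z y
        open Classes rest
          renaming (member to member′; inside to inside′; independent to independent′; disjoint to disjoint′; savings to savings′)
        member : Fin (suc t) → Fin m → Bool
        member zero = M
        member (suc c) = member′ c
        fresh : ∀ c f → member′ c f ≡ true → (Z f ≡ false) × (M f ≡ false)
        fresh c f p = ≡false (λ q → true≢false (∨-inl q) (proj₂ (inside′ c f p))) , ≡false (λ q → true≢false (∨-inr {Z f} q) (proj₂ (inside′ c f p)))
        inside : ∀ c f → member c f ≡ true → (W f ≡ true) × (Z f ≡ false)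
        inside zero f p = ∧-fst {W f} (∧-fst {W f ∧ not (Z f)} p) , not-elim (∧-snd {W f} (∧-fst {W f ∧ not (Z f)} p))
        inside (suc c) f p = proj₁ (inside′ c f p) , proj₁ (fresh c f p)
        independent : ∀ c f g → member c f ≡ true → member c g ≡ true → f ≢ g → adj f g ≡ false
        independent (suc c) f g p q f≢g = independent′ c f g p q f≢g
        independent zero f g p q f≢g = ≡false (λ fg → true≢false
          (∧-intro (∧-intro (∧-fst {W g} (∧-fst {W g ∧ not (Z g)} q)) (∧-intro (not-intro (≢⇒== (λ r → f≢g (sym r)))) fg)) (∧-fst {y g} (∧-snd {W g ∧ not (Z g)} q)))
          (any-false {b = λ h → nbr W f h ∧ y h} (not-elim (∧-snd {y f} (∧-snd {W f ∧ not (Z f)} p))) g))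
        disjoint : ∀ c d f → member c f ≡ true → member d f ≡ true → c ≡ d
        disjoint zero zero f p q = refl
        disjoint zero (suc d) f p q = ⊥-elim (true≢false p (proj₂ (fresh d f q)))
        disjoint (suc c) zero f p q = ⊥-elim (true≢false q (proj₂ (fresh c f p)))
        disjoint (suc c) (suc d) f p q = cong suc (disjoint′ c d f p q)
        savings : ∀ e → T e ≡ true → S₀ ℕ.≤ S e ℕ.+ # (λ c → saved e (member c))
        savings e Te = ℕₚ.≤-trans (savings′ e Te) (ℕₚ.≤-reflexive (trans (ring-n26 (b→ℕ (saved e M)) (S e) (# (λ c → saved e (member′ c))))
          (cong (S e ℕ.+_) (sym (#-suc (λ c → saved e (member c)))))))

      classes : 1ℚ ≤ ω → ∀ t Z S → Φ t Z S < 1ℚ → Classes t Z S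
      classes 1≤ω zero Z S Φ<1 = record { member = λ () ; inside = λ () ; independent = λ () ; disjoint = λ ()
        ; savings = λ e Te → ℕₚ.≤-trans (S₀≤ Z S Φ<1 e Te) (ℕₚ.m≤m+n (S e) 0) }
      classes 1≤ω (suc t) Z S Φ<1 = continue (advance 1≤ω t Z S Φ<1)
        where
        continue : (Σ (Fin m → Bool) λ y → Φ t (next Z (class Z y)) (λ e → b→ℕ (saved e (class Z y)) ℕ.+ S e) < 1ℚ) → Classes (suc t) Z S
        continue (y , Φ′<1) = prepend t Z S y (classes 1≤ω t (next Z (class Z y)) (λ e → b→ℕ (saved e (class Z y)) ℕ.+ S e) Φ′<1)

-- Locally saturated linear hypergraphs

leq : ℚ → ℚ → Bool
leq x y with x ≤? y
... | yes _ = true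
... | no _ = false

leq-elim : ∀ x y → leq x y ≡ true → x ≤ y
leq-elim x y p with x ≤? y
... | yes q = q
... | no _ = case p of λ ()

leq-false : ∀ x y → leq x y ≡ false → y < x
leq-false x y p with x ≤? y
... | yes _ = case p of λ ()
... | no ¬q = ≰⇒> ¬q

∑-guard-mono : ∀ {n} (b : Fin n → Bool) {f g : Fin n → ℚ} → (∀ i → b i ≡ true → f i ≤ g i) → ∑ (λ i → 𝟙 (b i) * f i) ≤ ∑ (λ i → 𝟙 (b i) * g i)
∑-guard-mono b h = ∑-mono (λ i → 𝟙-guard (b i) (h i))

module Degrees {n m} (inc : Fin m → Fin n → Bool) (lin : Linearᴮ inc) where
  open Linearᴮ lin
  open Incidence inc
  open ListColouring {m} {0} adj adj-sym using (deg; nbr)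

  N : ℚ
  N = ι n

  sz : Fin m → ℚ
  sz e = ι (size e)

  dg : (Fin m → Bool) → Fin n → ℚ
  dg F v = ∑ (λ f → 𝟙 (inc f v ∧ F f))

  -- The number of ordered pairs of distinct vertices covered by the edges of F; in a linear
  -- hypergraph each pair is covered at most once.
  vol : (Fin m → Bool) → ℚ
  vol F = ∑ (λ f → 𝟙 (F f) * (sz f * (sz f - 1ℚ)))

  0≤dg : ∀ F v → 0ℚ ≤ dg F v
  0≤dg F v = 0≤∑ (λ f → 0≤𝟙 (inc f v ∧ F f))

  dg-mono : ∀ {F G} v → (∀ e → F e ≡ true → G e ≡ true) → dg F v ≤ dg G v
  dg-mono {F} {G} v h = ∑-mono (λ f → 𝟙-mono (λ p → ∧-intro (∧-fst {inc f v} p) (h f (∧-snd {inc f v} p))))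

  deg≤∑dg : ∀ F e → deg F e ≤ ∑ (λ v → 𝟙 (inc e v) * dg F v)
  deg≤∑dg F e = ≤-trans (deg≤ inc F e) (≤-reflexive (∑-cong (λ v → cong (𝟙 (inc e v) *_) (ι# (λ f → inc f v ∧ F f)))))

  ∑sz : ∀ F → ∑ (λ f → 𝟙 (F f) * sz f) ≡ ∑ (dg F)
  ∑sz F = trans (∑-cong (λ f → trans (cong (𝟙 (F f) *_) (ι# (inc f))) (trans (sym (∑-*ˡ (𝟙 (F f)) (𝟙 ∘ inc f)))
      (∑-cong (λ v → trans (*-comm (𝟙 (F f)) (𝟙 (inc f v))) (sym (𝟙-∧ (inc f v) (F f))))))))
    (∑-swap (λ f v → 𝟙 (inc f v ∧ F f)))

  -- The edges of F through v are disjoint outside v, so they meet a vertex set G at most #G times there.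
  packing : ∀ (F : Fin m → Bool) v (G : Fin n → Bool) → ∑ (λ f → 𝟙 (inc f v ∧ F f) * ∑ (λ u → 𝟙 (not (u == v) ∧ (inc f u ∧ G u)))) ≤ ∑ (𝟙 ∘ G)
  packing F v G = begin
    ∑ (λ f → 𝟙 (inc f v ∧ F f) * ∑ (λ u → 𝟙 (not (u == v) ∧ (inc f u ∧ G u)))) ≡⟨ ∑-cong (λ f → sym (∑-*ˡ (𝟙 (inc f v ∧ F f)) (λ u → 𝟙 (not (u == v) ∧ (inc f u ∧ G u))))) ⟩
    ∑ (λ f → ∑ (λ u → 𝟙 (inc f v ∧ F f) * 𝟙 (not (u == v) ∧ (inc f u ∧ G u)))) ≡⟨ ∑-cong (λ f → ∑-cong (λ u → sym (𝟙-∧ (inc f v ∧ F f) (not (u == v) ∧ (inc f u ∧ G u))))) ⟩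
    ∑ (λ f → ∑ (λ u → 𝟙 (both f u))) ≡⟨ ∑-swap (λ f u → 𝟙 (both f u)) ⟩
    ∑ (λ u → ∑ (λ f → 𝟙 (both f u))) ≤⟨ ∑-mono column ⟩
    ∑ (𝟙 ∘ G) ∎
    where
    open ℚₚ.≤-Reasoning
    both : Fin m → Fin n → Bool
    both f u = (inc f v ∧ F f) ∧ (not (u == v) ∧ (inc f u ∧ G u))
    column : ∀ u → ∑ (λ f → 𝟙 (both f u)) ≤ 𝟙 (G u)
    column u with bool (any (λ f → both f u))
    ... | inj₂ none = ≤-trans (≤-reflexive (trans (∑-cong (λ f → cong 𝟙 (any-false {b = λ f → both f u} none f))) (∑-0 m))) (0≤𝟙 (G u))
    ... | inj₁ some with any-elim {b = λ f → both f u} some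
    ...   | g , p = ≤-trans (∑-mono (λ f → 𝟙-mono {both f u} {g == f} (same f))) (≤-reflexive (trans (trans (∑-cong (λ f → sym (*-identityʳ (𝟙 (g == f))))) (∑-δ g (λ _ → 1ℚ))) (cong 𝟙 (sym Gu))))
      where
      Gu : G u ≡ true
      Gu = ∧-snd {inc g u} (∧-snd {not (u == v)} (∧-snd {inc g v ∧ F g} p))
      same : ∀ f → both f u ≡ true → (g == f) ≡ true
      same f r with ≡⊎≢ g f
      ... | inj₁ refl = ==-refl g
      ... | inj₂ g≢f = ⊥-elim (linear g f u v g≢f (==false⇒≢ u v (not-elim (∧-fst {not (u == v)} (∧-snd {inc g v ∧ F g} p))))
        (∧-fst {inc g u} (∧-snd {not (u == v)} (∧-snd {inc g v ∧ F g} p))) (∧-fst {inc g v} (∧-fst {inc g v ∧ F g} p))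
        (∧-fst {inc f u} (∧-snd {not (u == v)} (∧-snd {inc f v ∧ F f} r))) (∧-fst {inc f v} (∧-fst {inc f v ∧ F f} r)))

  others : ∀ f v (G : Fin n → Bool) → ∑ (λ u → 𝟙 (inc f u ∧ G u)) - 1ℚ ≤ ∑ (λ u → 𝟙 (not (u == v) ∧ (inc f u ∧ G u)))
  others f v G = ≤-by ((1ℚ + ∑ (λ u → 𝟙 (not (u == v) ∧ (inc f u ∧ G u)))) - ∑ (λ u → 𝟙 (inc f u ∧ G u)))
    (ring-133 (∑ (λ u → 𝟙 (inc f u ∧ G u))) (∑ (λ u → 𝟙 (not (u == v) ∧ (inc f u ∧ G u)))))
    (0≤- (≤-trans (∑-mono pt) (≤-reflexive (trans (∑-+ (λ u → 𝟙 (v == u) * 1ℚ) (λ u → 𝟙 (not (u == v) ∧ (inc f u ∧ G u)))) (cong (_+ ∑ (λ u → 𝟙 (not (u == v) ∧ (inc f u ∧ G u)))) (∑-δ v (λ _ → 1ℚ)))))))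
    where
    pt : ∀ u → 𝟙 (inc f u ∧ G u) ≤ 𝟙 (v == u) * 1ℚ + 𝟙 (not (u == v) ∧ (inc f u ∧ G u))
    pt u = subst (λ b → 𝟙 (inc f u ∧ G u) ≤ 𝟙 b * 1ℚ + 𝟙 (not (u == v) ∧ (inc f u ∧ G u))) (==-sym u v) (go (u == v) (inc f u ∧ G u))
      where
      go : ∀ a b → 𝟙 b ≤ 𝟙 a * 1ℚ + 𝟙 (not a ∧ b)
      go true b = 𝟙≤1 b
      go false b = ≤-reflexive (sym (+-identityˡ (𝟙 b)))

  star : ∀ (F : Fin m → Bool) v → ∑ (λ f → 𝟙 (inc f v ∧ F f) * (sz f - 1ℚ)) ≤ N
  star F v = begin
    ∑ (λ f → 𝟙 (inc f v ∧ F f) * (sz f - 1ℚ)) ≤⟨ ∑-guard-mono (λ f → inc f v ∧ F f) (λ f _ → ≤-trans (≤-reflexive (cong (_- 1ℚ) (trans (ι# (inc f)) (∑-cong (λ u → cong 𝟙 (∧-true (inc f u))))))) (others f v (λ _ → true))) ⟩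
    ∑ (λ f → 𝟙 (inc f v ∧ F f) * ∑ (λ u → 𝟙 (not (u == v) ∧ (inc f u ∧ true)))) ≤⟨ packing F v (λ _ → true) ⟩
    ∑ {n} (λ _ → 1ℚ) ≡⟨ trans (∑-const n 1ℚ) (*-identityʳ N) ⟩
    N ∎
    where
    open ℚₚ.≤-Reasoning
    ∧-true : ∀ b → b ≡ b ∧ true
    ∧-true true = refl
    ∧-true false = refl

  vol≤ : ∀ F → vol F ≤ N * N
  vol≤ F = begin
    ∑ (λ f → 𝟙 (F f) * (sz f * (sz f - 1ℚ))) ≡⟨ ∑-cong (λ f → trans (ring-16 (𝟙 (F f)) (sz f) (sz f - 1ℚ)) (trans (cong (_* (𝟙 (F f) * (sz f - 1ℚ))) (ι# (inc f)))
        (trans (sym (∑-*ʳ (𝟙 (F f) * (sz f - 1ℚ)) (𝟙 ∘ inc f))) (∑-cong (λ v → trans (sym (*-assoc (𝟙 (inc f v)) (𝟙 (F f)) (sz f - 1ℚ))) (cong (_* (sz f - 1ℚ)) (sym (𝟙-∧ (inc f v) (F f))))))))) ⟩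
    ∑ (λ f → ∑ (λ v → 𝟙 (inc f v ∧ F f) * (sz f - 1ℚ))) ≡⟨ ∑-swap (λ f v → 𝟙 (inc f v ∧ F f) * (sz f - 1ℚ)) ⟩
    ∑ (λ v → ∑ (λ f → 𝟙 (inc f v ∧ F f) * (sz f - 1ℚ))) ≤⟨ ∑-mono (star F) ⟩
    ∑ {n} (λ _ → N) ≡⟨ ∑-const n N ⟩
    N * N ∎
    where
    open ℚₚ.≤-Reasoning

  vol-mono : ∀ {A B : Fin m → Bool} → (∀ f → A f ≡ true → B f ≡ true) → (∀ f → B f ≡ true → 1ℚ ≤ sz f) → vol A ≤ vol B
  vol-mono {A} {B} A⊆B 1≤sz = ∑-mono pt
    where
    pt : ∀ f → 𝟙 (A f) * (sz f * (sz f - 1ℚ)) ≤ 𝟙 (B f) * (sz f * (sz f - 1ℚ))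
    pt f = go (bool (B f))
      where
      go : B f ≡ true ⊎ B f ≡ false → 𝟙 (A f) * (sz f * (sz f - 1ℚ)) ≤ 𝟙 (B f) * (sz f * (sz f - 1ℚ))
      go (inj₁ p) = *-monoˡ (0≤* (0≤ι (size f)) (0≤- (1≤sz f p))) (𝟙-mono (A⊆B f))
      go (inj₂ p) = ≤-reflexive (cong (λ b → 𝟙 b * (sz f * (sz f - 1ℚ))) (trans (≡false (λ a → true≢false (A⊆B f a) p)) (sym p)))

  module MinSize (F : Fin m → Bool) (k : ℕ) (k≤ : ∀ e → F e ≡ true → k ℕ.≤ size e) (ε : ℚ) (0≤ε : 0ℚ ≤ ε) (ε≤1 : ε ≤ 1ℚ) (2≤εk : ι 2 ≤ ε * ι k) where
    K = ι k
    0≤K : 0ℚ ≤ K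
    0≤K = 0≤ι k
    0<K : 0ℚ < K
    0<K = <-≤-trans (0<ι 1) (≤-trans 2≤εk (≤-trans (*-monoˡ 0≤K ε≤1) (≤-reflexive (*-identityˡ K))))
    -- Replaces the K - 1 of the star estimate by K at the cost of 1 + ε; this is what εK ≥ 2 is
    -- for.
    K≤ : K ≤ (1ℚ + ε) * (K - 1ℚ)
    K≤ = ≤-by ((ε * K - ι 2) + (1ℚ - ε)) (ring-130 K ε) (0≤+ (0≤- 2≤εk) (0≤- ε≤1))
    0≤1+ε : 0ℚ ≤ 1ℚ + ε
    0≤1+ε = 0≤+ 0≤1 0≤ε

    large : ℚ → Fin m → Bool
    large t f = F f ∧ leq ((1ℚ + t) * K) (sz f)

    -- K d(v) + tK x(v) ≤ (1+ε)N, where x(v) counts the edges at v of size at least (1+t)K.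
    local : ∀ v t → 0ℚ ≤ t → K * dg F v + t * (K * dg (large t) v) ≤ (1ℚ + ε) * N
    local v t 0≤t = ≤-trans (+-mono-≤ (*-monoˡ (0≤dg F v) K≤) (≤-by (ε * (t * (K * dg (large t) v))) (ring-131 ε (t * (K * dg (large t) v))) (0≤* 0≤ε (0≤* 0≤t (0≤* 0≤K (0≤dg (large t) v))))))
      (≤-trans (≤-reflexive (ring-132 (1ℚ + ε) (K - 1ℚ) (dg F v) (t * (K * dg (large t) v)))) (*-monoʳ 0≤1+ε (≤-trans main (star F v))))
      where
      main : (K - 1ℚ) * dg F v + t * (K * dg (large t) v) ≤ ∑ (λ f → 𝟙 (inc f v ∧ F f) * (sz f - 1ℚ))
      main = ≤-trans (≤-reflexive (trans (cong₂ _+_ (sym (∑-*ˡ (K - 1ℚ) (λ f → 𝟙 (inc f v ∧ F f)))) (trans (sym (*-assoc t K (dg (large t) v))) (sym (∑-*ˡ (t * K) (λ f → 𝟙 (inc f v ∧ large t f))))))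
        (sym (∑-+ (λ f → (K - 1ℚ) * 𝟙 (inc f v ∧ F f)) (λ f → t * K * 𝟙 (inc f v ∧ large t f)))))) (∑-mono pt)
        where
        pt : ∀ f → (K - 1ℚ) * 𝟙 (inc f v ∧ F f) + t * K * 𝟙 (inc f v ∧ large t f) ≤ 𝟙 (inc f v ∧ F f) * (sz f - 1ℚ)
        pt f = go (bool (inc f v)) (bool (F f)) (bool (leq ((1ℚ + t) * K) (sz f)))
          where
          expr : Bool → Bool → Bool → Set
          expr a b c = (K - 1ℚ) * 𝟙 (a ∧ b) + t * K * 𝟙 (a ∧ (b ∧ c)) ≤ 𝟙 (a ∧ b) * (sz f - 1ℚ)
          goal : ∀ {a b c} → inc f v ≡ a → F f ≡ b → leq ((1ℚ + t) * K) (sz f) ≡ c → expr a b c → expr (inc f v) (F f) (leq ((1ℚ + t) * K) (sz f))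
          goal {a} {b} {c} p q r h = subst₂ (λ a b → expr a b (leq ((1ℚ + t) * K) (sz f))) (sym p) (sym q) (subst (expr a b) (sym r) h)
          go : inc f v ≡ true ⊎ inc f v ≡ false → F f ≡ true ⊎ F f ≡ false → leq ((1ℚ + t) * K) (sz f) ≡ true ⊎ leq ((1ℚ + t) * K) (sz f) ≡ false →
            expr (inc f v) (F f) (leq ((1ℚ + t) * K) (sz f))
          go (inj₂ p) _ _ = goal p refl refl (≤-reflexive (ring-129 K t (sz f)))
          go (inj₁ p) (inj₂ q) _ = goal p q refl (≤-reflexive (ring-129 K t (sz f)))
          go (inj₁ p) (inj₁ q) (inj₁ r) = goal p q r (≤-trans (≤-by (sz f - (1ℚ + t) * K) (ring-127 K t (sz f)) (0≤- (leq-elim ((1ℚ + t) * K) (sz f) r))) (≤-reflexive (sym (*-identityˡ (sz f - 1ℚ)))))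
          go (inj₁ p) (inj₁ q) (inj₂ r) = goal p q r (≤-trans (≤-by (sz f - K) (ring-128 K t (sz f)) (0≤- (ι-mono (k≤ f q)))) (≤-reflexive (sym (*-identityˡ (sz f - 1ℚ)))))

    Kdg≤ : ∀ v → K * dg F v ≤ (1ℚ + ε) * N
    Kdg≤ v = ≤-trans (≤-by (0ℚ * (K * dg (large 0ℚ) v)) refl (0≤* ≤-refl (0≤* 0≤K (0≤dg (large 0ℚ) v)))) (local v 0ℚ ≤-refl)

    Kdeg≤ : ∀ e → K * deg F e ≤ sz e * ((1ℚ + ε) * N)
    Kdeg≤ e = begin
      K * deg F e ≤⟨ *-monoʳ 0≤K (deg≤∑dg F e) ⟩
      K * ∑ (λ v → 𝟙 (inc e v) * dg F v) ≡⟨ trans (sym (∑-*ˡ K (λ v → 𝟙 (inc e v) * dg F v))) (∑-cong (λ v → ring-16 K (𝟙 (inc e v)) (dg F v))) ⟩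
      ∑ (λ v → 𝟙 (inc e v) * (K * dg F v)) ≤⟨ ∑-mono (λ v → *-monoʳ (0≤𝟙 (inc e v)) (Kdg≤ v)) ⟩
      ∑ (λ v → 𝟙 (inc e v) * ((1ℚ + ε) * N)) ≡⟨ trans (∑-*ʳ ((1ℚ + ε) * N) (𝟙 ∘ inc e)) (cong (_* ((1ℚ + ε) * N)) (sym (ι# (inc e)))) ⟩
      sz e * ((1ℚ + ε) * N) ∎
      where
      open ℚₚ.≤-Reasoning

-- If every edge of F meets nearly N edges of F, then the edges of nearly minimum size cover nearly all pairs.
module Saturated {n m} (inc : Fin m → Fin n → Bool) (lin : Linearᴮ inc) (F : Fin m → Bool) (k : ℕ) (e₀ : Fin m)
  (size≡ : Incidence.size inc e₀ ≡ k) (Fe₀ : F e₀ ≡ true) (k≤ : ∀ e → F e ≡ true → k ℕ.≤ Incidence.size inc e)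
  (q : ℚ) (0<q : 0ℚ < q) (10q≤1 : ι 10 * q ≤ 1ℚ) (2≤q⁵k : ι 2 ≤ q * (q * (q * (q * q))) * ι k) (0<N : 0ℚ < ι n)
  (saturated : ∀ e → F e ≡ true → (1ℚ - q * (q * (q * (q * q)))) * ι n ≤ ListColouring.deg {m} {0} (Incidence.adj inc) (Incidence.adj-sym inc) F e) where
  open Incidence inc
  open ListColouring {m} {0} adj adj-sym using (deg; nbr)
  open Degrees inc lin

  0≤q = <⇒≤ 0<q
  q≤1 : q ≤ 1ℚ
  q≤1 = ≤-trans (≤-trans (≤-reflexive (sym (*-identityˡ q))) (*-monoˡ 0≤q (ι-mono {1} {10} (s≤s z≤n)))) 10q≤1
  0≤1-q = 0≤- q≤1
  q² = q * q
  q³ = q * q²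
  q⁴ = q * q³
  q⁵ = q * q⁴
  0≤q² = 0≤* 0≤q 0≤q
  0≤q³ = 0≤* 0≤q 0≤q²
  0≤q⁴ = 0≤* 0≤q 0≤q³
  0≤q⁵ : 0ℚ ≤ q⁵
  0≤q⁵ = 0≤* 0≤q 0≤q⁴
  q*≤ : ∀ {x} → 0ℚ ≤ x → q * x ≤ x
  q*≤ {x} 0≤x = ≤-trans (*-monoˡ 0≤x q≤1) (≤-reflexive (*-identityˡ x))
  q³≤q² : q³ ≤ q²
  q³≤q² = q*≤ 0≤q²
  q²≤q : q² ≤ q
  q²≤q = q*≤ 0≤q
  q⁵≤q⁴ : q⁵ ≤ q⁴
  q⁵≤q⁴ = q*≤ 0≤q⁴
  q³≤q = ≤-trans q³≤q² q²≤q
  q⁴≤q = ≤-trans (q*≤ 0≤q³) q³≤q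
  q⁵≤q = ≤-trans q⁵≤q⁴ q⁴≤q
  q⁵≤q² : q⁵ ≤ q²
  q⁵≤q² = ≤-trans q⁵≤q⁴ (≤-trans (q*≤ 0≤q³) q³≤q²)

  open MinSize F k k≤ q⁵ 0≤q⁵ (≤-trans q⁵≤q q≤1) 2≤q⁵k public

  0≤N = <⇒≤ 0<N

  small-edges : ℚ → Fin m → Bool
  small-edges t f = F f ∧ not (leq ((1ℚ + t) * K) (sz f))

  small-size : ∀ t f → small-edges t f ≡ true → sz f < (1ℚ + t) * K
  small-size t f p = leq-false ((1ℚ + t) * K) (sz f) (not-elim (∧-snd {F f} p))

  dg-split : ∀ t v → dg F v ≡ dg (small-edges t) v + dg (large t) v
  dg-split t v = trans (∑-cong (λ f → pt (inc f v) (F f) (leq ((1ℚ + t) * K) (sz f)))) (∑-+ (λ f → 𝟙 (inc f v ∧ small-edges t f)) (λ f → 𝟙 (inc f v ∧ large t f)))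
    where
    pt : ∀ a b c → 𝟙 (a ∧ b) ≡ 𝟙 (a ∧ (b ∧ not c)) + 𝟙 (a ∧ (b ∧ c))
    pt true true true = refl
    pt true true false = refl
    pt true false _ = refl
    pt false _ _ = refl

  -- A vertex of nearly full degree leaves only (q⁵ + a)N in `local` for t times the contribution of
  -- the large edges, which is therefore at most yN. The pairs (t, a) = (q³, q⁴) and (q, q²) are
  -- used, both with y = 2q.
  many-small : ∀ t a y v → 0ℚ < t → (1ℚ - a) * N ≤ K * dg F v → q⁵ + a ≤ t * y → (1ℚ - a - y) * N ≤ K * dg (small-edges t) v
  many-small t a y v 0<t heavy ty = ≤-by ((K * dg F v - (1ℚ - a) * N) + (y * N - K * dg (large t) v)) (trans (ring-166 (K * dg (small-edges t) v) (K * dg (large t) v) a y N)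
      (cong (λ x → (1ℚ - a - y) * N + ((x - (1ℚ - a) * N) + (y * N - K * dg (large t) v))) (sym (trans (cong (K *_) (dg-split t v)) (*-distribˡ-+ K _ _)))))
    (0≤+ (0≤- heavy) (0≤- (*-cancel-≤ 0<t (begin
      t * (K * dg (large t) v) ≤⟨ ≤-by (((1ℚ + q⁵) * N - (K * dg F v + t * (K * dg (large t) v))) + (K * dg F v - (1ℚ - a) * N)) (ring-167 (t * (K * dg (large t) v)) q⁵ N (K * dg F v) a)
          (0≤+ (0≤- (local v t (<⇒≤ 0<t))) (0≤- heavy)) ⟩
      (q⁵ + a) * N ≤⟨ *-monoˡ 0≤N ty ⟩
      t * y * N ≡⟨ *-assoc t y N ⟩
      t * (y * N) ∎))))
    where
    open ℚₚ.≤-Reasoning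

  K[1-q⁵]≤ : ∀ e → F e ≡ true → (1ℚ - q⁵) * N * K ≤ ∑ (λ v → 𝟙 (inc e v) * (K * dg F v))
  K[1-q⁵]≤ e Fe = ≤-trans (*-monoˡ 0≤K (≤-trans (saturated e Fe) (deg≤∑dg F e))) (≤-reflexive (trans (sym (∑-*ʳ K (λ v → 𝟙 (inc e v) * dg F v))) (∑-cong (λ v → ring-168 K (𝟙 (inc e v)) (dg F v)))))

  -- The smallest edge has exactly K vertices, and over them K times the degree averages at least (1
  -- - q⁵)N; a vertex at or above the average exists with room to spare, as q⁵ < q⁴.
  centre : Σ (Fin n) λ v → (1ℚ - q⁴) * N ≤ K * dg F v
  centre = locate (∑<∑⇒∃< {f = λ v → 𝟙 (inc e₀ v) * ((1ℚ - q⁴) * N)} {λ v → 𝟙 (inc e₀ v) * (K * dg F v)} (<-≤-trans below (K[1-q⁵]≤ e₀ Fe₀)))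
    where
    open ℚₚ.≤-Reasoning
    0<q⁴ : 0ℚ < q⁴
    0<q⁴ = 0<* 0<q (0<* 0<q (0<* 0<q 0<q))
    q<1 : q < 1ℚ
    q<1 = <-≤-trans (<-by (ι 9 * q) (ring-148 q) (0<* (0<ι 8) 0<q)) 10q≤1
    below : ∑ (λ v → 𝟙 (inc e₀ v) * ((1ℚ - q⁴) * N)) < (1ℚ - q⁵) * N * K
    below = begin-strict
      ∑ (λ v → 𝟙 (inc e₀ v) * ((1ℚ - q⁴) * N)) ≡⟨ trans (∑-*ʳ ((1ℚ - q⁴) * N) (𝟙 ∘ inc e₀)) (cong (_* ((1ℚ - q⁴) * N)) (trans (sym (ι# (inc e₀))) (cong ι size≡))) ⟩
      K * ((1ℚ - q⁴) * N) <⟨ <-by (K * N * (q⁴ * (1ℚ - q))) (ring-169 K q q⁴ N) (0<* (0<* 0<K 0<N) (0<* 0<q⁴ (0<- q<1))) ⟩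
      (1ℚ - q⁵) * N * K ∎
    locate : (Σ (Fin n) λ v → 𝟙 (inc e₀ v) * ((1ℚ - q⁴) * N) < 𝟙 (inc e₀ v) * (K * dg F v)) → Σ (Fin n) λ v → (1ℚ - q⁴) * N ≤ K * dg F v
    locate (v , lt) = v , <⇒≤ (unguard (inc e₀ v) lt)
      where
      unguard : ∀ b {x y} → 𝟙 b * x < 𝟙 b * y → x < y
      unguard true lt = *-cancel-< 0<1 lt
      unguard false {x} {y} lt = ⊥-elim (<-irrefl refl (subst₂ _<_ (*-zeroˡ x) (*-zeroˡ y) lt))

  good : Fin n → Bool
  good u = leq ((1ℚ - q²) * N) (K * dg F u)

  -- A reverse Markov inequality. For an edge of size close to K the mean of K times the degree is
  -- close to the maximum (1 + q⁵)N, and every vertex that is not good lies q²N below N; so there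
  -- are few of those.
  good-in-edge : ∀ f → F f ≡ true → sz f ≤ (1ℚ + q³) * K → (1ℚ - ι 2 * q) * K ≤ ∑ (λ u → 𝟙 (inc f u ∧ good u))
  good-in-edge f Ff sz≤ = *-cancel-≤ (0<* (0<* (0<* 0<q 0<q) 0<N) (0<+ 0<1 0≤q³)) (begin
    q² * N * (1ℚ + q³) * ((1ℚ - ι 2 * q) * K) ≤⟨ ≤-by (q² * N * K * ((q - q³) + ι 2 * (q * q³))) (ring-170 q² N q³ q K) (0≤* (0≤* (0≤* 0≤q² 0≤N) 0≤K) (0≤+ (0≤- q³≤q) (0≤* (0≤ι 2) 0≤q⁴))) ⟩
    (q² - q³) * N * K ≡⟨ ring-171 q N K ⟩
    (1ℚ - q⁵) * N * K - (1ℚ + q³) * K * ((1ℚ - q²) * N) ≤⟨ -mono (K[1-q⁵]≤ f Ff) (*-monoˡ (0≤* (0≤- (≤-trans q²≤q q≤1)) 0≤N) sz≤) ⟩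
    ∑ (λ v → 𝟙 (inc f v) * (K * dg F v)) - sz f * ((1ℚ - q²) * N) ≤⟨ -mono (∑-mono split) ≤-refl ⟩
    ∑ (λ v → 𝟙 (inc f v) * ((1ℚ - q²) * N) + 𝟙 (inc f v ∧ good v) * ((q² + q⁵) * N)) - sz f * ((1ℚ - q²) * N)
      ≡⟨ trans (cong (_- sz f * ((1ℚ - q²) * N)) (trans (∑-+ (λ v → 𝟙 (inc f v) * ((1ℚ - q²) * N)) (λ v → 𝟙 (inc f v ∧ good v) * ((q² + q⁵) * N)))
           (cong₂ _+_ (trans (∑-*ʳ ((1ℚ - q²) * N) (𝟙 ∘ inc f)) (cong (_* ((1ℚ - q²) * N)) (sym (ι# (inc f))))) (∑-*ʳ ((q² + q⁵) * N) (λ v → 𝟙 (inc f v ∧ good v))))))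
           (ring-172 (sz f * ((1ℚ - q²) * N)) (∑ (λ v → 𝟙 (inc f v ∧ good v))) q N) ⟩
    q² * N * (1ℚ + q³) * ∑ (λ u → 𝟙 (inc f u ∧ good u)) ∎)
    where
    open ℚₚ.≤-Reasoning
    -mono : ∀ {a b c d} → a ≤ b → d ≤ c → a - c ≤ b - d
    -mono {a} {b} {c} {d} p r = ≤-by ((b - a) + (c - d)) (ring-91 a b c d) (0≤+ (0≤- p) (0≤- r))
    split : ∀ v → 𝟙 (inc f v) * (K * dg F v) ≤ 𝟙 (inc f v) * ((1ℚ - q²) * N) + 𝟙 (inc f v ∧ good v) * ((q² + q⁵) * N)
    split v = ≤-trans (*-monoʳ (0≤𝟙 (inc f v)) pt) (≤-reflexive (trans (ring-149 (𝟙 (inc f v)) ((1ℚ - q²) * N) (𝟙 (good v)) ((q² + q⁵) * N))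
        (cong (λ x → 𝟙 (inc f v) * ((1ℚ - q²) * N) + x * ((q² + q⁵) * N)) (sym (𝟙-∧ (inc f v) (good v))))))
      where
      pt : K * dg F v ≤ (1ℚ - q²) * N + 𝟙 (good v) * ((q² + q⁵) * N)
      pt = go (bool (good v))
        where
        go : good v ≡ true ⊎ good v ≡ false → K * dg F v ≤ (1ℚ - q²) * N + 𝟙 (good v) * ((q² + q⁵) * N)
        go (inj₁ p) = ≤-trans (Kdg≤ v) (≤-reflexive (trans (ring-150 N q² q⁵) (cong (λ b → (1ℚ - q²) * N + 𝟙 b * ((q² + q⁵) * N)) (sym p))))
        go (inj₂ p) = ≤-trans (<⇒≤ (leq-false ((1ℚ - q²) * N) (K * dg F v) p)) (≤-reflexive (trans (ring-151 ((1ℚ - q²) * N) ((q² + q⁵) * N)) (cong (λ b → (1ℚ - q²) * N + 𝟙 b * ((q² + q⁵) * N)) (sym p))))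

  r = 1ℚ - ι 3 * q
  0≤r : 0ℚ ≤ r
  0≤r = 0≤- (≤-trans (*-monoˡ 0≤q (ι-mono {3} {10} (s≤s (s≤s (s≤s z≤n))))) 10q≤1)

  1≤qK : 1ℚ ≤ q * K
  1≤qK = ≤-trans (ι-mono {1} {2} (s≤s z≤n)) (≤-trans 2≤q⁵k (*-monoˡ 0≤K q⁵≤q))

  -- The edges of size below (1 + q³)K through the centre number at least rN/K and are disjoint
  -- elsewhere. Each contains at least rK good vertices besides the centre, which is itself covered
  -- by 1 ≤ qK.
  good≥ : r * (r * N) ≤ ∑ (𝟙 ∘ good)
  good≥ = from centre
    where
    open ℚₚ.≤-Reasoning
    from : (Σ (Fin n) λ v → (1ℚ - q⁴) * N ≤ K * dg F v) → r * (r * N) ≤ ∑ (𝟙 ∘ good)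
    from (v , heavy) = begin
      r * (r * N) ≤⟨ *-monoʳ 0≤r (≤-trans (*-monoˡ 0≤N (≤-by {r} (q - q⁴) (ring-152 q q⁴) (0≤- q⁴≤q))) (many-small q³ q⁴ (ι 2 * q) v (0<* 0<q (0<* 0<q 0<q)) heavy
          (≤-by (q⁴ - q⁵) (ring-153 q) (0≤- q⁵≤q⁴)))) ⟩
      r * (K * dg (small-edges q³) v) ≡⟨ trans (ring-154 r K (dg (small-edges q³) v)) (sym (∑-*ʳ (r * K) (λ f → 𝟙 (inc f v ∧ small-edges q³ f)))) ⟩
      ∑ (λ f → 𝟙 (inc f v ∧ small-edges q³ f) * (r * K)) ≤⟨ ∑-guard-mono (λ f → inc f v ∧ small-edges q³ f) (λ f p → each f (∧-snd {inc f v} p)) ⟩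
      ∑ (λ f → 𝟙 (inc f v ∧ small-edges q³ f) * ∑ (λ u → 𝟙 (not (u == v) ∧ (inc f u ∧ good u)))) ≤⟨ packing (small-edges q³) v good ⟩
      ∑ (𝟙 ∘ good) ∎
      where
      each : ∀ f → small-edges q³ f ≡ true → r * K ≤ ∑ (λ u → 𝟙 (not (u == v) ∧ (inc f u ∧ good u)))
      each f p = ≤-trans (≤-by ((∑ (λ u → 𝟙 (inc f u ∧ good u)) - (1ℚ - ι 2 * q) * K) + (q * K - 1ℚ)) (ring-136 (∑ (λ u → 𝟙 (inc f u ∧ good u))) q K)
        (0≤+ (0≤- (good-in-edge f (∧-fst {F f} p) (<⇒≤ (small-size q³ f p)))) (0≤- 1≤qK))) (others f v good)

  W : Fin m → Bool
  W = small-edges q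

  W-size : ∀ f → W f ≡ true → sz f < (1ℚ + q) * K
  W-size = small-size q

  -- At each of the r²N good vertices the edges of size below (1 + q)K account for rN, and r³ ≥ 1 -
  -- 9q.
  W-total : (1ℚ - ι 9 * q) * (N * N) ≤ K * ∑ (λ f → 𝟙 (W f) * sz f)
  W-total = begin
    (1ℚ - ι 9 * q) * (N * N) ≤⟨ ≤-by (ι 27 * (q² * (1ℚ - q)) * (N * N)) (ring-173 q N) (0≤* (0≤* (0≤ι 27) (0≤* 0≤q² 0≤1-q)) (0≤* 0≤N 0≤N)) ⟩
    r * (r * N) * (r * N) ≤⟨ *-monoˡ (0≤* 0≤r 0≤N) good≥ ⟩
    ∑ (𝟙 ∘ good) * (r * N) ≡⟨ sym (∑-*ʳ (r * N) (𝟙 ∘ good)) ⟩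
    ∑ (λ u → 𝟙 (good u) * (r * N)) ≤⟨ ∑-mono (λ u → ≤-trans (𝟙-guard (good u) (λ p → ≤-trans (*-monoˡ 0≤N (≤-by {r} (q - q²) (ring-152 q q²) (0≤- q²≤q)))
        (many-small q q² (ι 2 * q) u 0<q (leq-elim ((1ℚ - q²) * N) (K * dg F u) p) (≤-by (q² - q⁵) (ring-174 q²  q⁵ q) (0≤- q⁵≤q²)))))
        (≤-trans (*-monoˡ (0≤* 0≤K (0≤dg W u)) (𝟙≤1 (good u))) (≤-reflexive (*-identityˡ (K * dg W u))))) ⟩
    ∑ (λ u → K * dg W u) ≡⟨ trans (∑-*ˡ K (dg W)) (cong (K *_) (sym (∑sz W))) ⟩
    K * ∑ (λ f → 𝟙 (W f) * sz f) ∎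
    where
    open ℚₚ.≤-Reasoning

  W⊆F : ∀ f → W f ≡ true → F f ≡ true
  W⊆F f = ∧-fst {F f}

  W-volume : (1ℚ - ι 10 * q) * (N * N) ≤ vol W
  W-volume = *-cancel-≤ (0<+ 0<1 0≤q⁵) (begin
    (1ℚ + q⁵) * ((1ℚ - ι 10 * q) * (N * N)) ≤⟨ ≤-by (((q - q⁵) + ι 10 * (q * q⁵)) * (N * N)) (ring-175 q q⁵ (N * N)) (0≤* (0≤+ (0≤- q⁵≤q) (0≤* (0≤ι 10) (0≤* 0≤q 0≤q⁵))) (0≤* 0≤N 0≤N)) ⟩
    (1ℚ - ι 9 * q) * (N * N) ≤⟨ W-total ⟩
    K * ∑ (λ f → 𝟙 (W f) * sz f) ≤⟨ *-monoˡ (0≤∑ (λ f → 0≤* (0≤𝟙 (W f)) (0≤ι (size f)))) K≤ ⟩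
    (1ℚ + q⁵) * (K - 1ℚ) * ∑ (λ f → 𝟙 (W f) * sz f) ≡⟨ trans (*-assoc (1ℚ + q⁵) (K - 1ℚ) (∑ (λ f → 𝟙 (W f) * sz f))) (cong ((1ℚ + q⁵) *_) (sym (∑-*ˡ (K - 1ℚ) (λ f → 𝟙 (W f) * sz f)))) ⟩
    (1ℚ + q⁵) * ∑ (λ f → (K - 1ℚ) * (𝟙 (W f) * sz f)) ≤⟨ *-monoʳ (0≤+ 0≤1 0≤q⁵) (∑-mono (λ f → ≤-trans (≤-reflexive (ring-176 (K - 1ℚ) (𝟙 (W f)) (sz f)))
        (𝟙-guard (W f) (λ p → *-monoʳ (0≤ι (size f)) (+-monoˡ-≤ (- 1ℚ) (ι-mono (k≤ f (W⊆F f p)))))))) ⟩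
    (1ℚ + q⁵) * vol W ∎)
    where
    open ℚₚ.≤-Reasoning

  volume≥ : (1ℚ - ι 10 * q) * (N * N) ≤ vol F
  volume≥ = ≤-trans W-volume (vol-mono W⊆F (λ f Ff → ≤-trans 1≤qK (≤-trans (q*≤ 0≤K) (ι-mono (k≤ f Ff)))))

  -- K² is at most about N, because F has nearly N edges of size at least K.
  K²≤ : (1ℚ - q⁵) * (K * K) ≤ (1ℚ + q⁵) * N
  K²≤ = *-cancel-≤ 0<N (begin
    N * ((1ℚ - q⁵) * (K * K)) ≡⟨ ring-177 N (1ℚ - q⁵) K ⟩
    (1ℚ - q⁵) * N * (K * K) ≤⟨ *-monoˡ (0≤* 0≤K 0≤K) (≤-trans (saturated e₀ Fe₀) deg≤#) ⟩
    ∑ (𝟙 ∘ F) * (K * K) ≤⟨ *-monoʳ (0≤∑ (0≤𝟙 ∘ F)) (*-monoʳ 0≤K K≤) ⟩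
    ∑ (𝟙 ∘ F) * (K * ((1ℚ + q⁵) * (K - 1ℚ))) ≡⟨ trans (ring-178 (∑ (𝟙 ∘ F)) K (1ℚ + q⁵)) (cong ((1ℚ + q⁵) *_) (sym (∑-*ʳ (K * (K - 1ℚ)) (𝟙 ∘ F)))) ⟩
    (1ℚ + q⁵) * ∑ (λ f → 𝟙 (F f) * (K * (K - 1ℚ))) ≤⟨ *-monoʳ (0≤+ 0≤1 0≤q⁵) (≤-trans (∑-guard-mono F (λ f p → *-mono 0≤K (ι-mono (k≤ f p)) 0≤K-1 (+-monoˡ-≤ (- 1ℚ) (ι-mono (k≤ f p))))) (vol≤ F)) ⟩
    (1ℚ + q⁵) * (N * N) ≡⟨ ring-179 (1ℚ + q⁵) N ⟩
    N * ((1ℚ + q⁵) * N) ∎)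
    where
    open ℚₚ.≤-Reasoning
    0≤K-1 : 0ℚ ≤ K - 1ℚ
    0≤K-1 = 0≤- (≤-trans 1≤qK (q*≤ 0≤K))
    deg≤# : deg F e₀ ≤ ∑ (𝟙 ∘ F)
    deg≤# = ∑-mono (λ f → 𝟙-mono {nbr F e₀ f} (∧-fst {F f}))

  -- The sizes in `W` add up to nearly N²/K and are at most (1 + q)K each; since K² is at most about
  -- N, nearly N edges are needed.
  #W≥ : (1ℚ - q⁵) * ((1ℚ - ι 9 * q) * N) ≤ (1ℚ + q) * ((1ℚ + q⁵) * ∑ (𝟙 ∘ W))
  #W≥ = *-cancel-≤ 0<N (begin
    N * ((1ℚ - q⁵) * ((1ℚ - ι 9 * q) * N)) ≡⟨ ring-180 N (1ℚ - q⁵) (1ℚ - ι 9 * q) ⟩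
    (1ℚ - q⁵) * ((1ℚ - ι 9 * q) * (N * N)) ≤⟨ *-monoʳ 0≤1-q⁵ W-total ⟩
    (1ℚ - q⁵) * (K * ∑ (λ f → 𝟙 (W f) * sz f)) ≤⟨ *-monoʳ 0≤1-q⁵ (*-monoʳ 0≤K (∑-guard-mono W (λ f p → <⇒≤ (W-size f p)))) ⟩
    (1ℚ - q⁵) * (K * ∑ (λ f → 𝟙 (W f) * ((1ℚ + q) * K))) ≡⟨ trans (cong (λ t → (1ℚ - q⁵) * (K * t)) (∑-*ʳ ((1ℚ + q) * K) (𝟙 ∘ W))) (ring-181 (1ℚ - q⁵) K (∑ (𝟙 ∘ W)) (1ℚ + q)) ⟩
    (1ℚ - q⁵) * (K * K) * ((1ℚ + q) * ∑ (𝟙 ∘ W)) ≤⟨ *-monoˡ (0≤* (0≤+ 0≤1 0≤q) (0≤∑ (0≤𝟙 ∘ W))) K²≤ ⟩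
    (1ℚ + q⁵) * N * ((1ℚ + q) * ∑ (𝟙 ∘ W)) ≡⟨ ring-182 (1ℚ + q⁵) N (1ℚ + q) (∑ (𝟙 ∘ W)) ⟩
    N * ((1ℚ + q) * ((1ℚ + q⁵) * ∑ (𝟙 ∘ W))) ∎)
    where
    open ℚₚ.≤-Reasoning
    0≤1-q⁵ = 0≤- (≤-trans q⁵≤q q≤1)

  10q⁵≤q : ι 10 * q⁵ ≤ q
  10q⁵≤q = ≤-trans (≤-trans (*-monoʳ (0≤ι 10) q⁵≤q²) (≤-reflexive (sym (*-assoc (ι 10) q q)))) (≤-trans (*-monoˡ 0≤q 10q≤1) (≤-reflexive (*-identityˡ q)))

  -- The sizes of W lie in the middle range as soon as K does, but W is too big for that.
  not-middle : ∀ δ → ι 10 * q ≤ δ → 0ℚ < δ → (1ℚ - δ) * (1ℚ - δ) * N ≤ K * K →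
    (∀ V → (∀ f → V f ≡ true → F f ≡ true) → (∀ f → V f ≡ true → ((1ℚ - δ) * (1ℚ - δ) * N ≤ sz f * sz f) × (sz f * sz f ≤ (1ℚ + δ) * (1ℚ + δ) * N)) →
      ∑ (𝟙 ∘ V) ≤ (1ℚ - ι 3 * δ) * N) → ⊥
  not-middle δ 10q≤δ 0<δ mid few = ≤⇒≯ (≤-trans #W≥ (*-monoʳ 0≤1+q (*-monoʳ (0≤+ 0≤1 0≤q⁵) (few W W⊆F range)))) gap
    where
    open ℚₚ.≤-Reasoning
    0≤1+q = 0≤+ 0≤1 0≤q
    p = q⁵
    10p≤1 : ι 10 * p ≤ 1ℚ
    10p≤1 = ≤-trans 10q⁵≤q q≤1
    2q≤δ : ι 2 * q ≤ δ
    2q≤δ = ≤-trans (*-monoˡ 0≤q (ι-mono {2} {10} (s≤s (s≤s z≤n)))) 10q≤δ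
    upper : (1ℚ + q) * (1ℚ + q) * (K * K) ≤ (1ℚ + δ) * (1ℚ + δ) * N
    upper = *-cancel-≤ (0<- (≤-<-trans q⁵≤q (<-≤-trans (<-by (ι 9 * q) (ring-148 q) (0<* (0<ι 8) 0<q)) 10q≤1))) (begin
      (1ℚ - p) * ((1ℚ + q) * (1ℚ + q) * (K * K)) ≡⟨ ring-16 (1ℚ - p) ((1ℚ + q) * (1ℚ + q)) (K * K) ⟩
      (1ℚ + q) * (1ℚ + q) * ((1ℚ - p) * (K * K)) ≤⟨ *-monoʳ (0≤* 0≤1+q 0≤1+q) K²≤ ⟩
      (1ℚ + q) * (1ℚ + q) * ((1ℚ + p) * N) ≤⟨ *-cancel-≤ (0<ι 9) (≤-by ((ι 20 * (q - p) + ι 6 * (q * (q - ι 10 * p)) + ι 5 * (q * q * (1ℚ - ι 10 * p)) + ι 19 * (q * q)) * N) (ring-155 q p N)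
          (0≤* (0≤+ (0≤+ (0≤+ (0≤* (0≤ι 20) (0≤- q⁵≤q)) (0≤* (0≤ι 6) (0≤* 0≤q (0≤- 10q⁵≤q)))) (0≤* (0≤ι 5) (0≤* 0≤q² (0≤- 10p≤1)))) (0≤* (0≤ι 19) 0≤q²)) 0≤N)) ⟩
      (1ℚ - p) * ((1ℚ + ι 2 * q) * (1ℚ + ι 2 * q) * N) ≤⟨ *-monoʳ (0≤- (≤-trans q⁵≤q q≤1)) (*-monoˡ 0≤N (*-mono 0≤1+2q (+-monoʳ-≤ 1ℚ 2q≤δ) 0≤1+2q (+-monoʳ-≤ 1ℚ 2q≤δ))) ⟩
      (1ℚ - p) * ((1ℚ + δ) * (1ℚ + δ) * N) ∎)
      where
      0≤1+2q = 0≤+ 0≤1 (0≤* (0≤ι 2) 0≤q)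
    range : ∀ f → W f ≡ true → ((1ℚ - δ) * (1ℚ - δ) * N ≤ sz f * sz f) × (sz f * sz f ≤ (1ℚ + δ) * (1ℚ + δ) * N)
    range f Wf = ≤-trans mid (*-mono 0≤K K≤sz 0≤K K≤sz) , ≤-trans (≤-trans (*-mono (0≤ι (size f)) sz≤ (0≤ι (size f)) sz≤) (≤-reflexive (ring-156 (1ℚ + q) K))) upper
      where
      K≤sz = ι-mono (k≤ f (W⊆F f Wf))
      sz≤ = <⇒≤ (W-size f Wf)
    -- Here the 3δ of the hypothesis on middle sizes is used: with δ ≥ 10q it outweighs all losses
    -- of order q.
    gap : (1ℚ + q) * ((1ℚ + p) * ((1ℚ - ι 3 * δ) * N)) < (1ℚ - p) * ((1ℚ - ι 9 * q) * N)
    gap = <-by ((ι 18 * q + (ι 3 * (δ - ι 10 * q) + ι 2 * (q - p) + ι 3 * (δ * (q + p + q * p)) + ι 8 * (q * p))) * N) (ring-157 q p δ N)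
      (0<* (0<+ (0<* (0<ι 17) 0<q) (0≤+ (0≤+ (0≤+ (0≤* (0≤ι 3) (0≤- 10q≤δ)) (0≤* (0≤ι 2) (0≤- q⁵≤q)))
        (0≤* (0≤ι 3) (0≤* (<⇒≤ 0<δ) (0≤+ (0≤+ 0≤q 0≤q⁵) (0≤* 0≤q 0≤q⁵))))) (0≤* (0≤ι 8) (0≤* 0≤q 0≤q⁵)))) 0<N)

  module Sparse (δ : ℚ) (0<δ : 0ℚ < δ) (3δ≤1 : ι 3 * δ ≤ 1ℚ) (1000q≤δ : ι 1000 * q ≤ δ) (K²-small : K * K ≤ (1ℚ - δ) * (1ℚ - δ) * N) where
    0≤δ = <⇒≤ 0<δ
    δ≤1 : δ ≤ 1ℚ
    δ≤1 = ≤-trans (≤-trans (≤-reflexive (sym (*-identityˡ δ))) (*-monoˡ 0≤δ (ι-mono {1} {3} (s≤s z≤n)))) 3δ≤1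
    100q≤δ : ι 100 * q ≤ δ
    100q≤δ = ≤-trans (*-monoˡ 0≤q (ι-mono (ℕₚ.≤ᵇ⇒≤ 100 1000 tt))) 1000q≤δ
    1≤K = ≤-trans 1≤qK (q*≤ 0≤K)

    K≤N : K ≤ N
    K≤N = ≤-trans (≤-trans (≤-reflexive (sym (*-identityʳ K))) (*-monoʳ 0≤K 1≤K)) (≤-trans K²-small
      (≤-trans (*-monoˡ 0≤N (*-mono (0≤- δ≤1) 1-δ≤1 (0≤- δ≤1) 1-δ≤1)) (≤-reflexive (trans (cong (_* N) (*-identityˡ 1ℚ)) (*-identityˡ N)))))
      where
      1-δ≤1 : 1ℚ - δ ≤ 1ℚ
      1-δ≤1 = ≤-by δ (ring-19 δ) 0≤δ
    1≤qN : 1ℚ ≤ q * N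
    1≤qN = ≤-trans 1≤qK (*-monoʳ 0≤q K≤N)

    W-deg : ∀ e → W e ≡ true → deg F e ≤ (1ℚ + ι 3 * q) * N
    W-deg e We = *-cancel-≤ 0<K (begin
      K * deg F e ≤⟨ Kdeg≤ e ⟩
      sz e * ((1ℚ + q⁵) * N) ≤⟨ *-monoˡ (0≤* (0≤+ 0≤1 0≤q⁵) 0≤N) (<⇒≤ (W-size e We)) ⟩
      (1ℚ + q) * K * ((1ℚ + q⁵) * N) ≤⟨ ≤-by (((q - q⁵) + q * (1ℚ - q⁵)) * (K * N)) (ring-158 q q⁵ K N) (0≤* (0≤+ (0≤- q⁵≤q) (0≤* 0≤q (0≤- (≤-trans q⁵≤q q≤1)))) (0≤* 0≤K 0≤N)) ⟩
      K * ((1ℚ + ι 3 * q) * N) ∎)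
      where
      open ℚₚ.≤-Reasoning

    -- Because K ≥ 1/q, a bound of order N on K times the degree makes each single degree
    -- negligible.
    dg≤2qN : ∀ v → dg W v ≤ ι 2 * q * N
    dg≤2qN v = begin
      dg W v ≤⟨ dg-mono {W} {F} v W⊆F ⟩
      dg F v ≤⟨ ≤-trans (≤-reflexive (sym (*-identityˡ (dg F v)))) (*-monoˡ (0≤dg F v) 1≤qK) ⟩
      q * K * dg F v ≡⟨ *-assoc q K (dg F v) ⟩
      q * (K * dg F v) ≤⟨ *-monoʳ 0≤q (≤-trans (Kdg≤ v) (*-monoˡ 0≤N (+-monoʳ-≤ 1ℚ (≤-trans q⁵≤q q≤1)))) ⟩
      q * ((1ℚ + 1ℚ) * N) ≡⟨ ring-159 q N ⟩
      ι 2 * q * N ∎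
      where
      open ℚₚ.≤-Reasoning

    -- Common neighbours pass through the common vertex or join another vertex of e to another vertex of f.
    common : ∀ e f → e ≢ f → W e ≡ true → W f ≡ true → adj e f ≡ true → ∑ (λ g → 𝟙 (nbr W e g ∧ nbr W f g)) ≤ ((1ℚ - δ) * (1ℚ - δ) + ι 5 * q) * N
    common e f e≢f We Wf ef = through (adj-elim e f ef)
      where
      through : (Σ (Fin n) λ w → (inc e w ≡ true) × (inc f w ≡ true)) → ∑ (λ g → 𝟙 (nbr W e g ∧ nbr W f g)) ≤ ((1ℚ - δ) * (1ℚ - δ) + ι 5 * q) * N
      through (w , ew , fw) = begin
        ∑ (λ g → 𝟙 (nbr W e g ∧ nbr W f g)) ≤⟨ ∑-mono pt ⟩
        ∑ (λ g → 𝟙 (inc g w ∧ W g) + ∑ (λ x → ∑ (λ y → 𝟙 (inc e x) * (𝟙 (inc f y) * 𝟙 (joins x y g)))))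
          ≡⟨ trans (∑-+ (λ g → 𝟙 (inc g w ∧ W g)) (λ g → ∑ (λ x → ∑ (λ y → 𝟙 (inc e x) * (𝟙 (inc f y) * 𝟙 (joins x y g))))))
               (cong (dg W w +_) (trans (∑-swap (λ g x → ∑ (λ y → 𝟙 (inc e x) * (𝟙 (inc f y) * 𝟙 (joins x y g)))))
                 (∑-cong (λ x → trans (∑-swap (λ g y → 𝟙 (inc e x) * (𝟙 (inc f y) * 𝟙 (joins x y g))))
                   (∑-cong (λ y → trans (∑-*ˡ (𝟙 (inc e x)) (λ g → 𝟙 (inc f y) * 𝟙 (joins x y g))) (cong (𝟙 (inc e x) *_) (∑-*ˡ (𝟙 (inc f y)) (λ g → 𝟙 (joins x y g)))))))))) ⟩
        dg W w + ∑ (λ x → ∑ (λ y → 𝟙 (inc e x) * (𝟙 (inc f y) * ∑ (λ g → 𝟙 (joins x y g)))))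
          ≤⟨ +-mono-≤ (dg≤2qN w) (∑-mono (λ x → ∑-mono (λ y → *-monoʳ (0≤𝟙 (inc e x)) (≤-trans (*-monoʳ (0≤𝟙 (inc f y)) (joins≤1 x y)) (≤-reflexive (*-identityʳ (𝟙 (inc f y)))))))) ⟩
        ι 2 * q * N + ∑ (λ x → ∑ (λ y → 𝟙 (inc e x) * 𝟙 (inc f y)))
          ≡⟨ cong (ι 2 * q * N +_) (trans (∑-cong (λ x → ∑-*ˡ (𝟙 (inc e x)) (𝟙 ∘ inc f))) (trans (∑-*ʳ (∑ (𝟙 ∘ inc f)) (𝟙 ∘ inc e)) (sym (cong₂ _*_ (ι# (inc e)) (ι# (inc f)))))) ⟩
        ι 2 * q * N + sz e * sz f ≤⟨ +-monoʳ-≤ (ι 2 * q * N) (≤-trans (*-mono (0≤ι (size e)) (<⇒≤ (W-size e We)) (0≤ι (size f)) (<⇒≤ (W-size f Wf))) (≤-reflexive (ring-137 q K))) ⟩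
        ι 2 * q * N + (1ℚ + q) * (1ℚ + q) * (K * K) ≤⟨ +-monoʳ-≤ (ι 2 * q * N) (*-monoʳ (0≤* (0≤+ 0≤1 0≤q) (0≤+ 0≤1 0≤q)) K²-small) ⟩
        ι 2 * q * N + (1ℚ + q) * (1ℚ + q) * ((1ℚ - δ) * (1ℚ - δ) * N)
          ≤⟨ ≤-by ((q * (1ℚ - q) + ι 2 * (q * (δ * (1ℚ - δ))) + ι 2 * (q * δ) + q * q * (δ * (1ℚ - δ)) + q * q * δ) * N) (ring-138 q δ N)
              (0≤* (0≤+ (0≤+ (0≤+ (0≤+ (0≤* 0≤q 0≤1-q) (0≤* (0≤ι 2) (0≤* 0≤q 0≤δ[1-δ]))) (0≤* (0≤ι 2) (0≤* 0≤q 0≤δ))) (0≤* 0≤q² 0≤δ[1-δ])) (0≤* 0≤q² 0≤δ)) 0≤N) ⟩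
        ((1ℚ - δ) * (1ℚ - δ) + ι 5 * q) * N ∎
        where
        open ℚₚ.≤-Reasoning
        0≤δ[1-δ] = 0≤* 0≤δ (0≤- δ≤1)
        joins : Fin n → Fin n → Fin m → Bool
        joins x y g = not (x == y) ∧ (inc g x ∧ inc g y)
        joins≤1 : ∀ x y → ∑ (λ g → 𝟙 (joins x y g)) ≤ 1ℚ
        joins≤1 x y = bound (bool (any (joins x y)))
          where
          bound : any (joins x y) ≡ true ⊎ any (joins x y) ≡ false → ∑ (λ g → 𝟙 (joins x y g)) ≤ 1ℚ
          bound (inj₂ none) = ≤-trans (≤-reflexive (trans (∑-cong (λ g → cong 𝟙 (any-false {b = joins x y} none g))) (∑-0 m))) 0≤1
          bound (inj₁ some) = at (any-elim {b = joins x y} some)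
            where
            at : (Σ (Fin m) λ g → joins x y g ≡ true) → ∑ (λ g → 𝟙 (joins x y g)) ≤ 1ℚ
            at (g , p) = ≤-trans (∑-mono (λ h → 𝟙-mono {joins x y h} {g == h} (same h))) (≤-reflexive (trans (∑-cong (λ h → sym (*-identityʳ (𝟙 (g == h))))) (∑-δ g (λ _ → 1ℚ))))
              where
              same : ∀ h → joins x y h ≡ true → (g == h) ≡ true
              same h r = decide (≡⊎≢ g h)
                where
                decide : g ≡ h ⊎ g ≢ h → (g == h) ≡ true
                decide (inj₁ refl) = ==-refl g
                decide (inj₂ g≢h) = ⊥-elim (Linearᴮ.linear lin g h x y g≢h (==false⇒≢ x y (not-elim (∧-fst {not (x == y)} p)))
                  (∧-fst {inc g x} (∧-snd {not (x == y)} p)) (∧-snd {inc g x} (∧-snd {not (x == y)} p)) (∧-fst {inc h x} (∧-snd {not (x == y)} r)) (∧-snd {inc h x} (∧-snd {not (x == y)} r)))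
        0≤summand : ∀ g x y → 0ℚ ≤ 𝟙 (inc e x) * (𝟙 (inc f y) * 𝟙 (joins x y g))
        0≤summand g x y = 0≤* (0≤𝟙 (inc e x)) (0≤* (0≤𝟙 (inc f y)) (0≤𝟙 (joins x y g)))
        pt : ∀ g → 𝟙 (nbr W e g ∧ nbr W f g) ≤ 𝟙 (inc g w ∧ W g) + ∑ (λ x → ∑ (λ y → 𝟙 (inc e x) * (𝟙 (inc f y) * 𝟙 (joins x y g))))
        pt g = cases (bool (nbr W e g ∧ nbr W f g)) (bool (inc g w))
          where
          rest = ∑ (λ x → ∑ (λ y → 𝟙 (inc e x) * (𝟙 (inc f y) * 𝟙 (joins x y g))))
          0≤rest : 0ℚ ≤ rest
          0≤rest = 0≤∑ (λ x → 0≤∑ (λ y → 0≤summand g x y))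
          cases : nbr W e g ∧ nbr W f g ≡ true ⊎ nbr W e g ∧ nbr W f g ≡ false → inc g w ≡ true ⊎ inc g w ≡ false →
            𝟙 (nbr W e g ∧ nbr W f g) ≤ 𝟙 (inc g w ∧ W g) + rest
          cases (inj₂ p) _ = ≤-trans (≤-reflexive (cong 𝟙 p)) (0≤+ (0≤𝟙 (inc g w ∧ W g)) 0≤rest)
          cases (inj₁ p) (inj₁ gw) = ≤-trans (𝟙-mono {nbr W e g ∧ nbr W f g} {inc g w ∧ W g} (λ _ → ∧-intro gw (∧-fst {W g} (∧-fst {nbr W e g} p)))) (≤-by rest refl 0≤rest)
          cases (inj₁ p) (inj₂ gw) = join (adj-elim e g (∧-snd {not (g == e)} (∧-snd {W g} (∧-fst {nbr W e g} p)))) (adj-elim f g (∧-snd {not (g == f)} (∧-snd {W g} (∧-snd {nbr W e g} p))))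
            where
            off-centre : ∀ x y → inc e x ≡ true → inc g x ≡ true → inc f y ≡ true → x ≡ y → ⊥
            off-centre x .x ex gx fx refl = Linearᴮ.linear lin e f w x e≢f (λ w≡x → true≢false (subst (λ z → inc g z ≡ true) (sym w≡x) gx) gw) ew ex fw fx
            join : (Σ (Fin n) λ x → (inc e x ≡ true) × (inc g x ≡ true)) → (Σ (Fin n) λ y → (inc f y ≡ true) × (inc g y ≡ true)) →
              𝟙 (nbr W e g ∧ nbr W f g) ≤ 𝟙 (inc g w ∧ W g) + rest
            join (x , ex , gx) (y , fy , gy) = decide (≡⊎≢ x y)
              where
              decide : x ≡ y ⊎ x ≢ y → 𝟙 (nbr W e g ∧ nbr W f g) ≤ 𝟙 (inc g w ∧ W g) + rest
              decide (inj₁ x≡y) = ⊥-elim (off-centre x y ex gx fy x≡y)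
              decide (inj₂ x≢y) = ≤-trans (𝟙≤1 (nbr W e g ∧ nbr W f g)) (≤-trans (≤-reflexive (sym (cong₂ _*_ (cong 𝟙 ex) (cong₂ _*_ (cong 𝟙 fy) (cong 𝟙 (∧-intro (not-intro (≢⇒== x≢y)) (∧-intro gx gy)))))))
                (≤-trans (≤-trans (term≤∑ (λ y → 0≤summand g x y) y) (term≤∑ (λ x → 0≤∑ (λ y → 0≤summand g x y)) x))
                  (≤-by (𝟙 (inc g w ∧ W g)) (+-comm (𝟙 (inc g w ∧ W g)) rest) (0≤𝟙 (inc g w ∧ W g)))))

    -- The edges for which repeated colours can be guaranteed: nearly all their neighbours have size
    -- close to K, which `common` requires.
    T : Fin m → Bool
    T e = W e ∧ leq ((1ℚ - ℚ.½ * δ) * N) (deg W e)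

    T⊆W : ∀ e → T e ≡ true → W e ≡ true
    T⊆W e = ∧-fst {W e}

    open Savings adj adj-sym W T using (ok)

    -- Of (1 - δ/2)N neighbours at most δN/16 are used, which leaves more than N/2 choices for f. At
    -- most about (1 - δ)²N neighbours are shared with f, and 3δ ≤ 1 makes 1 - (1 - δ)² at least
    -- 5δ/3; after subtracting δ/2 and δ/16 more than δN choices for g remain.
    pairs : ∀ z₀ → ι 16 * ι z₀ ≤ δ * N → ∀ Z e → T e ≡ true → # (λ f → nbr W e f ∧ Z f) ℕ.≤ z₀ →
      ℚ.½ * N * (δ * N) ≤ ∑ (λ f → ∑ (λ g → 𝟙 (ok Z e f g)))
    pairs z₀ z₀≤ Z e Te used = begin
      ℚ.½ * N * (δ * N) ≤⟨ *-monoˡ (0≤* 0≤δ 0≤N) many-f ⟩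
      ∑ (λ f → 𝟙 (a f)) * (δ * N) ≡⟨ sym (∑-*ʳ (δ * N) (λ f → 𝟙 (a f))) ⟩
      ∑ (λ f → 𝟙 (a f) * (δ * N)) ≤⟨ ∑-guard-mono a many-g ⟩
      ∑ (λ f → 𝟙 (a f) * ∑ (λ g → 𝟙 (b f g))) ≡⟨ ∑-cong (λ f → trans (sym (∑-*ˡ (𝟙 (a f)) (λ g → 𝟙 (b f g)))) (∑-cong (λ g → sym (𝟙-∧ (a f) (b f g))))) ⟩
      ∑ (λ f → ∑ (λ g → 𝟙 (ok Z e f g))) ∎
      where
      open ℚₚ.≤-Reasoning
      a : Fin m → Bool
      a f = nbr W e f ∧ not (Z f)
      b : Fin m → Fin m → Bool
      b f g = (nbr W e g ∧ not (Z g)) ∧ (not (g == f) ∧ not (adj f g))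
      We = T⊆W e Te
      deg≥ : (1ℚ - ℚ.½ * δ) * N ≤ deg W e
      deg≥ = leq-elim ((1ℚ - ℚ.½ * δ) * N) (deg W e) (∧-snd {W e} Te)
      used≤ : ∑ (λ f → 𝟙 (nbr W e f ∧ Z f)) ≤ ι z₀
      used≤ = ≤-trans (≤-reflexive (sym (ι# (λ f → nbr W e f ∧ Z f)))) (ι-mono used)
      many-f : ℚ.½ * N ≤ ∑ (λ f → 𝟙 (a f))
      many-f = ≤-trans (*-cancel-≤ (0<ι 47) (≤-by (ι 3 * (δ * N - ι 16 * ι z₀) + (ι 9 * (1ℚ - ι 3 * δ) + ι 15) * N) (ring-139 δ N (ι z₀))
          (0≤+ (0≤* (0≤ι 3) (0≤- z₀≤)) (0≤* (0≤+ (0≤* (0≤ι 9) (0≤- 3δ≤1)) (0≤ι 15)) 0≤N))))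
        (≤-by {(1ℚ - ℚ.½ * δ) * N - ι z₀} ((deg W e - (1ℚ - ℚ.½ * δ) * N) + (ι z₀ - ∑ (λ f → 𝟙 (nbr W e f ∧ Z f))) + (∑ (λ f → 𝟙 (nbr W e f ∧ Z f)) + ∑ (λ f → 𝟙 (a f)) - deg W e))
          (ring-140 (∑ (λ f → 𝟙 (a f))) (deg W e) δ N (ι z₀) (∑ (λ f → 𝟙 (nbr W e f ∧ Z f)))) (0≤+ (0≤+ (0≤- deg≥) (0≤- used≤)) (0≤- cover)))
        where
        cover : deg W e ≤ ∑ (λ f → 𝟙 (nbr W e f ∧ Z f)) + ∑ (λ f → 𝟙 (a f))
        cover = ≤-trans (∑-mono (λ f → pt (nbr W e f) (Z f))) (≤-reflexive (∑-+ (λ f → 𝟙 (nbr W e f ∧ Z f)) (λ f → 𝟙 (a f))))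
          where
          pt : ∀ x y → 𝟙 x ≤ 𝟙 (x ∧ y) + 𝟙 (x ∧ not y)
          pt true true = ≤-refl
          pt true false = ≤-refl
          pt false y = ≤-refl
      many-g : ∀ f → a f ≡ true → δ * N ≤ ∑ (λ g → 𝟙 (b f g))
      many-g f af = ≤-trans (*-cancel-≤ (0<ι 47) (≤-by (ι 48 * (q * N - 1ℚ) + ι 3 * (δ * N - ι 16 * ι z₀) + (ι 16 * (δ * (1ℚ - ι 3 * δ)) + ι 3 * (δ - ι 100 * q) + ι 2 * δ + ι 12 * q) * N) (ring-141 δ N q (ι z₀))
          (0≤+ (0≤+ (0≤* (0≤ι 48) (0≤- 1≤qN)) (0≤* (0≤ι 3) (0≤- z₀≤))) (0≤* (0≤+ (0≤+ (0≤+ (0≤* (0≤ι 16) (0≤* 0≤δ (0≤- 3δ≤1))) (0≤* (0≤ι 3) (0≤- 100q≤δ))) (0≤* (0≤ι 2) 0≤δ)) (0≤* (0≤ι 12) 0≤q)) 0≤N))))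
        (≤-by {(1ℚ - ℚ.½ * δ) * N - ι z₀ - 1ℚ - ((1ℚ - δ) * (1ℚ - δ) + ι 5 * q) * N} ((deg W e - (1ℚ - ℚ.½ * δ) * N) + (ι z₀ - ∑ (λ f → 𝟙 (nbr W e f ∧ Z f))) + (((1ℚ - δ) * (1ℚ - δ) + ι 5 * q) * N - common-ef)
            + (∑ (λ f → 𝟙 (nbr W e f ∧ Z f)) + (1ℚ + (common-ef + ∑ (λ g → 𝟙 (b f g)))) - deg W e))
          (ring-142 (∑ (λ g → 𝟙 (b f g))) (deg W e) δ N (ι z₀) (∑ (λ f → 𝟙 (nbr W e f ∧ Z f))) q common-ef)
          (0≤+ (0≤+ (0≤+ (0≤- deg≥) (0≤- used≤)) (0≤- (common e f (λ r → ==false⇒≢ f e (not-elim (∧-fst {not (f == e)} (∧-snd {W f} nf))) (sym r)) We (∧-fst {W f} nf) (∧-snd {not (f == e)} (∧-snd {W f} nf))))) (0≤- cover)))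
        where
        nf = ∧-fst {nbr W e f} af
        common-ef = ∑ (λ g → 𝟙 (nbr W e g ∧ nbr W f g))
        cover : deg W e ≤ ∑ (λ f → 𝟙 (nbr W e f ∧ Z f)) + (1ℚ + (common-ef + ∑ (λ g → 𝟙 (b f g))))
        cover = ≤-trans (∑-mono pt) (≤-reflexive (trans (∑-+ (λ g → 𝟙 (nbr W e g ∧ Z g)) (λ g → 𝟙 (f == g) * 1ℚ + (𝟙 (nbr W e g ∧ nbr W f g) + 𝟙 (b f g))))
          (cong (∑ (λ g → 𝟙 (nbr W e g ∧ Z g)) +_) (trans (∑-+ (λ g → 𝟙 (f == g) * 1ℚ) (λ g → 𝟙 (nbr W e g ∧ nbr W f g) + 𝟙 (b f g)))
            (cong₂ _+_ (∑-δ f (λ _ → 1ℚ)) (∑-+ (λ g → 𝟙 (nbr W e g ∧ nbr W f g)) (λ g → 𝟙 (b f g)))))))) 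
          where
          go : ∀ x z c w j → (x ≡ true → w ≡ true) → 𝟙 x ≤ 𝟙 (x ∧ z) + (𝟙 c * 1ℚ + (𝟙 (x ∧ (w ∧ (not c ∧ j))) + 𝟙 ((x ∧ not z) ∧ (not c ∧ not j))))
          go false z c w j h = 0≤+ (0≤𝟙 false) (0≤+ (0≤* (0≤𝟙 c) 0≤1) (0≤+ (0≤𝟙 false) (0≤𝟙 false)))
          go true true c w j h = ≤-by (𝟙 c * 1ℚ + (𝟙 (w ∧ (not c ∧ j)) + 0ℚ)) refl (0≤+ (0≤* (0≤𝟙 c) 0≤1) (0≤+ (0≤𝟙 (w ∧ (not c ∧ j))) ≤-refl))
          go true false true w j h = ≤-by (0ℚ + (𝟙 (w ∧ false) + 0ℚ)) (ring-134 (𝟙 (w ∧ false))) (0≤+ ≤-refl (0≤+ (0≤𝟙 (w ∧ false)) ≤-refl))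
          go true false false w j h = subst (λ w → 1ℚ ≤ 0ℚ + (0ℚ * 1ℚ + (𝟙 (w ∧ j) + 𝟙 (not j)))) (sym (h refl)) (last j)
            where
            last : ∀ j → 1ℚ ≤ 0ℚ + (0ℚ * 1ℚ + (𝟙 j + 𝟙 (not j)))
            last true = ≤-refl
            last false = ≤-refl
          pt : ∀ g → 𝟙 (nbr W e g) ≤ 𝟙 (nbr W e g ∧ Z g) + (𝟙 (f == g) * 1ℚ + (𝟙 (nbr W e g ∧ nbr W f g) + 𝟙 (b f g)))
          pt g = subst (λ c → 𝟙 (nbr W e g) ≤ 𝟙 (nbr W e g ∧ Z g) + (𝟙 c * 1ℚ + (𝟙 (nbr W e g ∧ nbr W f g) + 𝟙 (b f g)))) (==-sym g f)
            (go (nbr W e g) (Z g) (g == f) (W g) (adj f g) (∧-fst {W g}))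

    rest : Fin m → Bool
    rest e = F e ∧ not (T e)

    -- `rest` consists of `X`, the edges that are too large, and `W′`, the edges of suitable size
    -- with too few neighbours in `W`.
    X W′ : Fin m → Bool
    X e = F e ∧ not (W e)
    W′ e = W e ∧ not (leq ((1ℚ - ℚ.½ * δ) * N) (deg W e))

    -- K times the total size of F is at most (1 + q⁵)N², and `W` already takes (1 - 9q)N² of it.
    X-total : K * ∑ (λ f → 𝟙 (X f) * sz f) ≤ ι 10 * q * (N * N)
    X-total = ≤-by ((N * ((1ℚ + q⁵) * N) - K * ∑ (λ f → 𝟙 (F f) * sz f)) + (K * ∑ (λ f → 𝟙 (W f) * sz f) - (1ℚ - ι 9 * q) * (N * N)) + (q - q⁵) * (N * N))
        (trans (ring-160 (K * ∑ (λ f → 𝟙 (X f) * sz f)) (K * ∑ (λ f → 𝟙 (W f) * sz f)) q q⁵ N)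
          (cong (λ t → K * ∑ (λ f → 𝟙 (X f) * sz f) + ((N * ((1ℚ + q⁵) * N) - t) + (K * ∑ (λ f → 𝟙 (W f) * sz f) - (1ℚ - ι 9 * q) * (N * N)) + (q - q⁵) * (N * N)))
            (sym (trans (cong (K *_) split) (*-distribˡ-+ K (∑ (λ f → 𝟙 (W f) * sz f)) (∑ (λ f → 𝟙 (X f) * sz f)))))))
        (0≤+ (0≤+ (0≤- F-total) (0≤- W-total)) (0≤* (0≤- q⁵≤q) (0≤* 0≤N 0≤N)))
      where
      split : ∑ (λ f → 𝟙 (F f) * sz f) ≡ ∑ (λ f → 𝟙 (W f) * sz f) + ∑ (λ f → 𝟙 (X f) * sz f)
      split = trans (∑-cong (λ f → pt (F f) (leq ((1ℚ + q) * K) (sz f)) (sz f))) (∑-+ (λ f → 𝟙 (W f) * sz f) (λ f → 𝟙 (X f) * sz f))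
        where
        pt : ∀ a b s → 𝟙 a * s ≡ 𝟙 (a ∧ not b) * s + 𝟙 (a ∧ not (a ∧ not b)) * s
        pt true true s = ring-143 s
        pt true false s = ring-144 s
        pt false b s = ring-145 s
      F-total : K * ∑ (λ f → 𝟙 (F f) * sz f) ≤ N * ((1ℚ + q⁵) * N)
      F-total = ≤-trans (≤-reflexive (trans (cong (K *_) (∑sz F)) (sym (∑-*ˡ K (dg F))))) (≤-trans (∑-mono Kdg≤) (≤-reflexive (∑-const n ((1ℚ + q⁵) * N))))

    X-volume : vol X ≤ ι 10 * q * (N * N)
    X-volume = ≤-by ((N * N - vol F) + (vol W - (1ℚ - ι 10 * q) * (N * N))) (trans (ring-161 (vol X) (vol W) q (N * N)) (cong (λ t → vol X + ((N * N - t) + (vol W - (1ℚ - ι 10 * q) * (N * N)))) (sym split)))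
      (0≤+ (0≤- (vol≤ F)) (0≤- W-volume))
      where
      split : vol F ≡ vol W + vol X
      split = trans (∑-cong (λ f → pt (F f) (leq ((1ℚ + q) * K) (sz f)) (sz f * (sz f - 1ℚ)))) (∑-+ (λ f → 𝟙 (W f) * (sz f * (sz f - 1ℚ))) (λ f → 𝟙 (X f) * (sz f * (sz f - 1ℚ))))
        where
        pt : ∀ a b s → 𝟙 a * s ≡ 𝟙 (a ∧ not b) * s + 𝟙 (a ∧ not (a ∧ not b)) * s
        pt true true s = ring-143 s
        pt true false s = ring-144 s
        pt false b s = ring-145 s

    -- An edge of W′ has many neighbours in X, and X is too small for many such edges.
    W′-bound : δ * (K * K * ∑ (𝟙 ∘ W′)) ≤ ι 80 * q * (N * N)
    W′-bound = *-cancel-≤ 0<N (*-cancel-≤ (0<* (0<ι 0) (ℚₚ.positive⁻¹ (ℚ.½ * ℚ.½))) (begin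
      ι 1 * (ℚ.½ * ℚ.½) * (N * (δ * (K * K * ∑ (𝟙 ∘ W′)))) ≡⟨ trans (ring-162 N δ (K * K) (∑ (𝟙 ∘ W′))) (cong (K * K *_) (sym (∑-*ʳ (ℚ.½ * ℚ.½ * δ * N) (𝟙 ∘ W′)))) ⟩
      K * K * ∑ (λ e → 𝟙 (W′ e) * (ℚ.½ * ℚ.½ * δ * N)) ≤⟨ *-monoʳ (0≤* 0≤K 0≤K) (∑-mono each) ⟩
      K * K * ∑ (λ e → 𝟙 (W e) * deg X e) ≡⟨ cong (K * K *_) exchange ⟩
      K * K * ∑ (λ x → 𝟙 (X x) * deg W x) ≡⟨ trans (*-assoc K K (∑ (λ x → 𝟙 (X x) * deg W x))) (cong (K *_) (trans (sym (∑-*ˡ K (λ x → 𝟙 (X x) * deg W x))) (∑-cong (λ x → ring-16 K (𝟙 (X x)) (deg W x))))) ⟩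
      K * ∑ (λ x → 𝟙 (X x) * (K * deg W x)) ≤⟨ *-monoʳ 0≤K (∑-mono (λ x → *-monoʳ (0≤𝟙 (X x)) (≤-trans (*-monoʳ 0≤K (deg-mono′ x)) (≤-trans (Kdeg≤ x) (*-monoʳ (0≤ι (size x)) (*-monoˡ 0≤N (+-monoʳ-≤ 1ℚ (≤-trans q⁵≤q q≤1)))))))) ⟩
      K * ∑ (λ x → 𝟙 (X x) * (sz x * ((1ℚ + 1ℚ) * N))) ≡⟨ trans (cong (K *_) (trans (∑-cong (λ x → sym (*-assoc (𝟙 (X x)) (sz x) ((1ℚ + 1ℚ) * N)))) (∑-*ʳ ((1ℚ + 1ℚ) * N) (λ x → 𝟙 (X x) * sz x)))) (sym (*-assoc K (∑ (λ x → 𝟙 (X x) * sz x)) ((1ℚ + 1ℚ) * N))) ⟩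
      K * ∑ (λ x → 𝟙 (X x) * sz x) * ((1ℚ + 1ℚ) * N) ≤⟨ *-monoˡ (0≤* (0≤+ 0≤1 0≤1) 0≤N) X-total ⟩
      ι 10 * q * (N * N) * ((1ℚ + 1ℚ) * N) ≡⟨ ring-163 q N ⟩
      ι 1 * (ℚ.½ * ℚ.½) * (N * (ι 80 * q * (N * N))) ∎))
      where
      open ℚₚ.≤-Reasoning
      deg-mono′ : ∀ x → deg W x ≤ deg F x
      deg-mono′ x = ∑-mono (λ f → 𝟙-mono {nbr W x f} {nbr F x f} (λ p → ∧-intro (W⊆F f (∧-fst {W f} p)) (∧-snd {W f} p)))
      exchange : ∑ (λ e → 𝟙 (W e) * deg X e) ≡ ∑ (λ x → 𝟙 (X x) * deg W x)
      exchange = trans (∑-cong (λ e → sym (∑-*ˡ (𝟙 (W e)) (𝟙 ∘ nbr X e)))) (trans (∑-swap (λ e x → 𝟙 (W e) * 𝟙 (nbr X e x)))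
        (∑-cong (λ x → trans (∑-cong (λ e → flip e x)) (∑-*ˡ (𝟙 (X x)) (𝟙 ∘ nbr W x)))))
        where
        flip : ∀ e x → 𝟙 (W e) * 𝟙 (nbr X e x) ≡ 𝟙 (X x) * 𝟙 (nbr W x e)
        flip e x = trans (cong (𝟙 (W e) *_) (𝟙-∧ (X x) (not (x == e) ∧ adj e x))) (trans (ring-16 (𝟙 (W e)) (𝟙 (X x)) (𝟙 (not (x == e) ∧ adj e x)))
          (cong (𝟙 (X x) *_) (trans (cong (λ b → 𝟙 (W e) * 𝟙 b) (cong₂ (λ a b → not a ∧ b) (==-sym x e) (adj-sym e x))) (sym (𝟙-∧ (W e) (not (e == x) ∧ adj x e))))))
      degs : ∀ e → deg F e ≤ deg X e + deg W e
      degs e = ≤-trans (∑-mono (λ f → pt (F f) (W f) (not (f == e) ∧ adj e f))) (≤-reflexive (∑-+ (𝟙 ∘ nbr X e) (𝟙 ∘ nbr W e)))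
        where
        pt : ∀ a b c → 𝟙 (a ∧ c) ≤ 𝟙 ((a ∧ not b) ∧ c) + 𝟙 (b ∧ c)
        pt true true c = ≤-by 0ℚ (trans (+-identityˡ (𝟙 c)) (sym (+-identityʳ (𝟙 c)))) ≤-refl
        pt true false c = ≤-by 0ℚ refl ≤-refl
        pt false b c = 0≤+ ≤-refl (0≤𝟙 (b ∧ c))
      each : ∀ e → 𝟙 (W′ e) * (ℚ.½ * ℚ.½ * δ * N) ≤ 𝟙 (W e) * deg X e
      each e = ≤-trans (𝟙-guard (W′ e) (λ p → ≤-by ((deg X e + deg W e - deg F e) + (deg F e - (1ℚ - q⁵) * N) + ((1ℚ - ℚ.½ * δ) * N - deg W e) + ((q - q⁵) + ℚ.½ * ℚ.½ * (δ - ι 100 * q) + ι 24 * q) * N)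
          (ring-146 (deg X e) (deg W e) (deg F e) q q⁵ δ N)
          (0≤+ (0≤+ (0≤+ (0≤- (degs e)) (0≤- (saturated e (W⊆F e (∧-fst {W e} p))))) (0≤- (<⇒≤ (leq-false ((1ℚ - ℚ.½ * δ) * N) (deg W e) (not-elim (∧-snd {W e} p))))))
            (0≤* (0≤+ (0≤+ (0≤- q⁵≤q) (0≤* (0≤* 0≤½ 0≤½) (0≤- 100q≤δ))) (0≤* (0≤ι 24) 0≤q)) 0≤N))))
        (*-monoˡ (0≤∑ (0≤𝟙 ∘ nbr X e)) (𝟙-mono {W′ e} {W e} (∧-fst {W e})))

    -- `X` covers at most 10qN² pairs. An edge of `W′` covers at most 4K² pairs, and `W′-bound`
    -- limits their number up to a factor 1/δ, which 1000q ≤ δ compensates. One half suffices, since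
    -- `volume-degenerate` is applied with a fixed constant.
    rest-volume : vol rest < ℚ.½ * (N * N)
    rest-volume = *-cancel-< 0<δ (begin-strict
      δ * vol rest ≤⟨ *-monoʳ 0≤δ parts ⟩
      δ * (vol X + ∑ (𝟙 ∘ W′) * (ι 4 * (K * K))) ≤⟨ *-monoʳ 0≤δ (+-monoˡ-≤ (∑ (𝟙 ∘ W′) * (ι 4 * (K * K))) X-volume) ⟩
      δ * (ι 10 * q * (N * N) + ∑ (𝟙 ∘ W′) * (ι 4 * (K * K))) ≡⟨ ring-164 δ q (N * N) (∑ (𝟙 ∘ W′)) (K * K) ⟩
      δ * (ι 10 * q * (N * N)) + ι 4 * (δ * (K * K * ∑ (𝟙 ∘ W′))) ≤⟨ +-mono-≤ (*-monoˡ (0≤* (0≤* (0≤ι 10) 0≤q) (0≤* 0≤N 0≤N)) δ≤1) (*-monoʳ (0≤ι 4) W′-bound) ⟩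
      1ℚ * (ι 10 * q * (N * N)) + ι 4 * (ι 80 * q * (N * N)) <⟨ *-cancel-< (0<ι 2) (<-by ((1000q - (ι 990 * q)) * (N * N) + ((δ - 1000q) * (N * N) + ℚ.½ * δ * (N * N))) (ring-165 q δ (N * N) 1000q)
          (≤-<-trans ≤-refl (0<+′ (0≤* (0≤- (*-monoˡ 0≤q (ι-mono (ℕₚ.≤ᵇ⇒≤ 990 1000 tt)))) (0≤* 0≤N 0≤N)) (0<+′ (0≤* (0≤- 1000q≤δ) (0≤* 0≤N 0≤N)) (0<* (0<* (ℚₚ.positive⁻¹ ℚ.½) 0<δ) (0<* 0<N 0<N)))))) ⟩
      δ * (ℚ.½ * (N * N)) ∎)
      where
      open ℚₚ.≤-Reasoning
      1000q = ι 1000 * q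
      0<+′ : ∀ {a b} → 0ℚ ≤ a → 0ℚ < b → 0ℚ < a + b
      0<+′ {a} {b} p r = <-≤-trans (0<+ r p) (≤-reflexive (+-comm b a))
      parts : vol rest ≤ vol X + ∑ (𝟙 ∘ W′) * (ι 4 * (K * K))
      parts = ≤-trans (∑-mono pt) (≤-reflexive (trans (∑-+ (λ f → 𝟙 (X f) * (sz f * (sz f - 1ℚ))) (λ f → 𝟙 (W′ f) * (ι 4 * (K * K)))) (cong (vol X +_) (∑-*ʳ (ι 4 * (K * K)) (𝟙 ∘ W′)))))
        where
        sz² : ∀ f → W f ≡ true → sz f * (sz f - 1ℚ) ≤ ι 4 * (K * K)
        sz² f p = ≤-trans (*-monoʳ (0≤ι (size f)) (≤-by 1ℚ (ring-135 (sz f)) 0≤1)) (≤-trans (*-mono (0≤ι (size f)) (<⇒≤ (W-size f p)) (0≤ι (size f)) (<⇒≤ (W-size f p)))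
          (≤-by ((1ℚ - q) * (ι 3 + q) * (K * K)) (ring-147 q K) (0≤* (0≤* 0≤1-q (0≤+ (0≤ι 3) 0≤q)) (0≤* 0≤K 0≤K))))
        pt : ∀ f → 𝟙 (rest f) * (sz f * (sz f - 1ℚ)) ≤ 𝟙 (X f) * (sz f * (sz f - 1ℚ)) + 𝟙 (W′ f) * (ι 4 * (K * K))
        pt f = go (bool (W f))
          where
          S = sz f * (sz f - 1ℚ)
          0≤4KK = 0≤* (0≤ι 4) (0≤* 0≤K 0≤K)
          rest≡ : ∀ b → W f ≡ b → 𝟙 (rest f) ≡ 𝟙 (F f ∧ not (b ∧ leq ((1ℚ - ℚ.½ * δ) * N) (deg W f)))
          rest≡ b r = cong (λ w → 𝟙 (F f ∧ not (w ∧ leq ((1ℚ - ℚ.½ * δ) * N) (deg W f)))) r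
          go : W f ≡ true ⊎ W f ≡ false → 𝟙 (rest f) * S ≤ 𝟙 (X f) * S + 𝟙 (W′ f) * (ι 4 * (K * K))
          go (inj₂ r) = ≤-trans (≤-reflexive (trans (cong (_* S) (rest≡ false r)) (cong (λ w → 𝟙 (F f ∧ not w) * S) (sym r)))) (≤-by (𝟙 (W′ f) * (ι 4 * (K * K))) refl (0≤* (0≤𝟙 (W′ f)) 0≤4KK))
          go (inj₁ r) = ≤-trans (≤-trans (𝟙-guard (rest f) (λ _ → sz² f r)) (*-monoˡ 0≤4KK (≤-trans (≤-reflexive (rest≡ true r))
              (≤-trans (𝟙-mono {F f ∧ not (leq ((1ℚ - ℚ.½ * δ) * N) (deg W f))} {W′ f} (λ p → ∧-intro r (∧-snd {F f} p))) ≤-refl))))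
            (≤-by (𝟙 (X f) * S) (+-comm (𝟙 (X f) * S) (𝟙 (W′ f) * (ι 4 * (K * K)))) (≤-reflexive (sym (trans (cong (_* S) (cong 𝟙 (X-false r))) (*-zeroˡ S)))))
            where
            X-false : W f ≡ true → X f ≡ false
            X-false r = ≡false (λ p → true≢false r (not-elim (∧-snd {F f} p)))

-- Colouring the large edges

argmin : ∀ {m} (b : Fin m → Bool) (s : Fin m → ℕ) i → b i ≡ true → Σ (Fin m) λ e → (b e ≡ true) × (∀ f → b f ≡ true → s e ℕ.≤ s f)
argmin {m} b s i bi = go (s i) i bi ℕₚ.≤-refl
  where
  go : ∀ k i → b i ≡ true → s i ℕ.≤ k → Σ (Fin m) λ e → (b e ≡ true) × (∀ f → b f ≡ true → s e ℕ.≤ s f)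
  step : ∀ k i → b i ≡ true → s i ℕ.≤ k → any (λ f → b f ∧ geq (suc (s f)) (s i)) ≡ true ⊎ any (λ f → b f ∧ geq (suc (s f)) (s i)) ≡ false →
    Σ (Fin m) λ e → (b e ≡ true) × (∀ f → b f ≡ true → s e ℕ.≤ s f)
  go k i bi si≤k = step k i bi si≤k (bool (any (λ f → b f ∧ geq (suc (s f)) (s i))))
  step k i bi si≤k (inj₂ none) = i , bi , λ f bf → ℕₚ.≮⇒≥ (λ lt → true≢false (∧-intro bf (geq-intro lt)) (any-false {b = λ f → b f ∧ geq (suc (s f)) (s i)} none f))
  step zero i bi si≤k (inj₁ some) with any-elim {b = λ f → b f ∧ geq (suc (s f)) (s i)} some
  ... | f , p = case ℕₚ.≤-trans (geq-elim (suc (s f)) (s i) (∧-snd {b f} p)) si≤k of λ ()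
  step (suc k) i bi si≤k (inj₁ some) with any-elim {b = λ f → b f ∧ geq (suc (s f)) (s i)} some
  ... | f , p = go k f (∧-fst {b f} p) (ℕₚ.≤-pred (ℕₚ.≤-trans (geq-elim (suc (s f)) (s i) (∧-snd {b f} p)) si≤k))

-- Peeling off edges of low degree

module Peeling {m} (adj : Fin m → Fin m → Bool) (adj-sym : ∀ e f → adj e f ≡ adj f e) where
  open ListColouring {m} {0} adj adj-sym using (deg)

  saturated? : ∀ U c → (Σ (Fin m) λ e → (U e ≡ true) × (deg U e < c)) ⊎ (∀ e → U e ≡ true → c ≤ deg U e)
  saturated? U c with bool (any (λ e → U e ∧ not (leq c (deg U e))))
  ... | inj₂ none = inj₂ (λ e Ue → decide e Ue (bool (leq c (deg U e))))
    where
    decide : ∀ e → U e ≡ true → leq c (deg U e) ≡ true ⊎ leq c (deg U e) ≡ false → c ≤ deg U e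
    decide e Ue (inj₁ p) = leq-elim c (deg U e) p
    decide e Ue (inj₂ p) = ⊥-elim (true≢false (∧-intro Ue (not-intro p)) (any-false {b = λ e → U e ∧ not (leq c (deg U e))} none e))
  ... | inj₁ some with any-elim {b = λ e → U e ∧ not (leq c (deg U e))} some
  ...   | e , p = inj₁ (e , ∧-fst {U e} p , leq-false c (deg U e) (not-elim (∧-snd {U e} p)))

  -- Edges of degree below c are postponed one after the other; what remains is empty or saturated.
  -- `P` only has to survive putting such an edge back.
  peel : (P : (Fin m → Bool) → Set) → ∀ c → (∀ U e → U e ≡ true → deg U e < c → P (U ∖ e) → P U) →
    ∀ E → (∀ F → (∀ e → F e ≡ true → E e ≡ true) → (∀ e → F e ≡ true → c ≤ deg F e) → P F) → P E
  peel P c extend E saturated = go (# E) E ℕₚ.≤-refl (λ _ p → p)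
    where
    go : ∀ k U → # U ℕ.≤ k → (∀ e → U e ≡ true → E e ≡ true) → P U
    continue : ∀ k U → # U ℕ.≤ k → (∀ e → U e ≡ true → E e ≡ true) →
      (Σ (Fin m) λ e → (U e ≡ true) × (deg U e < c)) ⊎ (∀ e → U e ≡ true → c ≤ deg U e) → P U
    go k U #U U⊆E = continue k U #U U⊆E (saturated? U c)
    continue k U #U U⊆E (inj₂ s) = saturated U U⊆E s
    continue zero U #U U⊆E (inj₁ (e , Ue , _)) = ⊥-elim (true≢false Ue (#≡0 (ℕₚ.n≤0⇒n≡0 #U) e))
    continue (suc k) U #U U⊆E (inj₁ (e , Ue , lt)) = extend U e Ue lt (go k (U ∖ e) (ℕₚ.≤-pred (ℕₚ.≤-trans (#-drop e (∖-⊆ {U = U}) (∖-self {U = U} e) Ue) #U))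
      (λ f p → U⊆E f (∖-⊆ {U = U} f p)))

module _ {n m} (inc : Fin m → Fin n → Bool) (lin : Linearᴮ inc) where
  open Incidence inc
  open ListColouring {m} {0} adj adj-sym using (deg)
  open Degrees inc lin

  -- The contrapositive of `Saturated.volume≥`: a saturated subset would cover nearly all pairs,
  -- more than `Q` does. The threshold on sizes passes to the smallest edge of the subset.
  volume-degenerate : ∀ q → 0ℚ < q → ι 10 * q ≤ 1ℚ → 0ℚ < ι n → ∀ k → ι 2 ≤ q * (q * (q * (q * q))) * ι k →
    ∀ Q → (∀ e → Q e ≡ true → k ℕ.≤ size e) → (∀ e → Q e ≡ true → 1ℚ ≤ sz e) → vol Q < (1ℚ - ι 10 * q) * (N * N) →
    ∀ V → (∀ e → V e ≡ true → Q e ≡ true) → ∀ i → V i ≡ true → Σ (Fin m) λ e → (V e ≡ true) × (deg V e < (1ℚ - q * (q * (q * (q * q)))) * N)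
  volume-degenerate q 0<q 10q≤1 0<N k 2≤ Q k≤ 1≤sz vol< V V⊆Q i Vi = decide (Peeling.saturated? adj adj-sym V ((1ℚ - q * (q * (q * (q * q)))) * N))
    where
    decide : (Σ (Fin m) λ e → (V e ≡ true) × (deg V e < (1ℚ - q * (q * (q * (q * q)))) * N)) ⊎ (∀ e → V e ≡ true → (1ℚ - q * (q * (q * (q * q)))) * N ≤ deg V e) →
      Σ (Fin m) λ e → (V e ≡ true) × (deg V e < (1ℚ - q * (q * (q * (q * q)))) * N)
    decide (inj₁ p) = p
    decide (inj₂ s) = ⊥-elim (clash (argmin V size i Vi))
      where
      clash : (Σ (Fin m) λ e → (V e ≡ true) × (∀ f → V f ≡ true → size e ℕ.≤ size f)) → ⊥
      clash (e₀ , Ve₀ , least) = ≤⇒≯ (≤-trans (Saturated.volume≥ inc lin V (size e₀) e₀ refl Ve₀ least q 0<q 10q≤1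
          (≤-trans 2≤ (*-monoʳ (0≤* 0≤q (0≤* 0≤q (0≤* 0≤q (0≤* 0≤q 0≤q)))) (ι-mono (k≤ e₀ (V⊆Q e₀ Ve₀))))) 0<N s) (vol-mono V⊆Q 1≤sz)) vol<
        where
        0≤q = <⇒≤ 0<q

∑-splitAt : ∀ s {t} (g : Fin s → ℚ) (h : Fin t → ℚ) → ∑ (λ c → Data.Sum.[ g , h ] (Fin.splitAt s c)) ≡ ∑ g + ∑ h
∑-splitAt zero g h = sym (+-identityˡ (∑ h))
∑-splitAt (suc s) g h = trans (cong (g zero +_) (trans (∑-cong (λ c → lem (Fin.splitAt s c))) (∑-splitAt s (g ∘ suc) h))) (sym (+-assoc (g zero) (∑ (g ∘ suc)) (∑ h)))
  where
  lem : ∀ x → Data.Sum.[ g , h ] (Data.Sum.map₁ suc x) ≡ Data.Sum.[ g ∘ suc , h ] x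
  lem (inj₁ _) = refl
  lem (inj₂ _) = refl

-- Colours of the first s colours are reserved for the classes, Q uses only the others, and T profits from the repetitions.
module Assembly {m s C₁} (adj : Fin m → Fin m → Bool) (adj-sym : ∀ e f → adj e f ≡ adj f e) (c₀ : Fin (s ℕ.+ C₁))
  (F W T : Fin m → Bool) (W⊆F : ∀ e → W e ≡ true → F e ≡ true) (T⊆W : ∀ e → T e ≡ true → W e ≡ true)
  (member : Fin s → Fin m → Bool) (member⊆W : ∀ c f → member c f ≡ true → W f ≡ true)
  (independent : ∀ c f g → member c f ≡ true → member c g ≡ true → f ≢ g → adj f g ≡ false)
  (disjoint : ∀ c d f → member c f ≡ true → member d f ≡ true → c ≡ d)
  (S₀ : ℕ) (savings : ∀ e → T e ≡ true → S₀ ℕ.≤ # (λ c → Savings.saved adj adj-sym W T e (member c))) where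
  open ListColouring {m} {s ℕ.+ C₁} adj adj-sym
  open Savings adj adj-sym W T using (saved; twice)

  Q M : Fin m → Bool
  Q e = F e ∧ not (T e)
  M e = any (λ i → member i e)

  -- A class member is tied to the colour of its class. Other edges of T may use every colour, and
  -- other edges of Q only the last `C₁`.
  side : Fin m → Fin s ⊎ Fin C₁ → Bool
  side e (inj₁ i) = member i e ∨ (T e ∧ not (M e))
  side e (inj₂ j) = not (M e)

  A : Fin m → Fin (s ℕ.+ C₁) → Bool
  A e c = side e (Fin.splitAt s c)

  M-colour : ∀ e c → M e ≡ true → A e c ≡ true → Σ (Fin s) λ i → (member i e ≡ true) × (c ≡ i Fin.↑ˡ C₁)
  M-colour e c Me Aec = go (Fin.splitAt s c) refl Aec
    where
    go : ∀ x → Fin.splitAt s c ≡ x → side e x ≡ true → Σ (Fin s) λ i → (member i e ≡ true) × (c ≡ i Fin.↑ˡ C₁)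
    go (inj₂ j) eq p = ⊥-elim (true≢false Me (not-elim p))
    go (inj₁ i) eq p with ∨-elim {member i e} p
    ... | inj₁ q = i , q , trans (sym (Finₚ.join-splitAt s C₁ c)) (cong (Fin.join s C₁) eq)
    ... | inj₂ q = ⊥-elim (true≢false Me (not-elim (∧-snd {T e} q)))

  classes-coloured : Colourable M A
  classes-coloured = colouring χ inA prop
    where
    pick : ∀ e → M e ≡ true ⊎ M e ≡ false → Fin (s ℕ.+ C₁)
    pick e (inj₁ p) = proj₁ (any-elim {b = λ i → member i e} p) Fin.↑ˡ C₁
    pick e (inj₂ p) = c₀
    χ : Fin m → Fin (s ℕ.+ C₁)
    χ e = pick e (bool (M e))
    inA : ∀ e → M e ≡ true → A e (χ e) ≡ true
    inA e Me = go (bool (M e))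
      where
      go : ∀ d → A e (pick e d) ≡ true
      go (inj₁ p) = subst (λ x → side e x ≡ true) (sym (Finₚ.splitAt-↑ˡ s (proj₁ (any-elim {b = λ i → member i e} p)) C₁)) (∨-inl (proj₂ (any-elim {b = λ i → member i e} p)))
      go (inj₂ p) = ⊥-elim (true≢false Me p)
    prop : ∀ e f → M e ≡ true → M f ≡ true → e ≢ f → adj e f ≡ true → χ e ≢ χ f
    prop e f Me Mf e≢f ef same = clash (M-colour e (χ e) Me (inA e Me)) (M-colour f (χ f) Mf (inA f Mf))
      where
      clash : (Σ (Fin s) λ i → (member i e ≡ true) × (χ e ≡ i Fin.↑ˡ C₁)) → (Σ (Fin s) λ i → (member i f ≡ true) × (χ f ≡ i Fin.↑ˡ C₁)) → ⊥
      clash (i , p , a) (j , q , b) = true≢false ef (independent i e f p (subst (λ k → member k f ≡ true) (sym (Finₚ.↑ˡ-injective C₁ i j (trans (sym a) (trans same b)))) q) e≢f)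

  -- True on the last `C₁` colours, those not belonging to classes; they are reserved for `Q`.
  reserved : Fin (s ℕ.+ C₁) → Bool
  reserved c = Data.Sum.[ (λ _ → false) , (λ _ → true) ] (Fin.splitAt s c)

  #reserved : ∑ (𝟙 ∘ reserved) ≡ ι C₁
  #reserved = trans (∑-cong (λ c → lem (Fin.splitAt s c))) (trans (∑-splitAt s (λ _ → 0ℚ) (λ _ → 1ℚ)) (trans (cong₂ _+_ (∑-0 s) (trans (∑-const C₁ 1ℚ) (*-identityʳ (ι C₁)))) (+-identityˡ (ι C₁))))
    where
    lem : ∀ x → 𝟙 (Data.Sum.[ (λ _ → false) , (λ _ → true) ] x) ≡ Data.Sum.[ (λ _ → 0ℚ) , (λ _ → 1ℚ) ] x
    lem (inj₁ _) = refl
    lem (inj₂ _) = refl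

  module _ (degenerate-Q : ∀ V → (∀ e → V e ≡ true → Q e ≡ true) → ∀ i → V i ≡ true → Σ (Fin m) λ e → (V e ≡ true) × (deg V e < ι C₁))
    (deg-T : ∀ e → T e ≡ true → deg F e < ι S₀ + ι (s ℕ.+ C₁)) where

    -- Class members never block one of the last `C₁` colours, so only neighbours inside `V` matter
    -- and degeneracy of `Q` is enough.
    colour-Q : ∀ k V → # V ℕ.≤ k → (∀ e → V e ≡ true → (Q e ≡ true) × (M e ≡ false)) → Colourable (λ e → M e ∨ V e) A
    colour-Q zero V #V V⊆ = weaken (λ e p → empty e (∨-elim {M e} p)) (λ _ _ _ q → q) classes-coloured
      where
      empty : ∀ e → M e ≡ true ⊎ V e ≡ true → M e ≡ true
      empty e (inj₁ p) = p
      empty e (inj₂ p) = ⊥-elim (true≢false p (#≡0 (ℕₚ.n≤0⇒n≡0 #V) e))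
    colour-Q (suc k) V #V V⊆ = decide (bool (any V))
      where
      decide : any V ≡ true ⊎ any V ≡ false → Colourable (λ e → M e ∨ V e) A
      decide (inj₂ none) = weaken (λ e p → empty e (∨-elim {M e} p)) (λ _ _ _ q → q) classes-coloured
        where
        empty : ∀ e → M e ≡ true ⊎ V e ≡ true → M e ≡ true
        empty e (inj₁ p) = p
        empty e (inj₂ p) = ⊥-elim (true≢false p (any-false {b = V} none e))
      decide (inj₁ some) = add (degenerate-Q V (λ e p → proj₁ (V⊆ e p)) (proj₁ (any-elim {b = V} some)) (proj₂ (any-elim {b = V} some)))
        where
        add : (Σ (Fin m) λ e → (V e ≡ true) × (deg V e < ι C₁)) → Colourable (λ e → M e ∨ V e) A
        add (e , Ve , lt) = extend e κ′ (c , inA , avoid)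
          where
          κ : Colourable (λ f → M f ∨ (V ∖ e) f) A
          κ = colour-Q k (V ∖ e) (ℕₚ.≤-pred (ℕₚ.≤-trans (#-drop e (∖-⊆ {U = V}) (∖-self {U = V} e) Ve) #V)) (λ f p → V⊆ f (∖-⊆ {U = V} f p))
          κ′ : Colourable ((λ f → M f ∨ V f) ∖ e) A
          κ′ = weaken (λ f p → sub f p (∨-elim {M f} (∖-⊆ {U = λ f → M f ∨ V f} f p))) (λ _ _ _ q → q) κ
            where
            sub : ∀ f → ((λ f → M f ∨ V f) ∖ e) f ≡ true → M f ≡ true ⊎ V f ≡ true → M f ∨ (V ∖ e) f ≡ true
            sub f p (inj₁ q) = ∨-inl q
            sub f p (inj₂ q) = ∨-inr {M f} (∖-intro {U = V} f q (∖-≢ {U = λ f → M f ∨ V f} f p))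
          free = free-colour (colour κ′) (nbr V e) reserved (≤-<-trans (colours≤ (colour κ′) (nbr V e)) (<-≤-trans lt (≤-reflexive (sym #reserved))))
          c = proj₁ free
          inA : A e c ≡ true
          inA = go (Fin.splitAt s c) (proj₁ (proj₂ free))
            where
            go : ∀ x → Data.Sum.[ (λ _ → false) , (λ _ → true) ] x ≡ true → side e x ≡ true
            go (inj₂ j) _ = not-intro (proj₂ (V⊆ e Ve))
          avoid : ∀ f → nbr (λ f → M f ∨ V f) e f ≡ true → colour κ′ f ≢ c
          avoid f p same = go (∨-elim {M f} (∧-fst {M f ∨ V f} p))
            where
            go : M f ≡ true ⊎ V f ≡ true → ⊥
            go (inj₂ Vf) = proj₂ (proj₂ free) f (∧-intro Vf (∧-snd {M f ∨ V f} p)) same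
            go (inj₁ Mf) = clash (M-colour f (colour κ′ f) Mf (allowed κ′ f (∖-intro {U = λ f → M f ∨ V f} f (∧-fst {M f ∨ V f} p) (==false⇒≢ f e (not-elim (∧-fst {not (f == e)} (∧-snd {M f ∨ V f} p)))))))
              where
              clash : (Σ (Fin s) λ i → (member i f ≡ true) × (colour κ′ f ≡ i Fin.↑ˡ C₁)) → ⊥
              clash (i , _ , eq) = true≢false (proj₁ (proj₂ free)) (cong (Data.Sum.[ (λ _ → false) , (λ _ → true) ]) (trans (cong (Fin.splitAt s) (trans (sym same) eq)) (Finₚ.splitAt-↑ˡ s i C₁)))

    base : (Fin m → Bool) → Fin m → Bool
    base V e = M e ∨ ((Q e ∧ not (M e)) ∨ V e)

    M⊆F : ∀ e → M e ≡ true → F e ≡ true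
    M⊆F e p = W⊆F e (member⊆W (proj₁ (any-elim {b = λ i → member i e} p)) e (proj₂ (any-elim {b = λ i → member i e} p)))

    -- A saved class contributes two neighbours with one colour.
    few-colours : ∀ U e → T e ≡ true → (∀ f → M f ≡ true → U f ≡ true) → (κ : Colourable (U ∖ e) A) →
      ∑ (λ c → 𝟙 (any (λ f → nbr U e f ∧ (colour κ f == c)))) + ι S₀ ≤ deg U e
    few-colours U e Te M⊆U κ = begin
      ∑ (λ c → 𝟙 (any (λ f → nbr U e f ∧ (χ f == c)))) + ι S₀ ≤⟨ +-monoʳ-≤ (∑ (λ c → 𝟙 (any (λ f → nbr U e f ∧ (χ f == c))))) (≤-trans (ι-mono (savings e Te)) (≤-reflexive (trans (ι# (λ i → saved e (member i))) (sym total)))) ⟩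
      ∑ (λ c → 𝟙 (any (λ f → nbr U e f ∧ (χ f == c)))) + ∑ (λ c → 𝟙 (sv c)) ≡⟨ sym (∑-+ (λ c → 𝟙 (any (λ f → nbr U e f ∧ (χ f == c)))) (𝟙 ∘ sv)) ⟩
      ∑ (λ c → 𝟙 (any (λ f → nbr U e f ∧ (χ f == c))) + 𝟙 (sv c)) ≤⟨ ∑-mono each ⟩
      ∑ (λ c → ∑ (λ f → 𝟙 (nbr U e f ∧ (χ f == c)))) ≡⟨ ∑-swap (λ c f → 𝟙 (nbr U e f ∧ (χ f == c))) ⟩
      ∑ (λ f → ∑ (λ c → 𝟙 (nbr U e f ∧ (χ f == c)))) ≡⟨ ∑-cong (λ f → trans (∑-cong (λ c → trans (𝟙-∧ (nbr U e f) (χ f == c)) (*-comm (𝟙 (nbr U e f)) (𝟙 (χ f == c))))) (∑-δ (χ f) (λ _ → 𝟙 (nbr U e f)))) ⟩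
      deg U e ∎
      where
      open ℚₚ.≤-Reasoning
      χ = colour κ
      sv′ : Fin s ⊎ Fin C₁ → Bool
      sv′ (inj₁ i) = saved e (member i)
      sv′ (inj₂ _) = false
      sv : Fin (s ℕ.+ C₁) → Bool
      sv c = sv′ (Fin.splitAt s c)
      total : ∑ (𝟙 ∘ sv) ≡ ∑ (λ i → 𝟙 (saved e (member i)))
      total = trans (∑-cong (λ c → lem (Fin.splitAt s c))) (trans (∑-splitAt s (λ i → 𝟙 (saved e (member i))) (λ _ → 0ℚ)) (trans (cong (∑ (λ i → 𝟙 (saved e (member i))) +_) (∑-0 C₁)) (+-identityʳ (∑ (λ i → 𝟙 (saved e (member i)))))))
        where
        lem : ∀ x → 𝟙 (sv′ x) ≡ Data.Sum.[ (λ i → 𝟙 (saved e (member i))) , (λ _ → 0ℚ) ] x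
        lem (inj₁ _) = refl
        lem (inj₂ _) = refl
      each : ∀ c → 𝟙 (any (λ f → nbr U e f ∧ (χ f == c))) + 𝟙 (sv c) ≤ ∑ (λ f → 𝟙 (nbr U e f ∧ (χ f == c)))
      each c = go (Fin.splitAt s c) refl
        where
        uses : Fin m → Bool
        uses f = nbr U e f ∧ (χ f == c)
        go : ∀ x → Fin.splitAt s c ≡ x → 𝟙 (any uses) + 𝟙 (sv′ x) ≤ ∑ (𝟙 ∘ uses)
        go (inj₂ _) _ = ≤-trans (≤-reflexive (+-identityʳ (𝟙 (any uses)))) (𝟙any≤∑ uses)
        go (inj₁ i) eq = decide (bool (saved e (member i)))
          where
          decide : saved e (member i) ≡ true ⊎ saved e (member i) ≡ false → 𝟙 (any uses) + 𝟙 (saved e (member i)) ≤ ∑ (𝟙 ∘ uses)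
          decide (inj₂ p) = ≤-trans (≤-reflexive (trans (cong (λ b → 𝟙 (any uses) + 𝟙 b) p) (+-identityʳ (𝟙 (any uses))))) (𝟙any≤∑ uses)
          decide (inj₁ p) = pair (any-elim {b = λ f → any (λ g → twice e (member i) f g)} p)
            where
            pair : (Σ (Fin m) λ f → any (λ g → twice e (member i) f g) ≡ true) → 𝟙 (any uses) + 𝟙 (saved e (member i)) ≤ ∑ (𝟙 ∘ uses)
            pair (f , p′) = two (any-elim {b = λ g → twice e (member i) f g} p′)
              where
              two : (Σ (Fin m) λ g → twice e (member i) f g ≡ true) → 𝟙 (any uses) + 𝟙 (saved e (member i)) ≤ ∑ (𝟙 ∘ uses)
              two (g , r) = begin
                𝟙 (any uses) + 𝟙 (saved e (member i)) ≤⟨ +-mono-≤ (𝟙≤1 (any uses)) (𝟙≤1 (saved e (member i))) ⟩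
                1ℚ + 1ℚ ≡⟨ sym (cong₂ _+_ (∑-δ f (λ _ → 1ℚ)) (∑-δ g (λ _ → 1ℚ))) ⟩
                ∑ (λ h → 𝟙 (f == h) * 1ℚ) + ∑ (λ h → 𝟙 (g == h) * 1ℚ) ≡⟨ sym (∑-+ (λ h → 𝟙 (f == h) * 1ℚ) (λ h → 𝟙 (g == h) * 1ℚ)) ⟩
                ∑ (λ h → 𝟙 (f == h) * 1ℚ + 𝟙 (g == h) * 1ℚ) ≤⟨ ∑-mono pt ⟩
                ∑ (𝟙 ∘ uses) ∎
                where
                mf = ∧-snd {nbr W e f} (∧-fst {nbr W e f ∧ member i f} r)
                mg = ∧-snd {nbr W e g} (∧-fst {nbr W e g ∧ member i g} (∧-snd {nbr W e f ∧ member i f} r))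
                ef = ∧-fst {nbr W e f} (∧-fst {nbr W e f ∧ member i f} r)
                eg = ∧-fst {nbr W e g} (∧-fst {nbr W e g ∧ member i g} (∧-snd {nbr W e f ∧ member i f} r))
                g≢f = ==false⇒≢ g f (not-elim (∧-snd {nbr W e g ∧ member i g} (∧-snd {nbr W e f ∧ member i f} r)))
                in-uses : ∀ h → nbr W e h ≡ true → member i h ≡ true → uses h ≡ true
                in-uses h eh mh = ∧-intro (∧-intro (M⊆U h Mh) (∧-snd {W h} eh)) (locate (M-colour h (χ h) Mh (allowed κ h (∖-intro {U = U} h (M⊆U h Mh) (==false⇒≢ h e (not-elim (∧-fst {not (h == e)} (∧-snd {W h} eh))))))))
                  where
                  Mh : M h ≡ true
                  Mh = any-intro {b = λ i → member i h} i mh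
                  locate : (Σ (Fin s) λ j → (member j h ≡ true) × (χ h ≡ j Fin.↑ˡ C₁)) → (χ h == c) ≡ true
                  locate (j , mj , eq′) = subst (λ d → (χ h == d) ≡ true) (trans eq′ (trans (cong (Fin._↑ˡ C₁) (disjoint j i h mj mh)) (trans (sym (cong (Fin.join s C₁) eq)) (Finₚ.join-splitAt s C₁ c)))) (==-refl (χ h))
                pt : ∀ h → 𝟙 (f == h) * 1ℚ + 𝟙 (g == h) * 1ℚ ≤ 𝟙 (uses h)
                pt h = at (≡⊎≢ f h) (≡⊎≢ g h)
                  where
                  at : f ≡ h ⊎ f ≢ h → g ≡ h ⊎ g ≢ h → 𝟙 (f == h) * 1ℚ + 𝟙 (g == h) * 1ℚ ≤ 𝟙 (uses h)
                  at (inj₁ refl) (inj₁ refl) = ⊥-elim (g≢f refl)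
                  at (inj₁ refl) (inj₂ q) = ≤-reflexive (trans (cong₂ (λ a b → 𝟙 a * 1ℚ + 𝟙 b * 1ℚ) (==-refl f) (≢⇒== q)) (cong 𝟙 (sym (in-uses f ef mf))))
                  at (inj₂ q) (inj₁ refl) = ≤-reflexive (trans (cong₂ (λ a b → 𝟙 a * 1ℚ + 𝟙 b * 1ℚ) (≢⇒== q) (==-refl g)) (cong 𝟙 (sym (in-uses g eg mg))))
                  at (inj₂ q) (inj₂ q′) = ≤-trans (≤-reflexive (cong₂ (λ a b → 𝟙 a * 1ℚ + 𝟙 b * 1ℚ) (≢⇒== q) (≢⇒== q′))) (0≤𝟙 (uses h))

    -- T comes last, when all class members carry their colours. At most `deg` minus `S₀` colours
    -- are then blocked at e, fewer than the whole palette by `deg-T`.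
    colour-T : ∀ k V → # V ℕ.≤ k → (∀ e → V e ≡ true → (T e ≡ true) × (M e ≡ false)) → Colourable (base V) A
    colour-T k V #V V⊆ = decide k #V (bool (any V))
      where
      decide : ∀ k → # V ℕ.≤ k → any V ≡ true ⊎ any V ≡ false → Colourable (base V) A
      decide k #V (inj₂ none) = weaken (λ e p → drop-V e (∨-elim {M e} p)) (λ _ _ _ q → q)
          (colour-Q (# (λ e → Q e ∧ not (M e))) (λ e → Q e ∧ not (M e)) ℕₚ.≤-refl (λ e p → ∧-fst {Q e} p , not-elim (∧-snd {Q e} p)))
        where
        drop-V : ∀ e → M e ≡ true ⊎ (Q e ∧ not (M e)) ∨ V e ≡ true → M e ∨ (Q e ∧ not (M e)) ≡ true
        drop-V e (inj₁ p) = ∨-inl p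
        drop-V e (inj₂ p) with ∨-elim {Q e ∧ not (M e)} p
        ... | inj₁ q = ∨-inr {M e} q
        ... | inj₂ q = ⊥-elim (true≢false q (any-false {b = V} none e))
      decide zero #V (inj₁ some) = ⊥-elim (true≢false (proj₂ (any-elim {b = V} some)) (#≡0 (ℕₚ.n≤0⇒n≡0 #V) (proj₁ (any-elim {b = V} some))))
      decide (suc k) #V (inj₁ some) = extend e κ′ (c , inA , avoid)
        where
        e = proj₁ (any-elim {b = V} some)
        Ve = proj₂ (any-elim {b = V} some)
        Te = proj₁ (V⊆ e Ve)
        κ : Colourable (base (V ∖ e)) A
        κ = colour-T k (V ∖ e) (ℕₚ.≤-pred (ℕₚ.≤-trans (#-drop e (∖-⊆ {U = V}) (∖-self {U = V} e) Ve) #V)) (λ f p → V⊆ f (∖-⊆ {U = V} f p))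
        κ′ : Colourable (base V ∖ e) A
        κ′ = weaken (λ f p → sub f (∖-≢ {U = base V} f p) (∖-⊆ {U = base V} f p)) (λ _ _ _ q → q) κ
          where
          sub : ∀ f → f ≢ e → base V f ≡ true → base (V ∖ e) f ≡ true
          sub f f≢e p with ∨-elim {M f} p
          ... | inj₁ q = ∨-inl q
          ... | inj₂ q with ∨-elim {Q f ∧ not (M f)} q
          ...   | inj₁ r = ∨-inr {M f} (∨-inl r)
          ...   | inj₂ r = ∨-inr {M f} (∨-inr {Q f ∧ not (M f)} (∖-intro {U = V} f r f≢e))
        base⊆F : ∀ f → base V f ≡ true → F f ≡ true
        base⊆F f p with ∨-elim {M f} p
        ... | inj₁ q = M⊆F f q
        ... | inj₂ q with ∨-elim {Q f ∧ not (M f)} q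
        ...   | inj₁ r = ∧-fst {F f} (∧-fst {Q f} r)
        ...   | inj₂ r = W⊆F f (T⊆W f (proj₁ (V⊆ f r)))
        free = free-colour (colour κ′) (nbr (base V) e) (λ _ → true) (≤-<-trans
          (≤-by (deg (base V) e - (∑ (λ c → 𝟙 (any (λ f → nbr (base V) e f ∧ (colour κ′ f == c)))) + ι S₀)) (ring-184 (deg (base V) e) (∑ (λ c → 𝟙 (any (λ f → nbr (base V) e f ∧ (colour κ′ f == c))))) (ι S₀)) (0≤- (few-colours (base V) e Te (λ f → ∨-inl) κ′)))
          (-<0 (subst (0ℚ <_) (lem₁ (ι S₀) (ι (s ℕ.+ C₁)) (deg (base V) e) (∑ {s ℕ.+ C₁} (λ _ → 1ℚ)) (trans (∑-const (s ℕ.+ C₁) 1ℚ) (*-identityʳ (ι (s ℕ.+ C₁)))))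
            (0<- (≤-<-trans (deg-mono {base V} {F} e base⊆F) (deg-T e Te))))))
          where
          lem₁ : ∀ s c d c′ → c′ ≡ c → (s + c) - d ≡ c′ - (d - s)
          lem₁ s c d .c refl = ring-183 s c d
        c = proj₁ free
        inA : A e c ≡ true
        inA = go (Fin.splitAt s c)
          where
          go : ∀ x → side e x ≡ true
          go (inj₁ i) = ∨-inr {member i e} (∧-intro Te (not-intro (proj₂ (V⊆ e Ve))))
          go (inj₂ j) = not-intro (proj₂ (V⊆ e Ve))
        avoid : ∀ f → nbr (base V) e f ≡ true → colour κ′ f ≢ c
        avoid = proj₂ (proj₂ free)

    assemble : Colourable F (λ _ _ → true)
    assemble = weaken (λ e Fe → cover e Fe (bool (M e)) (bool (T e))) (λ _ _ _ _ → refl)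
        (colour-T (# (λ e → T e ∧ not (M e))) (λ e → T e ∧ not (M e)) ℕₚ.≤-refl (λ e p → ∧-fst {T e} p , not-elim (∧-snd {T e} p)))
      where
      cover : ∀ e → F e ≡ true → M e ≡ true ⊎ M e ≡ false → T e ≡ true ⊎ T e ≡ false → base (λ e → T e ∧ not (M e)) e ≡ true
      cover e Fe (inj₁ p) _ = ∨-inl p
      cover e Fe (inj₂ p) (inj₁ q) = ∨-inr {M e} (∨-inr {Q e ∧ not (M e)} (∧-intro q (not-intro p)))
      cover e Fe (inj₂ p) (inj₂ q) = ∨-inr {M e} (∨-inl (∧-intro (∧-intro Fe (not-intro q)) (not-intro p)))

-- One application of the class selection, with parameters proportional to y.
module Selection {m} (adj : Fin m → Fin m → Bool) (adj-sym : ∀ e f → adj e f ≡ adj f e) (W T : Fin m → Bool) (N δ p t ω : ℚ)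
  (0≤N : 0ℚ ≤ N) (0≤p : 0ℚ ≤ p) (p≤1 : p ≤ 1ℚ) (12pN≡1 : ι 12 * (p * N) ≡ 1ℚ) (5ω≡6 : ι 5 * ω ≡ ι 6) (1≤ω : 1ℚ ≤ ω)
  (0≤δ : 0ℚ ≤ δ) (δ≤1 : δ ≤ 1ℚ) (t≡ : ι 2304 * (1ℚ - t) ≡ δ) (0≤t : 0ℚ ≤ t)
  (T⊆W : ∀ e → T e ≡ true → W e ≡ true) (deg≤2N : ∀ e → W e ≡ true → ListColouring.deg {m} {0} adj adj-sym W e ≤ ι 2 * N)
  (J y : ℕ) (1≤J : 1 ℕ.≤ J) (tJ≤ : ι 4 * t ^ J ≤ 1ℚ) (small-enough : ι 2 * ι m * (ℚ.½ * ω) ^ y < 1ℚ)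
  (pairs : ∀ Z e → T e ≡ true → # (λ f → ListColouring.nbr {m} {0} adj adj-sym W e f ∧ Z f) ℕ.≤ J ℕ.* y →
    ℚ.½ * N * (δ * N) ≤ ∑ (λ f → ∑ (λ g → 𝟙 (Savings.ok adj adj-sym W T Z e f g)))) where
  open ListColouring {m} {0} adj adj-sym using (nbr; deg)

  6pD≤1 : ι 6 * (p * (ι 2 * N)) ≤ 1ℚ
  6pD≤1 = ≤-reflexive (trans (ring-189 p N) 12pN≡1)

  σ = ℚ.½ * N * (δ * N) * (p * (p * ℚ.½) * ℚ.½)

  -- Γ = δN²/2 pairs and p = 1/12N give Γp²/4 = δ/1152, independent of N; this is why a fixed
  -- proportion of the colours can be saved.
  σ≡ : ι 1152 * σ ≡ δ
  σ≡ = trans (ring-190 p N δ) (trans (cong (λ x → δ * (x * x)) 12pN≡1) (ring-191 δ))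

  0≤σ : 0ℚ ≤ σ
  0≤σ = 0≤* (0≤* (0≤* 0≤½ 0≤N) (0≤* 0≤δ 0≤N)) (0≤* (0≤* 0≤p (0≤* 0≤p 0≤½)) 0≤½)

  σ≤1 : σ ≤ 1ℚ
  σ≤1 = ≤-trans (≤-trans (≤-reflexive (sym (*-identityˡ σ))) (*-monoˡ 0≤σ (ι-mono (ℕₚ.≤ᵇ⇒≤ 1 1152 tt)))) (≤-trans (≤-reflexive σ≡) δ≤1)

  τ≡t : 1ℚ - ℚ.½ * σ ≡ t
  τ≡t = ℚₚ.≤-antisym (*-cancel-≤ (0<ι 2303) (≤-reflexive eq)) (*-cancel-≤ (0<ι 2303) (≤-reflexive (sym eq)))
    where
    eq : ι 2304 * (1ℚ - ℚ.½ * σ) ≡ ι 2304 * t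
    eq = trans (ring-192 σ) (trans (cong (λ x → ι 2304 - x) (trans σ≡ (sym t≡))) (ring-193 t))

  S = J ℕ.* y

  open Savings adj adj-sym W T using (Classes; classes)

  -- There are Jy classes and y savings are demanded. The first part is (2t^J)^y, at most 2^(-y) by
  -- 4t^J ≤ 1, and the second is (ω/2)^(Jy); so each e contributes at most 2(3/5)^y.
  initial : ∑ (λ e → 𝟙 (T e) * (ι 2 ^ y * (1ℚ - ℚ.½ * σ) ^ S * 1ℚ + ℚ.½ ^ S * ω ^ S * ι 2 ^ (# (λ f → nbr W e f ∧ false)))) < 1ℚ
  initial = ≤-<-trans (≤-trans (∑-mono each) (≤-reflexive (trans (∑-const m (ι 2 * (ℚ.½ * ω) ^ y)) (ring-194 (ι m) ((ℚ.½ * ω) ^ y))))) small-enough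
    where
    0≤½ω = 0≤* 0≤½ (≤-trans 0≤1 1≤ω)
    first : ι 2 ^ y * t ^ S ≤ (ℚ.½ * ω) ^ y
    first = ≤-trans (≤-reflexive (trans (cong (ι 2 ^ y *_) (trans (cong (t ^_) (ℕₚ.*-comm J y)) (^-* t y J))) (sym (*-^ (ι 2) (t ^ J) y))))
      (^-mono y (0≤* (0≤ι 2) (0≤^ J 0≤t)) (*-cancel-≤ (0<ι 1) (≤-trans (≤-reflexive (ring-186 (t ^ J))) (≤-trans tJ≤ (≤-trans 1≤ω (≤-reflexive (ring-187 ω)))))))
    second : ℚ.½ ^ S * ω ^ S ≤ (ℚ.½ * ω) ^ y
    second = ≤-trans (≤-reflexive (trans (sym (*-^ ℚ.½ ω S)) (trans (cong ((ℚ.½ * ω) ^_) (sym (ℕₚ.m+[n∸m]≡n y≤S))) (^-+ (ℚ.½ * ω) y (S ℕ.∸ y)))))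
      (≤-trans (*-monoʳ (0≤^ y 0≤½ω) (^≤1 (S ℕ.∸ y) 0≤½ω ½ω≤1)) (≤-reflexive (*-identityʳ ((ℚ.½ * ω) ^ y))))
      where
      y≤S : y ℕ.≤ S
      y≤S = ℕₚ.≤-trans (ℕₚ.≤-reflexive (sym (ℕₚ.*-identityˡ y))) (ℕₚ.*-monoˡ-≤ y 1≤J)
      ½ω≤1 : ℚ.½ * ω ≤ 1ℚ
      ½ω≤1 = *-cancel-≤ (0<ι 9) (≤-trans (≤-reflexive (trans (ring-185 ω) 5ω≡6)) (≤-trans (ι-mono (ℕₚ.≤ᵇ⇒≤ 6 10 tt)) (≤-reflexive (sym (*-identityʳ (ι 10))))))
    each : ∀ e → 𝟙 (T e) * (ι 2 ^ y * (1ℚ - ℚ.½ * σ) ^ S * 1ℚ + ℚ.½ ^ S * ω ^ S * ι 2 ^ (# (λ f → nbr W e f ∧ false))) ≤ ι 2 * (ℚ.½ * ω) ^ y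
    each e = ≤-trans (*-mono (0≤𝟙 (T e)) (𝟙≤1 (T e)) (0≤+ (0≤* (0≤* (0≤^ y (0≤ι 2)) (0≤^ S (subst (0ℚ ≤_) (sym τ≡t) 0≤t))) 0≤1) (0≤* (0≤* (0≤^ S 0≤½) (0≤^ S (≤-trans 0≤1 1≤ω))) (0≤^ (# (λ f → nbr W e f ∧ false)) (0≤ι 2))))
      (+-mono-≤ (≤-trans (≤-reflexive (trans (*-identityʳ (ι 2 ^ y * (1ℚ - ℚ.½ * σ) ^ S)) (cong (λ x → ι 2 ^ y * x ^ S) τ≡t))) first)
        (≤-trans (≤-reflexive (trans (cong (λ k → ℚ.½ ^ S * ω ^ S * ι 2 ^ k) none) (*-identityʳ (ℚ.½ ^ S * ω ^ S)))) second)))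
      (≤-reflexive (ring-188 ((ℚ.½ * ω) ^ y)))
      where
      none : # (λ f → nbr W e f ∧ false) ≡ 0
      none = ℕₚ.n≤0⇒n≡0 (ι-cancel-≤ (≤-reflexive (trans (ι# (λ f → nbr W e f ∧ false)) (trans (∑-cong (λ f → cong 𝟙 (∧-false (nbr W e f)))) (∑-0 m)))))
        where
        ∧-false : ∀ b → b ∧ false ≡ false
        ∧-false true = refl
        ∧-false false = refl

  selection : Classes (ι 2 * N) (ℚ.½ * N * (δ * N)) p ω 0≤p 6pD≤1 p≤1 5ω≡6 T⊆W deg≤2N S pairs y (≤-trans 0≤1 1≤ω) σ≤1 S (λ _ → false) (λ _ → 0)
  selection = classes (ι 2 * N) (ℚ.½ * N * (δ * N)) p ω 0≤p 6pD≤1 p≤1 5ω≡6 T⊆W deg≤2N S pairs y (≤-trans 0≤1 1≤ω) σ≤1 1≤ω S (λ _ → false) (λ _ → 0) initial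

fifth : ℚ → ℚ
fifth q = q * (q * (q * (q * q)))

-- Colours needed for the large edges, with all constants fixed in advance.
module LargeEdges {n m C : ℕ} (inc : Fin m → Fin n → Bool) (lin : Linearᴮ inc) (c₀ : Fin C) (E : Fin m → Bool)
  (δ q κ p t ω : ℚ) (J y r₀ : ℕ)
  (0<δ : 0ℚ < δ) (3δ≤1 : ι 3 * δ ≤ 1ℚ) (0<q : 0ℚ < q) (1000q≤δ : ι 1000 * q ≤ δ)
  (q₁ : ℚ) (0<q₁ : 0ℚ < q₁) (10q₁≡½ : ι 10 * q₁ ≡ ℚ.½) (κ≡ : κ ≡ fifth q₁)
  (0<N : 0ℚ < ι n) (2≤q⁵r₀ : ι 2 ≤ fifth q * ι r₀) (2≤κr₀ : ι 2 ≤ κ * ι r₀) (1≤r₀ : 1 ℕ.≤ r₀)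
  (large : ∀ e → E e ≡ true → r₀ ℕ.≤ Incidence.size inc e)
  (0≤p : 0ℚ ≤ p) (p≤1 : p ≤ 1ℚ) (12pN≡1 : ι 12 * (p * ι n) ≡ 1ℚ) (5ω≡6 : ι 5 * ω ≡ ι 6) (1≤ω : 1ℚ ≤ ω)
  (t≡ : ι 2304 * (1ℚ - t) ≡ δ) (0≤t : 0ℚ ≤ t) (1≤J : 1 ℕ.≤ J) (tJ≤ : ι 4 * t ^ J ≤ 1ℚ) (small-enough : ι 2 * ι m * (ℚ.½ * ω) ^ y < 1ℚ)
  (Jy≤δ : ι 16 * ι (J ℕ.* y) ≤ δ * ι n) (Jy≤κ : ι (J ℕ.* y) ≤ (κ - fifth q) * ι n) (y≥ : (ι 3 * q + fifth q) * ι n < ι y)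
  (κ≤1 : κ ≤ 1ℚ) (C≥ : (1ℚ - fifth q) * ι n ≤ ι C)
  (few-middle : ∀ V → (∀ f → V f ≡ true → E f ≡ true) →
    (∀ f → V f ≡ true → ((1ℚ - δ) * (1ℚ - δ) * ι n ≤ ι (Incidence.size inc f) * ι (Incidence.size inc f)) × (ι (Incidence.size inc f) * ι (Incidence.size inc f) ≤ (1ℚ + δ) * (1ℚ + δ) * ι n)) →
    ∑ (𝟙 ∘ V) ≤ (1ℚ - ι 3 * δ) * ι n) where
  open Incidence inc
  open ListColouring {m} {C} adj adj-sym
  open Degrees inc lin using (N; sz; vol; vol-mono)

  All : Fin m → Fin C → Bool
  All _ _ = true

  ∑All : ∑ {C} (λ _ → 1ℚ) ≡ ι C
  ∑All = trans (∑-const C 1ℚ) (*-identityʳ (ι C))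

  0≤q = <⇒≤ 0<q
  δ≤1 : δ ≤ 1ℚ
  δ≤1 = ≤-trans (≤-trans (≤-reflexive (sym (*-identityˡ δ))) (*-monoˡ (<⇒≤ 0<δ) (ι-mono {1} {3} (s≤s z≤n)))) 3δ≤1
  10q≤δ : ι 10 * q ≤ δ
  10q≤δ = ≤-trans (*-monoˡ 0≤q (ι-mono (ℕₚ.≤ᵇ⇒≤ 10 1000 tt))) 1000q≤δ
  10q≤1 = ≤-trans 10q≤δ δ≤1
  10q₁≤1 : ι 10 * q₁ ≤ 1ℚ
  10q₁≤1 = ≤-trans (≤-reflexive 10q₁≡½) ½≤1

  -- C = s + C₁ with s reserved colours.
  s C₁ : ℕ
  s = J ℕ.* y
  C₁ = C ℕ.∸ s
  s≤C : s ℕ.≤ C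
  s≤C = ι-cancel-≤ (≤-trans Jy≤κ (≤-trans (*-monoˡ (<⇒≤ 0<N) (+-monoˡ-≤ (- fifth q) κ≤1)) C≥))
  s+C₁≡C : s ℕ.+ C₁ ≡ C
  s+C₁≡C = ℕₚ.m+[n∸m]≡n s≤C
  C₁≥ : (1ℚ - κ) * N ≤ ι C₁
  C₁≥ = ≤-by ((ι C - (1ℚ - fifth q) * N) + ((κ - fifth q) * N - ι s)) (trans (ι-∸ s≤C) (ring-196 (ι C) (ι s) κ (fifth q) N)) (0≤+ (0≤- C≥) (0≤- Jy≤κ))

  module _ (F : Fin m → Bool) (F⊆E : ∀ e → F e ≡ true → E e ≡ true) (saturated : ∀ e → F e ≡ true → (1ℚ - fifth q) * N ≤ deg F e)
    (e₁ : Fin m) (Fe₁ : F e₁ ≡ true) (least : ∀ f → F f ≡ true → size e₁ ℕ.≤ size f) where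

    2≤q⁵k : ι 2 ≤ fifth q * ι (size e₁)
    2≤q⁵k = ≤-trans 2≤q⁵r₀ (*-monoʳ (0≤* 0≤q (0≤* 0≤q (0≤* 0≤q (0≤* 0≤q 0≤q)))) (ι-mono (large e₁ (F⊆E e₁ Fe₁))))

    module Sat = Saturated inc lin F (size e₁) e₁ refl Fe₁ least q 0<q 10q≤1 2≤q⁵k 0<N saturated

    module SmallSizes (K²≤ : ι (size e₁) * ι (size e₁) ≤ (1ℚ - δ) * (1ℚ - δ) * N) where
      module Sp = Sat.Sparse δ 0<δ 3δ≤1 1000q≤δ K²≤

      deg≤2N : ∀ e → Sat.W e ≡ true → ListColouring.deg {m} {0} adj adj-sym Sat.W e ≤ ι 2 * N
      deg≤2N e We = ≤-trans (deg-mono {Sat.W} {F} e Sat.W⊆F) (≤-trans (Sp.W-deg e We) (*-monoˡ (<⇒≤ 0<N) (≤-trans (+-monoʳ-≤ 1ℚ (≤-trans (*-monoˡ 0≤q (ι-mono (ℕₚ.≤ᵇ⇒≤ 3 10 tt))) 10q≤1)) (≤-reflexive refl))))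

      module Sel = Selection adj adj-sym Sat.W Sp.T N δ p t ω (<⇒≤ 0<N) 0≤p p≤1 12pN≡1 5ω≡6 1≤ω (<⇒≤ 0<δ) δ≤1 t≡ 0≤t Sp.T⊆W deg≤2N J y 1≤J tJ≤ small-enough
        (Sp.pairs (J ℕ.* y) Jy≤δ)

      rest-degenerate : ∀ V → (∀ e → V e ≡ true → Sp.rest e ≡ true) → ∀ i → V i ≡ true → Σ (Fin m) λ e → (V e ≡ true) × (deg V e < ι C₁)
      rest-degenerate V V⊆ i Vi = convert (volume-degenerate inc lin q₁ 0<q₁ 10q₁≤1 0<N r₀ (≤-trans 2≤κr₀ (≤-reflexive (cong (_* ι r₀) κ≡))) Sp.rest
          (λ e p → large e (F⊆E e (∧-fst {F e} p))) (λ e p → ι-mono (ℕₚ.≤-trans 1≤r₀ (large e (F⊆E e (∧-fst {F e} p)))))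
          (<-≤-trans Sp.rest-volume (≤-reflexive (cong (_* (N * N)) (sym (trans (cong (λ x → 1ℚ - x) 10q₁≡½) refl))))) V V⊆ i Vi)
        where
        convert : (Σ (Fin m) λ e → (V e ≡ true) × (deg V e < (1ℚ - fifth q₁) * N)) → Σ (Fin m) λ e → (V e ≡ true) × (deg V e < ι C₁)
        convert (e , Ve , lt) = e , Ve , <-≤-trans lt (≤-trans (≤-reflexive (cong (λ x → (1ℚ - x) * N) (sym κ≡))) C₁≥)

      -- The degree (1 + 3q)N exceeds the palette of at least (1 - q⁵)N colours by less than the y
      -- savings.
      few : ∀ e → Sp.T e ≡ true → deg F e < ι y + ι (s ℕ.+ C₁)
      few e Te = ≤-<-trans (Sp.W-deg e (Sp.T⊆W e Te)) (<-by ((ι y - (ι 3 * q + fifth q) * N) + (ι C - (1ℚ - fifth q) * N))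
          (trans (cong (λ c → ι y + ι c) s+C₁≡C) (ring-195 (ι y) (ι C) q (fifth q) N)) (0<+ (0<- y≥) (0≤- C≥)))

      module Cl = Savings.Classes Sel.selection

      coloured : ListColouring.Colourable {m} {s ℕ.+ C₁} adj adj-sym F (λ _ _ → true)
      coloured = Assembly.assemble adj adj-sym (subst Fin (sym s+C₁≡C) c₀) F Sat.W Sp.T Sat.W⊆F Sp.T⊆W Cl.member (λ c f p → proj₁ (Cl.inside c f p)) Cl.independent Cl.disjoint
        y Cl.savings rest-degenerate few

    colour-saturated : Colourable F All
    colour-saturated = decide (≤⊎> ((1ℚ - δ) * (1ℚ - δ) * N) (ι (size e₁) * ι (size e₁)))
      where
      decide : (1ℚ - δ) * (1ℚ - δ) * N ≤ ι (size e₁) * ι (size e₁) ⊎ ι (size e₁) * ι (size e₁) < (1ℚ - δ) * (1ℚ - δ) * N → Colourable F All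
      decide (inj₁ mid) = ⊥-elim (Sat.not-middle δ 10q≤δ 0<δ mid (λ V V⊆F → few-middle V (λ f p → F⊆E f (V⊆F f p))))
      decide (inj₂ small) = subst (λ c → ListColouring.Colourable {m} {c} adj adj-sym F (λ _ _ → true)) s+C₁≡C (SmallSizes.coloured (<⇒≤ small))

  colour-large : Colourable E All
  colour-large = Peeling.peel adj adj-sym (λ U → Colourable U All) ((1ℚ - fifth q) * N)
    (λ U e Ue lt κ → extend e κ (free-colour (colour κ) (nbr U e) (λ _ → true) (≤-<-trans (colours≤ (colour κ) (nbr U e)) (<-≤-trans lt (≤-trans C≥ (≤-reflexive (sym ∑All)))))))
    E (λ F F⊆E sat → saturated-case F F⊆E sat (bool (any F)))
    where
    saturated-case : ∀ F → (∀ e → F e ≡ true → E e ≡ true) → (∀ e → F e ≡ true → (1ℚ - fifth q) * N ≤ deg F e) → any F ≡ true ⊎ any F ≡ false → Colourable F All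
    saturated-case F F⊆E sat (inj₂ none) = colouring (λ _ → c₀) (λ _ _ → refl) (λ e f p → ⊥-elim (true≢false p (any-false {b = F} none e)))
    saturated-case F F⊆E sat (inj₁ some) = at (argmin F size (proj₁ (any-elim {b = F} some)) (proj₂ (any-elim {b = F} some)))
      where
      at : (Σ (Fin m) λ e → (F e ≡ true) × (∀ f → F f ≡ true → size e ℕ.≤ size f)) → Colourable F All
      at (e₁ , Fe₁ , least) = colour-saturated F F⊆E sat e₁ Fe₁ least

-- Choice of the constants for the large edges

LargeColouring : ℚ → ℚ → ℕ → ℕ → Set
LargeColouring δ τ r₀ n = ∀ {m C} (inc : Fin m → Fin n → Bool) (lin : Linearᴮ inc) → Fin C → (E : Fin m → Bool) → ι m ≤ ι n * ι n →
  (∀ e → E e ≡ true → r₀ ℕ.≤ Incidence.size inc e) →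
  (∀ V → (∀ f → V f ≡ true → E f ≡ true) →
    (∀ f → V f ≡ true → ((1ℚ - δ) * (1ℚ - δ) * ι n ≤ ι (Incidence.size inc f) * ι (Incidence.size inc f)) × (ι (Incidence.size inc f) * ι (Incidence.size inc f) ≤ (1ℚ + δ) * (1ℚ + δ) * ι n)) →
    ∑ (𝟙 ∘ V) ≤ (1ℚ - ι 3 * δ) * ι n) →
  (1ℚ - τ) * ι n ≤ ι C → ListColouring.Colourable {m} {C} (Incidence.adj inc) (Incidence.adj-sym inc) E (λ _ _ → true)

q*x≤x : ∀ {q x} → q ≤ 1ℚ → 0ℚ ≤ x → q * x ≤ x
q*x≤x {q} {x} q≤1 0≤x = ≤-trans (*-monoˡ 0≤x q≤1) (≤-reflexive (*-identityˡ x))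

fifth≤ : ∀ {q} → 0ℚ ≤ q → q ≤ 1ℚ → fifth q ≤ q
fifth≤ {q} 0≤q q≤1 = ≤-trans (q*x≤x q≤1 (0≤* 0≤q (0≤* 0≤q (0≤* 0≤q 0≤q)))) (≤-trans (q*x≤x q≤1 (0≤* 0≤q (0≤* 0≤q 0≤q))) (≤-trans (q*x≤x q≤1 (0≤* 0≤q 0≤q)) (q*x≤x q≤1 0≤q)))

0<fifth : ∀ {q} → 0ℚ < q → 0ℚ < fifth q
0<fifth p = 0<* p (0<* p (0<* p (0<* p p)))

-- `t`, `J` and `κ` come first. Then μ = δκ/16J makes the number Jy of classes, with y about μN,
-- small against both δN and κN, and q = μ/1000 makes the excess degree of order qN small against
-- the savings y. Last come `r₀`, so that q⁵r₀ ≥ 2, and `n₀`, so that y is large enough for the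
-- exponential decay.
module LargeConstants (δ : ℚ) (0<δ : 0ℚ < δ) (3δ≤1 : ι 3 * δ ≤ 1ℚ)
  (q₁ κ : ℚ) (0<q₁ : 0ℚ < q₁) (10q₁≡½ : ι 10 * q₁ ≡ ℚ.½) (κ≡ : κ ≡ fifth q₁) (0<κ : 0ℚ < κ) (κ≤1 : κ ≤ 1ℚ)
  (ω : ℚ) (5ω≡6 : ι 5 * ω ≡ ι 6) (1≤ω : 1ℚ ≤ ω)
  (t : ℚ) (t≡ : ι 2304 * (1ℚ - t) ≡ δ) (0≤t : 0ℚ ≤ t) (J : ℕ) (1≤J : 1 ℕ.≤ J) (tJ≤ : ι 4 * t ^ J ≤ 1ℚ)
  (μ u : ℚ) (0<μ : 0ℚ < μ) (16Jμ≡ : ι 16 * ι J * μ ≡ δ * κ) (0<u : 0ℚ < u) (μu≡1 : μ * u ≡ 1ℚ)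
  (q : ℚ) (0<q : 0ℚ < q) (1000q≡μ : ι 1000 * q ≡ μ)
  (y₀ : ℕ) (decay : ∀ y → y ≥ y₀ → ι 8 * (u * u) * (ι y * ι y) * (ℚ.½ * ω) ^ y < 1ℚ)
  (r₀ : ℕ) (1≤r₀ : 1 ℕ.≤ r₀) (2≤q⁵r₀ : ι 2 ≤ fifth q * ι r₀)
  (n₀ : ℕ) (1≤n₀ : 1 ℕ.≤ n₀) (n₀≥ : (ι y₀ + ι 2) * u ≤ ι n₀) where

  0≤δ = <⇒≤ 0<δ
  δ≤1 : δ ≤ 1ℚ
  δ≤1 = ≤-trans (≤-trans (≤-reflexive (sym (*-identityˡ δ))) (*-monoˡ 0≤δ (ι-mono {1} {3} (s≤s z≤n)))) 3δ≤1
  0≤q = <⇒≤ 0<q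
  0≤μ = <⇒≤ 0<μ
  0≤κ = <⇒≤ 0<κ
  16μ≤δκ : ι 16 * μ ≤ δ * κ
  16μ≤δκ = ≤-trans (*-monoˡ 0≤μ (≤-trans (≤-reflexive (sym (*-identityʳ (ι 16)))) (*-monoʳ (0≤ι 16) (ι-mono 1≤J)))) (≤-reflexive 16Jμ≡)
  μ≤16μ : μ ≤ ι 16 * μ
  μ≤16μ = ≤-trans (≤-reflexive (sym (*-identityˡ μ))) (*-monoˡ 0≤μ (ι-mono {1} {16} (s≤s z≤n)))
  δκ≤δ : δ * κ ≤ δ
  δκ≤δ = ≤-trans (*-monoʳ 0≤δ κ≤1) (≤-reflexive (*-identityʳ δ))
  δκ≤κ : δ * κ ≤ κ
  δκ≤κ = q*x≤x δ≤1 0≤κ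
  1000q≤δ : ι 1000 * q ≤ δ
  1000q≤δ = ≤-trans (≤-reflexive 1000q≡μ) (≤-trans μ≤16μ (≤-trans 16μ≤δκ δκ≤δ))
  16q≤μ : ι 16 * q ≤ μ
  16q≤μ = ≤-trans (*-monoˡ 0≤q (ι-mono (ℕₚ.≤ᵇ⇒≤ 16 1000 tt))) (≤-reflexive 1000q≡μ)
  16q≤κ : ι 16 * q ≤ κ
  16q≤κ = ≤-trans 16q≤μ (≤-trans μ≤16μ (≤-trans 16μ≤δκ δκ≤κ))
  q≤16q : q ≤ ι 16 * q
  q≤16q = ≤-trans (≤-reflexive (sym (*-identityˡ q))) (*-monoˡ 0≤q (ι-mono {1} {16} (s≤s z≤n)))
  q≤κ = ≤-trans q≤16q 16q≤κ
  q⁵≤q : fifth q ≤ q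
  q⁵≤q = fifth≤ 0≤q (≤-trans q≤κ κ≤1)
  2≤κr₀ : ι 2 ≤ κ * ι r₀
  2≤κr₀ = ≤-trans 2≤q⁵r₀ (*-monoˡ (0≤ι r₀) (≤-trans q⁵≤q q≤κ))

  module At (n : ℕ) (n≥ : n ≥ n₀) (p : ℚ) (0<p : 0ℚ < p) (12np≡1 : ι 12 * ι n * p ≡ 1ℚ) (y : ℕ) (y≤ : ι y ≤ μ * ι n) (<1+y : μ * ι n < 1ℚ + ι y) where
    N = ι n
    0<N : 0ℚ < N
    0<N = 0<ι⁺ (ℕₚ.≤-trans 1≤n₀ n≥)
    0≤N = <⇒≤ 0<N
    1≤N : 1ℚ ≤ N
    1≤N = ι-mono (ℕₚ.≤-trans 1≤n₀ n≥)
    μN≥ : ι y₀ + ι 2 ≤ μ * N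
    μN≥ = ≤-trans (≤-reflexive (trans (sym (*-identityʳ (ι y₀ + ι 2))) (trans (cong ((ι y₀ + ι 2) *_) (sym μu≡1)) (ring-16 (ι y₀ + ι 2) μ u)))) (*-monoʳ 0≤μ (≤-trans n₀≥ (ι-mono n≥)))
    y≥y₀ : y ≥ y₀
    y≥y₀ = ℕₚ.<⇒≤ (ι-cancel-< (-<0 (≤-<-trans ≤-refl (subst (0ℚ <_) (ring-199 (ι y) (ι y₀) (μ * N)) (0<+ (0<+ 0<1 (0≤- μN≥)) (<⇒≤ (0<- <1+y)))))))
    1≤y : 1ℚ ≤ ι y
    1≤y = ≤-by ((1ℚ + ι y - μ * N) + (μ * N - (ι y₀ + ι 2)) + ι y₀) (ring-200 (ι y) (ι y₀) (μ * N)) (0≤+ (0≤+ (<⇒≤ (0<- <1+y)) (0≤- μN≥)) (0≤ι y₀))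
    N≤ : N ≤ ι 2 * u * ι y
    N≤ = ≤-trans (≤-reflexive (trans (sym (*-identityʳ N)) (trans (cong (N *_) (sym μu≡1)) (ring-201 N μ u)))) (≤-trans (*-monoʳ (<⇒≤ 0<u) (≤-trans (<⇒≤ <1+y) (+-monoˡ-≤ (ι y) 1≤y))) (≤-reflexive (ring-202 u (ι y))))
    0≤½ω = 0≤* 0≤½ (≤-trans 0≤1 1≤ω)
    small-enough : ∀ {m} → ι m ≤ N * N → ι 2 * ι m * (ℚ.½ * ω) ^ y < 1ℚ
    small-enough {m} m≤ = ≤-<-trans (*-monoˡ (0≤^ y 0≤½ω) (≤-trans (*-monoʳ (0≤ι 2) (≤-trans m≤ (*-mono 0≤N N≤ 0≤N N≤))) (≤-reflexive (ring-203 u (ι y))))) (decay y y≥y₀)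
    0≤p = <⇒≤ 0<p
    p≤1 : p ≤ 1ℚ
    p≤1 = ≤-trans (≤-trans (≤-reflexive (sym (*-identityˡ p))) (*-monoˡ 0≤p (*-mono 0≤1 (ι-mono {1} {12} (s≤s z≤n)) 0≤1 1≤N))) (≤-reflexive 12np≡1)
    12pN≡1 : ι 12 * (p * N) ≡ 1ℚ
    12pN≡1 = trans (ring-204 (ι 12) p N) 12np≡1
    16Jy≤ : ι 16 * ι (J ℕ.* y) ≤ δ * κ * N
    16Jy≤ = ≤-trans (≤-reflexive (trans (cong (ι 16 *_) (ι-* J y)) (sym (*-assoc (ι 16) (ι J) (ι y))))) (≤-trans (*-monoʳ (0≤* (0≤ι 16) (0≤ι J)) y≤)
      (≤-reflexive (trans (sym (*-assoc (ι 16 * ι J) μ N)) (cong (_* N) 16Jμ≡))))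
    Jy≤δ : ι 16 * ι (J ℕ.* y) ≤ δ * N
    Jy≤δ = ≤-trans 16Jy≤ (*-monoˡ 0≤N δκ≤δ)
    Jy≤κ : ι (J ℕ.* y) ≤ (κ - fifth q) * N
    Jy≤κ = *-cancel-≤ (0<ι 15) (≤-trans (≤-trans 16Jy≤ (*-monoˡ 0≤N δκ≤κ)) (≤-by ((ι 14 * κ + ι 16 * (q - fifth q) + (κ - ι 16 * q)) * N) (ring-205 κ (fifth q) q N)
      (0≤* (0≤+ (0≤+ (0≤* (0≤ι 14) 0≤κ) (0≤* (0≤ι 16) (0≤- q⁵≤q))) (0≤- 16q≤κ)) 0≤N)))
    y≥ : (ι 3 * q + fifth q) * N < ι y
    y≥ = *-cancel-< (0<ι 3) (<-by (ι 4 * (1ℚ + ι y - μ * N) + (ι 3 * (μ * N - (ι y₀ + ι 2)) + ι 3 * ι y₀ + (μ - ι 16 * q) * N + ι 4 * (q - fifth q) * N + ι 2)) (ring-206 (ι y) μ N (ι y₀) q (fifth q))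
      (0<+ (0<* (0<ι 3) (0<- <1+y)) (0≤+ (0≤+ (0≤+ (0≤+ (0≤* (0≤ι 3) (0≤- μN≥)) (0≤* (0≤ι 3) (0≤ι y₀))) (0≤* (0≤- 16q≤μ) 0≤N)) (0≤* (0≤* (0≤ι 4) (0≤- q⁵≤q)) 0≤N)) (0≤ι 2))))

    colour-all : LargeColouring δ (fifth q) r₀ n
    colour-all {m} inc lin c₀ E m≤ large few C≥ = LargeEdges.colour-large inc lin c₀ E δ q κ p t ω J y r₀ 0<δ 3δ≤1 0<q 1000q≤δ q₁ 0<q₁ 10q₁≡½ κ≡ 0<N 2≤q⁵r₀ 2≤κr₀ 1≤r₀
      large 0≤p p≤1 12pN≡1 5ω≡6 1≤ω t≡ 0≤t 1≤J tJ≤ (small-enough {m} m≤) Jy≤δ Jy≤κ y≥ κ≤1 C≥ few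

  large-n : ∀ n → n ≥ n₀ → LargeColouring δ (fifth q) r₀ n
  large-n n n≥ = with-p (recip (0<* (0<ι 11) (0<ι⁺ (ℕₚ.≤-trans 1≤n₀ n≥))))
    where
    with-p : (Σ ℚ λ p → (0ℚ < p) × (ι 12 * ι n * p ≡ 1ℚ)) → LargeColouring δ (fifth q) r₀ n
    with-p (p , 0<p , 12np≡1) = with-y (floor (μ * ι n) (0≤* 0≤μ (0≤ι n)))
      where
      with-y : (Σ ℕ λ y → (ι y ≤ μ * ι n) × (μ * ι n < 1ℚ + ι y)) → LargeColouring δ (fifth q) r₀ n
      with-y (y , y≤ , <1+y) = At.colour-all n n≥ p 0<p 12np≡1 y y≤ <1+y

large-edges : ∀ δ → 0ℚ < δ → ι 3 * δ ≤ 1ℚ → Σ ℚ λ τ → (0ℚ < τ) × (ι 8 * τ ≤ δ) × Σ ℕ λ r₀ → Σ ℕ λ n₀ → ∀ n → n ≥ n₀ → LargeColouring δ τ r₀ n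
-- 10/20 = ½ matches the half in `rest-volume`. Each further constant enters as a function argument,
-- so later terms treat it as a variable.
large-edges δ 0<δ 3δ≤1 = with-q₁ ((ℤ.+ 1) ℚ./ 20) (ℚₚ.positive⁻¹ ((ℤ.+ 1) ℚ./ 20)) refl
  where
  Result : Set
  Result = Σ ℚ λ τ → (0ℚ < τ) × (ι 8 * τ ≤ δ) × Σ ℕ λ r₀ → Σ ℕ λ n₀ → ∀ n → n ≥ n₀ → LargeColouring δ τ r₀ n
  0≤δ = <⇒≤ 0<δ
  δ≤1 : δ ≤ 1ℚ
  δ≤1 = ≤-trans (≤-trans (≤-reflexive (sym (*-identityˡ δ))) (*-monoˡ 0≤δ (ι-mono {1} {3} (s≤s z≤n)))) 3δ≤1
  with-q₁ : ∀ q₁ → 0ℚ < q₁ → ι 10 * q₁ ≡ ℚ.½ → Result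
  with-q₁ q₁ 0<q₁ 10q₁≡½ = with-κ (fifth q₁) refl (0<fifth 0<q₁) (≤-trans (fifth≤ (<⇒≤ 0<q₁) q₁≤1) q₁≤1)
    where
    q₁≤1 : q₁ ≤ 1ℚ
    q₁≤1 = ≤-trans (≤-trans (≤-reflexive (sym (*-identityˡ q₁))) (*-monoˡ (<⇒≤ 0<q₁) (ι-mono {1} {10} (s≤s z≤n)))) (≤-trans (≤-reflexive 10q₁≡½) ½≤1)
    with-κ : ∀ κ → κ ≡ fifth q₁ → 0ℚ < κ → κ ≤ 1ℚ → Result
    with-κ κ κ≡ 0<κ κ≤1 = with-ω (recip (0<ι 4))
      where
      with-ω : (Σ ℚ λ g → (0ℚ < g) × (ι 5 * g ≡ 1ℚ)) → Result
      with-ω (g , 0<g , 5g≡1) = with-t (recip (0<ι 2303))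
        where
        ω = ι 6 * g
        5ω≡6 : ι 5 * ω ≡ ι 6
        5ω≡6 = trans (ring-198 g) (trans (cong (ι 6 *_) 5g≡1) (*-identityʳ (ι 6)))
        1≤ω : 1ℚ ≤ ω
        1≤ω = *-cancel-≤ (0<ι 4) (≤-trans (≤-trans (≤-reflexive (*-identityʳ (ι 5))) (ι-mono (ℕₚ.≤ᵇ⇒≤ 5 6 tt))) (≤-reflexive (sym 5ω≡6)))
        0<½ω : 0ℚ < ℚ.½ * ω
        0<½ω = 0<* (ℚₚ.positive⁻¹ ℚ.½) (<-≤-trans 0<1 1≤ω)
        ½ω<1 : ℚ.½ * ω < 1ℚ
        ½ω<1 = *-cancel-< (0<ι 9) (≤-<-trans (≤-reflexive (trans (ring-185 ω) 5ω≡6)) (<-≤-trans (ι-mono-< (ℕₚ.<ᵇ⇒< 6 10 tt)) (≤-reflexive (sym (*-identityʳ (ι 10))))))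
        with-t : (Σ ℚ λ h → (0ℚ < h) × (ι 2304 * h ≡ 1ℚ)) → Result
        with-t (h , 0<h , 2304h≡1) = with-J (geometric-beats-square 0<t t<1 (ι 4))
          where
          t = 1ℚ - δ * h
          t≡ : ι 2304 * (1ℚ - t) ≡ δ
          t≡ = trans (ring-197 (ι 2304) δ h) (trans (cong (δ *_) 2304h≡1) (*-identityʳ δ))
          h<1 : h < 1ℚ
          h<1 = *-cancel-< (0<ι 2303) (≤-<-trans (≤-reflexive 2304h≡1) (<-≤-trans (ι-mono-< (ℕₚ.<ᵇ⇒< 1 2304 tt)) (≤-reflexive (sym (*-identityʳ (ι 2304))))))
          0<t : 0ℚ < t
          0<t = 0<- (≤-<-trans (q*x≤x δ≤1 (<⇒≤ 0<h)) h<1)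
          t<1 : t < 1ℚ
          t<1 = <-by (δ * h) (ring-19 (δ * h)) (0<* 0<δ 0<h)
          with-J : (Σ ℕ λ z₀ → ∀ z → z ≥ z₀ → ι 4 * (ι z * ι z) * t ^ z < 1ℚ) → Result
          with-J (z₀ , f) = with-jj (recip (0<* (0<ι 15) (0<ι z₀)))
            where
            J = suc z₀
            1≤J : 1 ℕ.≤ J
            1≤J = s≤s z≤n
            1≤ιJ : 1ℚ ≤ ι J
            1≤ιJ = ι-mono 1≤J
            tJ≤ : ι 4 * t ^ J ≤ 1ℚ
            tJ≤ = ≤-trans (*-monoˡ (0≤^ J (<⇒≤ 0<t)) (≤-trans (≤-reflexive (sym (*-identityʳ (ι 4)))) (*-monoʳ (0≤ι 4) (*-mono 0≤1 1≤ιJ 0≤1 1≤ιJ)))) (<⇒≤ (f J (ℕₚ.n≤1+n z₀)))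
            with-jj : (Σ ℚ λ j → (0ℚ < j) × (ι 16 * ι J * j ≡ 1ℚ)) → Result
            with-jj (j , 0<j , 16Jj≡1) = with-u (recip 0<μ)
              where
              μ = δ * κ * j
              0<μ : 0ℚ < μ
              0<μ = 0<* (0<* 0<δ 0<κ) 0<j
              16Jμ≡ : ι 16 * ι J * μ ≡ δ * κ
              16Jμ≡ = trans (ring-16 (ι 16 * ι J) (δ * κ) j) (trans (cong (δ * κ *_) 16Jj≡1) (*-identityʳ (δ * κ)))
              with-u : (Σ ℚ λ u → (0ℚ < u) × (μ * u ≡ 1ℚ)) → Result
              with-u (u , 0<u , μu≡1) = with-q (recip (0<ι 999))
                where
                with-q : (Σ ℚ λ v → (0ℚ < v) × (ι 1000 * v ≡ 1ℚ)) → Result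
                with-q (v , 0<v , 1000v≡1) = with-y₀ (geometric-beats-square 0<½ω ½ω<1 (ι 8 * (u * u)))
                  where
                  q = μ * v
                  0<q : 0ℚ < q
                  0<q = 0<* 0<μ 0<v
                  1000q≡μ : ι 1000 * q ≡ μ
                  1000q≡μ = trans (ring-16 (ι 1000) μ v) (trans (cong (μ *_) 1000v≡1) (*-identityʳ μ))
                  with-y₀ : (Σ ℕ λ y₀ → ∀ y → y ≥ y₀ → ι 8 * (u * u) * (ι y * ι y) * (ℚ.½ * ω) ^ y < 1ℚ) → Result
                  with-y₀ (y₀ , decay) = with-w (recip (0<fifth 0<q))
                    where
                    with-w : (Σ ℚ λ w → (0ℚ < w) × (fifth q * w ≡ 1ℚ)) → Result
                    with-w (w , 0<w , q⁵w≡1) = with-r (archimedean⁺ (ι 2 * w)) (archimedean⁺ ((ι y₀ + ι 2) * u))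
                      where
                      with-r : (Σ ℕ λ r₀ → (1 ℕ.≤ r₀) × (ι 2 * w ≤ ι r₀)) → (Σ ℕ λ n₀ → (1 ℕ.≤ n₀) × ((ι y₀ + ι 2) * u ≤ ι n₀)) → Result
                      with-r (r₀ , 1≤r₀ , r₀≥) (n₀ , 1≤n₀ , n₀≥) = fifth q , 0<fifth 0<q , 8q⁵≤δ , r₀ , n₀ , LC.large-n
                        where
                        2≤q⁵r₀ : ι 2 ≤ fifth q * ι r₀
                        2≤q⁵r₀ = ≤-trans (≤-reflexive (trans (sym (*-identityʳ (ι 2))) (trans (cong (ι 2 *_) (sym q⁵w≡1)) (ring-16 (ι 2) (fifth q) w)))) (*-monoʳ (<⇒≤ (0<fifth 0<q)) r₀≥)
                        module LC = LargeConstants δ 0<δ 3δ≤1 q₁ κ 0<q₁ 10q₁≡½ κ≡ 0<κ κ≤1 ω 5ω≡6 1≤ω t t≡ (<⇒≤ 0<t) J 1≤J tJ≤ μ u 0<μ 16Jμ≡ 0<u μu≡1 q 0<q 1000q≡μ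
                          y₀ decay r₀ 1≤r₀ 2≤q⁵r₀ n₀ 1≤n₀ n₀≥
                        8q⁵≤δ : ι 8 * fifth q ≤ δ
                        8q⁵≤δ = ≤-trans (*-monoʳ (0≤ι 8) LC.q⁵≤q) (≤-trans (*-monoˡ (<⇒≤ 0<q) (ι-mono (ℕₚ.≤ᵇ⇒≤ 8 1000 tt))) LC.1000q≤δ)

-- Combining small, medium and large edges

if-true : ∀ {X : Set} {b} {x y : X} → b ≡ true → (if b then x else y) ≡ x
if-true refl = refl

if-false : ∀ {X : Set} {b} {x y : X} → b ≡ false → (if b then x else y) ≡ y
if-false refl = refl

∨-right : ∀ {a b} → a ≡ false → a ∨ b ≡ true → b ≡ true
∨-right refl p = p

module _ {m : ℕ} (adj : Fin m → Fin m → Bool) (adj-sym : ∀ e f → adj e f ≡ adj f e) where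

  module _ {C : ℕ} where
    open ListColouring {m} {C} adj adj-sym

    unblocked : ∀ {U A} → Colourable U A → Fin m → Fin C → Bool
    unblocked {U} κ e c = not (any (λ f → nbr U e f ∧ (colour κ f == c)))

    unblocked≥ : ∀ {U A} (κ : Colourable U A) e → ι C - deg U e ≤ ι (# (unblocked κ e))
    unblocked≥ {U} κ e = begin
      ι C - deg U e ≤⟨ +-monoʳ-≤ (ι C) (ℚₚ.neg-antimono-≤ (colours≤ (colour κ) (nbr U e))) ⟩
      ι C - ∑ (λ c → 𝟙 (blocked c)) ≡⟨ cong (_- ∑ (λ c → 𝟙 (blocked c))) (sym (trans (∑-const C 1ℚ) (*-identityʳ (ι C)))) ⟩
      ∑ {C} (λ _ → 1ℚ) - ∑ (λ c → 𝟙 (blocked c)) ≡⟨ sym (∑-- (λ _ → 1ℚ) (λ c → 𝟙 (blocked c))) ⟩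
      ∑ (λ c → 1ℚ - 𝟙 (blocked c)) ≡⟨ ∑-cong (λ c → sym (𝟙-not (blocked c))) ⟩
      ∑ (𝟙 ∘ unblocked κ e) ≡⟨ sym (ι# (unblocked κ e)) ⟩
      ι (# (unblocked κ e)) ∎
      where
      open ℚₚ.≤-Reasoning
      blocked : Fin C → Bool
      blocked c = any (λ f → nbr U e f ∧ (colour κ f == c))

    -- The lists of the second part omit every colour that the first part uses on a neighbour, so
    -- both parts share one palette; `juxtapose` spends two.
    union : ∀ {U V A} (κ : Colourable U A) → Colourable V (unblocked κ) → Colourable (λ e → U e ∨ V e) (λ _ _ → true)
    union {U} {V} κ κ′ = colouring χ (λ _ _ → refl) χ-proper
      where
      χ : Fin m → Fin C
      χ e = if U e then colour κ e else colour κ′ e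
      crossing : ∀ e f → U e ≡ true → V f ≡ true → e ≢ f → adj e f ≡ true → colour κ e ≢ colour κ′ f
      crossing e f Ue Vf e≢f ef same = true≢false
        (∧-intro {nbr U f e} (∧-intro Ue (∧-intro (not-intro (≢⇒== e≢f)) (trans (adj-sym f e) ef))) (subst (λ c → (colour κ e == c) ≡ true) same (==-refl (colour κ e))))
        (any-false (not-elim (allowed κ′ f Vf)) e)
      χ-proper : ∀ e f → U e ∨ V e ≡ true → U f ∨ V f ≡ true → e ≢ f → adj e f ≡ true → χ e ≢ χ f
      χ-proper e f p q e≢f ef = go (bool (U e)) (bool (U f))
        where
        go : U e ≡ true ⊎ U e ≡ false → U f ≡ true ⊎ U f ≡ false → χ e ≢ χ f
        go (inj₁ Ue) (inj₁ Uf) = subst₂ _≢_ (sym (if-true Ue)) (sym (if-true Uf)) (proper κ e f Ue Uf e≢f ef)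
        go (inj₁ Ue) (inj₂ Uf) = subst₂ _≢_ (sym (if-true Ue)) (sym (if-false Uf)) (crossing e f Ue (∨-right Uf q) e≢f ef)
        go (inj₂ Ue) (inj₁ Uf) = subst₂ _≢_ (sym (if-false Ue)) (sym (if-true Uf)) (crossing f e Uf (∨-right Ue p) (e≢f ∘ sym) (trans (adj-sym f e) ef) ∘ sym)
        go (inj₂ Ue) (inj₂ Uf) = subst₂ _≢_ (sym (if-false Ue)) (sym (if-false Uf)) (proper κ′ e f (∨-right Ue p) (∨-right Uf q) e≢f ef)

  juxtapose : ∀ {a b U V A B} → ListColouring.Colourable {m} {a} adj adj-sym U A → ListColouring.Colourable {m} {b} adj adj-sym V B →
    ListColouring.Colourable {m} {a ℕ.+ b} adj adj-sym (λ e → U e ∨ V e) (λ _ _ → true)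
  juxtapose {a} {b} {U} {V} κ κ′ = ListColouring.colouring χ (λ _ _ → refl) χ-proper
    where
    open ListColouring
    χ : Fin m → Fin (a ℕ.+ b)
    χ e = if U e then colour κ e Fin.↑ˡ b else a Fin.↑ʳ colour κ′ e
    apart : (i : Fin a) (j : Fin b) → i Fin.↑ˡ b ≢ a Fin.↑ʳ j
    apart i j p = case trans (sym (Finₚ.splitAt-↑ˡ a i b)) (trans (cong (Fin.splitAt a) p) (Finₚ.splitAt-↑ʳ a b j)) of λ ()
    χ-proper : ∀ e f → U e ∨ V e ≡ true → U f ∨ V f ≡ true → e ≢ f → adj e f ≡ true → χ e ≢ χ f
    χ-proper e f p q e≢f ef = go (bool (U e)) (bool (U f))
      where
      go : U e ≡ true ⊎ U e ≡ false → U f ≡ true ⊎ U f ≡ false → χ e ≢ χ f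
      go (inj₁ Ue) (inj₁ Uf) = subst₂ _≢_ (sym (if-true Ue)) (sym (if-true Uf)) (proper κ e f Ue Uf e≢f ef ∘ Finₚ.↑ˡ-injective b (colour κ e) (colour κ f))
      go (inj₁ Ue) (inj₂ Uf) = subst₂ _≢_ (sym (if-true Ue)) (sym (if-false Uf)) (apart (colour κ e) (colour κ′ f))
      go (inj₂ Ue) (inj₁ Uf) = subst₂ _≢_ (sym (if-false Ue)) (sym (if-true Uf)) (apart (colour κ f) (colour κ′ e) ∘ sym)
      go (inj₂ Ue) (inj₂ Uf) = subst₂ _≢_ (sym (if-false Ue)) (sym (if-false Uf)) (proper κ′ e f (∨-right Ue p) (∨-right Uf q) e≢f ef ∘ Finₚ.↑ʳ-injective a (colour κ′ e) (colour κ′ f))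

does⇒ : ∀ {X : Set} (d : Dec X) → does d ≡ true → X
does⇒ (yes x) _ = x

¬does⇒ : ∀ {X : Set} (d : Dec X) → does d ≡ false → ¬ X
¬does⇒ (no ¬x) _ = ¬x

module SizeClasses {n m} (inc : Fin m → Fin n → Bool) (lin : Linearᴮ inc) where
  open Incidence inc
  open Degrees inc lin using (N; sz; dg; star; ∑sz)

  star-count : ∀ F v r → (∀ e → F e ≡ true → r ℕ.< size e) → # (λ f → inc f v ∧ F f) ℕ.* r ℕ.≤ n
  star-count F v r big = ι-cancel-≤ (begin
    ι (# (λ f → inc f v ∧ F f) ℕ.* r) ≡⟨ trans (ι-* (# (λ f → inc f v ∧ F f)) r) (cong (_* ι r) (ι# (λ f → inc f v ∧ F f))) ⟩
    dg F v * ι r ≡⟨ sym (∑-*ʳ (ι r) (λ f → 𝟙 (inc f v ∧ F f))) ⟩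
    ∑ (λ f → 𝟙 (inc f v ∧ F f) * ι r) ≤⟨ ∑-guard-mono (λ f → inc f v ∧ F f) (λ f p → 0≤-sub (ι r) (sz f) (ι-mono (big f (∧-snd {inc f v} p)))) ⟩
    ∑ (λ f → 𝟙 (inc f v ∧ F f) * (sz f - 1ℚ)) ≤⟨ star F v ⟩
    ι n ∎)
    where
    open ℚₚ.≤-Reasoning
    0≤-sub : ∀ x y → 1ℚ + x ≤ y → x ≤ y - 1ℚ
    0≤-sub x y p = -≤0 (subst (0ℚ ≤_) (ring-208 x y) (0≤- p))

  edges≤ : (∀ e → 1 ℕ.≤ size e) → (∀ v → # (λ e → inc e v) ℕ.≤ n) → ι m ≤ N * N
  edges≤ 1≤size deg≤n = begin
    ι m ≡⟨ sym (trans (∑-const m 1ℚ) (*-identityʳ (ι m))) ⟩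
    ∑ {m} (λ _ → 1ℚ) ≤⟨ ∑-mono (λ e → ι-mono (1≤size e)) ⟩
    ∑ sz ≡⟨ ∑-cong (λ e → sym (*-identityˡ (sz e))) ⟩
    ∑ (λ e → 1ℚ * sz e) ≡⟨ ∑sz (λ _ → true) ⟩
    ∑ (dg (λ _ → true)) ≤⟨ ∑-mono (λ v → ≤-trans (≤-trans (∑-mono (λ e → 𝟙-mono (∧-fst {inc e v}))) (≤-reflexive (sym (ι# (λ e → inc e v))))) (ι-mono (deg≤n v))) ⟩
    ∑ {n} (λ _ → N) ≡⟨ ∑-const n N ⟩
    N * N ∎
    where open ℚₚ.≤-Reasoning

  module _ (S B D z r₀ : ℕ) where
    r₁ P : ℕ
    r₁ = suc (2 ℕ.* S)
    P = 2 ℕ.* S ℕ.* (2 ℕ.* S)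

    -- With n ≤ 2Sz, edges of size above 2S have degree at most z at any vertex, and edges of size
    -- above 2S r₁ at most z/r₁. A small edge, of size at most r₁, therefore meets at most z large
    -- ones.
    large medium small-edge : Fin m → Bool
    large e = does (r₀ ℕ.≤? size e)
    medium e = does (r₁ ℕ.≤? size e) ∧ not (large e)
    small-edge e = not (does (r₁ ℕ.≤? size e)) ∧ not (large e)

    module _ (1≤z : 1 ℕ.≤ z) (r₀> : 2 ℕ.* S ℕ.* r₁ ℕ.< r₀)
      (n≤ : n ℕ.≤ 2 ℕ.* S ℕ.* z) (1≤S : 1 ℕ.≤ S) (B< : B ℕ.< 2 ℕ.* S) (m≤ : ι m ≤ ι n * ι n)
      (degree≤ : ∀ v → # (λ e → inc e v) ℕ.≤ D ℕ.* z)
      (small-completable : CompletableAt r₁ B D D P z) (medium-completable : CompletableAt r₀ 2 1 1 P z)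
      (large-colourable : Fin (suc B ℕ.* z) → ListColouring.Colourable {m} {suc B ℕ.* z} adj adj-sym large (λ _ _ → true)) where

      1≤2S : 1 ℕ.≤ 2 ℕ.* S
      1≤2S = ℕₚ.*-mono-≤ {1} {2} (s≤s z≤n) 1≤S

      instance
        2S≢0 : ℕ.NonZero (2 ℕ.* S)
        2S≢0 = ℕ.>-nonZero 1≤2S

      n*≤ : ∀ {x} → x ℕ.≤ 2 ℕ.* S ℕ.* z → ι n * ι x ≤ ι P * (ι z * ι z)
      n*≤ {x} x≤ = ≤-trans (*-mono (0≤ι n) (ι-mono n≤) (0≤ι x) (ι-mono x≤)) (≤-reflexive
        (trans (cong₂ _*_ (ι-* (2 ℕ.* S) z) (ι-* (2 ℕ.* S) z)) (trans (ring-156 (ι (2 ℕ.* S)) (ι z)) (cong (_* (ι z * ι z)) (sym (ι-* (2 ℕ.* S) (2 ℕ.* S)))))))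
      m≤P : ι m ≤ ι P * (ι z * ι z)
      m≤P = ≤-trans m≤ (n*≤ n≤)
      n≤P : ι n ≤ ι P * (ι z * ι z)
      n≤P = ≤-trans (≤-reflexive (sym (*-identityʳ (ι n)))) (n*≤ {1} (ℕₚ.*-mono-≤ 1≤2S 1≤z))

      colour-large = large-colourable (Fin.fromℕ< {0} (ℕₚ.*-mono-≤ (s≤s (z≤n {B})) 1≤z))

      -- Degrees are at most z and 2z colours are available, so the nibble applies with ratio ½.
      colour-medium : ListColouring.Colourable {m} {2 ℕ.* z} adj adj-sym medium (λ _ _ → true)
      colour-medium = medium-completable inc lin (Fin.fromℕ< {0} (ℕₚ.*-mono-≤ (s≤s (z≤n {1})) 1≤z)) m≤P (n*≤ (ℕₚ.*-monoˡ-≤ z (ℕₚ.*-monoʳ-≤ 2 1≤S))) n≤P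
        (Nibble.state medium (λ _ _ → true)) (record
          { rank = λ e p → ℕₚ.<⇒≤ (ℕₚ.≰⇒> (¬does⇒ (r₀ ℕ.≤? size e) (not-elim (∧-snd {does (r₁ ℕ.≤? size e)} p))))
          ; lists≥ = λ e _ → ι-cancel-≤ (≤-reflexive (trans (sym (trans (∑-const (2 ℕ.* z) 1ℚ) (*-identityʳ (ι (2 ℕ.* z))))) (sym (ι# {2 ℕ.* z} (λ _ → true)))))
          ; colourDegree≤ = λ v c → ℕₚ.≤-trans (#-mono (λ e p → ∧-intro (∧-fst {inc e v} p) (∧-fst {medium e} (∧-snd {inc e v} p)))) (at-vertex v)
          ; openDegree≤ = at-vertex })
        where
        at-vertex : ∀ v → # (λ e → inc e v ∧ medium e) ℕ.≤ 1 ℕ.* z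
        at-vertex v = ℕₚ.≤-trans (ℕₚ.*-cancelʳ-≤ (# (λ e → inc e v ∧ medium e)) z (2 ℕ.* S)
          (ℕₚ.≤-trans (star-count medium v (2 ℕ.* S) (λ e p → does⇒ (r₁ ℕ.≤? size e) (∧-fst {does (r₁ ℕ.≤? size e)} p)))
            (ℕₚ.≤-trans n≤ (ℕₚ.≤-reflexive (ℕₚ.*-comm (2 ℕ.* S) z))))) (ℕₚ.≤-reflexive (sym (ℕₚ.*-identityˡ z)))

      large-degree : ∀ v → # (λ e → inc e v ∧ large e) ℕ.≤ z ℕ-DivMod./ r₁
      large-degree v = ℕₚ.≤-trans (ℕₚ.≤-reflexive (sym (ℕ-DivMod.m*n/n≡m (# (λ e → inc e v ∧ large e)) r₁)))
        (ℕ-DivMod./-monoˡ-≤ r₁ (ℕₚ.*-cancelˡ-≤ (2 ℕ.* S) (ℕₚ.≤-trans (ℕₚ.≤-reflexive (ring-n27 (2 ℕ.* S) (# (λ e → inc e v ∧ large e)) r₁)) (ℕₚ.≤-trans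
          (star-count large v (2 ℕ.* S ℕ.* r₁) (λ e p → ℕₚ.<-≤-trans r₀> (does⇒ (r₀ ℕ.≤? size e) p))) n≤))))

      -- The large edges block at most z of the (B + 1)z colours, so lists keep Bz colours against
      -- degrees of at most Dz.
      colour-small : ListColouring.Colourable {m} {suc B ℕ.* z} adj adj-sym small-edge (unblocked adj adj-sym colour-large)
      colour-small = small-completable inc lin (Fin.fromℕ< {0} (ℕₚ.*-mono-≤ (s≤s (z≤n {B})) 1≤z)) m≤P (n*≤ (ℕₚ.*-monoˡ-≤ z B<)) n≤P
        (Nibble.state small-edge (unblocked adj adj-sym colour-large)) (record
          { rank = rank
          ; lists≥ = λ e p → ι-cancel-≤ (≤-trans (-≤0 (subst (0ℚ ≤_) (remaining (lost e p)) (0≤- (lost e p)))) (unblocked≥ adj adj-sym colour-large e))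
          ; colourDegree≤ = λ v c → ℕₚ.≤-trans (#-mono (λ e → ∧-fst {inc e v})) (degree≤ v)
          ; openDegree≤ = λ v → ℕₚ.≤-trans (#-mono (λ e → ∧-fst {inc e v})) (degree≤ v) })
        where
        rank : ∀ e → small-edge e ≡ true → size e ℕ.≤ r₁
        rank e p = ℕₚ.<⇒≤ (ℕₚ.≰⇒> (¬does⇒ (r₁ ℕ.≤? size e) (not-elim (∧-fst {not (does (r₁ ℕ.≤? size e))} p))))
        lost : ∀ e → small-edge e ≡ true → ListColouring.deg {m} {0} adj adj-sym large e ≤ ι z
        lost e p = ≤-trans (deg≤size* inc large e (z ℕ-DivMod./ r₁) large-degree) (≤-trans (*-monoˡ (0≤ι (z ℕ-DivMod./ r₁)) (ι-mono (rank e p)))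
          (≤-trans (≤-reflexive (trans (sym (ι-* r₁ (z ℕ-DivMod./ r₁))) (cong ι (ℕₚ.*-comm r₁ (z ℕ-DivMod./ r₁))))) (ι-mono (ℕ-DivMod.m/n*n≤m z r₁))))
        remaining : ∀ {d} → d ≤ ι z → ι z - d ≡ (ι (suc B ℕ.* z) - d) - ι (B ℕ.* z)
        remaining {d} _ = trans (ring-207 (ι z) d (ι (B ℕ.* z))) (cong (λ x → (x - d) - ι (B ℕ.* z)) (sym (ι-+ z (B ℕ.* z))))

      colour-by-size : ListColouring.Colourable {m} {suc B ℕ.* z ℕ.+ 2 ℕ.* z} adj adj-sym (λ _ → true) (λ _ _ → true)
      colour-by-size = ListColouring.weaken adj adj-sym (λ e _ → cover (large e) (does (r₁ ℕ.≤? size e))) (λ _ _ _ _ → refl)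
        (juxtapose adj adj-sym (union adj adj-sym colour-large colour-small) colour-medium)
        where
        cover : ∀ a b → (a ∨ (not b ∧ not a)) ∨ (b ∧ not a) ≡ true
        cover true _ = refl
        cover false true = refl
        cover false false = refl

-- Choice of the scale

IncidenceBound : ℚ → ℚ → ℕ → Set
IncidenceBound δ σ n = ∀ {m} (inc : Fin m → Fin n → Bool) → Linearᴮ inc → (∀ e → 1 ℕ.≤ Incidence.size inc e) →
  (∀ v → ι (# (λ e → inc e v)) ≤ (1ℚ - δ) * ι n) →
  (∀ V → (∀ f → V f ≡ true → ((1ℚ - δ) * (1ℚ - δ) * ι n ≤ ι (Incidence.size inc f) * ι (Incidence.size inc f)) × (ι (Incidence.size inc f) * ι (Incidence.size inc f) ≤ (1ℚ + δ) * (1ℚ + δ) * ι n)) →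
    ∑ (𝟙 ∘ V) ≤ (1ℚ - ι 3 * δ) * ι n) →
  Σ ℕ λ k → (ι k ≤ (1ℚ - σ) * ι n) × ListColouring.Colourable {m} {k} (Incidence.adj inc) (Incidence.adj-sym inc) (λ _ → true) (λ _ _ → true)

-- n lies between Sz and (S + 1)z = (48 + D)z. The large and small edges get (42 + D)z colours, at
-- least (1 - τ)n by 6z ≤ τn; degrees are at most Dz by 48z ≤ δn. With 2z colours for the medium
-- edges the total stays below (S - 1)z, so σ = 1/S is saved.
module Scale (δ τ σ : ℚ) (0<δ : 0ℚ < δ) (0<τ : 0ℚ < τ) (8τ≤δ : ι 8 * τ ≤ δ) (S B D : ℕ) (S≡ : S ≡ 47 ℕ.+ D) (B≡ : B ≡ 41 ℕ.+ D)
  (6≤τD : ι 6 ≤ τ * ι D) (0<σ : 0ℚ < σ) (Sσ≡1 : ι S * σ ≡ 1ℚ)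
  (n z : ℕ) (S≤z : S ℕ.≤ z) (Sz≤n : z ℕ.* S ℕ.≤ n) (n≤S+Sz : n ℕ.≤ S ℕ.+ z ℕ.* S) where
  private
    N = ι n
    ζ = ι z
    s = ι D

  ιS : ι S ≡ ι 47 + s
  ιS = trans (cong ι S≡) (ι-+ 47 D)

  palette≡ : ι (suc B ℕ.* z) ≡ (ι 42 + s) * ζ
  palette≡ = trans (ι-* (suc B) z) (cong (_* ζ) (trans (cong (λ b → ι (suc b)) B≡) (ι-+ 42 D)))

  n≤ : n ℕ.≤ suc S ℕ.* z
  n≤ = ℕₚ.≤-trans n≤S+Sz (ℕₚ.≤-trans (ℕₚ.+-monoˡ-≤ (z ℕ.* S) S≤z) (ℕₚ.≤-reflexive (cong (z ℕ.+_) (ℕₚ.*-comm z S))))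

  N≤ : N ≤ (ι 48 + s) * ζ
  N≤ = ≤-trans (ι-mono n≤) (≤-reflexive (trans (ι-* (suc S) z) (cong (_* ζ) (trans (cong (λ x → ι (suc x)) S≡) (ι-+ 48 D)))))

  D≤S : D ℕ.≤ S
  D≤S = ℕₚ.≤-trans (ℕₚ.m≤n+m D 47) (ℕₚ.≤-reflexive (sym S≡))

  6ζ≤τN : ι 6 * ζ ≤ τ * N
  6ζ≤τN = begin
    ι 6 * ζ ≤⟨ *-monoˡ (0≤ι z) 6≤τD ⟩
    τ * s * ζ ≡⟨ trans (*-assoc τ s ζ) (cong (τ *_) (trans (sym (ι-* D z)) (cong ι (ℕₚ.*-comm D z)))) ⟩
    τ * ι (z ℕ.* D) ≤⟨ *-monoʳ (<⇒≤ 0<τ) (ι-mono (ℕₚ.≤-trans (ℕₚ.*-monoʳ-≤ z D≤S) Sz≤n)) ⟩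
    τ * N ∎
    where open ℚₚ.≤-Reasoning

  48ζ≤δN : ι 48 * ζ ≤ δ * N
  48ζ≤δN = begin
    ι 48 * ζ ≡⟨ trans (cong (_* ζ) (ι-* 8 6)) (*-assoc (ι 8) (ι 6) ζ) ⟩
    ι 8 * (ι 6 * ζ) ≤⟨ *-monoʳ (0≤ι 8) 6ζ≤τN ⟩
    ι 8 * (τ * N) ≡⟨ sym (*-assoc (ι 8) τ N) ⟩
    ι 8 * τ * N ≤⟨ *-monoˡ (0≤ι n) 8τ≤δ ⟩
    δ * N ∎
    where open ℚₚ.≤-Reasoning

  large-palette : (1ℚ - τ) * N ≤ ι (suc B ℕ.* z)
  large-palette = ≤-by (((ι 48 + s) * ζ - N) + (τ * N - ι 6 * ζ))
    (trans palette≡ (ring-209 s ζ τ N)) (0≤+ (0≤- N≤) (0≤- 6ζ≤τN))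

  degrees : (1ℚ - δ) * N ≤ ι (D ℕ.* z)
  degrees = ≤-by (((ι 48 + s) * ζ - N) + (δ * N - ι 48 * ζ)) (trans (ι-* D z) (ring-210 s ζ δ N)) (0≤+ (0≤- N≤) (0≤- 48ζ≤δN))

  1-δ≤1 : (1ℚ - δ) * N ≤ N
  1-δ≤1 = ≤-by (δ * N) (ring-211 δ N) (0≤* (<⇒≤ 0<δ) (0≤ι n))

  total : ι (suc B ℕ.* z ℕ.+ 2 ℕ.* z) ≤ (1ℚ - σ) * N
  total = begin
    ι (suc B ℕ.* z ℕ.+ 2 ℕ.* z) ≡⟨ trans (ι-+ (suc B ℕ.* z) (2 ℕ.* z)) (cong₂ _+_ palette≡ (ι-* 2 z)) ⟩
    (ι 42 + s) * ζ + ι 2 * ζ ≤⟨ ≤-by (ι 2 * ζ) (ring-212 s ζ) (0≤* (0≤ι 2) (0≤ι z)) ⟩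
    (ι 47 + s) * ζ - 1ℚ * ζ ≡⟨ cong₂ (λ x y → x * ζ - y * ζ) (sym ιS) (sym Sσ≡1) ⟩
    ι S * ζ - ι S * σ * ζ ≡⟨ trans (ring-213 (ι S) ζ σ) (cong ((1ℚ - σ) *_) (sym (ι-* z S))) ⟩
    (1ℚ - σ) * ι (z ℕ.* S) ≤⟨ *-monoʳ (0≤- σ≤1) (ι-mono Sz≤n) ⟩
    (1ℚ - σ) * N ∎
    where
    open ℚₚ.≤-Reasoning
    σ≤1 : σ ≤ 1ℚ
    σ≤1 = ≤-trans (≤-trans (≤-reflexive (sym (*-identityˡ σ))) (*-monoˡ (<⇒≤ 0<σ) (ι-mono {1} {S} (subst (1 ℕ.≤_) (sym S≡) (s≤s z≤n))))) (≤-reflexive Sσ≡1)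

incidence-bound : ∀ δ → 0ℚ < δ → ι 3 * δ ≤ 1ℚ → Σ ℕ λ n₀ → Σ ℚ λ σ → (0ℚ < σ) × (∀ n → n ≥ n₀ → IncidenceBound δ σ n)
incidence-bound δ 0<δ 3δ≤1 = with-τ (large-edges δ 0<δ 3δ≤1)
  where
  Result = Σ ℕ λ n₀ → Σ ℚ λ σ → (0ℚ < σ) × (∀ n → n ≥ n₀ → IncidenceBound δ σ n)
  with-τ : (Σ ℚ λ τ → (0ℚ < τ) × (ι 8 * τ ≤ δ) × Σ ℕ λ r₀ → Σ ℕ λ n₀ → ∀ n → n ≥ n₀ → LargeColouring δ τ r₀ n) → Result
  with-τ (τ , 0<τ , 8τ≤δ , r , n₁ , large-colouring) = with-t (recip 0<τ)
    where
    with-S : ∀ S B D → S ≡ 47 ℕ.+ D → B ≡ 41 ℕ.+ D → ι 6 ≤ τ * ι D → Result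
    with-S S B D S≡ B≡ 6≤τD = with-z (recip (0<ι⁺ 1≤S)) (completable r₁ B D D (s≤s z≤n) D<B P)
        (completable r₀ 2 1 1 (ℕₚ.m≤n+m 1 (r ℕ.+ 2 ℕ.* S ℕ.* r₁)) (s≤s (s≤s z≤n)) P)
      where
      r₁ = suc (2 ℕ.* S)
      r₀ = r ℕ.+ 2 ℕ.* S ℕ.* r₁ ℕ.+ 1
      P = 2 ℕ.* S ℕ.* (2 ℕ.* S)
      1≤S : 1 ℕ.≤ S
      1≤S = subst (1 ℕ.≤_) (sym S≡) (s≤s z≤n)
      D<B : D ℕ.< B
      D<B = subst (D ℕ.<_) (sym B≡) (ℕₚ.m≤n+m (suc D) 40)
      instance
        S≢0 : ℕ.NonZero S
        S≢0 = ℕ.>-nonZero 1≤S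
      B<S : suc B ℕ.≤ suc S
      B<S = s≤s (subst₂ ℕ._≤_ (sym B≡) (sym S≡) (ℕₚ.+-monoˡ-≤ D (ℕₚ.≤ᵇ⇒≤ 41 47 tt)))
      S<2S : suc S ℕ.≤ 2 ℕ.* S
      S<2S = ℕₚ.≤-trans (ℕₚ.≤-reflexive (ℕₚ.+-comm 1 S)) (ℕₚ.+-monoʳ-≤ S (ℕₚ.≤-trans 1≤S (ℕₚ.m≤m+n S 0)))
      r₀> : 2 ℕ.* S ℕ.* r₁ ℕ.< r₀
      r₀> = ℕₚ.≤-trans (ℕₚ.≤-reflexive (ℕₚ.+-comm 1 (2 ℕ.* S ℕ.* r₁))) (ℕₚ.+-monoˡ-≤ 1 (ℕₚ.m≤n+m (2 ℕ.* S ℕ.* r₁) r))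
      with-z : (Σ ℚ λ σ → (0ℚ < σ) × (ι S * σ ≡ 1ℚ)) → (Σ ℕ λ z₀ → ∀ z → z ≥ z₀ → CompletableAt r₁ B D D P z) →
        (Σ ℕ λ z₀ → ∀ z → z ≥ z₀ → CompletableAt r₀ 2 1 1 P z) → Result
      with-z (σ , 0<σ , Sσ≡1) (z₁ , small-completable) (z₂ , medium-completable) = n₁ ℕ.+ z₀ ℕ.* S , σ , 0<σ , bound
        where
        z₀ = S ℕ.+ (z₁ ℕ.+ z₂)
        bound : ∀ n → n ≥ n₁ ℕ.+ z₀ ℕ.* S → IncidenceBound δ σ n
        bound n n≥ {m} inc lin 1≤size degree≤ few = suc B ℕ.* z ℕ.+ 2 ℕ.* z , total ,
          SizeClasses.colour-by-size inc lin S B D z r₀ (ℕₚ.≤-trans 1≤S S≤z) r₀>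
            (ℕₚ.≤-trans n≤ (ℕₚ.*-monoˡ-≤ z S<2S)) 1≤S (ℕₚ.≤-trans B<S S<2S) m≤
            (λ v → ι-cancel-≤ (≤-trans (degree≤ v) degrees)) (small-completable z z≥z₁) (medium-completable z z≥z₂)
            (λ c₀ → large-colouring n (ℕₚ.≤-trans (ℕₚ.m≤m+n n₁ (z₀ ℕ.* S)) n≥) inc lin c₀ (SizeClasses.large inc lin S B D z r₀) m≤
              (λ e p → ℕₚ.≤-trans (ℕₚ.≤-trans (ℕₚ.m≤m+n r (2 ℕ.* S ℕ.* r₁)) (ℕₚ.m≤m+n (r ℕ.+ 2 ℕ.* S ℕ.* r₁) 1)) (does⇒ (r₀ ℕ.≤? Incidence.size inc e) p))
              (λ V _ → few V) large-palette)
          where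
          z = n ℕ-DivMod./ S
          z≥ : z ≥ z₀
          z≥ = ℕₚ.≤-trans (ℕₚ.≤-reflexive (sym (ℕ-DivMod.m*n/n≡m z₀ S))) (ℕ-DivMod./-monoˡ-≤ S (ℕₚ.≤-trans (ℕₚ.m≤n+m (z₀ ℕ.* S) n₁) n≥))
          S≤z = ℕₚ.≤-trans (ℕₚ.m≤m+n S (z₁ ℕ.+ z₂)) z≥
          z≥z₁ = ℕₚ.≤-trans (ℕₚ.≤-trans (ℕₚ.m≤m+n z₁ z₂) (ℕₚ.m≤n+m (z₁ ℕ.+ z₂) S)) z≥
          z≥z₂ = ℕₚ.≤-trans (ℕₚ.≤-trans (ℕₚ.m≤n+m z₂ z₁) (ℕₚ.m≤n+m (z₁ ℕ.+ z₂) S)) z≥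
          open Scale δ τ σ 0<δ 0<τ 8τ≤δ S B D S≡ B≡ 6≤τD 0<σ Sσ≡1 n z S≤z (ℕ-DivMod.m/n*n≤m n S)
            (ℕₚ.≤-trans (ℕₚ.≤-reflexive (ℕ-DivMod.m≡m%n+[m/n]*n n S)) (ℕₚ.+-monoˡ-≤ (z ℕ.* S) (ℕₚ.<⇒≤ (ℕ-DivMod.m%n<n n S))))
          m≤ = SizeClasses.edges≤ inc lin 1≤size (λ v → ι-cancel-≤ (≤-trans (degree≤ v) 1-δ≤1))
    with-t : (Σ ℚ λ t → (0ℚ < t) × (τ * t ≡ 1ℚ)) → Result
    with-t (t , 0<t , τt≡1) = with-S _ _ (proj₁ (archimedean (ι 6 * t))) refl refl (begin
      ι 6 ≡⟨ sym (trans (cong (ι 6 *_) τt≡1) (*-identityʳ (ι 6))) ⟩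
      ι 6 * (τ * t) ≡⟨ ring-16 (ι 6) τ t ⟩
      τ * (ι 6 * t) ≤⟨ *-monoʳ (<⇒≤ 0<τ) (proj₂ (archimedean (ι 6 * t))) ⟩
      τ * ι (proj₁ (archimedean (ι 6 * t))) ∎)
      where
      open ℚₚ.≤-Reasoning

-- From hypergraphs to incidence functions and back

#-cong : ∀ {n} {a b : Fin n → Bool} → (∀ i → a i ≡ b i) → # a ≡ # b
#-cong h = ℕₚ.≤-antisym (#-mono (λ i p → trans (sym (h i)) p)) (#-mono (λ i p → trans (h i) p))

∣∣≡# : ∀ {n} (p : Subset n) → ∣ p ∣ ≡ # (Vec.lookup p)
∣∣≡# [] = refl
∣∣≡# (true ∷ p) = cong suc (∣∣≡# p)
∣∣≡# (false ∷ p) = ∣∣≡# p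

count≡# : ∀ {m} {P : Fin m → Set} (P? : ∀ i → Dec (P i)) → count P? ≡ # (λ i → does (P? i))
count≡# P? = trans (∣∣≡# (Vec.tabulate (λ i → does (P? i)))) (#-cong (Vecₚ.lookup∘tabulate (λ i → does (P? i))))

module _ {n} (H : Hypergraph n) where

  incident : Fin (m H) → Fin n → Bool
  incident e = Vec.lookup (edge H e)

  incident-linear : Linear H → Linearᴮ incident
  incident-linear lin = record { linear = λ e f u v e≢f u≢v eu ev fu fv → true≢false
    (∖-intro {U = common e f} v (at e f v ev fv) (u≢v ∘ sym))
    (#≡0 {b = common e f ∖ u} (ℕₚ.n≤0⇒n≡0 (ℕₚ.≤-pred (ℕₚ.≤-trans
      (#-drop u (∖-⊆ {U = common e f}) (∖-self {U = common e f} u) (at e f u eu fu))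
      (subst (ℕ._≤ 1) (∣∣≡# (edge H e ∩ edge H f)) (lin e f e≢f))))) v) }
    where
    common : Fin (m H) → Fin (m H) → Fin n → Bool
    common e f = Vec.lookup (edge H e ∩ edge H f)
    at : ∀ e f u → incident e u ≡ true → incident f u ≡ true → common e f u ≡ true
    at e f u p q = trans (Vecₚ.lookup-zipWith _∧_ u (edge H e) (edge H f)) (∧-intro p q)

  incident-nonempty : ∀ e → 1 ℕ.≤ # (incident e)
  incident-nonempty e with nonempty H e
  ... | v , v∈e = ℕₚ.≤-trans (s≤s z≤n) (#-drop {a = λ _ → false} v (λ _ ()) refl (Vecₚ.[]=⇒lookup v∈e))

  incident-degree : ∀ v → # (λ e → incident e v) ℕ.≤ degree H v
  incident-degree v = ℕₚ.≤-trans (#-mono (λ e p → dec-true (v ∈? edge H e) (Vecₚ.lookup⇒[]= v (edge H e) p)))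
    (ℕₚ.≤-reflexive (sym (count≡# (λ e → v ∈? edge H e))))

  mid-edges : ∀ δ V → (∀ f → V f ≡ true → MidSize δ n ∣ edge H f ∣) → # V ℕ.≤ numMidEdges δ H
  mid-edges δ V mid = ℕₚ.≤-trans (#-mono (λ f p → dec-true (midSize? δ n ∣ edge H f ∣) (mid f p)))
    (ℕₚ.≤-reflexive (sym (count≡# (λ f → midSize? δ n ∣ edge H f ∣))))

  proper-edge-colouring : ∀ {k A} (κ : ListColouring.Colourable {m H} {k} (Incidence.adj incident) (Incidence.adj-sym incident) (λ _ → true) A) →
    ProperEdgeColouring H k (ListColouring.colour κ)
  proper-edge-colouring κ i j i≢j (v , v∈) = ListColouring.proper κ i j refl refl i≢j
    (Incidence.adj-intro incident {i} {j} v (Vecₚ.[]=⇒lookup (proj₁ both)) (Vecₚ.[]=⇒lookup (proj₂ both)))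
    where both = x∈p∩q⁻ (edge H i) (edge H j) v∈

  mid-size : ∀ δ f → (1ℚ - δ) * (1ℚ - δ) * ι n ≤ ι (# (incident f)) * ι (# (incident f)) → ι (# (incident f)) * ι (# (incident f)) ≤ (1ℚ + δ) * (1ℚ + δ) * ι n →
    MidSize δ n ∣ edge H f ∣
  mid-size δ f p q = inj₂ (subst₂ _≤_ (scaled (1ℚ - δ)) square p) , subst₂ _≤_ square (scaled (1ℚ + δ)) q
    where
    scaled : ∀ c → c * c * ι n ≡ c * c * ℕ→ℚ n
    scaled c = cong (c * c *_) (sym (ℕ→ℚ≡ι n))
    size≡ : ι (# (incident f)) ≡ ℕ→ℚ ∣ edge H f ∣
    size≡ = trans (cong ι (sym (∣∣≡# (edge H f)))) (sym (ℕ→ℚ≡ι ∣ edge H f ∣))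
    square : ι (# (incident f)) * ι (# (incident f)) ≡ ℕ→ℚ ∣ edge H f ∣ * ℕ→ℚ ∣ edge H f ∣
    square = cong₂ _*_ size≡ size≡

  few-mid : ∀ δ → ℕ→ℚ (numMidEdges δ H) ≤ (1ℚ - ℕ→ℚ 3 * δ) * ℕ→ℚ n → ι (numMidEdges δ H) ≤ (1ℚ - ι 3 * δ) * ι n
  few-mid δ = subst₂ _≤_ (ℕ→ℚ≡ι (numMidEdges δ H)) (cong₂ (λ t N → (1ℚ - t * δ) * N) (ℕ→ℚ≡ι 3) (ℕ→ℚ≡ι n))

theorem1p2 : (δ : ℚ) → 0ℚ < δ →
    Σ ℕ λ n₀ → Σ ℚ λ σ → (0ℚ < σ) ×
    ((n : ℕ) → n ≥ n₀ → (H : Hypergraph n) → Linear H →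
    (∀ v → ℕ→ℚ (degree H v) ≤ (1ℚ - δ) * ℕ→ℚ n) →
    ℕ→ℚ (numMidEdges δ H) ≤ (1ℚ - ℕ→ℚ 3 * δ) * ℕ→ℚ n →
    ChromaticIndex≤ H ((1ℚ - σ) * ℕ→ℚ n))
theorem1p2 δ 0<δ = split (≤⊎> (ι 3 * δ) 1ℚ)
  where
  Bound : ℚ → ℕ → Set
  Bound σ n = (H : Hypergraph n) → Linear H → (∀ v → ℕ→ℚ (degree H v) ≤ (1ℚ - δ) * ℕ→ℚ n) →
    ℕ→ℚ (numMidEdges δ H) ≤ (1ℚ - ℕ→ℚ 3 * δ) * ℕ→ℚ n → ChromaticIndex≤ H ((1ℚ - σ) * ℕ→ℚ n)
  transfer : ∀ {σ n} → IncidenceBound δ σ n → Bound σ n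
  transfer {σ} {n} bound H lin degree≤ few = conclude (bound (incident H) (incident-linear H lin) (incident-nonempty H) degree≤′ few′)
    where
    degree≤′ : ∀ v → ι (# (λ e → incident H e v)) ≤ (1ℚ - δ) * ι n
    degree≤′ v = ≤-trans (≤-trans (ι-mono (incident-degree H v)) (≤-reflexive (sym (ℕ→ℚ≡ι (degree H v))))) (≤-trans (degree≤ v) (≤-reflexive (cong ((1ℚ - δ) *_) (ℕ→ℚ≡ι n))))
    few′ : ∀ V → (∀ f → V f ≡ true → ((1ℚ - δ) * (1ℚ - δ) * ι n ≤ ι (# (incident H f)) * ι (# (incident H f))) × (ι (# (incident H f)) * ι (# (incident H f)) ≤ (1ℚ + δ) * (1ℚ + δ) * ι n)) →
      ∑ (𝟙 ∘ V) ≤ (1ℚ - ι 3 * δ) * ι n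
    few′ V mid = ≤-trans (≤-reflexive (sym (ι# V))) (≤-trans (ι-mono (mid-edges H δ V (λ f p → mid-size H δ f (proj₁ (mid f p)) (proj₂ (mid f p))))) (few-mid H δ few))
    conclude : (Σ ℕ λ k → (ι k ≤ (1ℚ - σ) * ι n) × ListColouring.Colourable {m H} {k} (Incidence.adj (incident H)) (Incidence.adj-sym (incident H)) (λ _ → true) (λ _ _ → true)) →
      ChromaticIndex≤ H ((1ℚ - σ) * ℕ→ℚ n)
    conclude (k , k≤ , κ) = k , subst₂ _≤_ (sym (ℕ→ℚ≡ι k)) (cong ((1ℚ - σ) *_) (sym (ℕ→ℚ≡ι n))) k≤ , ListColouring.colour κ , proper-edge-colouring H κ
  split : ι 3 * δ ≤ 1ℚ ⊎ 1ℚ < ι 3 * δ → Σ ℕ λ n₀ → Σ ℚ λ σ → (0ℚ < σ) × (∀ n → n ≥ n₀ → Bound σ n)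
  split (inj₁ 3δ≤1) = main (incidence-bound δ 0<δ 3δ≤1)
    where
    main : (Σ ℕ λ n₀ → Σ ℚ λ σ → (0ℚ < σ) × (∀ n → n ≥ n₀ → IncidenceBound δ σ n)) → Σ ℕ λ n₀ → Σ ℚ λ σ → (0ℚ < σ) × (∀ n → n ≥ n₀ → Bound σ n)
    main (n₀ , σ , 0<σ , bound) = n₀ , σ , 0<σ , λ n n≥ → transfer {σ} {n} (bound n n≥)
  -- For 3δ > 1 and n ≥ 1 the bound (1 - 3δ)n is negative, so no hypergraph satisfies the hypothesis
  -- on middle sizes and any σ will do.
  split (inj₂ 1<3δ) = 1 , 1ℚ , 0<1 , λ n 1≤n H _ _ few → ⊥-elim (≤⇒≯ (0≤ι (numMidEdges δ H)) (≤-<-trans (few-mid H δ few)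
    (-<0 (subst (0ℚ <_) (ring-214 (ι 3 * δ) (ι n)) (0<* (0<- 1<3δ) (0<ι⁺ 1≤n))))))
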